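{- For every sequent $\Gamma\Rightarrow\Delta$ of $\mathcal{L}_{\mathsf{RTC}}$ over the signature $\{0,\mathsf{s},+\}$: $\Gamma\Rightarrow\Delta$ is provable in $\mathsf{CRTC}^{\omega}_{G}+\mathsf{A}$ if and only if $\Gamma^{\beta}\Rightarrow\Delta^{\beta}$ is provable in $\mathsf{CA}_{G}$.
   Context: Formulas of $\mathcal{L}_{\mathsf{RTC}}$: first-order formulas with equality extended by $(RTC_{x,y}\,\varphi)(s,t)$ for distinct variables $x,y$ bound in $\varphi$ and terms $s,t$. Here the signature is $\{0,\mathsf{s},+\}$. $\mathcal{LK}_=$: classical sequent calculus with axiom $\varphi\Rightarrow\varphi$, weakening, usual connective/quantifier rules, $(=L_1)$: from $\Gamma\Rightarrow\varphi[s/x],\Delta$ infer $\Gamma,s=t\Rightarrow\varphi[t/x],\Delta$, $(=L_2)$: from $\Gamma\Rightarrow\varphi[t/x],\Delta$ infer $\Gamma,s=t\Rightarrow\varphi[s/x],\Delta$, $(=R)$: $\Rightarrow t=t$, Cut, and (Subst): from $\Gamma\Rightarrow\Delta$ infer $\Gamma\theta\Rightarrow\Delta\theta$. $\mathsf{RTC}^{\omega}_G$ = $\mathcal{LK}_=$ + (Refl) $\Gamma\Rightarrow\Delta,(RTC_{x,y}\varphi)(s,s)$ + (Trans) from $\Gamma\Rightarrow\Delta,(RTC_{x,y}\varphi)(s,r)$ and $\Gamma\Rightarrow\Delta,\varphi[r/x,t/y]$ infer $\Gamma\Rightarrow\Delta,(RTC_{x,y}\varphi)(s,t)$ + (Case)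 from $\Gamma,s=t\Rightarrow\Delta$ and $\Gamma,(RTC_{x,y}\varphi)(s,z),\varphi[z/x,t/y]\Rightarrow\Delta$ infer $\Gamma,(RTC_{x,y}\varphi)(s,t)\Rightarrow\Delta$ ($z$ fresh; $(RTC_{x,y}\varphi)(s,z)$ is the immediate ancestor of the principal formula). Proofs are possibly infinite derivation trees without open leaves in which every infinite path is followed by a trace (sequence of $RTC$-formulas in antecedents, consecutive ones being equal, or related by $\tau=\tau'\theta$ across a (Subst) with substitution $\theta$, or being a (Case) principal formula and its immediate ancestor, the latter counting as progress) that progresses infinitely often. $\mathsf{CRTC}^{\omega}_G$ consists of the finite and regular (finitely many distinct subtrees) such proofs. $\mathsf{CRTC}^{\omega}_{G}+\mathsf{A}$ is $\mathsf{CRTC}^{\omega}_{G}$ with the additional axiom sequents $\mathsf{s}x=0\Rightarrow$; $\mathsf{s}x=\mathsf{s}y\Rightarrow x=y$; $\Rightarrow x+0=x$; $\Rightarrow x+\mathsf{s}y=\mathsf{s}(x+y)$; $\Rightarrow(RTC_{w,u}\,\mathsf{s}w=u)(0,x)$. Let $B(c,i,v)$ be a fixed formula of the language of Peano arithmetic with three free variables capturing in PA a $\beta$-function. The translation $\varphi^{\beta}$ is the identity on formulas without $RTC$, commutes with connectives and quantifiers, and $((RTC_{x,y}\varphi)(s,t))^{\beta}$ is $s=t\vee\exists z,c.\,(B(c,0,s)\wedge B(c,\mathsf{s}z,t)\wedge\forall u\le z.\,\exists v,w.\,(B(c,u,v)\wedge B(c,\mathsf{s}u,w)\wedge\varphi^{\beta}[v/x,w/y]))$;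 $\Gamma^\beta$ is applied elementwise. $\mathsf{CA}_G$ is Simpson's cyclic proof system for Peano arithmetic ("Cyclic arithmetic is equivalent to Peano arithmetic", 2017): over the language $\{0,\mathsf{s},+,\cdot,<\}$, it is $\mathcal{LK}_=$ with substitution plus the axioms of Peano arithmetic without induction (successor injectivity and $\mathsf{s}x\neq0$, defining equations of $+$ and $\cdot$, and the order axioms $t<u,u<v\Rightarrow t<v$; $t<u,u<t\Rightarrow$; $t<u,u<\mathsf{s}t\Rightarrow$; $t<0\Rightarrow$; $t<u\Rightarrow\mathsf{s}t<\mathsf{s}u$; $\Rightarrow t<\mathsf{s}t$; $\Rightarrow t<u,t=u,u<t$) and the case rule: from $\Gamma,t=\mathsf{s}x\Rightarrow\Delta$ infer $\Gamma,0<t\Rightarrow\Delta$ ($x$ fresh); its proofs are finite or regular infinite derivation trees in which every infinite path is followed by a trace of terms (consecutive terms related through the precursor relation induced by each rule) which progresses infinitely often, a progress point being a step from a term $t$ to a term $t'$ where $t'<t$ occurs in the antecedent. -}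

module Defs where

open import Data.Nat using (ℕ; zero; suc; _+_; _≤_)
open import Data.Fin using (Fin)
open import Data.Bool using (Bool; true; false; _∨_)
open import Data.List using (List; []; _∷_; map; _++_)
open import Data.Bool.ListAction using (any)
open import Data.List.Membership.Propositional using (_∈_)
open import Data.List.Relation.Unary.All using (All)
open import Data.List.Relation.Binary.Subset.Propositional using (_⊆_)
open import Data.Product using (Σ; ∃; _×_)
open import Data.Sum using (_⊎_)
open import Data.Empty using (⊥)
open import Data.Unit using (⊤)
open import Relation.Binary.PropositionalEquality using (_≡_)

-- Syntax.  One term/formula syntax covering both languages:
--   L_RTC over {0,s,+}  : no `·`, no `≺`   (predicate LRTC below)
--   PA language {0,s,+,·,<} : no RTC       (predicate LPA below)
-- Variables are de Bruijn indices; free variables are the indices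
-- that are not bound.

data Tm : Set where
  var  : ℕ → Tm
  `0   : Tm
  `s   : Tm → Tm
  _`+_ : Tm → Tm → Tm
  _`·_ : Tm → Tm → Tm

infix  9 _≐_ _≺_
infixr 8 _`∧_
infixr 7 _`∨_
infixr 6 _`→_

data Fm : Set where
  _≐_  : Tm → Tm → Fm
  _≺_  : Tm → Tm → Fm
  -- (RTC_{x,y} φ)(s,t) : the body φ has two extra bound variables,
  -- de Bruijn index 1 is x and index 0 is y.
  RTC  : Fm → Tm → Tm → Fm
  `¬   : Fm → Fm
  _`∧_ : Fm → Fm → Fm
  _`∨_ : Fm → Fm → Fm
  _`→_ : Fm → Fm → Fm
  `∀   : Fm → Fm
  `∃   : Fm → Fm

TmNoMul : Tm → Set
TmNoMul (var _)  = ⊤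
TmNoMul `0       = ⊤
TmNoMul (`s t)   = TmNoMul t
TmNoMul (t `+ u) = TmNoMul t × TmNoMul u
TmNoMul (t `· u) = ⊥

LRTC : Fm → Set
LRTC (s ≐ t)     = TmNoMul s × TmNoMul t
LRTC (s ≺ t)     = ⊥
LRTC (RTC φ s t) = LRTC φ × TmNoMul s × TmNoMul t
LRTC (`¬ φ)      = LRTC φ
LRTC (φ `∧ ψ)    = LRTC φ × LRTC ψ
LRTC (φ `∨ ψ)    = LRTC φ × LRTC ψ
LRTC (φ `→ ψ)    = LRTC φ × LRTC ψ
LRTC (`∀ φ)      = LRTC φ
LRTC (`∃ φ)      = LRTC φ

LPA : Fm → Set
LPA (s ≐ t)     = ⊤
LPA (s ≺ t)     = ⊤
LPA (RTC φ s t) = ⊥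
LPA (`¬ φ)      = LPA φ
LPA (φ `∧ ψ)    = LPA φ × LPA ψ
LPA (φ `∨ ψ)    = LPA φ × LPA ψ
LPA (φ `→ ψ)    = LPA φ × LPA ψ
LPA (`∀ φ)      = LPA φ
LPA (`∃ φ)      = LPA φ

Subst : Set
Subst = ℕ → Tm

tsub : Subst → Tm → Tm
tsub σ (var n)  = σ n
tsub σ `0       = `0
tsub σ (`s t)   = `s (tsub σ t)
tsub σ (t `+ u) = tsub σ t `+ tsub σ u
tsub σ (t `· u) = tsub σ t `· tsub σ u

ren : (ℕ → ℕ) → Tm → Tm
ren ρ = tsub (λ n → var (ρ n))

lift : Subst → Subst
lift σ zero    = var zero
lift σ (suc n) = ren suc (σ n)

fsub : Subst → Fm → Fm
fsub σ (s ≐ t)     = tsub σ s ≐ tsub σ t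
fsub σ (s ≺ t)     = tsub σ s ≺ tsub σ t
fsub σ (RTC φ s t) = RTC (fsub (lift (lift σ)) φ) (tsub σ s) (tsub σ t)
fsub σ (`¬ φ)      = `¬ (fsub σ φ)
fsub σ (φ `∧ ψ)    = fsub σ φ `∧ fsub σ ψ
fsub σ (φ `∨ ψ)    = fsub σ φ `∨ fsub σ ψ
fsub σ (φ `→ ψ)    = fsub σ φ `→ fsub σ ψ
fsub σ (`∀ φ)      = `∀ (fsub (lift σ) φ)
fsub σ (`∃ φ)      = `∃ (fsub (lift σ) φ)

inst1 : Fm → Tm → Fm
inst1 φ t = fsub σ φ
  where
  σ : Subst
  σ zero    = t
  σ (suc n) = var n

-- φ[r/x, t/y] for the body φ of an RTC_{x,y} (x = index 1, y = index 0)
inst2 : Fm → Tm → Tm → Fm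
inst2 φ r t = fsub σ φ
  where
  σ : Subst
  σ zero          = t
  σ (suc zero)    = r
  σ (suc (suc n)) = var n

occT : ℕ → Tm → Bool
occT n (var m)  = Data.Nat._≡ᵇ_ n m
occT n `0       = false
occT n (`s t)   = occT n t
occT n (t `+ u) = occT n t ∨ occT n u
occT n (t `· u) = occT n t ∨ occT n u

occF : ℕ → Fm → Bool
occF n (s ≐ t)     = occT n s ∨ occT n t
occF n (s ≺ t)     = occT n s ∨ occT n t
occF n (RTC φ s t) = occF (suc (suc n)) φ ∨ occT n s ∨ occT n t
occF n (`¬ φ)      = occF n φ
occF n (φ `∧ ψ)    = occF n φ ∨ occF n ψ
occF n (φ `∨ ψ)    = occF n φ ∨ occF n ψ
occF n (φ `→ ψ)    = occF n φ ∨ occF n ψ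
occF n (`∀ φ)      = occF (suc n) φ
occF n (`∃ φ)      = occF (suc n) φ

-- Sequents (finite sets of formulas, represented by lists; the
-- structural rule `wk` below makes provability insensitive to order
-- and multiplicity)

infix 3 _⇒_
record Seq : Set where
  constructor _⇒_
  field
    ant : List Fm
    sc  : List Fm
open Seq public

substSeq : Subst → Seq → Seq
substSeq θ (Γ ⇒ Δ) = map (fsub θ) Γ ⇒ map (fsub θ) Δ

FreeIn : ℕ → Seq → Set
FreeIn z (Γ ⇒ Δ) = any (occF z) (Γ ++ Δ) ≡ true

Fresh : ℕ → Seq → Set
Fresh z (Γ ⇒ Δ) = any (occF z) (Γ ++ Δ) ≡ false

-- LK_= without (Subst) (which is added per system, since traces
-- treat it specially).  Rule r : LK S Ps has conclusion S, premises Ps.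

data LK : Seq → List Seq → Set where
  ax   : ∀ {φ} → LK (φ ∷ [] ⇒ φ ∷ []) []
  wk   : ∀ {Γ Γ' Δ Δ'} → Γ' ⊆ Γ → Δ' ⊆ Δ → LK (Γ ⇒ Δ) ((Γ' ⇒ Δ') ∷ [])
  ¬L   : ∀ {Γ Δ φ} → LK (`¬ φ ∷ Γ ⇒ Δ) ((Γ ⇒ φ ∷ Δ) ∷ [])
  ¬R   : ∀ {Γ Δ φ} → LK (Γ ⇒ `¬ φ ∷ Δ) ((φ ∷ Γ ⇒ Δ) ∷ [])
  ∧L   : ∀ {Γ Δ φ ψ} → LK (φ `∧ ψ ∷ Γ ⇒ Δ) ((φ ∷ ψ ∷ Γ ⇒ Δ) ∷ [])
  ∧R   : ∀ {Γ Δ φ ψ} → LK (Γ ⇒ φ `∧ ψ ∷ Δ) ((Γ ⇒ φ ∷ Δ) ∷ (Γ ⇒ ψ ∷ Δ) ∷ [])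
  ∨L   : ∀ {Γ Δ φ ψ} → LK (φ `∨ ψ ∷ Γ ⇒ Δ) ((φ ∷ Γ ⇒ Δ) ∷ (ψ ∷ Γ ⇒ Δ) ∷ [])
  ∨R   : ∀ {Γ Δ φ ψ} → LK (Γ ⇒ φ `∨ ψ ∷ Δ) ((Γ ⇒ φ ∷ ψ ∷ Δ) ∷ [])
  →L   : ∀ {Γ Δ φ ψ} → LK (φ `→ ψ ∷ Γ ⇒ Δ) ((Γ ⇒ φ ∷ Δ) ∷ (ψ ∷ Γ ⇒ Δ) ∷ [])
  →R   : ∀ {Γ Δ φ ψ} → LK (Γ ⇒ φ `→ ψ ∷ Δ) ((φ ∷ Γ ⇒ ψ ∷ Δ) ∷ [])
  ∀L   : ∀ {Γ Δ φ} (t : Tm) → LK (`∀ φ ∷ Γ ⇒ Δ) ((inst1 φ t ∷ Γ ⇒ Δ) ∷ [])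
  ∀R   : ∀ {Γ Δ φ} (z : ℕ) → Fresh z (Γ ⇒ `∀ φ ∷ Δ) →
         LK (Γ ⇒ `∀ φ ∷ Δ) ((Γ ⇒ inst1 φ (var z) ∷ Δ) ∷ [])
  ∃L   : ∀ {Γ Δ φ} (z : ℕ) → Fresh z (`∃ φ ∷ Γ ⇒ Δ) →
         LK (`∃ φ ∷ Γ ⇒ Δ) ((inst1 φ (var z) ∷ Γ ⇒ Δ) ∷ [])
  ∃R   : ∀ {Γ Δ φ} (t : Tm) → LK (Γ ⇒ `∃ φ ∷ Δ) ((Γ ⇒ inst1 φ t ∷ Δ) ∷ [])
  =L₁  : ∀ {Γ Δ φ s t} → LK (s ≐ t ∷ Γ ⇒ inst1 φ t ∷ Δ) ((Γ ⇒ inst1 φ s ∷ Δ) ∷ [])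
  =L₂  : ∀ {Γ Δ φ s t} → LK (s ≐ t ∷ Γ ⇒ inst1 φ s ∷ Δ) ((Γ ⇒ inst1 φ t ∷ Δ) ∷ [])
  =R   : ∀ {t} → LK ([] ⇒ t ≐ t ∷ []) []
  cut  : ∀ {Γ Δ} (φ : Fm) → LK (Γ ⇒ Δ) ((Γ ⇒ φ ∷ Δ) ∷ (φ ∷ Γ ⇒ Δ) ∷ [])

-- Cyclic proofs: a finite graph of rule instances.  Regular (possibly
-- infinite) derivation trees are exactly the unfoldings of such graphs.

record Graph (R : Seq → List Seq → Set) : Set where
  field
    size : ℕ
    node : Fin size → Seq
    prem : Fin size → List (Fin size)
    rule : (i : Fin size) → R (node i) (map node (prem i))

record Path {R : Seq → List Seq → Set} (G : Graph R) : Set where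
  open Graph G
  field
    at   : ℕ → Fin size
    step : ∀ k → at (suc k) ∈ prem (at k)

-- A notion of trace for a rule system R: trace objects, which objects
-- may be followed in a sequent, the step relation between the object
-- in the conclusion and the object in the chosen premise, and the
-- progressing steps.
record TraceSys (R : Seq → List Seq → Set) : Set₁ where
  field
    Obj   : Set
    Valid : Seq → Obj → Set
    Step  : ∀ {S Ps} → R S Ps → Seq → Obj → Obj → Set
    Prog  : ∀ {S Ps} → R S Ps → Seq → Obj → Obj → Set

module _ {R : Seq → List Seq → Set} (TS : TraceSys R) (G : Graph R) where
  open TraceSys TS
  open Graph G

  IsTrace : Path G → ℕ → (ℕ → Obj) → Set
  IsTrace p k₀ τ = ∀ k → k₀ ≤ k →
      Valid (node (Path.at p k)) (τ k)
    × Step (rule (Path.at p k)) (node (Path.at p (suc k))) (τ k) (τ (suc k))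

  InfProg : Path G → ℕ → (ℕ → Obj) → Set
  InfProg p k₀ τ = ∀ m → ∃ λ k → m ≤ k × k₀ ≤ k ×
      Prog (rule (Path.at p k)) (node (Path.at p (suc k))) (τ k) (τ (suc k))

record Proof (R : Seq → List Seq → Set) (TS : TraceSys R) (L : Fm → Set)
             (S : Seq) : Set where
  field
    graph  : Graph R
    root   : Fin (Graph.size graph)
    rootIs : Graph.node graph root ≡ S
    lang   : ∀ i → All L (ant (Graph.node graph i)) × All L (sc (Graph.node graph i))
    good   : (p : Path graph) →
             Σ ℕ λ k₀ → Σ (ℕ → TraceSys.Obj TS) λ τ →
               IsTrace TS graph p k₀ τ × InfProg TS graph p k₀ τ

-- additional axiom sequents A (x = var 0, y = var 1; instances via Subst)
data AxA : Seq → Set where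
  a-s0  : AxA (`s (var 0) ≐ `0 ∷ [] ⇒ [])
  a-inj : AxA (`s (var 0) ≐ `s (var 1) ∷ [] ⇒ var 0 ≐ var 1 ∷ [])
  a-+0  : AxA ([] ⇒ (var 0 `+ `0) ≐ var 0 ∷ [])
  a-+s  : AxA ([] ⇒ (var 0 `+ `s (var 1)) ≐ `s (var 0 `+ var 1) ∷ [])
  a-nat : AxA ([] ⇒ RTC (`s (var 1) ≐ var 0) `0 (var 0) ∷ [])

data RTCRule : Seq → List Seq → Set where
  lk    : ∀ {S Ps} → LK S Ps → RTCRule S Ps
  sub   : ∀ {S} (θ : Subst) → RTCRule (substSeq θ S) (S ∷ [])
  axA   : ∀ {S} → AxA S → RTCRule S []
  refl  : ∀ {Γ Δ φ s} → RTCRule (Γ ⇒ RTC φ s s ∷ Δ) []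
  trans : ∀ {Γ Δ φ s t} (r : Tm) →
          RTCRule (Γ ⇒ RTC φ s t ∷ Δ)
                  ((Γ ⇒ RTC φ s r ∷ Δ) ∷ (Γ ⇒ inst2 φ r t ∷ Δ) ∷ [])
  case  : ∀ {Γ Δ φ s t} (z : ℕ) → Fresh z (RTC φ s t ∷ Γ ⇒ Δ) →
          RTCRule (RTC φ s t ∷ Γ ⇒ Δ)
                  ((s ≐ t ∷ Γ ⇒ Δ) ∷
                   (RTC φ s (var z) ∷ inst2 φ (var z) t ∷ Γ ⇒ Δ) ∷ [])

IsRTCFm : Fm → Set
IsRTCFm (RTC _ _ _) = ⊤
IsRTCFm _           = ⊥

rtcStep : ∀ {S Ps} → RTCRule S Ps → Seq → Fm → Fm → Set
rtcStep (sub θ) S' τ τ' = τ ≡ fsub θ τ'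
rtcStep (case {φ = φ} {s} {t} z _) S' τ τ' =
  (τ ≡ τ') ⊎ (τ ≡ RTC φ s t × τ' ≡ RTC φ s (var z))
rtcStep _ S' τ τ' = τ ≡ τ'

rtcProg : ∀ {S Ps} → RTCRule S Ps → Seq → Fm → Fm → Set
rtcProg (case {φ = φ} {s} {t} z _) S' τ τ' = τ ≡ RTC φ s t × τ' ≡ RTC φ s (var z)
rtcProg _ S' τ τ' = ⊥

RTCTrace : TraceSys RTCRule
RTCTrace = record
  { Obj   = Fm
  ; Valid = λ S τ → τ ∈ ant S × IsRTCFm τ
  ; Step  = rtcStep
  ; Prog  = rtcProg
  }

ProvRTC : Seq → Set
ProvRTC = Proof RTCRule RTCTrace LRTC

data AxPA : Seq → Set where
  p-s0   : ∀ {t} → AxPA (`s t ≐ `0 ∷ [] ⇒ [])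
  p-inj  : ∀ {t u} → AxPA (`s t ≐ `s u ∷ [] ⇒ t ≐ u ∷ [])
  p-+0   : ∀ {t} → AxPA ([] ⇒ (t `+ `0) ≐ t ∷ [])
  p-+s   : ∀ {t u} → AxPA ([] ⇒ (t `+ `s u) ≐ `s (t `+ u) ∷ [])
  p-·0   : ∀ {t} → AxPA ([] ⇒ (t `· `0) ≐ `0 ∷ [])
  p-·s   : ∀ {t u} → AxPA ([] ⇒ (t `· `s u) ≐ ((t `· u) `+ t) ∷ [])
  o-tr   : ∀ {t u v} → AxPA (t ≺ u ∷ u ≺ v ∷ [] ⇒ t ≺ v ∷ [])
  o-as   : ∀ {t u} → AxPA (t ≺ u ∷ u ≺ t ∷ [] ⇒ [])
  o-dis  : ∀ {t u} → AxPA (t ≺ u ∷ u ≺ `s t ∷ [] ⇒ [])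
  o-0    : ∀ {t} → AxPA (t ≺ `0 ∷ [] ⇒ [])
  o-mon  : ∀ {t u} → AxPA (t ≺ u ∷ [] ⇒ `s t ≺ `s u ∷ [])
  o-suc  : ∀ {t} → AxPA ([] ⇒ t ≺ `s t ∷ [])
  o-tot  : ∀ {t u} → AxPA ([] ⇒ t ≺ u ∷ t ≐ u ∷ u ≺ t ∷ [])

data CARule : Seq → List Seq → Set where
  lk    : ∀ {S Ps} → LK S Ps → CARule S Ps
  sub   : ∀ {S} (θ : Subst) → CARule (substSeq θ S) (S ∷ [])
  axPA  : ∀ {S} → AxPA S → CARule S []
  case  : ∀ {Γ Δ t} (x : ℕ) → Fresh x (`0 ≺ t ∷ Γ ⇒ Δ) →
          CARule (`0 ≺ t ∷ Γ ⇒ Δ) ((t ≐ `s (var x) ∷ Γ ⇒ Δ) ∷ [])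

caStep : ∀ {S Ps} → CARule S Ps → Seq → Tm → Tm → Set
caStep (sub θ) S' t t' = t ≡ tsub θ t'
caStep _ S' t t' = (t ≡ t') ⊎ ((t' ≐ t) ∈ ant S') ⊎ ((t ≐ t') ∈ ant S')
                 ⊎ ((t' ≺ t) ∈ ant S')

caProg : ∀ {S Ps} → CARule S Ps → Seq → Tm → Tm → Set
caProg (sub θ) S' t t' = ⊥
caProg _ S' t t' = (t' ≺ t) ∈ ant S'

TmIn : Seq → Tm → Set
TmIn S t = ∀ n → occT n t ≡ true → FreeIn n S

CATrace : TraceSys CARule
CATrace = record
  { Obj   = Tm
  ; Valid = TmIn
  ; Step  = caStep
  ; Prog  = caProg
  }

ProvCA : Seq → Set
ProvCA = Proof CARule CATrace LPA

-- The β-function formula B(c,i,v): Gödel's β-function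
--   β(c,i) = a mod (1 + (i+1)·d)   where c = ⟨a,d⟩ (Cantor pairing),
-- i.e.  ∃a ∃d ∃q. c+c = (a+d)·s(a+d) + (d+d) ∧ a = q·m + v ∧ v < m,
-- with m = s(s i · d).  Free variables: c = 0, i = 1, v = 2.
Bf : Fm
Bf = `∃ (`∃ (`∃ (
       ((c `+ c) ≐ (((a `+ d) `· `s (a `+ d)) `+ (d `+ d)))
   `∧ (a ≐ ((q `· m) `+ v))
   `∧ (v ≺ m))))
  where
  q d a c i v m : Tm
  q = var 0
  d = var 1
  a = var 2
  c = var 3
  i = var 4
  v = var 5
  m = `s (`s i `· d)

B : Tm → Tm → Tm → Fm
B c i v = fsub σ Bf
  where
  σ : Subst
  σ 0 = c
  σ 1 = i
  σ 2 = v
  σ n = var n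

_≤'_ : Tm → Tm → Fm
u ≤' z = (u ≺ z) `∨ (u ≐ z)

β : Fm → Fm
β (s ≐ t)     = s ≐ t
β (s ≺ t)     = s ≺ t
β (`¬ φ)      = `¬ (β φ)
β (φ `∧ ψ)    = β φ `∧ β ψ
β (φ `∨ ψ)    = β φ `∨ β ψ
β (φ `→ ψ)    = β φ `→ β ψ
β (`∀ φ)      = `∀ (β φ)
β (`∃ φ)      = `∃ (β φ)
-- s = t ∨ ∃z ∃c. B(c,0,s) ∧ B(c,sz,t) ∧
--    ∀u (u ≤ z → ∃v ∃w. B(c,u,v) ∧ B(c,su,w) ∧ φ^β[v/x,w/y])
-- (under ∃z∃c: c = 0, z = 1; under ∀u: u = 0, c = 1, z = 2;
--  under ∃v∃w: w = 0, v = 1, u = 2, c = 3, z = 4)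
β (RTC φ s t) =
  (s ≐ t) `∨
  `∃ (`∃ (
       B (var 0) `0 (ren (λ n → suc (suc n)) s)
   `∧ B (var 0) (`s (var 1)) (ren (λ n → suc (suc n)) t)
   `∧ `∀ ((var 0 ≤' var 2) `→
          `∃ (`∃ (
               B (var 3) (var 2) (var 1)
           `∧ B (var 3) (`s (var 2)) (var 0)
           `∧ fsub σ (β φ))))))
  where
  σ : Subst
  σ 0             = var 0
  σ 1             = var 1
  σ (suc (suc n)) = var (suc (suc (suc (suc (suc n)))))

{-# OPTIONS --safe #-}
-- Each of the two calculi is compared with ordinary induction.  Derivability in a cyclic calculus is
-- closed under its rules and under induction, so that natural deduction with induction can be carried
-- out inside it.  Conversely, the global trace condition is turned into finitely many nested inductions
-- (as in Simpson's theorem): the relations between trace objects along paths form a finite semigroup,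
-- the trace condition makes each of its idempotents strictly decreasing in some quantity, and by
-- induction on subsemigroups the union of all these relations satisfies the induction schema.
--
-- An RTC-proof thus becomes a derivation in arithmetic, the quantity attached to an RTC-formula being
-- the length of a β-coded path; the step rule for RTC needs that a β-coded sequence can be extended.
-- A proof in cyclic arithmetic becomes a derivation with RTC, the quantities being the values of terms;
-- here multiplication is a relation defined by RTC.  Translating the facts about β-coded paths in the
-- same way shows that the image of φ^β is equivalent to φ.
module Submission where

open import Defs hiding (refl; trans)
open import Algebra.Bundles using (CommutativeSemiring)
import Algebra.Solver.Ring.NaturalCoefficients.Default as Solver
open import Data.Bool using (Bool; true; false; _∨_)
open import Data.Bool.ListAction using (any)
open import Data.Empty using (⊥; ⊥-elim)
open import Data.Fin as F using (Fin)
import Data.Fin.Properties as Fₚ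
open import Data.List as List using (List; []; _∷_; map; _++_; foldr; filter; length; concatMap; allFin; cartesianProduct; cartesianProductWith; upTo)
import Data.List.Membership.DecPropositional as DecMem
open import Data.List.Membership.Propositional using (_∈_; _∉_; find)
import Data.List.Membership.Propositional.Properties as ∈ₚ
import Data.List.Properties as Lₚ
open import Data.List.Relation.Binary.Subset.Propositional using (_⊆_)
open import Data.List.Relation.Unary.All as All using (All; []; _∷_)
import Data.List.Relation.Unary.All.Properties as Allₚ
open import Data.List.Relation.Unary.Any as Any using (Any; here; there)
import Data.List.Relation.Unary.Any.Properties as Anyₚ
open import Data.Maybe using (Maybe; just; nothing)
import Data.Maybe.Properties as Mₚ
open import Data.Nat as N using (ℕ; zero; suc; _+_; _*_; _⊔_; _≤_; _<_; z≤n; s≤s)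
import Data.Nat.DivMod as DM
open import Data.Nat.DivMod using (_/_; _%_)
import Data.Nat.Properties as Nₚ
open import Data.Product using (Σ; ∃; _×_; _,_; proj₁; proj₂)
import Data.Product.Properties as ×ₚ
open import Data.Sum as Sum using (_⊎_; inj₁; inj₂)
open import Data.Unit using (⊤; tt)
open import Data.Vec as V using (Vec; []; _∷_)
import Data.Vec.Properties as Vₚ
open import Function using (_∘_; id; _$_; case_of_)
open import Function.Bundles using (_⇔_; mk⇔)
open import Relation.Binary.Definitions using (DecidableEquality)
open import Relation.Binary.PropositionalEquality using (_≡_; _≢_; refl; sym; trans; cong; cong₂; subst; subst₂)
open import Relation.Nullary using (¬_; Dec; yes; no; contradiction)
open import Relation.Nullary.Decidable using (¬?; _×-dec_; _⊎-dec_; _→-dec_; map′; isYes)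

-- Substitutions

-- Every trace has to be computed from its path, which rules out the usual appeal to Ramsey's
-- theorem for an arbitrary infinite path. The trace condition of the given proof is used for
-- periodic paths only, each repeating one walk with an idempotent matrix; all other infinite
-- behaviour is left to the induction schema of the target theory. The quantities of the two calculi
-- behave differently. A term has exactly one value, but a true RTC-formula may have coded paths of
-- many lengths, so lengths have to be chosen and handed on along the trace. On the other hand the
-- traces of arithmetic range over infinitely many terms, until a progress point bounds the depth of
-- the term. In the RTC language a closure relates single elements, while defining multiplication
-- calls for an iteration on pairs, and no pairing is definable by addition at that stage. Hence the
-- detour through points kN + kx for a large N. All derivations live in the joint language of both
-- calculi; foreign symbols are removed from the finished proofs at the end.

infixr 5 _∷ˢ_
_∷ˢ_ : Tm → Subst → Subst
(t ∷ˢ σ) zero    = t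
(t ∷ˢ σ) (suc n) = σ n

∨-introˡ : ∀ {a} b → a ≡ true → a ∨ b ≡ true
∨-introˡ _ refl = refl

∨-introʳ : ∀ a {b} → b ≡ true → a ∨ b ≡ true
∨-introʳ true  refl = refl
∨-introʳ false refl = refl

∨-elim : ∀ a {b} → a ∨ b ≡ true → a ≡ true ⊎ b ≡ true
∨-elim true  _ = inj₁ refl
∨-elim false e = inj₂ e

-- Agreement is demanded only at occurring variables, since an update at a fresh variable guarantees
-- no more than that.
tsub-occ : ∀ {σ τ} t → (∀ n → occT n t ≡ true → σ n ≡ τ n) → tsub σ t ≡ tsub τ t
tsub-occ (var n)  h = h n (≡ᵇ-refl n)
  where
  ≡ᵇ-refl : ∀ n → (n N.≡ᵇ n) ≡ true
  ≡ᵇ-refl zero    = refl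
  ≡ᵇ-refl (suc n) = ≡ᵇ-refl n
tsub-occ `0       h = refl
tsub-occ (`s t)   h = cong `s (tsub-occ t h)
tsub-occ (t `+ u) h = cong₂ _`+_ (tsub-occ t λ n o → h n (∨-introˡ _ o)) (tsub-occ u λ n o → h n (∨-introʳ (occT n t) o))
tsub-occ (t `· u) h = cong₂ _`·_ (tsub-occ t λ n o → h n (∨-introˡ _ o)) (tsub-occ u λ n o → h n (∨-introʳ (occT n t) o))

lift-agree : ∀ {σ τ : Subst} {P : ℕ → Set} → (∀ n → P (suc n) → σ n ≡ τ n) → ∀ n → P n → lift σ n ≡ lift τ n
lift-agree h zero    _ = refl
lift-agree h (suc n) o = cong (ren suc) (h n o)

fsub-occ : ∀ {σ τ} φ → (∀ n → occF n φ ≡ true → σ n ≡ τ n) → fsub σ φ ≡ fsub τ φ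
fsub-occ (s ≐ t)     h = cong₂ _≐_ (tsub-occ s λ n o → h n (∨-introˡ _ o)) (tsub-occ t λ n o → h n (∨-introʳ (occT n s) o))
fsub-occ (s ≺ t)     h = cong₂ _≺_ (tsub-occ s λ n o → h n (∨-introˡ _ o)) (tsub-occ t λ n o → h n (∨-introʳ (occT n s) o))
fsub-occ (RTC φ s t) h
  rewrite fsub-occ φ (lift-agree {P = λ n → occF n φ ≡ true} (lift-agree {P = λ n → occF (suc n) φ ≡ true} λ n o → h n (∨-introˡ _ o)))
        | tsub-occ s (λ n o → h n (∨-introʳ (occF (suc (suc n)) φ) (∨-introˡ _ o)))
        | tsub-occ t (λ n o → h n (∨-introʳ (occF (suc (suc n)) φ) (∨-introʳ (occT n s) o))) = refl
fsub-occ (`¬ φ)      h = cong `¬ (fsub-occ φ h)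
fsub-occ (φ `∧ ψ)    h = cong₂ _`∧_ (fsub-occ φ λ n o → h n (∨-introˡ _ o)) (fsub-occ ψ λ n o → h n (∨-introʳ (occF n φ) o))
fsub-occ (φ `∨ ψ)    h = cong₂ _`∨_ (fsub-occ φ λ n o → h n (∨-introˡ _ o)) (fsub-occ ψ λ n o → h n (∨-introʳ (occF n φ) o))
fsub-occ (φ `→ ψ)    h = cong₂ _`→_ (fsub-occ φ λ n o → h n (∨-introˡ _ o)) (fsub-occ ψ λ n o → h n (∨-introʳ (occF n φ) o))
fsub-occ (`∀ φ)      h = cong `∀ (fsub-occ φ (lift-agree {P = λ n → occF n φ ≡ true} h))
fsub-occ (`∃ φ)      h = cong `∃ (fsub-occ φ (lift-agree {P = λ n → occF n φ ≡ true} h))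

fsub-ext : ∀ {σ τ} φ → (∀ n → σ n ≡ τ n) → fsub σ φ ≡ fsub τ φ
fsub-ext φ h = fsub-occ φ λ n _ → h n

tsub-fuse : ∀ {σ τ} t → tsub σ (tsub τ t) ≡ tsub (tsub σ ∘ τ) t
tsub-fuse (var n)  = refl
tsub-fuse `0       = refl
tsub-fuse (`s t)   = cong `s (tsub-fuse t)
tsub-fuse (t `+ u) = cong₂ _`+_ (tsub-fuse t) (tsub-fuse u)
tsub-fuse (t `· u) = cong₂ _`·_ (tsub-fuse t) (tsub-fuse u)

lift-fuse : ∀ {σ τ : Subst} n → tsub (lift σ) (lift τ n) ≡ lift (tsub σ ∘ τ) n
lift-fuse zero    = refl
lift-fuse {σ} {τ} (suc n) = trans (tsub-fuse (τ n)) (sym (tsub-fuse (τ n)))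

fsub-fuse : ∀ {σ τ} φ → fsub σ (fsub τ φ) ≡ fsub (tsub σ ∘ τ) φ
fsub-fuse (s ≐ t)     = cong₂ _≐_ (tsub-fuse s) (tsub-fuse t)
fsub-fuse (s ≺ t)     = cong₂ _≺_ (tsub-fuse s) (tsub-fuse t)
fsub-fuse {σ} {τ} (RTC φ s t)
  rewrite fsub-fuse {lift (lift σ)} {lift (lift τ)} φ
        | fsub-ext φ (λ n → trans (lift-fuse {lift σ} {lift τ} n) (lift-agree {P = λ _ → ⊤} (λ m _ → lift-fuse {σ} {τ} m) n tt))
        | tsub-fuse {σ} {τ} s | tsub-fuse {σ} {τ} t = refl
fsub-fuse (`¬ φ)      = cong `¬ (fsub-fuse φ)
fsub-fuse (φ `∧ ψ)    = cong₂ _`∧_ (fsub-fuse φ) (fsub-fuse ψ)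
fsub-fuse (φ `∨ ψ)    = cong₂ _`∨_ (fsub-fuse φ) (fsub-fuse ψ)
fsub-fuse (φ `→ ψ)    = cong₂ _`→_ (fsub-fuse φ) (fsub-fuse ψ)
fsub-fuse (`∀ φ)      = cong `∀ (trans (fsub-fuse φ) (fsub-ext φ lift-fuse))
fsub-fuse (`∃ φ)      = cong `∃ (trans (fsub-fuse φ) (fsub-ext φ lift-fuse))

tsub-id : ∀ t → tsub var t ≡ t
tsub-id (var n)  = refl
tsub-id `0       = refl
tsub-id (`s t)   = cong `s (tsub-id t)
tsub-id (t `+ u) = cong₂ _`+_ (tsub-id t) (tsub-id u)
tsub-id (t `· u) = cong₂ _`·_ (tsub-id t) (tsub-id u)

lift-var : ∀ n → lift var n ≡ var n
lift-var zero    = refl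
lift-var (suc n) = refl

fsub-id : ∀ φ → fsub var φ ≡ φ
fsub-id (s ≐ t)     = cong₂ _≐_ (tsub-id s) (tsub-id t)
fsub-id (s ≺ t)     = cong₂ _≺_ (tsub-id s) (tsub-id t)
fsub-id (RTC φ s t)
  rewrite fsub-ext φ (λ n → trans (lift-agree {P = λ _ → ⊤} (λ m _ → lift-var m) n tt) (lift-var n))
        | fsub-id φ | tsub-id s | tsub-id t = refl
fsub-id (`¬ φ)      = cong `¬ (fsub-id φ)
fsub-id (φ `∧ ψ)    = cong₂ _`∧_ (fsub-id φ) (fsub-id ψ)
fsub-id (φ `∨ ψ)    = cong₂ _`∨_ (fsub-id φ) (fsub-id ψ)
fsub-id (φ `→ ψ)    = cong₂ _`→_ (fsub-id φ) (fsub-id ψ)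
fsub-id (`∀ φ)      = cong `∀ (trans (fsub-ext φ lift-var) (fsub-id φ))
fsub-id (`∃ φ)      = cong `∃ (trans (fsub-ext φ lift-var) (fsub-id φ))

inst1-cons : ∀ φ t → inst1 φ t ≡ fsub (t ∷ˢ var) φ
inst1-cons φ t = fsub-ext φ λ { zero → refl ; (suc n) → refl }

inst2-cons : ∀ φ r t → inst2 φ r t ≡ fsub (t ∷ˢ r ∷ˢ var) φ
inst2-cons φ r t = fsub-ext φ λ { zero → refl ; (suc zero) → refl ; (suc (suc n)) → refl }

ren-suc : ∀ t {σ u} → tsub (u ∷ˢ σ) (ren suc t) ≡ tsub σ t
ren-suc t = tsub-fuse t

cons-lift : ∀ {σ t} n → tsub (t ∷ˢ var) (lift σ n) ≡ (t ∷ˢ σ) n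
cons-lift zero        = refl
cons-lift {σ} (suc n) = trans (ren-suc (σ n)) (tsub-id (σ n))

inst1-lift : ∀ {σ} φ t → inst1 (fsub (lift σ) φ) t ≡ fsub (t ∷ˢ σ) φ
inst1-lift φ t = trans (inst1-cons _ t) (trans (fsub-fuse φ) (fsub-ext φ cons-lift))

inst2-lift : ∀ {σ} φ r t → inst2 (fsub (lift (lift σ)) φ) r t ≡ fsub (t ∷ˢ r ∷ˢ σ) φ
inst2-lift {σ} φ r t = trans (inst2-cons _ r t) (trans (fsub-fuse φ) (fsub-ext φ
  λ { zero → refl
    ; (suc zero) → refl
    ; (suc (suc n)) → trans (tsub-fuse (ren suc (σ n))) (trans (tsub-fuse (σ n)) (tsub-id (σ n))) }))

-- Freshness

bndT : Tm → ℕ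
bndT (var n)  = suc n
bndT `0       = 0
bndT (`s t)   = bndT t
bndT (t `+ u) = bndT t ⊔ bndT u
bndT (t `· u) = bndT t ⊔ bndT u

-- Binders do not lower the bound. The overestimate does no harm, because it serves only to pick
-- fresh variables.
bndF : Fm → ℕ
bndF (s ≐ t)     = bndT s ⊔ bndT t
bndF (s ≺ t)     = bndT s ⊔ bndT t
bndF (RTC φ s t) = bndF φ ⊔ (bndT s ⊔ bndT t)
bndF (`¬ φ)      = bndF φ
bndF (φ `∧ ψ)    = bndF φ ⊔ bndF ψ
bndF (φ `∨ ψ)    = bndF φ ⊔ bndF ψ
bndF (φ `→ ψ)    = bndF φ ⊔ bndF ψ
bndF (`∀ φ)      = bndF φ
bndF (`∃ φ)      = bndF φ

≡ᵇ-true : ∀ m n → (m N.≡ᵇ n) ≡ true → m ≡ n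
≡ᵇ-true m n e = Nₚ.≡ᵇ⇒≡ m n (subst Data.Bool.T (sym e) tt)

private
  ⊔ˡ : ∀ {n a} b → n < a → n < a ⊔ b
  ⊔ˡ {a = a} b h = Nₚ.≤-trans h (Nₚ.m≤m⊔n a b)
  ⊔ʳ : ∀ {n b} a → n < b → n < a ⊔ b
  ⊔ʳ {b = b} a h = Nₚ.≤-trans h (Nₚ.m≤n⊔m a b)
  ∨⊔ : ∀ {n} a {b p q} → (a ≡ true → n < p) → (b ≡ true → n < q) → a ∨ b ≡ true → n < p ⊔ q
  ∨⊔ a {p = p} {q} f g e with ∨-elim a e
  ... | inj₁ x = ⊔ˡ q (f x)
  ... | inj₂ y = ⊔ʳ p (g y)

occT-bnd : ∀ n t → occT n t ≡ true → n < bndT t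
occT-bnd n (var m)  e = s≤s (Nₚ.≤-reflexive (≡ᵇ-true n m e))
occT-bnd n (`s t)   e = occT-bnd n t e
occT-bnd n (t `+ u) e = ∨⊔ (occT n t) (occT-bnd n t) (occT-bnd n u) e
occT-bnd n (t `· u) e = ∨⊔ (occT n t) (occT-bnd n t) (occT-bnd n u) e

occF-bnd : ∀ n φ → occF n φ ≡ true → n < bndF φ
occF-bnd n (s ≐ t)     e = ∨⊔ (occT n s) (occT-bnd n s) (occT-bnd n t) e
occF-bnd n (s ≺ t)     e = ∨⊔ (occT n s) (occT-bnd n s) (occT-bnd n t) e
occF-bnd n (RTC φ s t) e = ∨⊔ (occF (suc (suc n)) φ) (λ x → Nₚ.<-trans (Nₚ.m<n⇒m<1+n (Nₚ.n<1+n n)) (occF-bnd _ φ x))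
  (∨⊔ (occT n s) (occT-bnd n s) (occT-bnd n t)) e
occF-bnd n (`¬ φ)      e = occF-bnd n φ e
occF-bnd n (φ `∧ ψ)    e = ∨⊔ (occF n φ) (occF-bnd n φ) (occF-bnd n ψ) e
occF-bnd n (φ `∨ ψ)    e = ∨⊔ (occF n φ) (occF-bnd n φ) (occF-bnd n ψ) e
occF-bnd n (φ `→ ψ)    e = ∨⊔ (occF n φ) (occF-bnd n φ) (occF-bnd n ψ) e
occF-bnd n (`∀ φ)      e = Nₚ.<-trans (Nₚ.n<1+n n) (occF-bnd (suc n) φ e)
occF-bnd n (`∃ φ)      e = Nₚ.<-trans (Nₚ.n<1+n n) (occF-bnd (suc n) φ e)

any-elim : ∀ (p : Fm → Bool) xs → any p xs ≡ true → ∃ λ x → x ∈ xs × p x ≡ true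
any-elim p (x ∷ xs) e with ∨-elim (p x) e
... | inj₁ y = x , here refl , y
... | inj₂ y with any-elim p xs y
...   | z , m , q = z , there m , q

any-intro : ∀ (p : Fm → Bool) {x xs} → x ∈ xs → p x ≡ true → any p xs ≡ true
any-intro p (here refl) e = ∨-introˡ _ e
any-intro p {xs = y ∷ _} (there m) e = ∨-introʳ (p y) (any-intro p m e)

¬true : ∀ {b} → ¬ b ≡ true → b ≡ false
¬true {false} _ = refl
¬true {true}  f = ⊥-elim (f refl)

bndL : List Fm → ℕ
bndL []       = 0
bndL (φ ∷ Γ) = bndF φ ⊔ bndL Γ

bndL-∈ : ∀ {φ Γ} → φ ∈ Γ → bndF φ ≤ bndL Γ
bndL-∈ {Γ = φ ∷ Γ} (here refl) = Nₚ.m≤m⊔n (bndF φ) (bndL Γ)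
bndL-∈ {Γ = φ ∷ Γ} (there m)   = Nₚ.≤-trans (bndL-∈ m) (Nₚ.m≤n⊔m (bndF φ) (bndL Γ))

free⇒< : ∀ {Γ Δ z} → FreeIn z (Γ ⇒ Δ) → z < bndL (Γ ++ Δ)
free⇒< {Γ} {Δ} {z} e with any-elim (occF z) (Γ ++ Δ) e
... | φ , m , o = Nₚ.≤-trans (occF-bnd z φ o) (bndL-∈ m)

freshFor : ∀ Γ Δ → Fresh (bndL (Γ ++ Δ)) (Γ ⇒ Δ)
freshFor Γ Δ = ¬true λ e → Nₚ.<-irrefl refl (free⇒< {Γ} {Δ} e)

false≢true : ∀ {b : Bool} {A : Set} → b ≡ false → b ≡ true → A
false≢true refl ()

_[_↦_] : Subst → ℕ → Tm → Subst
(σ [ z ↦ t ]) n with z N.≟ n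
... | yes _ = t
... | no  _ = σ n

upd-same : ∀ σ z t → (σ [ z ↦ t ]) z ≡ t
upd-same σ z t with z N.≟ z
... | yes _ = refl
... | no ne = contradiction refl ne

upd-other : ∀ σ {z} t {n} → z ≢ n → (σ [ z ↦ t ]) n ≡ σ n
upd-other σ {z} t {n} ne with z N.≟ n
... | yes e = contradiction e ne
... | no _  = refl

-- Joining cyclic proofs

AnyFm : Fm → Set
AnyFm _ = ⊤

module Join {R : Seq → List Seq → Set} (TS : TraceSys R) where
  open TraceSys TS

  module _ {I : Set} (node : I → Seq) (prem : I → List I) (rule : ∀ i → R (node i) (map node (prem i))) where
    Traced : (ℕ → I) → Set
    Traced at = Σ ℕ λ k₀ → Σ (ℕ → Obj) λ τ →
        (∀ k → k₀ ≤ k → Valid (node (at k)) (τ k) × Step (rule (at k)) (node (at (suc k))) (τ k) (τ (suc k)))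
      × (∀ m → ∃ λ k → m ≤ k × k₀ ≤ k × Prog (rule (at k)) (node (at (suc k))) (τ k) (τ (suc k)))

    delay : ∀ at → Traced (at ∘ suc) → Traced at
    -- The entry at 0 lies before the start of the trace and is arbitrary.
    delay at (k₀ , τ , tr , pr) = suc k₀ , (λ { zero → τ zero ; (suc k) → τ k }) ,
      (λ { (suc k) (s≤s h) → tr k h }) ,
      λ m → let k , a , b , p = pr m in suc k , Nₚ.m≤n⇒m≤1+n a , s≤s b , p

  -- Index sets other than Fin m spare index arithmetic when graphs are joined.
  record Forest (Ss : List Seq) : Set₁ where
    field
      {I}     : Set
      {m}     : ℕ
      enc     : I → Fin m
      dec     : Fin m → I
      dec-enc : ∀ i → dec (enc i) ≡ i
      node    : I → Seq
      prem    : I → List I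
      rule    : ∀ i → R (node i) (map node (prem i))
      roots   : List I
      rootsIs : map node roots ≡ Ss
      good    : ∀ at → (∀ k → at (suc k) ∈ prem (at k)) → Traced node prem rule at

  Step-subst : ∀ {S Ps Qs} (e : Ps ≡ Qs) {r : R S Ps} {S' a b} → Step r S' a b → Step (subst (R S) e r) S' a b
  Step-subst refl s = s

  Prog-subst : ∀ {S Ps Qs} (e : Ps ≡ Qs) {r : R S Ps} {S' a b} → Prog r S' a b → Prog (subst (R S) e r) S' a b
  Prog-subst refl s = s

  -- The image of `f` is closed under premises, so a path that starts in it lifts to a path of the
  -- first graph, and the trace found there can be used unchanged.
  module Embed {I J : Set}
    (node : I → Seq) (prem : I → List I) (rule : ∀ i → R (node i) (map node (prem i)))
    (node' : J → Seq) (prem' : J → List J) (rule' : ∀ j → R (node' j) (map node' (prem' j)))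
    (f : I → J) (nd : ∀ i → node' (f i) ≡ node i)
    (pr : ∀ i → prem' (f i) ≡ map f (prem i))
    (st : ∀ i j a b → Step (rule i) (node j) a b → Step (rule' (f i)) (node' (f j)) a b)
    (pg : ∀ i j a b → Prog (rule i) (node j) a b → Prog (rule' (f i)) (node' (f j)) a b)
    where
    module _ (at : ℕ → J) (i₀ : I) (e₀ : at 0 ≡ f i₀) (step : ∀ k → at (suc k) ∈ prem' (at k)) where
      next : ∀ k i → at k ≡ f i → Σ I λ i' → i' ∈ prem i × at (suc k) ≡ f i'
      next k i e = ∈ₚ.∈-map⁻ f (subst (at (suc k) ∈_) (trans (cong prem' e) (pr i)) (step k))
      pre : ∀ k → Σ I λ i → at k ≡ f i
      pre zero    = i₀ , e₀
      pre (suc k) = let i' , _ , e = next k _ (proj₂ (pre k)) in i' , e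
      at' : ℕ → I
      at' = proj₁ ∘ pre
      step' : ∀ k → at' (suc k) ∈ prem (at' k)
      step' k = proj₁ (proj₂ (next k _ (proj₂ (pre k))))
      transfer : Traced node prem rule at' → Traced node' prem' rule' at
      transfer (k₀ , τ , tr , pr) = k₀ , τ ,
        (λ k h → subst (λ S → Valid S (τ k)) (sym (trans (cong node' (proj₂ (pre k))) (nd _))) (proj₁ (tr k h))
               , subst₂ (λ x y → Step (rule' x) (node' y) (τ k) (τ (suc k))) (sym (proj₂ (pre k))) (sym (proj₂ (pre (suc k)))) (st _ _ _ _ (proj₂ (tr k h)))) ,
        λ m → let k , a , b , p = pr m in
          k , a , b , subst₂ (λ x y → Prog (rule' x) (node' y) (τ k) (τ (suc k))) (sym (proj₂ (pre k))) (sym (proj₂ (pre (suc k)))) (pg _ _ _ _ p)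

  empty : Forest []
  empty = record { I = ⊥ ; m = 0 ; enc = λ () ; dec = λ () ; dec-enc = λ () ; node = λ () ; prem = λ () ; rule = λ ()
                 ; roots = [] ; rootsIs = refl ; good = λ at _ → ⊥-elim (at 0) }

  cons : ∀ {S Ss} → Proof R TS AnyFm S → Forest Ss → Forest (S ∷ Ss)
  cons {S} {Ss} P Fo = record
    { I = Fin P.size ⊎ Fo.I ; m = P.size + Fo.m
    ; enc = F.join P.size Fo.m ∘ Sum.map id Fo.enc
    ; dec = Sum.map id Fo.dec ∘ F.splitAt P.size
    ; dec-enc = de
    ; node = nd ; prem = pm ; rule = rl
    ; roots = inj₁ (Proof.root P) ∷ map inj₂ Fo.roots
    ; rootsIs = cong₂ _∷_ (Proof.rootIs P) (trans (sym (Lₚ.map-∘ Fo.roots)) Fo.rootsIs)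
    ; good = gd }
    where
    module P = Graph (Proof.graph P)
    module Fo = Forest Fo
    nd : Fin P.size ⊎ Fo.I → Seq
    nd (inj₁ i) = P.node i
    nd (inj₂ i) = Fo.node i
    pm : Fin P.size ⊎ Fo.I → List (Fin P.size ⊎ Fo.I)
    pm (inj₁ i) = map inj₁ (P.prem i)
    pm (inj₂ i) = map inj₂ (Fo.prem i)
    rl : ∀ i → R (nd i) (map nd (pm i))
    rl (inj₁ i) = subst (R _) (Lₚ.map-∘ (P.prem i)) (P.rule i)
    rl (inj₂ i) = subst (R _) (Lₚ.map-∘ (Fo.prem i)) (Fo.rule i)
    de : ∀ i → Sum.map id Fo.dec (F.splitAt P.size (F.join P.size Fo.m (Sum.map id Fo.enc i))) ≡ i
    de (inj₁ i) rewrite Fₚ.splitAt-↑ˡ P.size i Fo.m = refl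
    de (inj₂ i) rewrite Fₚ.splitAt-↑ʳ P.size Fo.m (Fo.enc i) = cong inj₂ (Fo.dec-enc i)
    module L = Embed P.node P.prem P.rule nd pm rl inj₁ (λ _ → refl) (λ _ → refl)
      (λ i _ _ _ → Step-subst (Lₚ.map-∘ (P.prem i))) (λ i _ _ _ → Prog-subst (Lₚ.map-∘ (P.prem i)))
    module Rt = Embed Fo.node Fo.prem Fo.rule nd pm rl inj₂ (λ _ → refl) (λ _ → refl)
      (λ i _ _ _ → Step-subst (Lₚ.map-∘ (Fo.prem i))) (λ i _ _ _ → Prog-subst (Lₚ.map-∘ (Fo.prem i)))
    gd : ∀ at → (∀ k → at (suc k) ∈ pm (at k)) → Traced nd pm rl at
    -- No path leaves its component, so the first node decides which of the two trace conditions
    -- applies.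
    gd at st = go (at 0) refl
      where
      go : ∀ x → at 0 ≡ x → Traced nd pm rl at
      go (inj₁ i) e = L.transfer at i e st (Proof.good P (record { at = L.at' at i e st ; step = L.step' at i e st }))
      go (inj₂ i) e = Rt.transfer at i e st (Fo.good (Rt.at' at i e st) (Rt.step' at i e st))

  forest : ∀ {Ss} → All (Proof R TS AnyFm) Ss → Forest Ss
  forest []       = empty
  forest (p ∷ ps) = cons p (forest ps)

  toProof : ∀ {S Ss} → Forest (S ∷ Ss) → Proof R TS AnyFm S
  toProof {S} {Ss} Fo = go Fo.roots Fo.rootsIs
    where
    module Fo = Forest Fo
    node' : Fin Fo.m → Seq
    node' = Fo.node ∘ Fo.dec
    prem' : Fin Fo.m → List (Fin Fo.m)
    prem' i = map Fo.enc (Fo.prem (Fo.dec i))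
    pe : ∀ xs → map Fo.node xs ≡ map node' (map Fo.enc xs)
    pe []       = refl
    pe (x ∷ xs) = cong₂ _∷_ (cong Fo.node (sym (Fo.dec-enc x))) (pe xs)
    g : Graph R
    g = record { size = Fo.m ; node = node' ; prem = prem' ; rule = λ i → subst (R _) (pe (Fo.prem (Fo.dec i))) (Fo.rule (Fo.dec i)) }
    gd : (p : Path g) → Σ ℕ λ k₀ → Σ (ℕ → Obj) λ τ → IsTrace TS g p k₀ τ × InfProg TS g p k₀ τ
    gd p with Fo.good (Fo.dec ∘ Path.at p)
                (λ k → let j , m , e = ∈ₚ.∈-map⁻ Fo.enc (Path.step p k)
                       in subst (_∈ Fo.prem (Fo.dec (Path.at p k))) (sym (trans (cong Fo.dec e) (Fo.dec-enc j))) m)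
    ... | k₀ , τ , tr , pr = k₀ , τ ,
      (λ k h → proj₁ (tr k h) , Step-subst (pe (Fo.prem (Fo.dec (Path.at p k)))) (proj₂ (tr k h))) ,
      λ m → let k , a , b , q = pr m in k , a , b , Prog-subst (pe (Fo.prem (Fo.dec (Path.at p k)))) q
    go : ∀ rs → map Fo.node rs ≡ S ∷ Ss → Proof R TS AnyFm S
    go (r ∷ rs) e = record
      { graph = g ; root = Fo.enc r ; rootIs = trans (cong Fo.node (Fo.dec-enc r)) (Lₚ.∷-injectiveˡ e)
      ; lang = λ i → All.universal (λ _ → tt) _ , All.universal (λ _ → tt) _ ; good = gd }

  infer : ∀ {S Ps} → R S Ps → All (Proof R TS AnyFm) Ps → Proof R TS AnyFm S
  infer {S} {Ps} r ps = toProof {Ss = []} record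
    { I = Maybe Fo.I ; m = suc Fo.m ; enc = en ; dec = de
    ; dec-enc = λ { nothing → refl ; (just i) → cong just (Fo.dec-enc i) }
    ; node = nd ; prem = pm ; rule = rl ; roots = nothing ∷ [] ; rootsIs = refl ; good = gd }
    where
    module Fo = Forest (forest ps)
    en : Maybe Fo.I → Fin (suc Fo.m)
    en nothing  = F.zero
    en (just i) = F.suc (Fo.enc i)
    de : Fin (suc Fo.m) → Maybe Fo.I
    de F.zero    = nothing
    de (F.suc i) = just (Fo.dec i)
    nd : Maybe Fo.I → Seq
    nd nothing  = S
    nd (just i) = Fo.node i
    pm : Maybe Fo.I → List (Maybe Fo.I)
    pm nothing  = map just Fo.roots
    pm (just i) = map just (Fo.prem i)
    rl : ∀ i → R (nd i) (map nd (pm i))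
    rl nothing  = subst (R S) (trans (sym Fo.rootsIs) (Lₚ.map-∘ Fo.roots)) r
    rl (just i) = subst (R _) (Lₚ.map-∘ (Fo.prem i)) (Fo.rule i)
    module Em = Embed Fo.node Fo.prem Fo.rule nd pm rl just (λ _ → refl) (λ _ → refl)
      (λ i _ _ _ → Step-subst (Lₚ.map-∘ (Fo.prem i))) (λ i _ _ _ → Prog-subst (Lₚ.map-∘ (Fo.prem i)))
    inside : ∀ at → (∀ k → at (suc k) ∈ pm (at k)) → ∀ i → at 0 ≡ just i → Traced nd pm rl at
    inside at st i e = Em.transfer at i e st (Fo.good (Em.at' at i e st) (Em.step' at i e st))
    gd : ∀ at → (∀ k → at (suc k) ∈ pm (at k)) → Traced nd pm rl at
    gd at st = go (at 0) refl
      where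
      go : ∀ x → at 0 ≡ x → Traced nd pm rl at
      go (just i) e = inside at st i e
      go nothing  e =
        let i , _ , e' = ∈ₚ.∈-map⁻ just (subst (λ x → at 1 ∈ pm x) e (st 0))
        in delay nd pm rl at (inside (at ∘ suc) (st ∘ suc) i e')

-- Under the empty trace condition a proof has no infinite path at all.
finitary : (R : Seq → List Seq → Set) → TraceSys R
finitary R = record { Obj = ⊤ ; Valid = λ _ _ → ⊥ ; Step = λ _ _ _ _ → ⊤ ; Prog = λ _ _ _ _ → ⊤ }

-- The side premises of a loop must have finite proofs: otherwise it could not be decided
-- whether a path eventually leaves the loop, and its trace could not be computed.
module Loop {R : Seq → List Seq → Set} (TS : TraceSys R) (L : ℕ) (s : Fin (suc L) → Seq)
  (Ss : List Seq) (side : All (Proof R (finitary R) AnyFm) Ss)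
  (prs : Fin (suc L) → List (Fin (suc L) ⊎ Σ Seq (_∈ Ss)))
  (rule : ∀ i → R (s i) (map Sum.[ s , proj₁ ] (prs i)))
  (o : Fin (suc L) → TraceSys.Obj TS) (valid : ∀ i → TraceSys.Valid TS (s i) (o i))
  (stp : ∀ i j → inj₁ j ∈ prs i → TraceSys.Step TS (rule i) (s j) (o i) (o j))
  -- An edge without progress lowers the rank, so a path inside the loop meets a progressing edge
  -- again and again.
  (rank : Fin (suc L) → ℕ)
  (prg : ∀ i j → inj₁ j ∈ prs i → TraceSys.Prog TS (rule i) (s j) (o i) (o j) ⊎ rank j < rank i)
  where
  private
    module J = Join TS
    module FJ = Join (finitary R)
    Fo : FJ.Forest Ss
    Fo = FJ.forest side
    module Fo = FJ.Forest Fo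
    I : Set
    I = Fin (suc L) ⊎ Fo.I
    nd : I → Seq
    nd = Sum.[ s , Fo.node ]
    rootOf : ∀ {S} → S ∈ Ss → Σ Fo.I λ i → S ≡ Fo.node i
    rootOf {S} m = let i , _ , e = ∈ₚ.∈-map⁻ Fo.node (subst (S ∈_) (sym Fo.rootsIs) m) in i , e
    conv : Fin (suc L) ⊎ Σ Seq (_∈ Ss) → I
    conv (inj₁ j)       = inj₁ j
    conv (inj₂ (_ , m)) = inj₂ (proj₁ (rootOf m))
    conv-nd : ∀ xs → map Sum.[ s , proj₁ ] xs ≡ map nd (map conv xs)
    conv-nd []                  = refl
    conv-nd (inj₁ j ∷ xs)       = cong (s j ∷_) (conv-nd xs)
    conv-nd (inj₂ (_ , m) ∷ xs) = cong₂ _∷_ (proj₂ (rootOf m)) (conv-nd xs)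
    pm : I → List I
    pm (inj₁ i) = map conv (prs i)
    pm (inj₂ i) = map inj₂ (Fo.prem i)
    rl : ∀ i → R (nd i) (map nd (pm i))
    rl (inj₁ i) = subst (R _) (conv-nd (prs i)) (rule i)
    rl (inj₂ i) = subst (R _) (Lₚ.map-∘ (Fo.prem i)) (Fo.rule i)
    module Em = FJ.Embed Fo.node Fo.prem Fo.rule nd pm rl inj₂ (λ _ → refl) (λ _ → refl) (λ _ _ _ _ _ → tt) (λ _ _ _ _ _ → tt)
    module _ (at : ℕ → I) (st : ∀ k → at (suc k) ∈ pm (at k)) where
      stays : ∀ k → Σ (Fin (suc L)) λ i → at k ≡ inj₁ i
      stays k = go (at k) refl
        where
        go : ∀ x → at k ≡ x → Σ (Fin (suc L)) λ i → at k ≡ inj₁ i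
        go (inj₁ i) e = i , e
        -- From a side proof the path could never return and would have a trace there; but no object
        -- is valid under the empty trace condition.
        go (inj₂ i) e = ⊥-elim (proj₁ (proj₁ (proj₂ (proj₂ tr)) (proj₁ tr) Nₚ.≤-refl))
          where
          at″ : ℕ → I
          at″ n = at (n + k)
          st″ : ∀ n → at″ (suc n) ∈ pm (at″ n)
          st″ n = st (n + k)
          tr = Fo.good (Em.at' at″ i e st″) (Em.step' at″ i e st″)
      here? : ℕ → Fin (suc L)
      here? k = proj₁ (stays k)
      succ : ∀ k → inj₁ (here? (suc k)) ∈ prs (here? k)
      succ k with stays k | stays (suc k) | st k
      ... | i , e | j , e' | m rewrite e | e' with ∈ₚ.∈-map⁻ conv m
      ...   | inj₁ j' , m' , refl = m'
      τ : ℕ → TraceSys.Obj TS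
      τ k = o (here? k)
      tr : ∀ k → TraceSys.Valid TS (nd (at k)) (τ k) × TraceSys.Step TS (rl (at k)) (nd (at (suc k))) (τ k) (τ (suc k))
      tr k with stays k | stays (suc k) | succ k
      ... | i , e | j , e' | m rewrite e | e' = valid i , J.Step-subst (conv-nd (prs i)) (stp i j m)
      pr : ∀ m → TraceSys.Prog TS (rl (at m)) (nd (at (suc m))) (τ m) (τ (suc m)) ⊎ rank (here? (suc m)) < rank (here? m)
      pr k with stays k | stays (suc k) | succ k
      ... | i , e | j , e' | m rewrite e | e' with prg i j m
      ...   | inj₁ p = inj₁ (J.Prog-subst (conv-nd (prs i)) p)
      ...   | inj₂ l = inj₂ l
      infpr : ∀ fuel m → rank (here? m) < fuel → ∃ λ k → m ≤ k × TraceSys.Prog TS (rl (at k)) (nd (at (suc k))) (τ k) (τ (suc k))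
      infpr (suc f) m (s≤s h) with pr m
      ... | inj₁ p = m , Nₚ.≤-refl , p
      ... | inj₂ l = let k , a , p = infpr f (suc m) (Nₚ.≤-trans l h) in k , Nₚ.<⇒≤ a , p
      gd : J.Traced nd pm rl at
      gd = 0 , τ , (λ k _ → tr k) , λ m → let k , a , p = infpr _ m Nₚ.≤-refl in k , a , z≤n , p

  loop : ∀ i → Proof R TS AnyFm (s i)
  loop i = J.toProof {Ss = []} record
    { I = I ; m = suc L + Fo.m
    ; enc = F.join (suc L) Fo.m ∘ Sum.map id Fo.enc
    ; dec = Sum.map id Fo.dec ∘ F.splitAt (suc L)
    ; dec-enc = λ { (inj₁ i) → cong (Sum.map id Fo.dec) (Fₚ.splitAt-↑ˡ (suc L) i Fo.m)
                  ; (inj₂ i) → trans (cong (Sum.map id Fo.dec) (Fₚ.splitAt-↑ʳ (suc L) Fo.m (Fo.enc i))) (cong inj₂ (Fo.dec-enc i)) }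
    ; node = nd ; prem = pm ; rule = rl ; roots = inj₁ i ∷ [] ; rootsIs = refl ; good = gd }

-- Natural deduction inside the sequent calculi

-- The syntax has no falsum; this equation is refuted by the axioms of both calculi.
⊥' : Fm
⊥' = `s `0 ≐ `0

up : ℕ → Subst
up k n = var (k + n)

-- The premises of `∀I₀` and `∃E₀` range over all terms t instead of one eigenvariable. The sequent
-- calculus uses their instance at a fresh variable, and no freshness condition is left in later
-- derivations.
record Logic : Set₁ where
  infix 3 _⊢_
  field
    _⊢_ : List Fm → Fm → Set
    hyp : ∀ {Γ φ} → φ ∈ Γ → Γ ⊢ φ
    wkN : ∀ {Γ Δ φ} → Γ ⊆ Δ → Γ ⊢ φ → Δ ⊢ φ
    cutN : ∀ {Γ φ ψ} → Γ ⊢ φ → φ ∷ Γ ⊢ ψ → Γ ⊢ ψ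
    →I  : ∀ {Γ φ ψ} → φ ∷ Γ ⊢ ψ → Γ ⊢ φ `→ ψ
    →E  : ∀ {Γ φ ψ} → Γ ⊢ φ `→ ψ → Γ ⊢ φ → Γ ⊢ ψ
    ∧I  : ∀ {Γ φ ψ} → Γ ⊢ φ → Γ ⊢ ψ → Γ ⊢ φ `∧ ψ
    ∧E₁ : ∀ {Γ φ ψ} → Γ ⊢ φ `∧ ψ → Γ ⊢ φ
    ∧E₂ : ∀ {Γ φ ψ} → Γ ⊢ φ `∧ ψ → Γ ⊢ ψ
    ∨I₁ : ∀ {Γ φ ψ} → Γ ⊢ φ → Γ ⊢ φ `∨ ψ
    ∨I₂ : ∀ {Γ φ ψ} → Γ ⊢ ψ → Γ ⊢ φ `∨ ψ
    ∨E  : ∀ {Γ φ ψ χ} → Γ ⊢ φ `∨ ψ → φ ∷ Γ ⊢ χ → ψ ∷ Γ ⊢ χ → Γ ⊢ χ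
    ¬I  : ∀ {Γ φ} → φ ∷ Γ ⊢ ⊥' → Γ ⊢ `¬ φ
    ¬E  : ∀ {Γ φ ψ} → Γ ⊢ `¬ φ → Γ ⊢ φ → Γ ⊢ ψ
    raa : ∀ {Γ φ} → `¬ φ ∷ Γ ⊢ ⊥' → Γ ⊢ φ
    ∀I₀ : ∀ {Γ} φ → (∀ t → Γ ⊢ fsub (t ∷ˢ var) φ) → Γ ⊢ `∀ φ
    ∀E₀ : ∀ {Γ} φ → Γ ⊢ `∀ φ → ∀ t → Γ ⊢ fsub (t ∷ˢ var) φ
    ∃I₀ : ∀ {Γ} φ t → Γ ⊢ fsub (t ∷ˢ var) φ → Γ ⊢ `∃ φ
    ∃E₀ : ∀ {Γ ψ} φ → Γ ⊢ `∃ φ → (∀ t → fsub (t ∷ˢ var) φ ∷ Γ ⊢ ψ) → Γ ⊢ ψ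
    ≐R  : ∀ {Γ} t → Γ ⊢ t ≐ t
    ≐S₀ : ∀ {Γ s t} φ → Γ ⊢ s ≐ t → Γ ⊢ fsub (s ∷ˢ var) φ → Γ ⊢ fsub (t ∷ˢ var) φ
    botE : ∀ {Γ φ} → Γ ⊢ ⊥' → Γ ⊢ φ

  infixl 20 _↑ _↑² _↑³
  _↑ : ∀ {Γ φ ψ} → Γ ⊢ φ → ψ ∷ Γ ⊢ φ
  d ↑ = wkN there d
  _↑² : ∀ {Γ φ ψ χ} → Γ ⊢ φ → ψ ∷ χ ∷ Γ ⊢ φ
  d ↑² = d ↑ ↑
  _↑³ : ∀ {Γ φ ψ χ θ} → Γ ⊢ φ → θ ∷ ψ ∷ χ ∷ Γ ⊢ φ
  d ↑³ = d ↑ ↑ ↑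

  h0 : ∀ {Γ φ} → φ ∷ Γ ⊢ φ
  h0 = hyp (here refl)
  h1 : ∀ {Γ φ ψ} → ψ ∷ φ ∷ Γ ⊢ φ
  h1 = h0 ↑
  h2 : ∀ {Γ φ ψ χ} → χ ∷ ψ ∷ φ ∷ Γ ⊢ φ
  h2 = h1 ↑
  h3 : ∀ {Γ φ ψ χ θ} → θ ∷ χ ∷ ψ ∷ φ ∷ Γ ⊢ φ
  h3 = h2 ↑

  cast : ∀ {Γ φ ψ} → φ ≡ ψ → Γ ⊢ φ → Γ ⊢ ψ
  cast refl d = d

  private
    lift-cons : ∀ σ φ t → fsub (t ∷ˢ var) (fsub (lift σ) φ) ≡ fsub (t ∷ˢ σ) φ
    lift-cons σ φ t = trans (sym (inst1-cons _ t)) (inst1-lift φ t)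

  -- In this and the following rules φ is a template and σ lists its parameters. For concrete φ both
  -- substitutions compute, so that applications of the rules need no substitution lemma.
  ∀I : ∀ {Γ} φ σ → (∀ t → Γ ⊢ fsub (t ∷ˢ σ) φ) → Γ ⊢ fsub σ (`∀ φ)
  ∀I φ σ d = ∀I₀ _ λ t → cast (sym (lift-cons σ φ t)) (d t)
  ∀E : ∀ {Γ} φ σ → Γ ⊢ fsub σ (`∀ φ) → ∀ t → Γ ⊢ fsub (t ∷ˢ σ) φ
  ∀E φ σ d t = cast (lift-cons σ φ t) (∀E₀ _ d t)
  ∃I : ∀ {Γ} φ σ t → Γ ⊢ fsub (t ∷ˢ σ) φ → Γ ⊢ fsub σ (`∃ φ)
  ∃I φ σ t d = ∃I₀ _ t (cast (sym (lift-cons σ φ t)) d)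
  ∃E : ∀ {Γ ψ} φ σ → Γ ⊢ fsub σ (`∃ φ) → (∀ t → fsub (t ∷ˢ σ) φ ∷ Γ ⊢ ψ) → Γ ⊢ ψ
  ∃E {Γ} {ψ} φ σ d k = ∃E₀ _ d λ t → subst (λ χ → χ ∷ Γ ⊢ ψ) (sym (lift-cons σ φ t)) (k t)
  ≐S : ∀ {Γ s t} φ σ → Γ ⊢ s ≐ t → Γ ⊢ fsub (s ∷ˢ σ) φ → Γ ⊢ fsub (t ∷ˢ σ) φ
  ≐S {s = s} {t} φ σ e d = cast (lift-cons σ φ t) (≐S₀ _ e (cast (sym (lift-cons σ φ s)) d))

  ≐sym : ∀ {Γ s t} → Γ ⊢ s ≐ t → Γ ⊢ t ≐ s
  ≐sym {s = s} e = ≐S (var 0 ≐ var 1) (s ∷ˢ var) e (≐R s)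
  ≐trans : ∀ {Γ s t u} → Γ ⊢ s ≐ t → Γ ⊢ t ≐ u → Γ ⊢ s ≐ u
  ≐trans {s = s} e f = ≐S (var 1 ≐ var 0) (s ∷ˢ var) f e

record Theory : Set₁ where
  field logic : Logic
  open Logic logic public
  field
    ind₀ : ∀ {Γ} φ → Γ ⊢ fsub (`0 ∷ˢ var) φ →
           (∀ t → fsub (t ∷ˢ var) φ ∷ Γ ⊢ fsub (`s t ∷ˢ var) φ) → ∀ t → Γ ⊢ fsub (t ∷ˢ var) φ
    s0   : ∀ {Γ t} → Γ ⊢ `s t ≐ `0 → Γ ⊢ ⊥'
    inj  : ∀ {Γ s t} → Γ ⊢ `s s ≐ `s t → Γ ⊢ s ≐ t
    +0   : ∀ {Γ} t → Γ ⊢ t `+ `0 ≐ t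
    +s   : ∀ {Γ} t u → Γ ⊢ t `+ `s u ≐ `s (t `+ u)

  ind : ∀ {Γ} φ σ → Γ ⊢ fsub (`0 ∷ˢ σ) φ →
        (∀ t → fsub (t ∷ˢ σ) φ ∷ Γ ⊢ fsub (`s t ∷ˢ σ) φ) → ∀ t → Γ ⊢ fsub (t ∷ˢ σ) φ
  ind {Γ} φ σ b s t = subst (Γ ⊢_) (e t) (ind₀ (fsub (lift σ) φ) (subst (Γ ⊢_) (sym (e `0)) b)
      (λ u → subst₂ (λ x y → x ∷ Γ ⊢ y) (sym (e u)) (sym (e (`s u))) (s u)) t)
    where
    e : ∀ t → fsub (t ∷ˢ var) (fsub (lift σ) φ) ≡ fsub (t ∷ˢ σ) φ
    e t = trans (sym (inst1-cons _ t)) (inst1-lift φ t)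

module Sequents (P : Seq → Set) (lkr : ∀ {S Ps} → LK S Ps → All P Ps → P S) (bot : P (⊥' ∷ [] ⇒ [])) where

  weaken : ∀ {Γ Γ' Δ Δ'} → Γ' ⊆ Γ → Δ' ⊆ Δ → P (Γ' ⇒ Δ') → P (Γ ⇒ Δ)
  weaken a b p = lkr (wk a b) (p ∷ [])
  ante : ∀ {Γ Γ' Δ} → Γ' ⊆ Γ → P (Γ' ⇒ Δ) → P (Γ ⇒ Δ)
  ante a = weaken a id
  addR : ∀ {Γ φ Δ} → P (Γ ⇒ φ ∷ []) → P (Γ ⇒ φ ∷ Δ)
  addR = weaken id λ { (here e) → here e }
  addR₂ : ∀ {Γ φ ψ Δ} → P (Γ ⇒ φ ∷ []) → P (Γ ⇒ ψ ∷ φ ∷ Δ)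
  addR₂ = weaken id λ { (here e) → there (here e) }
  idn : ∀ {Γ φ Δ} → φ ∈ Γ → φ ∈ Δ → P (Γ ⇒ Δ)
  idn a b = weaken (λ { (here refl) → a }) (λ { (here refl) → b }) (lkr ax [])
  under : ∀ {φ : Fm} {Γ Δ} → Γ ⊆ Δ → φ ∷ Γ ⊆ φ ∷ Δ
  under s (here e)  = here e
  under s (there m) = there (s m)
  cutP : ∀ {Γ Δ} φ → P (Γ ⇒ φ ∷ Δ) → P (φ ∷ Γ ⇒ Δ) → P (Γ ⇒ Δ)
  cutP φ a b = lkr (cut φ) (a ∷ b ∷ [])
  z : List Fm → List Fm → ℕ
  z Γ Δ = bndL (Γ ++ Δ)

  logicOf : Logic
  logicOf = record
    { _⊢_ = λ Γ φ → P (Γ ⇒ φ ∷ [])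
    ; hyp = λ m → idn m (here refl)
    ; wkN = ante
    ; cutN = λ a b → cutP _ (addR a) b
    ; →I = λ a → lkr →R (a ∷ [])
    ; →E = λ {Γ} {φ} {ψ} a b → cutP (φ `→ ψ) (addR a) (lkr →L (addR b ∷ idn (here refl) (here refl) ∷ []))
    ; ∧I = λ a b → lkr ∧R (a ∷ b ∷ [])
    ; ∧E₁ = λ {Γ} {φ} {ψ} a → cutP (φ `∧ ψ) (addR a) (lkr ∧L (idn (here refl) (here refl) ∷ []))
    ; ∧E₂ = λ {Γ} {φ} {ψ} a → cutP (φ `∧ ψ) (addR a) (lkr ∧L (idn (there (here refl)) (here refl) ∷ []))
    ; ∨I₁ = λ a → lkr ∨R (addR a ∷ [])
    ; ∨I₂ = λ a → lkr ∨R (addR₂ a ∷ [])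
    ; ∨E = λ {Γ} {φ} {ψ} a b c → cutP (φ `∨ ψ) (addR a) (lkr ∨L (b ∷ c ∷ []))
    ; ¬I = λ a → lkr ¬R (cutP ⊥' (addR a) (weaken (λ { (here e) → here e }) (λ ()) bot) ∷ [])
    ; ¬E = λ {Γ} {φ} a b → cutP (`¬ φ) (addR a) (lkr ¬L (addR b ∷ []))
    ; raa = λ {Γ} {φ} a → cutP (`¬ φ) (lkr ¬R (idn (here refl) (here refl) ∷ []))
        (cutP ⊥' (addR a) (weaken (λ { (here e) → here e }) (λ ()) bot))
    ; ∀I₀ = λ {Γ} φ a → lkr (∀R (z Γ (`∀ φ ∷ [])) (freshFor Γ (`∀ φ ∷ [])))
        (subst (λ χ → P (Γ ⇒ χ ∷ [])) (sym (inst1-cons φ _)) (a _) ∷ [])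
    ; ∀E₀ = λ {Γ} φ a t → cutP (`∀ φ) (addR a) (lkr (∀L t) (idn (here (sym (inst1-cons φ t))) (here refl) ∷ []))
    ; ∃I₀ = λ {Γ} φ t a → lkr (∃R t) (subst (λ χ → P (Γ ⇒ χ ∷ [])) (sym (inst1-cons φ t)) a ∷ [])
    ; ∃E₀ = λ {Γ} {ψ} φ a k → cutP (`∃ φ) (addR a) (lkr (∃L (z (`∃ φ ∷ Γ) (ψ ∷ [])) (freshFor (`∃ φ ∷ Γ) (ψ ∷ [])))
        (subst (λ χ → P (χ ∷ Γ ⇒ ψ ∷ [])) (sym (inst1-cons φ _)) (k _) ∷ []))
    ; ≐R = λ t → weaken (λ ()) id (lkr =R [])
    ; ≐S₀ = λ {Γ} {s} {t} φ e a → cutP (s ≐ t) (addR e)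
        (subst (λ χ → P (s ≐ t ∷ Γ ⇒ χ ∷ [])) (inst1-cons φ t)
          (lkr (=L₁ {φ = φ}) (subst (λ χ → P (Γ ⇒ χ ∷ [])) (sym (inst1-cons φ s)) a ∷ [])))
    ; botE = λ a → cutP ⊥' (addR a) (weaken (λ { (here e) → here e }) (λ ()) bot)
    }

  module _ where
    open Logic logicOf
    -- This leads from natural deduction with one conclusion to sequents with several: a negated
    -- formula among the hypotheses is cut against ¬R, which moves the formula to the succedent.
    refute : ∀ Δ {Γ} → map `¬ Δ ++ Γ ⊢ ⊥' → P (Γ ⇒ Δ)
    refute Δ {Γ} d = subst (λ Θ → P (Γ ⇒ Θ)) (Lₚ.++-identityʳ Δ) $ go Δ [] (cutP ⊥' d (weaken (λ { (here e) → here e }) (λ ()) bot))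
      where
      go : ∀ Δ Θ → P (map `¬ Δ ++ Γ ⇒ Θ) → P (Γ ⇒ Δ ++ Θ)
      go []      Θ p = p
      go (δ ∷ Δ) Θ p = weaken id (mv Δ) (go Δ (δ ∷ Θ)
          (cutP (`¬ δ) (lkr ¬R (idn (here refl) (here refl) ∷ [])) (weaken id there p)))
        where
        mv : ∀ Δ → Δ ++ δ ∷ Θ ⊆ δ ∷ Δ ++ Θ
        mv Δ m with ∈ₚ.∈-++⁻ Δ m
        ... | inj₁ a         = there (∈ₚ.∈-++⁺ˡ a)
        ... | inj₂ (here e)  = here e
        ... | inj₂ (there b) = there (∈ₚ.∈-++⁺ʳ Δ b)

    split∨ : ∀ {Γ φ ψ} → Γ ⊢ φ `∨ ψ → P (Γ ⇒ φ ∷ ψ ∷ [])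
    split∨ {Γ} {φ} {ψ} d = cutP (φ `∨ ψ) (addR d) (lkr ∨L (idn (here refl) (here refl) ∷ idn (here refl) (there (here refl)) ∷ []))

only : ∀ {φ : Fm} {Γ} → φ ∷ [] ⊆ φ ∷ Γ
only (here e) = here e

≡ᵇ-same : ∀ n → (n N.≡ᵇ n) ≡ true
≡ᵇ-same zero    = refl
≡ᵇ-same (suc n) = ≡ᵇ-same n

upd-bnd : ∀ {z t} φ → bndF φ ≤ z → fsub (var [ z ↦ t ]) φ ≡ φ
upd-bnd {z} {t} φ h = trans (fsub-occ φ λ n o → upd-other var {z} t λ { refl → Nₚ.<-irrefl refl (Nₚ.≤-trans (occF-bnd n φ o) h) }) (fsub-id φ)

upd-inst : ∀ {z t} φ → bndF φ ≤ z → fsub (var [ z ↦ t ]) (fsub (var z ∷ˢ var) φ) ≡ fsub (t ∷ˢ var) φ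
upd-inst {z} {t} φ h = trans (fsub-fuse φ) (fsub-occ φ λ
  { zero _    → upd-same var z t
  ; (suc n) o → upd-other var {z} t λ { refl → Nₚ.<-irrefl refl (Nₚ.≤-trans (Nₚ.m<n⇒m<1+n (Nₚ.≤-refl)) (Nₚ.≤-trans (occF-bnd (suc n) φ o) h)) } })

-- Cyclic arithmetic as a theory with induction

-- The trace system is a parameter because the side premises of the induction loop must be derived
-- under the empty trace condition, and all the rest under the proper one.
module CA (TS : TraceSys CARule) where
  ProvT : Seq → Set
  ProvT = Proof CARule TS AnyFm
  inf : ∀ {S Ps} → CARule S Ps → All ProvT Ps → ProvT S
  inf = Join.infer TS
  ax₀ : ∀ {S} → AxPA S → ProvT S
  ax₀ a = inf (axPA a) []
  open Sequents ProvT (λ r → inf (lk r)) (ax₀ p-s0) public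
  open Logic logicOf public
  by₀ : ∀ {φ Γ} → AxPA ([] ⇒ φ ∷ []) → Γ ⊢ φ
  by₀ a = ante (λ ()) (ax₀ a)
  by₁ : ∀ {φ ψ Γ} → AxPA (φ ∷ [] ⇒ ψ ∷ []) → Γ ⊢ φ → Γ ⊢ ψ
  by₁ a d = cutN d (ante only (ax₀ a))
  no₁ : ∀ {φ ψ Γ} → AxPA (φ ∷ [] ⇒ []) → Γ ⊢ φ → Γ ⊢ ψ
  no₁ a d = cutN d (weaken only (λ ()) (ax₀ a))
  by₂ : ∀ {φ χ ψ Γ} → AxPA (φ ∷ χ ∷ [] ⇒ ψ ∷ []) → Γ ⊢ φ → Γ ⊢ χ → Γ ⊢ ψ
  by₂ a d e = cutN e (cutN (d ↑) (ante (λ { (here e) → here e ; (there (here e)) → there (here e) }) (ax₀ a)))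
  no₂ : ∀ {φ χ ψ Γ} → AxPA (φ ∷ χ ∷ [] ⇒ []) → Γ ⊢ φ → Γ ⊢ χ → Γ ⊢ ψ
  no₂ a d e = cutN e (cutN (d ↑) (weaken (λ { (here e) → here e ; (there (here e)) → there (here e) }) (λ ()) (ax₀ a)))
  tri : ∀ {Γ} t u → Γ ⊢ (t ≺ u) `∨ ((t ≐ u) `∨ (u ≺ t))
  tri t u = ante (λ ()) (inf (lk ∨R) (weaken id rot' (inf (lk ∨R) (weaken id rot (ax₀ (o-tot {t} {u})) ∷ [])) ∷ []))
    where
    rot : ∀ {a b c : Fm} → a ∷ b ∷ c ∷ [] ⊆ b ∷ c ∷ a ∷ []
    rot (here e)                 = there (there (here e))
    rot (there (here e))         = here e
    rot (there (there (here e))) = there (here e)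
    rot' : ∀ {a b : Fm} → a ∷ b ∷ [] ⊆ b ∷ a ∷ []
    rot' (here e)         = there (here e)
    rot' (there (here e)) = here e

step-inst : ∀ φ t u → fsub (u ∷ˢ t ∷ˢ var) (fsub (var 0 ∷ˢ up 2) φ) ≡ fsub (u ∷ˢ var) φ
step-inst φ t u = trans (fsub-fuse φ) (fsub-ext φ λ { zero → refl ; (suc n) → refl })

succ-inst : ∀ φ t → fsub (t ∷ˢ var) (fsub (`s (var 0) ∷ˢ up 1) φ) ≡ fsub (`s t ∷ˢ var) φ
succ-inst φ t = trans (fsub-fuse φ) (fsub-ext φ λ { zero → refl ; (suc n) → refl })

module CAInd (φ₀ : Fm) where
  private
    module Fi = CA (finitary CARule)
    open Fi using (_⊢_; _↑; h0; h1; h2; h3; hyp)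
  -- The conjunct keeps the induction variable free in the sequents of the loop, as required of a trace.
  φ st : Fm
  φ  = φ₀ `∧ (var 0 ≐ var 0)
  st = `∀ (φ `→ fsub (`s (var 0) ∷ˢ up 1) φ)
  F : Tm → Fm
  F t = fsub (t ∷ˢ var) φ
  H : List Fm
  H = F `0 ∷ st ∷ []
  private
    z x : ℕ
    z = bndL (φ ∷ H)
    x = bndL ((`0 ≺ var z ∷ H) ++ F (var z) ∷ [])
    θ : Subst
    θ = var [ z ↦ var x ]
    H-fix : ∀ {ψ} → ψ ∈ H → fsub θ ψ ≡ ψ
    H-fix {ψ} m = upd-bnd ψ (Nₚ.≤-trans (bndL-∈ m) (Nₚ.m≤n⊔m (bndF φ) (bndL H)))
    θF : fsub θ (F (var z)) ≡ F (var x)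
    θF = upd-inst φ (Nₚ.m≤m⊔n (bndF φ) (bndL H))
    -- One round of infinite descent on z. A positive z is written as `s x`, a cut puts x ≺ z into
    -- the antecedent, F z is reduced to F x, and the substitution z ↦ x leads back to the start.
    -- The cut on x ≺ z is what produces progress: the case rule itself yields only an equation.
    seqs : Fin 6 → Seq
    seqs F.zero = H ⇒ F (var z) ∷ []
    seqs (F.suc F.zero) = `0 ≺ var z ∷ H ⇒ F (var z) ∷ []
    seqs (F.suc (F.suc F.zero)) = var z ≐ `s (var x) ∷ H ⇒ F (var z) ∷ []
    seqs (F.suc (F.suc (F.suc F.zero))) = var x ≺ var z ∷ var z ≐ `s (var x) ∷ H ⇒ F (var z) ∷ []
    seqs (F.suc (F.suc (F.suc (F.suc F.zero)))) = var x ≺ var z ∷ var z ≐ `s (var x) ∷ H ⇒ F (var x) ∷ F (var z) ∷ []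
    seqs (F.suc (F.suc (F.suc (F.suc (F.suc F.zero))))) = substSeq θ (H ⇒ F (var z) ∷ [])
    S₀ S₁ S₂ : Seq
    S₀ = H ⇒ `0 ≺ var z ∷ F (var z) ∷ []
    S₁ = var z ≐ `s (var x) ∷ H ⇒ var x ≺ var z ∷ F (var z) ∷ []
    S₂ = F (var x) ∷ var x ≺ var z ∷ var z ≐ `s (var x) ∷ H ⇒ F (var z) ∷ []
    d₀ : Fi.ProvT S₀
    d₀ = Fi.split∨ (Fi.∨E (Fi.tri `0 (var z)) (Fi.∨I₁ h0)
      (Fi.∨E h0 (Fi.∨I₂ (Fi.≐S₀ φ h0 (hyp (there (there (here refl)))))) (Fi.no₁ o-0 h0)))
    d₁ : Fi.ProvT S₁
    d₁ = Fi.addR (Fi.≐S (var 1 ≺ var 0) (var x ∷ˢ var) (Fi.≐sym h0) (Fi.by₀ o-suc))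
    d₂ : Fi.ProvT S₂
    d₂ = Fi.≐S₀ φ (Fi.≐sym h2) (Fi.→E (subst (λ ψ → F (var x) ∷ var x ≺ var z ∷ var z ≐ `s (var x) ∷ H ⊢ F (var x) `→ ψ)
           (succ-inst φ (var x)) (Fi.∀E₀ _ (hyp (there (there (there (there (here refl)))))) (var x))) h0)
    sides : List Seq
    sides = S₀ ∷ S₁ ∷ S₂ ∷ []
    i1 i2 i3 i4 i5 : Fin 6
    i1 = F.suc F.zero
    i2 = F.suc (F.suc F.zero)
    i3 = F.suc (F.suc (F.suc F.zero))
    i4 = F.suc (F.suc (F.suc (F.suc F.zero)))
    i5 = F.suc (F.suc (F.suc (F.suc (F.suc F.zero))))
    prs : Fin 6 → List (Fin 6 ⊎ Σ Seq (_∈ sides))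
    prs F.zero = inj₂ (S₀ , here refl) ∷ inj₁ i1 ∷ []
    prs (F.suc F.zero) = inj₁ i2 ∷ []
    prs (F.suc (F.suc F.zero)) = inj₂ (S₁ , there (here refl)) ∷ inj₁ i3 ∷ []
    prs (F.suc (F.suc (F.suc F.zero))) = inj₁ i4 ∷ inj₂ (S₂ , there (there (here refl))) ∷ []
    prs (F.suc (F.suc (F.suc (F.suc F.zero)))) = inj₁ i5 ∷ []
    prs (F.suc (F.suc (F.suc (F.suc (F.suc F.zero))))) = inj₁ F.zero ∷ []
    rule : ∀ i → CARule (seqs i) (map Sum.[ seqs , proj₁ ] (prs i))
    rule F.zero = lk (cut (`0 ≺ var z))
    rule (F.suc F.zero) = case x (freshFor (`0 ≺ var z ∷ H) (F (var z) ∷ []))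
    rule (F.suc (F.suc F.zero)) = lk (cut (var x ≺ var z))
    rule (F.suc (F.suc (F.suc F.zero))) = lk (cut (F (var x)))
    rule (F.suc (F.suc (F.suc (F.suc F.zero)))) = lk (wk
      (λ m → let ψ , m' , e = ∈ₚ.∈-map⁻ (fsub θ) m in there (there (subst (_∈ H) (trans (sym (H-fix m')) (sym e)) m')))
      λ { (here e) → here (trans e θF) })
    rule (F.suc (F.suc (F.suc (F.suc (F.suc F.zero))))) = sub θ
    o : Fin 6 → Tm
    o F.zero = var z
    o (F.suc F.zero) = var z
    o (F.suc (F.suc F.zero)) = var z
    o (F.suc (F.suc (F.suc F.zero))) = var x
    o (F.suc (F.suc (F.suc (F.suc F.zero)))) = var x
    o (F.suc (F.suc (F.suc (F.suc (F.suc F.zero))))) = var x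
    occ-F : ∀ v → occF v (F (var v)) ≡ true
    occ-F v = ∨-introʳ (occF v (fsub (var v ∷ˢ var) φ₀)) (∨-introˡ _ (≡ᵇ-same v))
    in-seq : ∀ v {Γ Δ ψ} → ψ ∈ Γ ++ Δ → occF v ψ ≡ true → TmIn (Γ ⇒ Δ) (var v)
    in-seq v {Γ} {Δ} m o n e rewrite ≡ᵇ-true n v e = any-intro (occF v) m o
    valid : ∀ i → TmIn (seqs i) (o i)
    valid F.zero = in-seq z {H} {F (var z) ∷ []} (∈ₚ.∈-++⁺ʳ H (here refl)) (occ-F z)
    valid (F.suc F.zero) = in-seq z {`0 ≺ var z ∷ H} {F (var z) ∷ []} (∈ₚ.∈-++⁺ʳ (`0 ≺ var z ∷ H) (here refl)) (occ-F z)
    valid (F.suc (F.suc F.zero)) = in-seq z {var z ≐ `s (var x) ∷ H} {F (var z) ∷ []} (here refl) (∨-introˡ _ (≡ᵇ-same z))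
    valid (F.suc (F.suc (F.suc F.zero))) = in-seq x {var x ≺ var z ∷ var z ≐ `s (var x) ∷ H} {F (var z) ∷ []} (here refl) (∨-introˡ _ (≡ᵇ-same x))
    valid (F.suc (F.suc (F.suc (F.suc F.zero)))) = in-seq x {var x ≺ var z ∷ var z ≐ `s (var x) ∷ H} {F (var x) ∷ F (var z) ∷ []} (here refl) (∨-introˡ _ (≡ᵇ-same x))
    valid (F.suc (F.suc (F.suc (F.suc (F.suc F.zero))))) =
      in-seq x {map (fsub θ) H} {fsub θ (F (var z)) ∷ []} (∈ₚ.∈-++⁺ʳ (map (fsub θ) H) (here (sym θF))) (occ-F x)
    stp : ∀ i j → inj₁ j ∈ prs i → caStep (rule i) (seqs j) (o i) (o j)
    stp F.zero .i1 (there (here refl)) = inj₁ refl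
    stp (F.suc F.zero) .i2 (here refl) = inj₁ refl
    stp (F.suc (F.suc F.zero)) .i3 (there (here refl)) = inj₂ (inj₂ (inj₂ (here refl)))
    stp (F.suc (F.suc (F.suc F.zero))) .i4 (here refl) = inj₁ refl
    stp (F.suc (F.suc (F.suc F.zero))) j (there (here ()))
    stp (F.suc (F.suc (F.suc (F.suc F.zero)))) .i5 (here refl) = inj₁ refl
    stp (F.suc (F.suc (F.suc (F.suc (F.suc F.zero))))) .F.zero (here refl) = sym (upd-same var z (var x))
    -- The number of edges still to be passed before the progressing one, at which x ≺ z enters the
    -- antecedent.
    rank : Fin 6 → ℕ
    rank F.zero = 2
    rank (F.suc F.zero) = 1
    rank (F.suc (F.suc F.zero)) = 0
    rank (F.suc (F.suc (F.suc F.zero))) = 5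
    rank (F.suc (F.suc (F.suc (F.suc F.zero)))) = 4
    rank (F.suc (F.suc (F.suc (F.suc (F.suc F.zero))))) = 3
    prg : ∀ i j → inj₁ j ∈ prs i → caProg (rule i) (seqs j) (o i) (o j) ⊎ rank j < rank i
    prg F.zero .i1 (there (here refl)) = inj₂ Nₚ.≤-refl
    prg (F.suc F.zero) .i2 (here refl) = inj₂ Nₚ.≤-refl
    prg (F.suc (F.suc F.zero)) .i3 (there (here refl)) = inj₁ (here refl)
    prg (F.suc (F.suc (F.suc F.zero))) .i4 (here refl) = inj₂ Nₚ.≤-refl
    prg (F.suc (F.suc (F.suc F.zero))) j (there (here ()))
    prg (F.suc (F.suc (F.suc (F.suc F.zero)))) .i5 (here refl) = inj₂ Nₚ.≤-refl
    prg (F.suc (F.suc (F.suc (F.suc (F.suc F.zero))))) .F.zero (here refl) = inj₂ Nₚ.≤-refl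
    generic : Proof CARule CATrace AnyFm (H ⇒ F (var z) ∷ [])
    generic = Loop.loop CATrace 5 seqs sides (d₀ ∷ d₁ ∷ d₂ ∷ []) prs rule o valid stp rank prg F.zero

  provable : ∀ t → Proof CARule CATrace AnyFm (H ⇒ F t ∷ [])
  provable t = subst₂ (λ Γ ψ → Proof CARule CATrace AnyFm (Γ ⇒ ψ ∷ [])) (fix H H-fix') (upd-inst φ (Nₚ.m≤m⊔n (bndF φ) (bndL H)))
      (Join.infer CATrace (sub (var [ z ↦ t ])) (generic ∷ []))
    where
    H-fix' : ∀ {ψ} → ψ ∈ H → fsub (var [ z ↦ t ]) ψ ≡ ψ
    H-fix' {ψ} m = upd-bnd ψ (Nₚ.≤-trans (bndL-∈ m) (Nₚ.m≤n⊔m (bndF φ) (bndL H)))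
    fix : ∀ Γ → (∀ {ψ} → ψ ∈ Γ → fsub (var [ z ↦ t ]) ψ ≡ ψ) → map (fsub (var [ z ↦ t ])) Γ ≡ Γ
    fix []      h = refl
    fix (ψ ∷ Γ) h = cong₂ _∷_ (h (here refl)) (fix Γ (h ∘ there))

module C = CA CATrace

TPA : Theory
TPA = record
  { logic = C.logicOf
  ; ind₀ = λ {Γ} φ b s t → let module I = CAInd φ in
      C.∧E₁ (C.cutN (C.∧I b (C.≐R `0)) (C.cutN
        (C.wkN there (C.∀I₀ _ λ u → C.→I (subst (λ ψ → I.F u ∷ Γ C.⊢ ψ) (sym (succ-inst I.φ u))
          (C.∧I (C.cutN (C.∧E₁ C.h0) (C.ante (C.under there) (s u))) (C.≐R (`s u))))))
        (C.ante (λ { (here e) → there (here e) ; (there (here e)) → here e }) (I.provable t))))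
  ; s0  = C.no₁ p-s0
  ; inj = C.by₁ p-inj
  ; +0  = λ t → C.by₀ p-+0
  ; +s  = λ t u → C.by₀ p-+s
  }

-- The cyclic RTC calculus as a theory with induction along RTC

module RT (TS : TraceSys RTCRule) where
  ProvT : Seq → Set
  ProvT = Proof RTCRule TS AnyFm
  inf : ∀ {S Ps} → RTCRule S Ps → All ProvT Ps → ProvT S
  inf = Join.infer TS
  axθ : ∀ {S} → AxA S → ∀ θ → ProvT (substSeq θ S)
  axθ a θ = inf (sub θ) (inf (axA a) [] ∷ [])
  open Sequents ProvT (λ r → inf (lk r)) (axθ a-s0 (λ _ → `0)) public
  open Logic logicOf public
  rtcR : ∀ {Γ} φ s → Γ ⊢ RTC φ s s
  rtcR φ s = inf RTCRule.refl []
  rtcT : ∀ {Γ φ s t} r → Γ ⊢ RTC φ s r → Γ ⊢ fsub (t ∷ˢ r ∷ˢ var) φ → Γ ⊢ RTC φ s t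
  rtcT {Γ} {φ} {s} {t} r a b = inf (RTCRule.trans r) (a ∷ subst (Γ ⊢_) (sym (inst2-cons φ r t)) b ∷ [])

module RTInd (φ ψ : Fm) (s : Tm) where
  private
    module Fi = RT (finitary RTCRule)
    open Fi using (_⊢_; _↑; h0; h1; h2; h3; hyp)
  st : Fm
  st  = `∀ (`∀ (fsub (var 1 ∷ˢ up 2) ψ `→ (φ `→ fsub (var 0 ∷ˢ up 2) ψ)))
  F : Tm → Fm
  F t = fsub (t ∷ˢ var) ψ
  H : List Fm
  H = F s ∷ st ∷ []
  private
    -- Only its variable bound matters. The entry `RTC φ s s` ensures that a substitution for z
    -- changes neither the body φ nor the start s.
    B₀ : List Fm
    B₀ = φ ∷ ψ ∷ RTC φ s s ∷ H
    z y : ℕ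
    z = bndL B₀
    y = bndL ((RTC φ s (var z) ∷ H) ++ F (var z) ∷ [])
    θ : Subst
    θ = var [ z ↦ var y ]
    H-fix : ∀ {t χ} → χ ∈ H → fsub (var [ z ↦ t ]) χ ≡ χ
    H-fix {χ = χ} m = upd-bnd χ (bndL-∈ {Γ = B₀} (there (there (there m))))
    θF : ∀ {t} → fsub (var [ z ↦ t ]) (F (var z)) ≡ F t
    θF = upd-inst ψ (bndL-∈ {Γ = B₀} (there (here refl)))
    RTC-inj : ∀ {φ φ' s s' t t'} → RTC φ s t ≡ RTC φ' s' t' → φ ≡ φ' × s ≡ s'
    RTC-inj refl = refl , refl
    θR : ∀ {t} → fsub (var [ z ↦ t ]) (RTC φ s (var z)) ≡ RTC φ s t
    θR {t} with RTC-inj (upd-bnd {z} {t} (RTC φ s s) (bndL-∈ {Γ = B₀} (there (there (here refl)))))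
    ... | a , b rewrite a | b | upd-same var z t = refl
    X : Fm
    X = inst2 φ (var y) (var z)
    -- Here Case makes the progress by passing to the immediate ancestor, so the loop consists of
    -- Case, a cut on F y, and the return through z ↦ y.
    seqs : Fin 4 → Seq
    seqs F.zero = RTC φ s (var z) ∷ H ⇒ F (var z) ∷ []
    seqs (F.suc F.zero) = RTC φ s (var y) ∷ X ∷ H ⇒ F (var z) ∷ []
    seqs (F.suc (F.suc F.zero)) = RTC φ s (var y) ∷ X ∷ H ⇒ F (var y) ∷ F (var z) ∷ []
    seqs (F.suc (F.suc (F.suc F.zero))) = substSeq θ (RTC φ s (var z) ∷ H ⇒ F (var z) ∷ [])
    S₀ S₁ : Seq
    S₀ = s ≐ var z ∷ H ⇒ F (var z) ∷ []
    S₁ = F (var y) ∷ RTC φ s (var y) ∷ X ∷ H ⇒ F (var z) ∷ []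
    d₀ : Fi.ProvT S₀
    d₀ = Fi.≐S₀ ψ h0 h1
    d₁ : Fi.ProvT S₁
    d₁ = Fi.→E (Fi.→E (subst (λ χ → F (var y) ∷ RTC φ s (var y) ∷ X ∷ H ⊢ χ)
           (cong₂ _`→_ (trans (fsub-fuse ψ) (fsub-ext ψ λ { zero → refl ; (suc n) → refl })) (cong₂ _`→_ (sym (inst2-cons φ (var y) (var z))) (step-inst ψ (var y) (var z))))
           (Fi.∀E _ (var y ∷ˢ var) (Fi.∀E₀ _ (hyp (there (there (there (there (here refl)))))) (var y)) (var z))) h0) h2
    sides : List Seq
    sides = S₀ ∷ S₁ ∷ []
    i1 i2 i3 : Fin 4
    i1 = F.suc F.zero
    i2 = F.suc (F.suc F.zero)
    i3 = F.suc (F.suc (F.suc F.zero))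
    prs : Fin 4 → List (Fin 4 ⊎ Σ Seq (_∈ sides))
    prs F.zero = inj₂ (S₀ , here refl) ∷ inj₁ i1 ∷ []
    prs (F.suc F.zero) = inj₁ i2 ∷ inj₂ (S₁ , there (here refl)) ∷ []
    prs (F.suc (F.suc F.zero)) = inj₁ i3 ∷ []
    prs (F.suc (F.suc (F.suc F.zero))) = inj₁ F.zero ∷ []
    rule : ∀ i → RTCRule (seqs i) (map Sum.[ seqs , proj₁ ] (prs i))
    rule F.zero = case y (freshFor (RTC φ s (var z) ∷ H) (F (var z) ∷ []))
    rule (F.suc F.zero) = lk (cut (F (var y)))
    rule (F.suc (F.suc F.zero)) = lk (wk
      (λ { (here e) → here (trans e θR)
         ; (there m) → let χ , m' , e = ∈ₚ.∈-map⁻ (fsub θ) m in there (there (subst (_∈ H) (trans (sym (H-fix m')) (sym e)) m')) })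
      λ { (here e) → here (trans e θF) })
    rule (F.suc (F.suc (F.suc F.zero))) = sub θ
    o : Fin 4 → Fm
    o F.zero = RTC φ s (var z)
    o (F.suc F.zero) = RTC φ s (var y)
    o (F.suc (F.suc F.zero)) = RTC φ s (var y)
    o (F.suc (F.suc (F.suc F.zero))) = fsub θ (RTC φ s (var z))
    valid : ∀ i → o i ∈ ant (seqs i) × IsRTCFm (o i)
    valid F.zero = here refl , tt
    valid (F.suc F.zero) = here refl , tt
    valid (F.suc (F.suc F.zero)) = here refl , tt
    valid (F.suc (F.suc (F.suc F.zero))) = here refl , tt
    stp : ∀ i j → inj₁ j ∈ prs i → rtcStep (rule i) (seqs j) (o i) (o j)
    stp F.zero .i1 (there (here refl)) = inj₂ (refl , refl)
    stp (F.suc F.zero) .i2 (here refl) = refl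
    stp (F.suc F.zero) j (there (here ()))
    stp (F.suc (F.suc F.zero)) .i3 (here refl) = sym θR
    stp (F.suc (F.suc (F.suc F.zero))) .F.zero (here refl) = refl
    rank : Fin 4 → ℕ
    rank F.zero = 0
    rank (F.suc F.zero) = 3
    rank (F.suc (F.suc F.zero)) = 2
    rank (F.suc (F.suc (F.suc F.zero))) = 1
    prg : ∀ i j → inj₁ j ∈ prs i → rtcProg (rule i) (seqs j) (o i) (o j) ⊎ rank j < rank i
    prg F.zero .i1 (there (here refl)) = inj₁ (refl , refl)
    prg (F.suc F.zero) .i2 (here refl) = inj₂ Nₚ.≤-refl
    prg (F.suc F.zero) j (there (here ()))
    prg (F.suc (F.suc F.zero)) .i3 (here refl) = inj₂ Nₚ.≤-refl
    prg (F.suc (F.suc (F.suc F.zero))) .F.zero (here refl) = inj₂ Nₚ.≤-refl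
    generic : Proof RTCRule RTCTrace AnyFm (RTC φ s (var z) ∷ H ⇒ F (var z) ∷ [])
    generic = Loop.loop RTCTrace 3 seqs sides (d₀ ∷ d₁ ∷ []) prs rule o valid stp rank prg F.zero

  provable : ∀ t → Proof RTCRule RTCTrace AnyFm (RTC φ s t ∷ H ⇒ F t ∷ [])
  provable t = subst₂ (λ Γ χ → Proof RTCRule RTCTrace AnyFm (Γ ⇒ χ ∷ [])) (cong₂ _∷_ θR (fix H H-fix)) θF
      (Join.infer RTCTrace (sub (var [ z ↦ t ])) (generic ∷ []))
    where
    fix : ∀ Γ → (∀ {χ} → χ ∈ Γ → fsub (var [ z ↦ t ]) χ ≡ χ) → map (fsub (var [ z ↦ t ])) Γ ≡ Γ
    fix []      h = refl
    fix (χ ∷ Γ) h = cong₂ _∷_ (h (here refl)) (fix Γ (h ∘ there))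

module RC = RT RTCTrace

rtcI₀ : ∀ {Γ} φ ψ {s t} → Γ RC.⊢ RTC φ s t → Γ RC.⊢ fsub (s ∷ˢ var) ψ →
        (∀ x y → fsub (y ∷ˢ x ∷ˢ var) φ ∷ fsub (x ∷ˢ var) ψ ∷ Γ RC.⊢ fsub (y ∷ˢ var) ψ) → Γ RC.⊢ fsub (t ∷ˢ var) ψ
rtcI₀ {Γ} φ ψ {s} {t} r b k = cutN r (cutN (b ↑) (cutN (stepd ↑²)
    (ante (λ { (here e) → there (there (here e)) ; (there (here e)) → there (here e) ; (there (there (here e))) → here e }) (I.provable t))))
  where
  open RC
  module I = RTInd φ ψ s
  stepd : Γ ⊢ I.st
  stepd = ∀I₀ _ λ x → ∀I _ (x ∷ˢ var) λ y → subst (Γ ⊢_)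
    (sym (cong₂ _`→_ (trans (fsub-fuse ψ) (fsub-ext ψ λ { zero → refl ; (suc n) → refl })) (cong₂ _`→_ refl (step-inst ψ x y))))
    (→I (→I (k x y)))

rtcI : ∀ {Γ} φ ψ σ {s t} → Γ RC.⊢ fsub σ (RTC φ s t) → Γ RC.⊢ fsub (tsub σ s ∷ˢ σ) ψ →
       (∀ x y → fsub (y ∷ˢ x ∷ˢ σ) φ ∷ fsub (x ∷ˢ σ) ψ ∷ Γ RC.⊢ fsub (y ∷ˢ σ) ψ) → Γ RC.⊢ fsub (tsub σ t ∷ˢ σ) ψ
rtcI {Γ} φ ψ σ {s} {t} r b k = subst (Γ RC.⊢_) (e (tsub σ t)) (rtcI₀ (fsub (lift (lift σ)) φ) (fsub (lift σ) ψ) r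
    (subst (Γ RC.⊢_) (sym (e (tsub σ s))) b)
    λ x y → subst₂ (λ Δ χ → Δ RC.⊢ χ) (cong₂ _∷_ (sym (trans (sym (inst2-cons _ x y)) (inst2-lift φ x y))) (cong (_∷ Γ) (sym (e x)))) (sym (e y)) (k x y))
  where
  e : ∀ u → fsub (u ∷ˢ var) (fsub (lift σ) ψ) ≡ fsub (u ∷ˢ σ) ψ
  e u = trans (sym (inst1-cons _ u)) (inst1-lift ψ u)

TR : Theory
TR = record
  { logic = RC.logicOf
  -- By `a-nat` the term t is reachable from 0 by successor steps, so induction on numbers is
  -- RTC-induction for the successor relation.
  ; ind₀ = λ {Γ} φ b s t → rtcI₀ (`s (var 1) ≐ var 0) φ (RC.ante (λ ()) (RC.axθ a-nat (λ _ → t))) b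
      λ x y → RC.≐S₀ φ RC.h0 (s x RC.↑)
  ; s0  = λ {Γ} {t} d → RC.cutN d (RC.weaken only (λ ()) (RC.axθ a-s0 (λ _ → t)))
  ; inj = λ {Γ} {s} {t} d → RC.cutN d (RC.weaken only id (RC.axθ a-inj (s ∷ˢ λ _ → t)))
  ; +0  = λ t → RC.ante (λ ()) (RC.axθ a-+0 (λ _ → t))
  ; +s  = λ t u → RC.ante (λ ()) (RC.axθ a-+s (t ∷ˢ λ _ → u))
  }

-- Addition and order

ren-lift : ∀ {τ} a → tsub (lift τ) (ren suc a) ≡ ren suc (tsub τ a)
ren-lift a = trans (tsub-fuse a) (sym (tsub-fuse a))

-- The order is defined by addition, as the RTC language has no `≺`; in this way one development
-- serves both theories.
le lt : Tm → Tm → Fm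
le a b = `∃ ((ren suc a `+ var 0) ≐ ren suc b)
lt a b = le (`s a) b

le-sub : ∀ {τ} a b → fsub τ (le a b) ≡ le (tsub τ a) (tsub τ b)
le-sub a b = cong₂ (λ x y → `∃ ((x `+ var 0) ≐ y)) (ren-lift a) (ren-lift b)

module Arith (T : Theory) where
  open Theory T public

  infixr 6 _∙_
  infixl 20 _⁻¹
  _∙_ : ∀ {Γ s t u} → Γ ⊢ s ≐ t → Γ ⊢ t ≐ u → Γ ⊢ s ≐ u
  _∙_ = ≐trans
  _⁻¹ : ∀ {Γ s t} → Γ ⊢ s ≐ t → Γ ⊢ t ≐ s
  _⁻¹ = ≐sym

  s-cong : ∀ {Γ a b} → Γ ⊢ a ≐ b → Γ ⊢ `s a ≐ `s b
  s-cong {a = a} e = ≐S (`s (var 1) ≐ `s (var 0)) (a ∷ˢ var) e (≐R _)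
  +-cong : ∀ {Γ a b c d} → Γ ⊢ a ≐ b → Γ ⊢ c ≐ d → Γ ⊢ a `+ c ≐ b `+ d
  +-cong {a = a} {b} {c} e f = ≐S (var 1 `+ var 2 ≐ var 0 `+ var 2) (a ∷ˢ c ∷ˢ var) e (≐R _)
                             ∙ ≐S (var 2 `+ var 1 ≐ var 2 `+ var 0) (c ∷ˢ b ∷ˢ var) f (≐R _)

  0+ : ∀ {Γ} t → Γ ⊢ `0 `+ t ≐ t
  0+ = ind (`0 `+ var 0 ≐ var 0) var (+0 `0) λ t → +s `0 t ∙ s-cong h0
  s+ : ∀ {Γ} a b → Γ ⊢ `s a `+ b ≐ `s (a `+ b)
  s+ a = ind (`s (var 1) `+ var 0 ≐ `s (var 1 `+ var 0)) (a ∷ˢ var)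
    (+0 (`s a) ∙ s-cong (+0 a ⁻¹)) λ t → +s (`s a) t ∙ s-cong (h0 ∙ (+s a t ⁻¹))
  +comm : ∀ {Γ} a b → Γ ⊢ a `+ b ≐ b `+ a
  +comm a = ind (var 1 `+ var 0 ≐ var 0 `+ var 1) (a ∷ˢ var)
    (+0 a ∙ (0+ a ⁻¹)) λ t → +s a t ∙ s-cong h0 ∙ (s+ t a ⁻¹)
  +assoc : ∀ {Γ} a b c → Γ ⊢ (a `+ b) `+ c ≐ a `+ (b `+ c)
  +assoc a b = ind ((var 1 `+ var 2) `+ var 0 ≐ var 1 `+ (var 2 `+ var 0)) (a ∷ˢ b ∷ˢ var)
    (+0 (a `+ b) ∙ +-cong (≐R a) (+0 b ⁻¹))
    λ t → +s (a `+ b) t ∙ s-cong h0 ∙ (+s a (b `+ t) ⁻¹) ∙ +-cong (≐R a) (+s b t ⁻¹)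
  +cancelʳ : ∀ {Γ} a b c → Γ ⊢ a `+ c ≐ b `+ c → Γ ⊢ a ≐ b
  +cancelʳ a b c = →E (ind ((var 1 `+ var 0 ≐ var 2 `+ var 0) `→ (var 1 ≐ var 2)) (a ∷ˢ b ∷ˢ var)
    (→I ((+0 a ⁻¹) ∙ h0 ∙ +0 b)) (λ t → →I (→E h1 (inj ((+s a t ⁻¹) ∙ h0 ∙ +s b t)))) c)
  +cancelˡ : ∀ {Γ} c a b → Γ ⊢ c `+ a ≐ c `+ b → Γ ⊢ a ≐ b
  +cancelˡ c a b e = +cancelʳ a b c (+comm a c ∙ e ∙ +comm c b)
  +-zeroʳ : ∀ {Γ ψ} a b → Γ ⊢ a `+ `s b ≐ `0 → Γ ⊢ ψ
  +-zeroʳ a b e = botE (s0 ((+s a b ⁻¹) ∙ e))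

  cases : ∀ {Γ ψ} t → (t ≐ `0) ∷ Γ ⊢ ψ → (∀ x → (t ≐ `s x) ∷ Γ ⊢ ψ) → Γ ⊢ ψ
  cases t a k = ∨E
    (ind ((var 0 ≐ `0) `∨ `∃ (var 1 ≐ `s (var 0))) var (∨I₁ (≐R `0))
         (λ u → ∨I₂ (∃I (var 1 ≐ `s (var 0)) (`s u ∷ˢ var) u (≐R (`s u)))) t)
    a (∃E (var 1 ≐ `s (var 0)) (t ∷ˢ var) h0 λ x → wkN (λ { (here e) → here e ; (there m) → there (there m) }) (k x))

  leI : ∀ {Γ} a b w → Γ ⊢ a `+ w ≐ b → Γ ⊢ le a b
  leI a b w = ∃I ((var 1 `+ var 0) ≐ var 2) (a ∷ˢ b ∷ˢ var) w
  leE : ∀ {Γ ψ} a b → Γ ⊢ le a b → (∀ w → (a `+ w ≐ b) ∷ Γ ⊢ ψ) → Γ ⊢ ψ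
  leE a b = ∃E ((var 1 `+ var 0) ≐ var 2) (a ∷ˢ b ∷ˢ var)

  le-refl : ∀ {Γ} a → Γ ⊢ le a a
  le-refl a = leI a a `0 (+0 a)
  le-0 : ∀ {Γ} a → Γ ⊢ le `0 a
  le-0 a = leI `0 a a (0+ a)
  le-+ : ∀ {Γ} a b → Γ ⊢ le a (a `+ b)
  le-+ a b = leI a _ b (≐R _)
  le-+ʳ : ∀ {Γ} a b → Γ ⊢ le b (a `+ b)
  le-+ʳ a b = leI b _ a (+comm b a)
  le-trans : ∀ {Γ} a b c → Γ ⊢ le a b → Γ ⊢ le b c → Γ ⊢ le a c
  le-trans a b c p q = leE a b p λ w → leE b c (q ↑) λ v →
    leI a c (w `+ v) ((+assoc a w v ⁻¹) ∙ +-cong h1 (≐R v) ∙ h0)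
  le-resp : ∀ {Γ a a' b b'} → Γ ⊢ a ≐ a' → Γ ⊢ b ≐ b' → Γ ⊢ le a b → Γ ⊢ le a' b'
  le-resp {a = a} {a'} {b} {b'} e f p = leE a b p λ w → leI a' b' w (+-cong (e ↑ ⁻¹) (≐R w) ∙ h0 ∙ (f ↑))
  le-s : ∀ {Γ} a b → Γ ⊢ le a b → Γ ⊢ le (`s a) (`s b)
  le-s a b p = leE a b p λ w → leI _ _ w (s+ a w ∙ s-cong h0)
  le-s⁻ : ∀ {Γ} a b → Γ ⊢ le (`s a) (`s b) → Γ ⊢ le a b
  le-s⁻ a b p = leE _ _ p λ w → leI a b w (inj ((s+ a w ⁻¹) ∙ h0))
  lt-0 : ∀ {Γ ψ} a → Γ ⊢ lt a `0 → Γ ⊢ ψ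
  lt-0 a p = leE _ _ p λ w → botE (s0 ((s+ a w ⁻¹) ∙ h0))
  le-suc : ∀ {Γ} a → Γ ⊢ le a (`s a)
  le-suc a = leI a _ (`s `0) (+s a `0 ∙ s-cong (+0 a))
  lt⇒le : ∀ {Γ} a b → Γ ⊢ lt a b → Γ ⊢ le a b
  lt⇒le a b p = le-trans a (`s a) b (le-suc a) p
  lt-irr : ∀ {Γ ψ} a → Γ ⊢ lt a a → Γ ⊢ ψ
  lt-irr a p = leE _ _ p λ w → +-zeroʳ `0 w (0+ _ ∙ +cancelˡ a (`s w) `0 (+s a w ∙ (s+ a w ⁻¹) ∙ h0 ∙ (+0 a ⁻¹)))
  le-total : ∀ {Γ} a b → Γ ⊢ le a b `∨ lt b a
  le-total a = ind (le (var 1) (var 0) `∨ le (`s (var 0)) (var 1)) (a ∷ˢ var)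
    (cases a (∨I₁ (le-resp (h0 ⁻¹) (≐R `0) (le-refl `0)))
             (λ x → ∨I₂ (le-resp (≐R (`s `0)) (h0 ⁻¹) (le-s `0 x (le-0 x)))))
    λ t → ∨E h0 (∨I₁ (le-trans a t (`s t) h0 (le-suc t)))
      (leE (`s t) a h0 λ w → cases w
        (∨I₁ (le-resp ((+0 (`s t) ⁻¹) ∙ +-cong (≐R (`s t)) (h0 ⁻¹) ∙ h1) (≐R (`s t)) (le-refl (`s t))))
        λ v → ∨I₂ (leI (`s (`s t)) a v (s+ (`s t) v ∙ (+s (`s t) v ⁻¹) ∙ +-cong (≐R _) (h0 ⁻¹) ∙ h1)))
  le-antisym : ∀ {Γ} a b → Γ ⊢ le a b → Γ ⊢ le b a → Γ ⊢ a ≐ b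
  le-antisym a b p q = leE a b p λ w → cases w
    ((+0 a ⁻¹) ∙ +-cong (≐R a) (h0 ⁻¹) ∙ h1)
    λ v → lt-irr b (le-trans (`s b) (`s a) b (le-s b a (q ↑²)) (leI (`s a) b v (s+ a v ∙ (+s a v ⁻¹) ∙ +-cong (≐R a) (h0 ⁻¹) ∙ h1)))
  le-split : ∀ {Γ ψ} a b → Γ ⊢ le a b → lt a b ∷ Γ ⊢ ψ → (a ≐ b) ∷ Γ ⊢ ψ → Γ ⊢ ψ
  le-split a b p k l = ∨E (le-total b a) (cutN (le-antisym a b (p ↑) h0) (wkN (λ { (here e) → here e ; (there m) → there (there m) }) l)) k

-- Blocks of variables

infixr 5 _⊕_
_⊕_ : ∀ {n} → Vec Tm n → Subst → Subst
[]      ⊕ σ = σ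
(t ∷ v) ⊕ σ = t ∷ˢ (v ⊕ σ)

blk : ∀ n → ℕ → Vec Tm n
blk zero    k = []
blk (suc n) k = var k ∷ blk n (suc k)

⊕-up : ∀ {n} (v : Vec Tm n) σ i → (v ⊕ σ) (n + i) ≡ σ i
⊕-up []      σ i = refl
⊕-up (t ∷ v) σ i = ⊕-up v σ i

⊕-ext : ∀ {n} (v : Vec Tm n) {σ τ} → (∀ i → σ i ≡ τ i) → ∀ i → (v ⊕ σ) i ≡ (v ⊕ τ) i
⊕-ext []      h i       = h i
⊕-ext (t ∷ v) h zero    = refl
⊕-ext (t ∷ v) h (suc i) = ⊕-ext v h i

⊕-map : ∀ {n} (v : Vec Tm n) {σ τ} i → tsub τ ((v ⊕ σ) i) ≡ (V.map (tsub τ) v ⊕ (tsub τ ∘ σ)) i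
⊕-map []      i       = refl
⊕-map (t ∷ v) zero    = refl
⊕-map (t ∷ v) (suc i) = ⊕-map v i

blk-map : ∀ {n} (v : Vec Tm n) {σ τ} k → (∀ i → τ (i + k) ≡ (v ⊕ σ) i) → V.map (tsub τ) (blk n k) ≡ v
blk-map []      k h = refl
blk-map (t ∷ v) {τ = τ} k h = cong₂ _∷_ (h 0) (blk-map v (suc k) λ i → trans (cong τ (Nₚ.+-suc i k)) (h (suc i)))

blk-here : ∀ {n} (v : Vec Tm n) σ → V.map (tsub (v ⊕ σ)) (blk n 0) ≡ v
blk-here v σ = blk-map v {σ} 0 λ i → cong (v ⊕ σ) (Nₚ.+-identityʳ i)

blk-next : ∀ {m n} (u : Vec Tm m) (v : Vec Tm n) σ → V.map (tsub (u ⊕ v ⊕ σ)) (blk n m) ≡ v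
blk-next {m} u v σ = blk-map v {σ} m λ i → trans (cong (u ⊕ v ⊕ σ) (Nₚ.+-comm i m)) (⊕-up u (v ⊕ σ) i)

-- A as a formula about the first block, when g more variables are inserted after it
skip : ℕ → ℕ → Fm → Fm
skip n g = fsub (blk n 0 ⊕ up (n + g))

skip-eval : ∀ {n} g (y : Vec Tm n) {ρ σ} A → (∀ i → ρ (g + i) ≡ σ i) → fsub (y ⊕ ρ) (skip n g A) ≡ fsub (y ⊕ σ) A
skip-eval {n} g y {ρ} {σ} A h = trans (fsub-fuse A) (fsub-ext A λ i → trans (⊕-map (blk n 0) i)
  (trans (cong (λ v → (v ⊕ (tsub (y ⊕ ρ) ∘ up (n + g))) i) (blk-here y ρ))
         (⊕-ext y (λ j → trans (cong (y ⊕ ρ) (Nₚ.+-assoc n g j)) (trans (⊕-up y ρ (g + j)) (h j))) i)))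

∀ⁿ : ℕ → Fm → Fm
∀ⁿ zero    φ = φ
∀ⁿ (suc n) φ = ∀ⁿ n (`∀ φ)

imps : List Fm → Fm → Fm
imps φs ψ = foldr _`→_ ψ φs

-- Well-foundedness as an induction schema: W X says that every formula A progressive along the
-- relations R c (c ∈ X) between n-tuples holds everywhere.
module WF (T : Theory) (n : ℕ) (C : Set) (_≟_ : DecidableEquality C) (_·_ : C → C → C)
  (assoc : ∀ a b c → (a · b) · c ≡ a · (b · c))
  (R : C → Vec Tm n → Vec Tm n → Fm)
  (R-sub : ∀ τ c x y → fsub τ (R c x y) ≡ R c (V.map (tsub τ) x) (V.map (tsub τ) y))
  (R-comp : ∀ {Γ} c d x y z → Theory._⊢_ T Γ (R c x y) → Theory._⊢_ T Γ (R d y z) → Theory._⊢_ T Γ (R (c · d) x z))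
  where
  open Arith T
  open DecMem _≟_ using (_∈?_)

  ∀ⁿI : ∀ {m Γ} φ σ → (∀ (v : Vec Tm m) → Γ ⊢ fsub (v ⊕ σ) φ) → Γ ⊢ fsub σ (∀ⁿ m φ)
  ∀ⁿI {zero}  φ σ d = d []
  ∀ⁿI {suc m} φ σ d = ∀ⁿI {m} (`∀ φ) σ λ v → ∀I φ (v ⊕ σ) λ t → d (t ∷ v)

  ∀ⁿE : ∀ {m Γ} φ σ → Γ ⊢ fsub σ (∀ⁿ m φ) → (v : Vec Tm m) → Γ ⊢ fsub (v ⊕ σ) φ
  ∀ⁿE φ σ d []      = d
  ∀ⁿE φ σ d (t ∷ v) = ∀E φ (v ⊕ σ) (∀ⁿE (`∀ φ) σ d v) t

  impsI : ∀ {Γ} φs ψ σ → (∀ {Δ} → Γ ⊆ Δ → (∀ {φ} → φ ∈ φs → Δ ⊢ fsub σ φ) → Δ ⊢ fsub σ ψ) → Γ ⊢ fsub σ (imps φs ψ)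
  impsI []       ψ σ d = d id λ ()
  impsI (φ ∷ φs) ψ σ d = →I (impsI φs ψ σ λ w h → d (w ∘ there) λ { (here refl) → hyp (w (here refl)) ; (there m) → h m })

  impsE : ∀ {Γ} φs ψ σ → Γ ⊢ fsub σ (imps φs ψ) → (∀ {φ} → φ ∈ φs → Γ ⊢ fsub σ φ) → Γ ⊢ fsub σ ψ
  impsE []       ψ σ d h = d
  impsE (φ ∷ φs) ψ σ d h = impsE φs ψ σ (→E d (h (here refl))) (h ∘ there)

  rel→ : C → Fm → Fm
  rel→ c A = R c (blk n n) (blk n 0) `→ skip n n A

  rel→-eval : ∀ c A (y z : Vec Tm n) σ → fsub (z ⊕ y ⊕ σ) (rel→ c A) ≡ (R c y z `→ fsub (z ⊕ σ) A)
  rel→-eval c A y z σ = cong₂ _`→_ (trans (R-sub _ c _ _) (cong₂ (R c) (blk-next z y σ) (blk-here z (y ⊕ σ)))) (skip-eval n z A (⊕-up y σ))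

  -- The modal box for steps along `R c`. The inner block of variables is the successor tuple, the
  -- next one the present tuple, and the parameters follow.
  □ : C → Fm → Fm
  □ c A = ∀ⁿ n (rel→ c A)

  □E : ∀ {Γ} c A (y : Vec Tm n) σ → Γ ⊢ fsub (y ⊕ σ) (□ c A) → ∀ z → Γ ⊢ R c y z → Γ ⊢ fsub (z ⊕ σ) A
  □E c A y σ d z r = →E (cast (rel→-eval c A y z σ) (∀ⁿE (rel→ c A) (y ⊕ σ) d z)) r

  □I : ∀ {Γ} c A (y : Vec Tm n) σ → (∀ z → R c y z ∷ Γ ⊢ fsub (z ⊕ σ) A) → Γ ⊢ fsub (y ⊕ σ) (□ c A)
  □I c A y σ d = ∀ⁿI (rel→ c A) (y ⊕ σ) λ z → cast (sym (rel→-eval c A y z σ)) (→I (d z))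

  -- The quantification over larger contexts, as in Kripke semantics, allows progressiveness to be
  -- applied below hypotheses that are introduced during the induction.
  Progressive : List C → List Fm → Fm → Subst → Set
  Progressive X Γ A σ = ∀ {Δ} → Γ ⊆ Δ → ∀ (y : Vec Tm n) → (∀ {c} → c ∈ X → Δ ⊢ fsub (y ⊕ σ) (□ c A)) → Δ ⊢ fsub (y ⊕ σ) A

  W : List C → Set
  W X = ∀ {Γ} A σ → Progressive X Γ A σ → ∀ (y : Vec Tm n) → Γ ⊢ fsub (y ⊕ σ) A

  Descent : C → Set
  Descent c = Σ (Fin n) λ i → ∀ {Γ} (x y : Vec Tm n) → Γ ⊢ R c x y → Γ ⊢ lt (V.lookup y i) (V.lookup x i)

  -- A left zero a absorbs later steps: `R a x y` and `R c y z` give `R a x z`. So for fixed x the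
  -- hypothesis `R a x y` survives all steps along the remaining colours, and the induction for
  -- these colours applies to the formula "if `R a x y` then A y". Steps along a itself lower a
  -- coordinate and are dealt with by induction on its value.
  W-leftZero : ∀ X → (∀ {a c} → a ∈ X → c ∈ X → a · c ≡ a) → (∀ {a} → a ∈ X → Descent a) → W X
  W-leftZero []      lz ds A σ prog y = prog id y λ ()
  W-leftZero (a ∷ X) lz ds {Γ} A σ prog y =
    W-leftZero X (λ p q → lz (there p) (there q)) (ds ∘ there) A σ
      (λ w y' ih → prog w y' λ { (here refl) → wkN w (allA y') ; (there m) → ih m }) y
    where
    t  = proj₁ (ds (here refl))
    below = proj₂ (ds (here refl))
    module _ {Γ' : List Fm} (w : Γ ⊆ Γ') (x : Vec Tm n)
      (ih : ∀ {Δ} → Γ' ⊆ Δ → ∀ z → Δ ⊢ lt (V.lookup z t) (V.lookup x t) → Δ ⊢ fsub (z ⊕ σ) (□ a A)) where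
      core : Γ' ⊢ fsub (x ⊕ σ) (□ a A)
      core = □I a A x σ λ y → →E (cast (rel→-eval a A x y σ)
        (W-leftZero X (λ p q → lz (there p) (there q)) (ds ∘ there) (rel→ a A) (x ⊕ σ)
          (λ {Δ} w' y' ih' → cast (sym (rel→-eval a A x y' σ)) (→I
            (prog (there ∘ w' ∘ there ∘ w) y' λ
              { (here refl) → ih (there ∘ w' ∘ there) y' (below x y' h0)
              ; {c} (there m) → □I c A y' σ λ z →
                  →E (cast (rel→-eval a A x z σ) (□E c (rel→ a A) y' (x ⊕ σ) (ih' m ↑²) z h0))
                     (cast (cong (λ d → R d x z) (lz (here refl) (there m))) (R-comp a c x y' z h1 h0)) })))
          y)) h0
    -- The bound m on coordinate t turns course-of-values induction into plain induction on m.
    G : Fm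
    G = ∀ⁿ n (le (V.lookup (blk n 0) t) (var (n + 0)) `→ skip n 1 (□ a A))
    G-eval : ∀ m (x : Vec Tm n) → fsub (x ⊕ m ∷ˢ σ) (le (V.lookup (blk n 0) t) (var (n + 0)) `→ skip n 1 (□ a A))
                                ≡ (le (V.lookup x t) m `→ fsub (x ⊕ σ) (□ a A))
    G-eval m x = cong₂ _`→_ (trans (le-sub (V.lookup (blk n 0) t) (var (n + 0))) (cong₂ le
        (trans (sym (Vₚ.lookup-map t _ (blk n 0))) (cong (λ v → V.lookup v t) (blk-here x (m ∷ˢ σ))))
        (⊕-up x (m ∷ˢ σ) 0))) (skip-eval 1 x (□ a A) λ _ → refl)
    allG : ∀ m → Γ ⊢ fsub (m ∷ˢ σ) G
    allG = ind G σ
      (∀ⁿI _ (`0 ∷ˢ σ) λ x → cast (sym (G-eval `0 x)) (→I (core there x λ w z l →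
        lt-0 (V.lookup z t) (le-trans (`s (V.lookup z t)) (V.lookup x t) `0 l (hyp (w (here refl)))))))
      λ m → ∀ⁿI _ (`s m ∷ˢ σ) λ x → cast (sym (G-eval (`s m) x)) (→I (core (there ∘ there) x λ {Δ} w z l →
        →E (cast (G-eval m z) (∀ⁿE _ (m ∷ˢ σ) (hyp (w (there (here refl)))) z))
           (le-s⁻ (V.lookup z t) m (le-trans (`s (V.lookup z t)) (V.lookup x t) (`s m) l (hyp (w (here refl)))))))
    allA : ∀ (x : Vec Tm n) → Γ ⊢ fsub (x ⊕ σ) (□ a A)
    allA x = →E (cast (G-eval _ x) (∀ⁿE _ (V.lookup x t ∷ˢ σ) (allG (V.lookup x t)) x)) (le-refl (V.lookup x t))

  -- Every infinite product over X eventually stabilises the prefix products; the elements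
  -- stabilising a given prefix form a smaller semigroup, unless the prefix is a left zero.
  module _ where
    W-closed : ∀ fuel X → length X < fuel → (∀ {a b} → a ∈ X → b ∈ X → a · b ∈ X) →
               (∀ {e} → e ∈ X → e · e ≡ e → Descent e) → W X
    W-closed (suc fuel) X (s≤s len) cl ds {Γ} A σ prog y =
      -- Left zeros are idempotent and therefore descend. A step along any other element is pursued
      -- by `lem` until the product read since y is a left zero; there `ih` applies.
      W-leftZero L (λ p q → leftZ p (proj₁ (inL q)))
        (λ p → ds (proj₁ (inL p)) (leftZ p (proj₁ (inL p)))) A σ
        (λ w y' ih → prog w y' λ {e} eX → □I e A y' σ λ z →
          lem (suc (length rest)) rest Nₚ.≤-refl inRest eX (there ∘ w) z
            (λ nV → □E e A y' σ (ih (toL eX nV) ↑) z h0)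
            (λ {c} cX nV → □I c A z σ λ u → □E (e · c) A y' σ (ih (toL (cl eX cX) nV) ↑²) u (R-comp e c y' z u h1 h0))) y
      where
      leftZ? = λ s → All.all? (λ c → (s · c) ≟ s) X
      L rest : List C
      L = filter leftZ? X
      rest = filter (¬? ∘ leftZ?) X
      inL : ∀ {s} → s ∈ L → s ∈ X × All (λ c → s · c ≡ s) X
      inL = ∈ₚ.∈-filter⁻ leftZ?
      leftZ : ∀ {s c} → s ∈ L → c ∈ X → s · c ≡ s
      leftZ p q = All.lookup (proj₂ (inL p)) q
      toL : ∀ {s} → s ∈ X → s ∉ rest → s ∈ L
      toL {s} sX nV with leftZ? s
      ... | yes p = ∈ₚ.∈-filter⁺ leftZ? sX p
      ... | no np = contradiction (∈ₚ.∈-filter⁺ (¬? ∘ leftZ?) sX np) nV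
      NonLZ : C → Set
      NonLZ v = Any (λ c → ¬ v · c ≡ v) X
      inRest : ∀ {v} → v ∈ rest → NonLZ v
      inRest p = Allₚ.¬All⇒Any¬ (λ c → (_ · c) ≟ _) X (proj₂ (∈ₚ.∈-filter⁻ (¬? ∘ leftZ?) {xs = X} p))
      -- s is the prefix product read so far, V the list of prefixes still to be discharged
      lem : ∀ k V → length V < k → (∀ {v} → v ∈ V → NonLZ v) → ∀ {s} → s ∈ X →
            ∀ {Δ} → Γ ⊆ Δ → ∀ (y : Vec Tm n) → (s ∉ V → Δ ⊢ fsub (y ⊕ σ) A) →
            (∀ {c} → c ∈ X → s · c ∉ V → Δ ⊢ fsub (y ⊕ σ) (□ c A)) → Δ ⊢ fsub (y ⊕ σ) A
      lem (suc k) V (s≤s lenV) nz {s} sX {Δ} w y now later with s ∈? V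
      ... | no s∉V  = now s∉V
      ... | yes s∈V = impsE (map (λ c → □ c A) cs) A (y ⊕ σ)
              (W-closed fuel Stab (Nₚ.≤-trans (Lₚ.filter-notAll stab? X (nz s∈V)) len)
                 (λ p q → ∈ₚ.∈-filter⁺ stab? (cl (inX p) (inX q)) (stab-mul p (fixes q)))
                 (λ p → ds (inX p)) Bx σ progB y)
              λ m → let c , c∈ , e = ∈ₚ.∈-map⁻ _ m in cast (cong (fsub (y ⊕ σ)) (sym e)) (later (proj₁ (inCs c∈)) (proj₂ (inCs c∈)))
        where
        stab? = λ c → (s · c) ≟ s
        Stab cs V' : List C
        Stab = filter stab? X
        cs? = λ c → ¬? ((s · c) ∈? V)
        cs = filter cs? X
        V'? = λ v → ¬? (v ≟ s)
        V' = filter V'? V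
        inX : ∀ {c} → c ∈ Stab → c ∈ X
        inX p = proj₁ (∈ₚ.∈-filter⁻ stab? p)
        fixes : ∀ {c} → c ∈ Stab → s · c ≡ s
        fixes p = proj₂ (∈ₚ.∈-filter⁻ stab? {xs = X} p)
        stab-mul : ∀ {c d t} → c ∈ Stab → s · d ≡ t → s · (c · d) ≡ t
        stab-mul {c} {d} p e = trans (sym (assoc s c d)) (trans (cong (_· d) (fixes p)) e)
        inCs : ∀ {c} → c ∈ cs → c ∈ X × s · c ∉ V
        inCs = ∈ₚ.∈-filter⁻ cs?
        -- A relative to its exits: `cs` contains the elements that take the prefix s out of V.
        -- Steps along `Stab` leave s unchanged and with it the set of exits, so this formula is fit
        -- for induction along `Stab`.
        Bx : Fm
        Bx = imps (map (λ c → □ c A) cs) A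
        progB : Progressive Stab Δ Bx σ
        progB w' y' ih = impsI (map (λ c → □ c A) cs) A (y' ⊕ σ) λ {Δ'} w'' hs →
          let
            out : ∀ {c} → c ∈ cs → Δ' ⊢ fsub (y' ⊕ σ) (□ c A)
            out m = hs (∈ₚ.∈-map⁺ (λ c → □ c A) m)
            -- A step c that fixes s, followed by an exit c', amounts to one exit, since s · (c ·
            -- c') = s · c'. This discharges the hypotheses of `Bx` at the successor.
            stay : ∀ {c} → c ∈ Stab → Δ' ⊢ fsub (y' ⊕ σ) (□ c A)
            stay {c} m = □I c A y' σ λ z → impsE (map (λ c → □ c A) cs) A (z ⊕ σ) (□E c Bx y' σ (wkN (there ∘ w'') (ih m)) z h0)
              λ m' → let c' , c'∈ , e = ∈ₚ.∈-map⁻ _ m' in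
                cast (cong (fsub (z ⊕ σ)) (sym e)) (□I c' A z σ λ u →
                  □E (c · c') A y' σ (out (∈ₚ.∈-filter⁺ cs? (cl (inX m) (proj₁ (inCs c'∈)))
                        (subst (_∉ V) (sym (stab-mul m refl)) (proj₂ (inCs c'∈)))) ↑²) u (R-comp c c' y' z u h1 h0))
            anyc : ∀ {c} → c ∈ X → s · c ∉ V' → Δ' ⊢ fsub (y' ⊕ σ) (□ c A)
            anyc {c} cX nV' = case (s · c) ∈? V of λ
              { (no nV) → out (∈ₚ.∈-filter⁺ cs? cX nV)
              ; (yes iV) → case (s · c) ≟ s of λ
                  { (yes e) → stay (∈ₚ.∈-filter⁺ stab? cX e)
                  ; (no ne) → contradiction (∈ₚ.∈-filter⁺ V'? iV ne) nV' } }
          in prog (w'' ∘ w' ∘ w) y' λ {e} eX → □I e A y' σ λ z →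
            -- Now s may be deleted from V: a product s · c outside `V'` either has left V or is s
            -- again, and `anyc` covers both cases.
            lem k V' (Nₚ.≤-trans (Lₚ.filter-notAll V'? V (Any.map (λ { refl ne → ne refl }) s∈V)) lenV)
              (λ p → nz (proj₁ (∈ₚ.∈-filter⁻ V'? p))) (cl sX eX) (there ∘ w'' ∘ w' ∘ w) z
              (λ nV' → □E e A y' σ (anyc eX nV' ↑) z h0)
              λ {c} cX nV' → □I c A z σ λ u →
                □E (e · c) A y' σ (anyc (cl eX cX) (subst (_∉ V') (assoc s e c) nV') ↑²) u (R-comp e c y' z u h1 h0)

-- Size-change graphs: every trace condition is witnessed by strict idempotents

allVec : ∀ {A : Set} → List A → ∀ k → List (Vec A k)
allVec xs zero    = [] ∷ []
allVec xs (suc k) = cartesianProductWith _∷_ xs (allVec xs k)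

∈-allVec : ∀ {A : Set} {xs : List A} → (∀ a → a ∈ xs) → ∀ {k} (v : Vec A k) → v ∈ allVec xs k
∈-allVec h []      = here refl
∈-allVec h (a ∷ v) = ∈ₚ.∈-cartesianProductWith⁺ _∷_ (h a) (∈-allVec h v)

module Saturate {C : Set} (_≟_ : DecidableEquality C) (_·_ : C → C → C) (us : List C) (complete : ∀ c → c ∈ us)
  (Gen : C → Set) (mul : ∀ {a b} → Gen a → Gen b → Gen (a · b)) where
  open DecMem _≟_ using (_∈?_)

  saturate : ∀ X → All Gen X → Σ (List C) λ Y → X ⊆ Y × All Gen Y × (∀ {a b} → a ∈ Y → b ∈ Y → a · b ∈ Y)
  saturate X gX = go (suc (length us)) X us (λ c → inj₂ (complete c)) Nₚ.≤-refl gX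
    where
    -- `rest` covers whatever X still lacks, so each new product shortens it.
    go : ∀ fuel X rest → (∀ c → c ∈ X ⊎ c ∈ rest) → length rest < fuel → All Gen X →
         Σ (List C) λ Y → X ⊆ Y × All Gen Y × (∀ {a b} → a ∈ Y → b ∈ Y → a · b ∈ Y)
    go (suc fuel) X rest cov (s≤s l) gX
      with Any.any? (λ ab → ¬? ((proj₁ ab · proj₂ ab) ∈? X)) (cartesianProduct X X)
    ... | no closed = X , id , gX , λ {a} {b} p q → case (a · b) ∈? X of λ
            { (yes m) → m
            ; (no nm) → contradiction (Any.map (λ { refl → nm }) (∈ₚ.∈-cartesianProduct⁺ p q)) closed }
    ... | yes open' with find open'
    ...   | (a , b) , m , new with ∈ₚ.∈-cartesianProduct⁻ X X m
    ...     | p , q =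
      let Y , s , g , c = go fuel (a · b ∷ X) (filter other? rest) cov'
                            (Nₚ.≤-trans (Lₚ.filter-notAll other? rest (Any.map (λ { refl ne → ne refl }) inRest)) l)
                            (mul (All.lookup gX p) (All.lookup gX q) ∷ gX)
      in Y , s ∘ there , g , c
      where
      other? = λ c → ¬? (c ≟ (a · b))
      inRest : (a · b) ∈ rest
      inRest with cov (a · b)
      ... | inj₁ m' = contradiction m' new
      ... | inj₂ m' = m'
      cov' : ∀ c → c ∈ (a · b) ∷ X ⊎ c ∈ filter other? rest
      cov' c with c ≟ (a · b) | cov c
      ... | yes e | _      = inj₁ (here e)
      ... | no ne | inj₁ i = inj₁ (there i)
      ... | no ne | inj₂ i = inj₂ (∈ₚ.∈-filter⁺ other? i ne)

-- Boolean matrices, and colours with source and target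

module Matrix (m : ℕ) where
  -- Tables instead of functions: they form a finite set with decidable equality, and matrices with
  -- equal entries are propositionally equal.
  Mat : Set
  Mat = Vec (Vec Bool m) m

  mk : (Fin m → Fin m → Bool) → Mat
  mk f = V.tabulate λ a → V.tabulate (f a)

  Rel : Mat → Fin m → Fin m → Set
  Rel M a b = V.lookup (V.lookup M a) b ≡ true

  mk-at : ∀ f a b → V.lookup (V.lookup (mk f) a) b ≡ f a b
  mk-at f a b = trans (cong (λ v → V.lookup v b) (Vₚ.lookup∘tabulate (λ a → V.tabulate (f a)) a)) (Vₚ.lookup∘tabulate (f a) b)

  bool-ext : ∀ {a b : Bool} → (a ≡ true → b ≡ true) → (b ≡ true → a ≡ true) → a ≡ b
  bool-ext {true}  {b}     f g = sym (f refl)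
  bool-ext {false} {true}  f g = g refl
  bool-ext {false} {false} f g = refl

  vec-ext : ∀ {A : Set} {k} (u v : Vec A k) → (∀ i → V.lookup u i ≡ V.lookup v i) → u ≡ v
  vec-ext []      []      h = refl
  vec-ext (a ∷ u) (b ∷ v) h = cong₂ _∷_ (h F.zero) (vec-ext u v (h ∘ F.suc))

  mat-ext : ∀ M M' → (∀ a b → Rel M a b → Rel M' a b) → (∀ a b → Rel M' a b → Rel M a b) → M ≡ M'
  mat-ext M M' f g = vec-ext M M' λ a → vec-ext _ _ λ b → bool-ext (f a b) (g a b)

  comp? : ∀ M M' a c → Dec (∃ λ b → Rel M a b × Rel M' b c)
  comp? M M' a c = Fₚ.any? λ b → (V.lookup (V.lookup M a) b Data.Bool.≟ true) ×-dec (V.lookup (V.lookup M' b) c Data.Bool.≟ true)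

  infixl 7 _⊙_
  _⊙_ : Mat → Mat → Mat
  M ⊙ M' = mk λ a c → isYes (comp? M M' a c)

  ⊙⁺ : ∀ {M M' a b c} → Rel M a b → Rel M' b c → Rel (M ⊙ M') a c
  ⊙⁺ {M} {M'} {a} {b} {c} p q = trans (mk-at _ a c) (yes! (comp? M M' a c) (b , p , q))
    where
    yes! : ∀ {P : Set} (d : Dec P) → P → isYes d ≡ true
    yes! (yes _) _ = refl
    yes! (no np) p = contradiction p np

  ⊙⁻ : ∀ {M M' a c} → Rel (M ⊙ M') a c → ∃ λ b → Rel M a b × Rel M' b c
  ⊙⁻ {M} {M'} {a} {c} e = get (comp? M M' a c) (trans (sym (mk-at _ a c)) e)
    where
    get : ∀ {P : Set} (d : Dec P) → isYes d ≡ true → P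
    get (yes p) _ = p

  ⊙-assoc : ∀ A B C → (A ⊙ B) ⊙ C ≡ A ⊙ (B ⊙ C)
  ⊙-assoc A B C = mat-ext _ _
    (λ a d h → let c , p , r = ⊙⁻ {A ⊙ B} {C} h ; b , s , t = ⊙⁻ {A} {B} p in ⊙⁺ {A} {B ⊙ C} s (⊙⁺ {B} {C} t r))
    (λ a d h → let b , p , r = ⊙⁻ {A} {B ⊙ C} h ; c , s , t = ⊙⁻ {B} {C} r in ⊙⁺ {A ⊙ B} {C} (⊙⁺ {A} {B} p s) t)

module Typed (N : ℕ) {A : Set} (_≟ᴬ_ : DecidableEquality A) (_⊙_ : A → A → A) (⊙-assoc : ∀ a b c → (a ⊙ b) ⊙ c ≡ a ⊙ (b ⊙ c)) where
  -- The category of matrices between nodes, made into a semigroup by adjoining the zero `nothing`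
  -- as the product of arrows that do not compose.
  Colour : Set
  Colour = Maybe (Fin N × Fin N × A)

  _≟ᶜ_ : DecidableEquality Colour
  _≟ᶜ_ = Mₚ.≡-dec (×ₚ.≡-dec F._≟_ (×ₚ.≡-dec F._≟_ _≟ᴬ_))

  infixl 7 _·ᶜ_
  _·ᶜ_ : Colour → Colour → Colour
  just (i , j , a) ·ᶜ just (j' , k , b) with j F.≟ j'
  ... | yes _ = just (i , k , a ⊙ b)
  ... | no _  = nothing
  just _  ·ᶜ nothing = nothing
  nothing ·ᶜ _       = nothing

  ·-match : ∀ i j k a b → just (i , j , a) ·ᶜ just (j , k , b) ≡ just (i , k , a ⊙ b)
  ·-match i j k a b with j F.≟ j
  ... | yes _ = refl
  ... | no ne = contradiction refl ne

  ·-clash : ∀ i {j j'} k a b → j ≢ j' → just (i , j , a) ·ᶜ just (j' , k , b) ≡ nothing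
  ·-clash i {j} {j'} k a b ne with j F.≟ j'
  ... | yes e = contradiction e ne
  ... | no _  = refl

  ·-null : ∀ a → a ·ᶜ nothing ≡ nothing
  ·-null nothing  = refl
  ·-null (just _) = refl

  ·-assoc : ∀ a b c → (a ·ᶜ b) ·ᶜ c ≡ a ·ᶜ (b ·ᶜ c)
  ·-assoc nothing b c = refl
  ·-assoc (just _) nothing c = refl
  ·-assoc a@(just _) b@(just _) nothing = trans (·-null (a ·ᶜ b)) (sym (trans (cong (a ·ᶜ_) (·-null b)) (·-null a)))
  ·-assoc (just (i , j , a)) (just (j' , k , b)) (just (k' , l , c)) = go (j F.≟ j') (k F.≟ k')
    where
    x = just (i , j , a)
    y = just (j' , k , b)
    z = just (k' , l , c)
    go : Dec (j ≡ j') → Dec (k ≡ k') → (x ·ᶜ y) ·ᶜ z ≡ x ·ᶜ (y ·ᶜ z)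
    go (yes refl) (yes refl) = trans (cong (_·ᶜ z) (·-match i j k a b)) (trans (·-match i k l (a ⊙ b) c)
      (trans (cong (λ m → just (i , l , m)) (⊙-assoc a b c)) (sym (trans (cong (x ·ᶜ_) (·-match j k l b c)) (·-match i j l a (b ⊙ c))))))
    go (yes refl) (no ne) = trans (cong (_·ᶜ z) (·-match i j k a b)) (trans (·-clash i l (a ⊙ b) c ne)
      (sym (trans (cong (x ·ᶜ_) (·-clash j l b c ne)) (·-null x))))
    go (no ne) (yes refl) = trans (cong (_·ᶜ z) (·-clash i k a b ne))
      (sym (trans (cong (x ·ᶜ_) (·-match j' k l b c)) (·-clash i l a (b ⊙ c) ne)))
    go (no ne) (no ne') = trans (cong (_·ᶜ z) (·-clash i k a b ne))
      (sym (trans (cong (x ·ᶜ_) (·-clash j' l b c ne')) (·-null x)))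

-- The entries of a matrix relate the 2n quantities x_t and x_t + 1 (t < n).
module SizeChange (N : ℕ) (prem : Fin N → List (Fin N)) (n : ℕ)
  (stp prg : Fin N → Fin N → Fin n → Fin n → Bool)
  (good : ∀ (at : ℕ → Fin N) → (∀ k → at (suc k) ∈ prem (at k)) → Σ ℕ λ k₀ → Σ (ℕ → Fin n) λ τ →
    (∀ k → k₀ ≤ k → stp (at k) (at (suc k)) (τ k) (τ (suc k)) ≡ true) ×
    (∀ m → ∃ λ k → m ≤ k × k₀ ≤ k × prg (at k) (at (suc k)) (τ k) (τ (suc k)) ≡ true))
  where
  open Matrix (n + n) public

  weak strict : Fin n → Fin (n + n)
  weak t   = t F.↑ˡ n
  strict t = n F.↑ʳ t

  -- The entry from weak t to strict u stands for x_u + 1 ≤ x_t. Strictness is thus an ordinary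
  -- entry, and matrices compose as plain relations.
  entry : Fin N → Fin N → Fin n ⊎ Fin n → Fin n ⊎ Fin n → Bool
  entry i j (inj₁ t) (inj₁ u) = stp i j t u
  entry i j (inj₁ t) (inj₂ u) = prg i j t u
  entry i j (inj₂ t) (inj₁ u) = false
  entry i j (inj₂ t) (inj₂ u) = stp i j t u

  edgeMat : Fin N → Fin N → Mat
  edgeMat i j = mk λ a b → entry i j (F.splitAt n a) (F.splitAt n b)

  edge-ww : ∀ {i j t u} → stp i j t u ≡ true → Rel (edgeMat i j) (weak t) (weak u)
  edge-ww {i} {j} {t} {u} e = trans (mk-at _ (weak t) (weak u)) (trans (cong₂ (entry i j) (Fₚ.splitAt-↑ˡ n t n) (Fₚ.splitAt-↑ˡ n u n)) e)
  edge-ss : ∀ {i j t u} → stp i j t u ≡ true → Rel (edgeMat i j) (strict t) (strict u)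
  edge-ss {i} {j} {t} {u} e = trans (mk-at _ (strict t) (strict u)) (trans (cong₂ (entry i j) (Fₚ.splitAt-↑ʳ n n t) (Fₚ.splitAt-↑ʳ n n u)) e)
  edge-ws : ∀ {i j t u} → prg i j t u ≡ true → Rel (edgeMat i j) (weak t) (strict u)
  edge-ws {i} {j} {t} {u} e = trans (mk-at _ (weak t) (strict u)) (trans (cong₂ (entry i j) (Fₚ.splitAt-↑ˡ n t n) (Fₚ.splitAt-↑ʳ n n u)) e)

  -- Every colour of the closure other than `nothing` carries such a witness that it belongs to an
  -- actual path of the proof graph, to which the trace condition can be applied.
  data Walk : Fin N → Fin N → Mat → Set where
    edge : ∀ {i j} → j ∈ prem i → Walk i j (edgeMat i j)
    _⨟_  : ∀ {i j k A B} → Walk i j A → Walk j k B → Walk i k (A ⊙ B)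

  nodes : ∀ {i j A} → Walk i j A → List (Fin N)
  nodes (edge {i} _) = i ∷ []
  nodes (w ⨟ v)      = nodes w ++ nodes v

  len : ∀ {i j A} → Walk i j A → ℕ
  len w = length (nodes w)

  Follows : ∀ {i j A} → (ℕ → Fin N) → Walk i j A → Set
  Follows at (edge {i} {j} _) = at 0 ≡ i × at 1 ≡ j
  Follows at (w ⨟ v)          = Follows at w × Follows (λ k → at (len w + k)) v

  Follows-ext : ∀ {i j A at at'} (w : Walk i j A) → (∀ k → at k ≡ at' k) → Follows at w → Follows at' w
  Follows-ext (edge _) h (a , b) = trans (sym (h 0)) a , trans (sym (h 1)) b
  Follows-ext (w ⨟ v)  h (a , b) = Follows-ext w h a , Follows-ext v (λ k → h (len w + k)) b

  walk-steps : ∀ {i j A at} (w : Walk i j A) → Follows at w → ∀ k → k < len w → at (suc k) ∈ prem (at k)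
  walk-steps (edge m) (refl , refl) zero l = m
  walk-steps (edge m) _ (suc k) (s≤s ())
  walk-steps {at = at} (w ⨟ v) (a , b) k l with k N.<? len w
  ... | yes p = walk-steps w a k p
  ... | no np with Nₚ.m≤n⇒∃[o]m+o≡n (Nₚ.≮⇒≥ np)
  ...   | o , refl = subst (λ x → at x ∈ prem (at (len w + o))) (Nₚ.+-suc (len w) o)
                       (walk-steps v b o (Nₚ.+-cancelˡ-< (len w) _ _ (subst (len w + o <_) (Lₚ.length-++ (nodes w)) l)))

  -- Before a progress point the trace is followed along weak entries, at the point it crosses from
  -- weak to strict, and afterwards it stays strict; hence the third component.
  walk-rel : ∀ {i j A} (at : ℕ → Fin N) (τ : ℕ → Fin n) → (∀ k → stp (at k) (at (suc k)) (τ k) (τ (suc k)) ≡ true) → (w : Walk i j A) → Follows at w →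
      Rel A (weak (τ 0)) (weak (τ (len w))) × Rel A (strict (τ 0)) (strict (τ (len w)))
    × (∀ k → k < len w → prg (at k) (at (suc k)) (τ k) (τ (suc k)) ≡ true → Rel A (weak (τ 0)) (strict (τ (len w))))
  walk-rel at τ h (edge _) (refl , refl) = edge-ww (h 0) , edge-ss (h 0) , λ { zero _ p → edge-ws p ; (suc k) (s≤s ()) }
  walk-rel at τ h (_⨟_ {A = A} {B} w v) (f , g) = subst Goal (sym (Lₚ.length-++ (nodes w)))
      (⊙⁺ {A} {B} a (shift weak weak (proj₁ rec)) , ⊙⁺ {A} {B} b (shift strict strict (proj₁ (proj₂ rec))) , last)
    where
    l₁ = len w
    l₂ = len v
    Goal : ℕ → Set
    Goal l = Rel (A ⊙ B) (weak (τ 0)) (weak (τ l)) × Rel (A ⊙ B) (strict (τ 0)) (strict (τ l))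
      × (∀ k → k < l → prg (at k) (at (suc k)) (τ k) (τ (suc k)) ≡ true → Rel (A ⊙ B) (weak (τ 0)) (strict (τ l)))
    fst = walk-rel at τ h w f
    a = proj₁ fst
    b = proj₁ (proj₂ fst)
    rec = walk-rel (λ k → at (l₁ + k)) (λ k → τ (l₁ + k))
            (λ k → subst (λ x → stp (at (l₁ + k)) (at x) (τ (l₁ + k)) (τ x) ≡ true) (sym (Nₚ.+-suc l₁ k)) (h (l₁ + k))) v g
    shift : ∀ (p q : Fin n → Fin (n + n)) → Rel B (p (τ (l₁ + 0))) (q (τ (l₁ + l₂))) → Rel B (p (τ l₁)) (q (τ (l₁ + l₂)))
    shift p q = subst (λ x → Rel B (p (τ x)) (q (τ (l₁ + l₂)))) (Nₚ.+-identityʳ l₁)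
    last : ∀ k → k < l₁ + l₂ → prg (at k) (at (suc k)) (τ k) (τ (suc k)) ≡ true → Rel (A ⊙ B) (weak (τ 0)) (strict (τ (l₁ + l₂)))
    last k l p with k N.<? l₁
    ... | yes q = ⊙⁺ {A} {B} (proj₂ (proj₂ fst) k q p) (shift strict strict (proj₁ (proj₂ rec)))
    ... | no nq with Nₚ.m≤n⇒∃[o]m+o≡n (Nₚ.≮⇒≥ nq)
    ...   | o , refl = ⊙⁺ {A} {B} a (shift weak strict (proj₂ (proj₂ rec) o (Nₚ.+-cancelˡ-< l₁ _ _ l)
              (subst (λ x → prg (at (l₁ + o)) (at x) (τ (l₁ + o)) (τ x) ≡ true) (sym (Nₚ.+-suc l₁ o)) p)))

  -- `P q` is the trace object at the start of round q. Since M is idempotent, any positive number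
  -- of rounds has the matrix M again, which is the content of `absorb`.
  module Rounds {i M} (w : Walk i i M) (idem : M ⊙ M ≡ M) (L : ℕ) (len-suc : len w ≡ suc L)
    (at : ℕ → Fin N) (at-period : ∀ q k → at (k + q * suc L) ≡ at k) (follows : Follows at w) (k₀ : ℕ) (τ : ℕ → Fin n)
    (steps : ∀ k → k₀ ≤ k → stp (at k) (at (suc k)) (τ k) (τ (suc k)) ≡ true)
    (progs : ∀ m → ∃ λ k → m ≤ k × k₀ ≤ k × prg (at k) (at (suc k)) (τ k) (τ (suc k)) ≡ true) where

    P : ℕ → Fin n
    P q = τ (q * suc L)

    ≤-round : ∀ q k → k₀ ≤ q → k₀ ≤ k + q * suc L
    ≤-round q k h = Nₚ.≤-trans h (Nₚ.≤-trans (Nₚ.m≤m*n q (suc L)) (Nₚ.m≤n+m _ k))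

    round : ∀ q → k₀ ≤ q → Rel M (weak (P q)) (weak (P (suc q))) × Rel M (strict (P q)) (strict (P (suc q)))
      × (∀ k → k < suc L → prg (at (k + q * suc L)) (at (suc k + q * suc L)) (τ (k + q * suc L)) (τ (suc k + q * suc L)) ≡ true → Rel M (weak (P q)) (strict (P (suc q))))
    round q h = subst G len-suc (walk-rel (λ k → at (k + q * suc L)) (λ k → τ (k + q * suc L)) (λ k → steps _ (≤-round q k h)) w
                                   (Follows-ext w (λ k → sym (at-period q k)) follows))
      where
      G : ℕ → Set
      G l = Rel M (weak (P q)) (weak (τ (l + q * suc L))) × Rel M (strict (P q)) (strict (τ (l + q * suc L)))
        × (∀ k → k < l → prg (at (k + q * suc L)) (at (suc k + q * suc L)) (τ (k + q * suc L)) (τ (suc k + q * suc L)) ≡ true →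
             Rel M (weak (P q)) (strict (τ (l + q * suc L))))

    absorb : ∀ {a b c} → Rel M a b → Rel M b c → Rel M a c
    absorb p q = subst (λ A → Rel A _ _) idem (⊙⁺ {M} {M} p q)

    weaks : ∀ d q → k₀ ≤ q → Rel M (weak (P q)) (weak (P (suc d + q)))
    weaks zero    q h = proj₁ (round q h)
    weaks (suc d) q h = absorb (weaks d q h) (proj₁ (round (suc d + q) (Nₚ.≤-trans h (Nₚ.m≤n+m q (suc d)))))

    stricts : ∀ d q → k₀ ≤ q → Rel M (strict (P q)) (strict (P (suc d + q)))
    stricts zero    q h = proj₁ (proj₂ (round q h))
    stricts (suc d) q h = absorb (stricts d q h) (proj₁ (proj₂ (round (suc d + q) (Nₚ.≤-trans h (Nₚ.m≤n+m q (suc d))))))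

    abstract
      -- The progress point at position k lies in round k / `suc L`; the rounds from q up to that
      -- one are crossed weakly.
      next : ∀ q → k₀ ≤ q → Σ ℕ λ q' → q < q' × Rel M (weak (P q)) (strict (P q'))
      next q h with progs (q * suc L)
      ... | k , a , b , p = suc r , s≤s q≤r , go
        where
        r : ℕ
        r = k / suc L
        q≤r : q ≤ r
        q≤r = subst (_≤ r) (DM.m*n/n≡m q (suc L)) (DM./-monoˡ-≤ (suc L) a)
        now : Rel M (weak (P r)) (strict (P (suc r)))
        now = proj₂ (proj₂ (round r (Nₚ.≤-trans h q≤r))) (k % suc L) (DM.m%n<n k (suc L))
                (subst (λ x → prg (at x) (at (suc x)) (τ x) (τ (suc x)) ≡ true) (DM.m≡m%n+[m/n]*n k (suc L)) p)
        go : Rel M (weak (P q)) (strict (P (suc r)))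
        go with q N.≟ r
        ... | yes refl = now
        ... | no ne with Nₚ.m≤n⇒∃[o]m+o≡n (Nₚ.≤∧≢⇒< q≤r ne)
        ...   | o , e = absorb (subst (λ x → Rel M (weak (P q)) (weak (P x))) (trans (cong suc (Nₚ.+-comm o q)) e) (weaks o q h)) now

    -- Round numbers chosen so that consecutive ones are separated by a progress point.
    bs : ℕ → Σ ℕ λ q → k₀ ≤ q
    bs zero    = k₀ , Nₚ.≤-refl
    bs (suc k) = let q , h = bs k ; q' , l , _ = next q h in q' , Nₚ.≤-trans h (Nₚ.<⇒≤ l)

    chain : ∀ d k → Rel M (weak (P (proj₁ (bs k)))) (strict (P (proj₁ (bs (suc d + k))))) × proj₁ (bs k) < proj₁ (bs (suc d + k))
    chain zero    k = let _ , l , r = next (proj₁ (bs k)) (proj₂ (bs k)) in r , l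
    chain (suc d) k with chain d k | next (proj₁ (bs (suc d + k))) (proj₂ (bs (suc d + k)))
    ... | r , l | q' , l' , _ with Nₚ.m≤n⇒∃[o]m+o≡n l'
    ...   | o , e = absorb r (subst (λ x → Rel M (strict (P (proj₁ (bs (suc d + k))))) (strict (P x))) (trans (cong suc (Nₚ.+-comm o _)) e)
                       (stricts o _ (proj₂ (bs (suc d + k))))) , Nₚ.<-trans l l'

    -- By the pigeonhole principle two of n + 1 selected rounds start with the same object t; the
    -- strict relation between these rounds is then an entry of M at t itself.
    strictLoop : Σ (Fin n) λ t → Rel M (weak t) (strict t)
    strictLoop with Fₚ.pigeonhole (Nₚ.n<1+n n) (λ k → P (proj₁ (bs (F.toℕ k))))
    ... | a , b , a<b , e with Nₚ.m≤n⇒∃[o]m+o≡n a<b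
    ...   | o , e' = P (proj₁ (bs (F.toℕ a))) , subst (λ t → Rel M (weak (P (proj₁ (bs (F.toℕ a))))) (strict t)) (sym e)
              (subst (λ k → Rel M (weak (P (proj₁ (bs (F.toℕ a))))) (strict (P (proj₁ (bs k))))) (trans (cong suc (Nₚ.+-comm o _)) e') (proj₁ (chain o (F.toℕ a))))

  module Periodic {i M} (w : Walk i i M) (idem : M ⊙ M ≡ M) where
    -- The nodes of w repeated forever. `restart` reads a node at once, so that a return to the
    -- start of w consumes an index and the mutual recursion terminates.
    cyc : List (Fin N) → ℕ → Fin N
    restart : List (Fin N) → ℕ → Fin N
    cyc (x ∷ xs) zero    = x
    cyc (x ∷ xs) (suc k) = cyc xs k
    cyc []       k       = restart (nodes w) k
    restart [] _             = i
    restart (x ∷ xs) zero    = x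
    restart (x ∷ xs) (suc k) = cyc xs k

    cyc-++ : ∀ xs ys k → cyc (xs ++ ys) (length xs + k) ≡ cyc ys k
    cyc-++ []       ys k = refl
    cyc-++ (x ∷ xs) ys k = cyc-++ xs ys k

    cyc-[] : ∀ k → cyc [] k ≡ cyc (nodes w) k
    cyc-[] k = go (nodes w) (nonempty w) k
      where
      nonempty : ∀ {i j A} (w : Walk i j A) → 0 < length (nodes w)
      nonempty (edge _) = s≤s z≤n
      nonempty (w ⨟ v)  = Nₚ.≤-trans (nonempty w) (Nₚ.≤-trans (Nₚ.m≤m+n _ _) (Nₚ.≤-reflexive (sym (Lₚ.length-++ (nodes w)))))
      go : ∀ xs → 0 < length xs → ∀ k → restart xs k ≡ cyc xs k
      go (x ∷ xs) _ zero    = refl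
      go (x ∷ xs) _ (suc k) = refl

    cyc-head : ∀ {i j A} (v : Walk i j A) ys → cyc (nodes v ++ ys) 0 ≡ i
    cyc-head (edge _) ys = refl
    cyc-head (v ⨟ u) ys  = trans (cong (λ l → cyc l 0) (Lₚ.++-assoc (nodes v) (nodes u) ys)) (cyc-head v (nodes u ++ ys))

    cyc-follows : ∀ {i j A} (v : Walk i j A) ys → cyc ys 0 ≡ j → Follows (cyc (nodes v ++ ys)) v
    cyc-follows (edge _) ys e = refl , e
    cyc-follows (v ⨟ u) ys e rewrite Lₚ.++-assoc (nodes v) (nodes u) ys =
      cyc-follows v (nodes u ++ ys) (cyc-head u ys) ,
      Follows-ext u (λ k → sym (cyc-++ (nodes v) (nodes u ++ ys) k)) (cyc-follows u ys e)

    at : ℕ → Fin N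
    at = cyc (nodes w)

    L : ℕ
    L = N.pred (len w)

    len-suc : len w ≡ suc L
    len-suc = go w
      where
      go : ∀ {i j A} (w : Walk i j A) → len w ≡ suc (N.pred (len w))
      go (edge _) = refl
      go (w ⨟ v) rewrite Lₚ.length-++ (nodes w) {nodes v} | go w = refl

    at-period : ∀ q k → at (k + q * suc L) ≡ at k
    at-period zero    k = cong at (Nₚ.+-identityʳ k)
    at-period (suc q) k = trans (cong at (trans (cong (k +_) (cong (_+ q * suc L) (sym len-suc))) (trans (sym (Nₚ.+-assoc k (len w) (q * suc L)))
        (trans (cong (_+ q * suc L) (Nₚ.+-comm k (len w))) (Nₚ.+-assoc (len w) k (q * suc L))))))
      (trans (trans (cong (λ l → cyc l (len w + (k + q * suc L))) (sym (Lₚ.++-identityʳ (nodes w))))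
        (trans (cyc-++ (nodes w) [] (k + q * suc L)) (cyc-[] (k + q * suc L)))) (at-period q k))

    follows : Follows at w
    follows = subst (λ l → Follows (cyc l) w) (Lₚ.++-identityʳ (nodes w))
      (cyc-follows w [] (trans (cyc-[] 0) (trans (cong (λ l → cyc l 0) (sym (Lₚ.++-identityʳ (nodes w)))) (cyc-head w []))))

    step : ∀ k → at (suc k) ∈ prem (at k)
    step k = subst₂ (λ x y → x ∈ prem y)
      (trans (sym (at-period (k / suc L) (suc (k % suc L)))) (cong (at ∘ suc) (sym (DM.m≡m%n+[m/n]*n k (suc L)))))
      (trans (sym (at-period (k / suc L) (k % suc L))) (cong at (sym (DM.m≡m%n+[m/n]*n k (suc L)))))
      (walk-steps w follows (k % suc L) (subst (k % suc L <_) (sym len-suc) (DM.m%n<n k (suc L))))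

    strictLoop : Σ (Fin n) λ t → Rel M (weak t) (strict t)
    strictLoop = let k₀ , τ , steps , progs = good at step
                 in Rounds.strictLoop w idem L len-suc at at-period follows k₀ τ steps progs

  open Typed N (Vₚ.≡-dec (Vₚ.≡-dec Data.Bool._≟_)) _⊙_ ⊙-assoc public

  Gen : Colour → Set
  Gen nothing            = ⊤
  Gen (just (i , j , A)) = Walk i j A

  Gen-mul : ∀ {a b} → Gen a → Gen b → Gen (a ·ᶜ b)
  Gen-mul {nothing} {b} _ _ = tt
  Gen-mul {just _} {nothing} _ _ = tt
  Gen-mul {just (i , j , A)} {just (j' , k , B)} w v = go (j F.≟ j') v
    where
    go : Dec (j ≡ j') → Walk j' k B → Gen (just (i , j , A) ·ᶜ just (j' , k , B))
    go (yes refl) v = subst Gen (sym (·-match i j k A B)) (w ⨟ v)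
    go (no ne)    _ = subst Gen (sym (·-clash i k A B ne)) tt

  edges : List Colour
  edges = concatMap (λ i → map (λ j → just (i , j , edgeMat i j)) (prem i)) (allFin N)

  ∈-edges : ∀ {i j} → j ∈ prem i → just (i , j , edgeMat i j) ∈ edges
  ∈-edges {i} m = ∈ₚ.∈-concatMap⁺ (λ i → map (λ j → just (i , j , edgeMat i j)) (prem i))
    (Any.map (λ { refl → ∈ₚ.∈-map⁺ _ m }) (∈ₚ.∈-allFin i))

  edges-gen : All Gen edges
  edges-gen = All.tabulate λ {c} m →
    let i , _ , m' = find (∈ₚ.∈-concatMap⁻ (λ i → map (λ j → just (i , j , edgeMat i j)) (prem i)) {xs = allFin N} m)
        j , p , e = ∈ₚ.∈-map⁻ (λ j → just (i , j , edgeMat i j)) m'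
    in subst Gen (sym e) (edge p)

  colours : List Colour
  colours = nothing ∷ map just (cartesianProduct (allFin N) (cartesianProduct (allFin N)
              (allVec (allVec (true ∷ false ∷ []) (n + n)) (n + n))))

  ∈-colours : ∀ c → c ∈ colours
  ∈-colours nothing            = here refl
  ∈-colours (just (i , j , A)) = there (∈ₚ.∈-map⁺ just (∈ₚ.∈-cartesianProduct⁺ (∈ₚ.∈-allFin i) (∈ₚ.∈-cartesianProduct⁺ (∈ₚ.∈-allFin j)
    (∈-allVec (λ v → ∈-allVec (λ { true → here refl ; false → there (here refl) }) v) A))))

  closure : Σ (List Colour) λ X → edges ⊆ X × All Gen X × (∀ {a b} → a ∈ X → b ∈ X → a ·ᶜ b ∈ X)
  closure = Saturate.saturate _≟ᶜ_ _·ᶜ_ colours ∈-colours Gen (λ {a} → Gen-mul {a}) edges edges-gen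

  -- The two ends must coincide, since otherwise the square is `nothing`; so the walk is closed and
  -- can be repeated.
  idempotent-strict : ∀ {i j A} → Walk i j A → just (i , j , A) ·ᶜ just (i , j , A) ≡ just (i , j , A) → Σ (Fin n) λ t → Rel A (weak t) (strict t)
  idempotent-strict {i} {j} {A} w e = go (j F.≟ i) w e
    where
    go : ∀ {j} → Dec (j ≡ i) → Walk i j A → just (i , j , A) ·ᶜ just (i , j , A) ≡ just (i , j , A) → Σ (Fin n) λ t → Rel A (weak t) (strict t)
    go (yes refl) w e = Periodic.strictLoop w (×ₚ.,-injectiveʳ (×ₚ.,-injectiveʳ (Mₚ.just-injective (trans (sym (·-match i i i A A)) e))))
    go (no ne)    w e = case trans (sym (·-clash i _ A A ne)) e of λ ()

-- Soundness of size-change graphs in a theory with induction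

num : ℕ → Tm
num zero    = `0
num (suc k) = `s (num k)

num-sub : ∀ {σ} k → tsub σ (num k) ≡ num k
num-sub zero    = refl
num-sub (suc k) = cong `s (num-sub k)

⋀ : List Fm → Fm
⋀ = foldr _`∧_ (`0 ≐ `0)

module Conj (T : Theory) where
  open Theory T
  ⋀I : ∀ {Γ} {A : Set} (f : A → Fm) xs → (∀ {x} → x ∈ xs → Γ ⊢ f x) → Γ ⊢ ⋀ (map f xs)
  ⋀I f []       h = ≐R `0
  ⋀I f (x ∷ xs) h = ∧I (h (here refl)) (⋀I f xs (h ∘ there))
  ⋀E : ∀ {Γ} {A : Set} (f : A → Fm) {xs x} → Γ ⊢ ⋀ (map f xs) → x ∈ xs → Γ ⊢ f x
  ⋀E f d (here refl) = ∧E₁ d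
  ⋀E f d (there m)   = ⋀E f (∧E₂ d) m

⋀-sub : ∀ {σ} {A : Set} {f g : A → Fm} xs → (∀ x → fsub σ (f x) ≡ g x) → fsub σ (⋀ (map f xs)) ≡ ⋀ (map g xs)
⋀-sub []       h = refl
⋀-sub (x ∷ xs) h = cong₂ _`∧_ (h x) (⋀-sub xs h)

module Descending (T : Theory) (N : ℕ) (prem : Fin N → List (Fin N)) (n : ℕ)
  (stp prg : Fin N → Fin N → Fin n → Fin n → Bool)
  (good : ∀ (at : ℕ → Fin N) → (∀ k → at (suc k) ∈ prem (at k)) → Σ ℕ λ k₀ → Σ (ℕ → Fin n) λ τ →
    (∀ k → k₀ ≤ k → stp (at k) (at (suc k)) (τ k) (τ (suc k)) ≡ true) ×
    (∀ m → ∃ λ k → m ≤ k × k₀ ≤ k × prg (at k) (at (suc k)) (τ k) (τ (suc k)) ≡ true))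
  (A : Fin N → Fm)
  (local : ∀ i {Γ} (xs : Vec Tm n) →
    (∀ j → j ∈ prem i → ∀ {Δ} → Γ ⊆ Δ → ∀ (zs : Vec Tm n) →
      (∀ t u → stp i j t u ≡ true → Theory._⊢_ T Δ (le (V.lookup zs u) (V.lookup xs t))) →
      (∀ t u → prg i j t u ≡ true → Theory._⊢_ T Δ (lt (V.lookup zs u) (V.lookup xs t))) →
      Theory._⊢_ T Δ (fsub (zs ⊕ var) (A j))) →
    Theory._⊢_ T Γ (fsub (xs ⊕ var) (A i)))
  where
  open SizeChange N prem n stp prg good
  open Arith T
  open Conj T

  quantity : Vec Tm n → Fin n ⊎ Fin n → Tm
  quantity xs (inj₁ t) = V.lookup xs t
  quantity xs (inj₂ t) = `s (V.lookup xs t)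

  μ : Vec Tm n → Fin (n + n) → Tm
  μ xs a = quantity xs (F.splitAt n a)

  μ-sub : ∀ σ xs a → tsub σ (μ xs a) ≡ μ (V.map (tsub σ) xs) a
  μ-sub σ xs a = go (F.splitAt n a)
    where
    go : ∀ p → tsub σ (quantity xs p) ≡ quantity (V.map (tsub σ) xs) p
    go (inj₁ t) = sym (Vₚ.lookup-map t _ xs)
    go (inj₂ t) = cong `s (sym (Vₚ.lookup-map t _ xs))

  Pair : Set
  Pair = Fin (n + n) × Fin (n + n)
  rel? : ∀ M (p : Pair) → Dec (Rel M (proj₁ p) (proj₂ p))
  rel? M (a , b) = V.lookup (V.lookup M a) b Data.Bool.≟ true
  pairs : List Pair
  pairs = cartesianProduct (allFin (n + n)) (allFin (n + n))

  below : Vec Tm n → Vec Tm n → Pair → Fm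
  below xs ys (a , b) = le (μ ys b) (μ xs a)

  -- The first coordinate holds the number of the node. This lets a single formula speak about all
  -- nodes, and it makes relations of mismatching colours contradictory when they are composed.
  R : Colour → Vec Tm (suc n) → Vec Tm (suc n) → Fm
  R nothing            _        _        = ⊥'
  R (just (i , j , M)) (x ∷ xs) (y ∷ ys) =
    (x ≐ num (F.toℕ i)) `∧ (y ≐ num (F.toℕ j)) `∧ ⋀ (map (below xs ys) (filter (rel? M) pairs))

  R-sub : ∀ σ c x y → fsub σ (R c x y) ≡ R c (V.map (tsub σ) x) (V.map (tsub σ) y)
  R-sub σ nothing x y = refl
  R-sub σ (just (i , j , M)) (x ∷ xs) (y ∷ ys) = cong₂ _`∧_ (cong (tsub σ x ≐_) (num-sub (F.toℕ i)))
    (cong₂ _`∧_ (cong (tsub σ y ≐_) (num-sub (F.toℕ j)))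
      (⋀-sub (filter (rel? M) pairs) λ { (a , b) → trans (le-sub (μ ys b) (μ xs a)) (cong₂ le (μ-sub σ ys b) (μ-sub σ xs a)) }))

  Rel-le : ∀ {Γ i j} M {x xs y ys a b} → Γ ⊢ R (just (i , j , M)) (x ∷ xs) (y ∷ ys) → Rel M a b → Γ ⊢ le (μ ys b) (μ xs a)
  Rel-le M {xs = xs} {ys = ys} {a} {b} d r = ⋀E (below xs ys) (∧E₂ (∧E₂ d))
    (∈ₚ.∈-filter⁺ (rel? M) (∈ₚ.∈-cartesianProduct⁺ (∈ₚ.∈-allFin a) (∈ₚ.∈-allFin b)) r)

  le-Rel : ∀ {Γ} M xs ys → (∀ a b → Rel M a b → Γ ⊢ le (μ ys b) (μ xs a)) → Γ ⊢ ⋀ (map (below xs ys) (filter (rel? M) pairs))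
  le-Rel M xs ys h = ⋀I (below xs ys) _ λ { {a , b} m → h a b (proj₂ (∈ₚ.∈-filter⁻ (rel? M) {xs = pairs} m)) }

  num-distinct : ∀ {Γ ψ} i j → i ≢ j → Γ ⊢ num i ≐ num j → Γ ⊢ ψ
  num-distinct zero    zero    ne d = contradiction refl ne
  num-distinct zero    (suc j) ne d = botE (s0 (d ⁻¹))
  num-distinct (suc i) zero    ne d = botE (s0 d)
  num-distinct (suc i) (suc j) ne d = num-distinct i j (ne ∘ cong suc) (inj d)

  R-comp : ∀ {Γ} c d (x y z : Vec Tm (suc n)) → Γ ⊢ R c x y → Γ ⊢ R d y z → Γ ⊢ R (c ·ᶜ d) x z
  R-comp nothing d x y z p q = p
  R-comp (just _) nothing x y z p q = q
  R-comp {Γ} (just (i , j , M)) (just (k , l , M')) (x ∷ xs) (y ∷ ys) (z ∷ zs) p q = go (j F.≟ k) p q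
    where
    go : ∀ {k} → Dec (j ≡ k) → Γ ⊢ R (just (i , j , M)) (x ∷ xs) (y ∷ ys) → Γ ⊢ R (just (k , l , M')) (y ∷ ys) (z ∷ zs) →
         Γ ⊢ R (just (i , j , M) ·ᶜ just (k , l , M')) (x ∷ xs) (z ∷ zs)
    go (yes refl) p q = cast (cong (λ c → R c (x ∷ xs) (z ∷ zs)) (sym (·-match i j l M M')))
      (∧I (∧E₁ p) (∧I (∧E₁ (∧E₂ q)) (le-Rel (M ⊙ M') xs zs λ a c r →
        let b , s , t = ⊙⁻ {M} {M'} r in le-trans (μ zs c) (μ ys b) (μ xs a) (Rel-le M' q t) (Rel-le M p s))))
    go {k} (no ne) p q = num-distinct (F.toℕ j) (F.toℕ k) (ne ∘ Fₚ.toℕ-injective) ((∧E₁ (∧E₂ p) ⁻¹) ∙ ∧E₁ q)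

  open WF T (suc n) Colour _≟ᶜ_ _·ᶜ_ ·-assoc R R-sub R-comp

  private
    X = proj₁ closure

  descent : ∀ {e} → e ∈ X → e ·ᶜ e ≡ e → Descent e
  descent {nothing} m _ = F.zero , λ x y d → botE d
  descent {just (i , j , M)} m idem =
    let t , r = idempotent-strict (All.lookup (proj₁ (proj₂ (proj₂ closure))) m) idem
    in F.suc t , λ { (x ∷ xs) (y ∷ ys) d → cast (cong₂ le (cong (quantity ys) (Fₚ.splitAt-↑ʳ n n t)) (cong (quantity xs) (Fₚ.splitAt-↑ˡ n t n))) (Rel-le M d r) }

  at-node : Fin N → Fm
  at-node i = (var 0 ≐ num (F.toℕ i)) `→ fsub (up 1) (A i)

  All-nodes : Fm
  All-nodes = ⋀ (map at-node (allFin N))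

  all-eval : ∀ x (xs : Vec Tm n) → fsub ((x ∷ xs) ⊕ var) All-nodes
           ≡ ⋀ (map (λ i → (x ≐ num (F.toℕ i)) `→ fsub (xs ⊕ var) (A i)) (allFin N))
  all-eval x xs = ⋀-sub (allFin N) λ i → cong₂ _`→_ (cong (x ≐_) (num-sub (F.toℕ i))) (fsub-fuse (A i))

  progressive : ∀ {Γ} → Progressive X Γ All-nodes var
  progressive w (y ∷ ys) ih = cast (sym (all-eval y ys)) (⋀I _ (allFin N) λ {i} _ → →I (local i ys λ j m {Δ} w' zs hs hp →
    →E (⋀E (λ k → (num (F.toℕ j) ≐ num (F.toℕ k)) `→ fsub (zs ⊕ var) (A k)) {x = j} (cast (all-eval (num (F.toℕ j)) zs)
      (□E (just (i , j , edgeMat i j)) All-nodes (y ∷ ys) var (wkN (w' ∘ there) (ih (proj₁ (proj₂ closure) (∈-edges m)))) (num (F.toℕ j) ∷ zs)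
        (∧I (hyp (w' (here refl))) (∧I (≐R _) (le-Rel (edgeMat i j) ys zs λ a b r →
          edge-le {j = j} ys zs hs hp (F.splitAt n a) (F.splitAt n b) (trans (sym (mk-at _ a b)) r)))))) (∈ₚ.∈-allFin j)) (≐R _)))
    where
    module _ {i j Δ} (ys zs : Vec Tm n)
      (hs : ∀ t u → stp i j t u ≡ true → Δ ⊢ le (V.lookup zs u) (V.lookup ys t))
      (hp : ∀ t u → prg i j t u ≡ true → Δ ⊢ lt (V.lookup zs u) (V.lookup ys t)) where
      edge-le : ∀ a b → entry i j a b ≡ true → Δ ⊢ le (quantity zs b) (quantity ys a)
      edge-le (inj₁ t) (inj₁ u) e = hs t u e
      edge-le (inj₁ t) (inj₂ u) e = hp t u e
      edge-le (inj₂ t) (inj₂ u) e = le-s (V.lookup zs u) (V.lookup ys t) (hs t u e)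

  holds : ∀ i {Γ} (xs : Vec Tm n) → Γ ⊢ fsub (xs ⊕ var) (A i)
  holds i xs = →E (⋀E (λ j → (num (F.toℕ i) ≐ num (F.toℕ j)) `→ fsub (xs ⊕ var) (A j)) (cast (all-eval (num (F.toℕ i)) xs)
    (W-closed (suc (length X)) X Nₚ.≤-refl (λ {a} {b} → proj₂ (proj₂ (proj₂ closure)) {a} {b}) descent All-nodes var progressive
      (num (F.toℕ i) ∷ xs))) (∈ₚ.∈-allFin i)) (≐R _)

-- Interpretations of the sequent calculus in a theory

-- Values form a relation because a product has no term in the RTC language. `sub→` and `sub←` ask
-- for values at occurring variables only: an assignment changed at an eigenvariable agrees with the
-- old one nowhere else than there is need for.
record Interp (T : Theory) : Set₁ where
  open Theory T
  field
    tr   : Fm → Fm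
    tr-¬ : ∀ φ → tr (`¬ φ) ≡ `¬ (tr φ)
    tr-∧ : ∀ φ ψ → tr (φ `∧ ψ) ≡ tr φ `∧ tr ψ
    tr-∨ : ∀ φ ψ → tr (φ `∨ ψ) ≡ tr φ `∨ tr ψ
    tr-→ : ∀ φ ψ → tr (φ `→ ψ) ≡ (tr φ `→ tr ψ)
    tr-∀ : ∀ φ → tr (`∀ φ) ≡ `∀ (tr φ)
    tr-∃ : ∀ φ → tr (`∃ φ) ≡ `∃ (tr φ)
    -- Val Γ t η v: under the hypotheses Γ and the assignment η, the term t has value v
    Val     : List Fm → Tm → Subst → Tm → Set
    Val-wk  : ∀ {Γ Δ t η v} → Γ ⊆ Δ → Val Γ t η v → Val Δ t η v
    Val-var : ∀ {Γ} n η → Val Γ (var n) η (η n)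
    Val-ex  : ∀ {Γ ψ} t η → (∀ v {Δ} → Γ ⊆ Δ → Val Δ t η v → Δ ⊢ ψ) → Γ ⊢ ψ
    sub→    : ∀ {Γ σ η η'} φ → (∀ n → occF n φ ≡ true → Val Γ (σ n) η (η' n)) → Γ ⊢ fsub η (tr (fsub σ φ)) → Γ ⊢ fsub η' (tr φ)
    sub←    : ∀ {Γ σ η η'} φ → (∀ n → occF n φ ≡ true → Val Γ (σ n) η (η' n)) → Γ ⊢ fsub η' (tr φ) → Γ ⊢ fsub η (tr (fsub σ φ))
    eq→     : ∀ {Γ s t η v w} → Val Γ s η v → Val Γ t η w → Γ ⊢ fsub η (tr (s ≐ t)) → Γ ⊢ v ≐ w
    eq←     : ∀ {Γ s t η v w} → Val Γ s η v → Val Γ t η w → Γ ⊢ v ≐ w → Γ ⊢ fsub η (tr (s ≐ t))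

Agree : Seq → Subst → Subst → Set
Agree S η η' = ∀ n → FreeIn n S → η n ≡ η' n

agree-upd : ∀ {z S η v} → Fresh z S → Agree S η (η [ z ↦ v ])
agree-upd {z} {S} {η} {v} f n o = sym (upd-other η {z} v λ { refl → false≢true f o })

free-ant : ∀ {n φ} S → φ ∈ ant S → occF n φ ≡ true → FreeIn n S
free-ant (Γ ⇒ Δ) m o = any-intro _ (∈ₚ.∈-++⁺ˡ m) o

free-sc : ∀ {n φ} S → φ ∈ sc S → occF n φ ≡ true → FreeIn n S
free-sc (Γ ⇒ Δ) m o = any-intro _ (∈ₚ.∈-++⁺ʳ Γ m) o

module LKSound (T : Theory) (In : Interp T) where
  open Interp In
  open Arith T

  sat : Subst → Fm → Fm
  sat η φ = fsub η (tr φ)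

  Ants Negs : List Fm → List Fm → Subst → Set
  Ants Δ Φ η = ∀ {φ} → φ ∈ Φ → Δ ⊢ sat η φ
  Negs Δ Φ η = ∀ {φ} → φ ∈ Φ → Δ ⊢ `¬ (sat η φ)

  -- Refutation form: with the negated succedent among the hypotheses, several succedent formulas
  -- require no disjunction.
  True : List Fm → Seq → Subst → Set
  True Γ S η = ∀ {Δ} → Γ ⊆ Δ → Ants Δ (ant S) η → Negs Δ (sc S) η → Δ ⊢ ⊥'

  infixr 5 _▸_ _▸ⁿ_
  _▸_ : ∀ {Δ Φ η φ} → Δ ⊢ sat η φ → Ants Δ Φ η → Ants Δ (φ ∷ Φ) η
  (d ▸ a) (here refl) = d
  (d ▸ a) (there m)   = a m
  _▸ⁿ_ : ∀ {Δ Φ η φ} → Δ ⊢ `¬ (sat η φ) → Negs Δ Φ η → Negs Δ (φ ∷ Φ) η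
  (d ▸ⁿ a) (here refl) = d
  (d ▸ⁿ a) (there m)   = a m

  sat-agree : ∀ {Γ η η'} φ → (∀ n → occF n φ ≡ true → η n ≡ η' n) → Γ ⊢ sat η φ → Γ ⊢ sat η' φ
  sat-agree {Γ} {η} {η'} φ h d = sub→ {σ = var} φ (λ n o → subst (Val Γ (var n) η) (h n o) (Val-var n η)) (cast (cong (sat η) (sym (fsub-id φ))) d)

  inst→ : ∀ {Γ η t v} φ → Val Γ t η v → Γ ⊢ sat η (inst1 φ t) → Γ ⊢ fsub (v ∷ˢ η) (tr φ)
  inst→ {Γ} {η} {t} φ x d = sub→ φ (λ { zero _ → x ; (suc n) _ → Val-var n η }) (cast (cong (sat η) (inst1-cons φ t)) d)
  inst← : ∀ {Γ η t v} φ → Val Γ t η v → Γ ⊢ fsub (v ∷ˢ η) (tr φ) → Γ ⊢ sat η (inst1 φ t)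
  inst← {Γ} {η} {t} φ x d = cast (cong (sat η) (sym (inst1-cons φ t))) (sub← φ (λ { zero _ → x ; (suc n) _ → Val-var n η }) d)

  module Eigen {S : Seq} {z : ℕ} (f : Fresh z S) (η : Subst) (v : Tm) where
    η' : Subst
    η' = η [ z ↦ v ]
    val-z : ∀ {Γ} → Val Γ (var z) η' v
    val-z {Γ} = subst (Val Γ (var z) η') (upd-same η z v) (Val-var z η')
    val-n : ∀ {Γ} n → FreeIn n S → Val Γ (var n) η' (η n)
    val-n {Γ} n o = subst (Val Γ (var n) η') (sym (agree-upd {S = S} f n o)) (Val-var n η')
    keep : ∀ {Γ} φ → (∀ n → occF n φ ≡ true → FreeIn n S) → Γ ⊢ sat η φ → Γ ⊢ sat η' φ
    keep φ h = sat-agree φ λ n o → agree-upd {S = S} f n (h n o)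
    eig→ : ∀ {Γ} φ → (∀ n → occF (suc n) φ ≡ true → FreeIn n S) → Γ ⊢ sat η' (inst1 φ (var z)) → Γ ⊢ fsub (v ∷ˢ η) (tr φ)
    eig→ φ h d = sub→ φ (λ { zero _ → val-z ; (suc n) o → val-n n (h n o) }) (cast (cong (sat η') (inst1-cons φ (var z))) d)
    eig← : ∀ {Γ} φ → (∀ n → occF (suc n) φ ≡ true → FreeIn n S) → Γ ⊢ fsub (v ∷ˢ η) (tr φ) → Γ ⊢ sat η' (inst1 φ (var z))
    eig← φ h d = cast (cong (sat η') (sym (inst1-cons φ (var z)))) (sub← φ (λ { zero _ → val-z ; (suc n) o → val-n n (h n o) }) d)
    keep¬ : ∀ {Γ} φ → (∀ n → occF n φ ≡ true → FreeIn n S) → Γ ⊢ `¬ (sat η φ) → Γ ⊢ `¬ (sat η' φ)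
    keep¬ φ h d = ¬I (¬E (d ↑) (sat-agree φ (λ n o → sym (agree-upd {S = S} f n (h n o))) h0))

  -- Only ∀R and ∃L change the assignment, and they do so at a variable not free in the conclusion.
  -- The condition `Agree` passes this on, so that quantities of trace objects in the conclusion can
  -- be kept.
  lkSound : ∀ {S Ps} → LK S Ps → ∀ {Γ η} →
    (∀ S' → S' ∈ Ps → ∀ {Δ} → Γ ⊆ Δ → ∀ η' → Agree S η η' → True Δ S' η') → True Γ S η
  lkSound ax p w a b = ¬E (b (here refl)) (a (here refl))
  lkSound (wk s s') p w a b = p _ (here refl) id _ (λ _ _ → refl) w (a ∘ s) (b ∘ s')
  lkSound {`¬ φ ∷ _ ⇒ _} ¬L p w a b = p _ (here refl) id _ (λ _ _ → refl) w (a ∘ there) (cast (cong (fsub _) (tr-¬ φ)) (a (here refl)) ▸ⁿ b)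
  lkSound {_ ⇒ `¬ φ ∷ _} ¬R p w a b = ¬E (b (here refl)) (cast (cong (fsub _) (sym (tr-¬ φ)))
    (¬I (p _ (here refl) id _ (λ _ _ → refl) (there ∘ w) (h0 ▸ λ m → a m ↑) (λ m → b (there m) ↑))))
  lkSound {φ `∧ ψ ∷ _ ⇒ _} ∧L p w a b = let d = cast (cong (fsub _) (tr-∧ φ ψ)) (a (here refl)) in
    p _ (here refl) id _ (λ _ _ → refl) w (∧E₁ d ▸ ∧E₂ d ▸ a ∘ there) b
  lkSound {_ ⇒ φ `∧ ψ ∷ _} ∧R p w a b = ¬E (b (here refl)) (cast (cong (fsub _) (sym (tr-∧ φ ψ)))
    (∧I (raa (p _ (here refl) id _ (λ _ _ → refl) (there ∘ w) (λ m → a m ↑) (h0 ▸ⁿ λ m → b (there m) ↑)))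
        (raa (p _ (there (here refl)) id _ (λ _ _ → refl) (there ∘ w) (λ m → a m ↑) (h0 ▸ⁿ λ m → b (there m) ↑)))))
  lkSound {φ `∨ ψ ∷ _ ⇒ _} ∨L p w a b = ∨E (cast (cong (fsub _) (tr-∨ φ ψ)) (a (here refl)))
    (p _ (here refl) id _ (λ _ _ → refl) (there ∘ w) (h0 ▸ λ m → a (there m) ↑) (λ m → b m ↑))
    (p _ (there (here refl)) id _ (λ _ _ → refl) (there ∘ w) (h0 ▸ λ m → a (there m) ↑) (λ m → b m ↑))
  lkSound {_ ⇒ φ `∨ ψ ∷ _} ∨R p w a b = p _ (here refl) id _ (λ _ _ → refl) w a
    (¬I (¬E (b (here refl) ↑) (cast (cong (fsub _) (sym (tr-∨ φ ψ))) (∨I₁ h0))) ▸ⁿ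
     ¬I (¬E (b (here refl) ↑) (cast (cong (fsub _) (sym (tr-∨ φ ψ))) (∨I₂ h0))) ▸ⁿ b ∘ there)
  lkSound {φ `→ ψ ∷ _ ⇒ _} →L p w a b =
    cutN (→E (cast (cong (fsub _) (tr-→ φ ψ)) (a (here refl)))
             (raa (p _ (here refl) id _ (λ _ _ → refl) (there ∘ w) (λ m → a (there m) ↑) (h0 ▸ⁿ λ m → b m ↑))))
         (p _ (there (here refl)) id _ (λ _ _ → refl) (there ∘ w) (h0 ▸ λ m → a (there m) ↑) (λ m → b m ↑))
  lkSound {_ ⇒ φ `→ ψ ∷ _} →R p w a b = ¬E (b (here refl)) (cast (cong (fsub _) (sym (tr-→ φ ψ)))
    (→I (raa (p _ (here refl) id _ (λ _ _ → refl) (there ∘ there ∘ w) (h1 ▸ λ m → a m ↑²) (h0 ▸ⁿ λ m → b (there m) ↑²)))))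
  lkSound {`∀ φ ∷ _ ⇒ _} (∀L t) {η = η} p w a b = Val-ex t η λ v w' x →
    p _ (here refl) id _ (λ _ _ → refl) (w' ∘ w)
      (inst← φ x (∀E (tr φ) η (cast (cong (fsub η) (tr-∀ φ)) (wkN w' (a (here refl)))) v) ▸ λ m → wkN w' (a (there m)))
      (λ m → wkN w' (b m))
  lkSound {S@(Φ ⇒ `∀ φ ∷ Ψ)} (∀R z f) {η = η} p w a b = ¬E (b (here refl)) (cast (cong (fsub η) (sym (tr-∀ φ)))
    (∀I (tr φ) η λ v → let module E = Eigen {S} f η v in
      raa (p _ (here refl) id E.η' (agree-upd {S = S} f) (there ∘ w)
        (λ {χ} m → E.keep χ (λ n → free-ant S m) (a m ↑))
        (¬I (¬E h1 (E.eig→ φ (λ n o → free-sc S (here refl) o) h0)) ▸ⁿ λ {χ} m → E.keep¬ χ (λ n → free-sc S (there m)) (b (there m) ↑)))))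
  lkSound {S@(`∃ φ ∷ Φ ⇒ Ψ)} (∃L z f) {η = η} p w a b =
    ∃E (tr φ) η (cast (cong (fsub η) (tr-∃ φ)) (a (here refl))) λ v → let module E = Eigen {S} f η v in
      p _ (here refl) id E.η' (agree-upd {S = S} f) (there ∘ w)
        (E.eig← φ (λ n o → free-ant S (here refl) o) h0 ▸ λ {χ} m → E.keep χ (λ n → free-ant S (there m)) (a (there m) ↑))
        (λ {χ} m → E.keep¬ χ (λ n → free-sc S m) (b m ↑))
  lkSound {_ ⇒ `∃ φ ∷ _} (∃R t) {η = η} p w a b = Val-ex t η λ v w' x →
    p _ (here refl) id _ (λ _ _ → refl) (w' ∘ w) (λ m → wkN w' (a m))
      (¬I (¬E (wkN w' (b (here refl)) ↑) (cast (cong (fsub η) (sym (tr-∃ φ))) (∃I (tr φ) η v (inst→ φ (Val-wk there x) h0)))) ▸ⁿ λ m → wkN w' (b (there m)))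
  lkSound (=L₁ {φ = φ} {s} {t}) {η = η} p w a b = Val-ex s η λ v w₁ x → Val-ex t η λ u w₂ y →
    ¬E (wkN w₂ (wkN w₁ (b (here refl))))
      (inst← φ y (≐S (tr φ) η (eq→ (Val-wk w₂ x) y (wkN w₂ (wkN w₁ (a (here refl))))) (inst→ φ (Val-wk w₂ x)
      (raa (p _ (here refl) id _ (λ _ _ → refl) (there ∘ w₂ ∘ w₁ ∘ w) (λ m → wkN w₂ (wkN w₁ (a (there m))) ↑) (h0 ▸ⁿ λ m → wkN w₂ (wkN w₁ (b (there m))) ↑))))))
  lkSound (=L₂ {φ = φ} {s} {t}) {η = η} p w a b = Val-ex s η λ v w₁ x → Val-ex t η λ u w₂ y →
    ¬E (wkN w₂ (wkN w₁ (b (here refl))))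
      (inst← φ (Val-wk w₂ x) (≐S (tr φ) η (eq→ (Val-wk w₂ x) y (wkN w₂ (wkN w₁ (a (here refl)))) ⁻¹) (inst→ φ y
      (raa (p _ (here refl) id _ (λ _ _ → refl) (there ∘ w₂ ∘ w₁ ∘ w) (λ m → wkN w₂ (wkN w₁ (a (there m))) ↑) (h0 ▸ⁿ λ m → wkN w₂ (wkN w₁ (b (there m))) ↑))))))
  lkSound (=R {t}) {η = η} p w a b = Val-ex t η λ v w' x → ¬E (wkN w' (b (here refl))) (eq← x x (≐R v))
  lkSound (cut φ) p w a b =
    cutN (raa (p _ (here refl) id _ (λ _ _ → refl) (there ∘ w) (λ m → a m ↑) (h0 ▸ⁿ λ m → b m ↑)))
         (p _ (there (here refl)) id _ (λ _ _ → refl) (there ∘ w) (h0 ▸ λ m → a m ↑) (λ m → b m ↑))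

-- A cyclic graph is sound if the quantities x_t attached to the trace objects t, described by the
-- formulas measure t, do not increase along stp and decrease along prg.
module Soundness (T : Theory) (In : Interp T) (N : ℕ) (node : Fin N → Seq) (prem : Fin N → List (Fin N)) (n : ℕ)
  (stp prg : Fin N → Fin N → Fin n → Fin n → Bool)
  (good : ∀ (at : ℕ → Fin N) → (∀ k → at (suc k) ∈ prem (at k)) → Σ ℕ λ k₀ → Σ (ℕ → Fin n) λ τ →
    (∀ k → k₀ ≤ k → stp (at k) (at (suc k)) (τ k) (τ (suc k)) ≡ true) ×
    (∀ m → ∃ λ k → m ≤ k × k₀ ≤ k × prg (at k) (at (suc k)) (τ k) (τ (suc k)) ≡ true))
  (valid : Fin N → Fin n → Bool) (measure : Fin n → Fm)
  where
  open Interp In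
  open LKSound T In
  open Arith T

  Holds : List Fm → Fin N → Vec Tm n → Set
  Holds Γ i xs = ∀ η {Δ} → Γ ⊆ Δ → (∀ t → valid i t ≡ true → Δ ⊢ fsub (V.lookup xs t ∷ˢ η) (measure t)) → True Δ (node i) η

  Local : Set
  Local = ∀ i {Γ} (xs : Vec Tm n) →
    (∀ j → j ∈ prem i → ∀ {Δ} → Γ ⊆ Δ → ∀ (zs : Vec Tm n) →
      (∀ t u → stp i j t u ≡ true → Δ ⊢ le (V.lookup zs u) (V.lookup xs t)) →
      (∀ t u → prg i j t u ≡ true → Δ ⊢ lt (V.lookup zs u) (V.lookup xs t)) →
      Holds Δ j zs) → Holds Γ i xs

  module _ (local : Local) where
    private
      objs = allFin n
      relevant : List Fm
      relevant = concatMap (λ i → map tr (ant (node i) ++ sc (node i))) (allFin N) ++ map measure objs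
      K = bndL relevant
      valid? = λ i t → valid i t Data.Bool.≟ true
      measured : Fin n → Fm
      measured t = fsub (var (K + F.toℕ t) ∷ˢ var) (measure t)
      ms ants negs : Fin N → List Fm
      ms i   = map measured (filter (valid? i) objs)
      ants i = map tr (ant (node i))
      negs i = map (`¬ ∘ tr) (sc (node i))
      -- Truth under all assignments as one formula. The formulas in question have variables below K
      -- only, so these are quantified; the n variables after them are the quantities, whence the
      -- index K + t in `measured`.
      body A : Fin N → Fm
      body i = imps (ms i) (imps (ants i) (imps (negs i) ⊥'))
      A i = ∀ⁿ K (body i)

      ⊕-lookup : ∀ {k} (xs : Vec Tm k) σ t → (xs ⊕ σ) (F.toℕ t) ≡ V.lookup xs t
      ⊕-lookup (x ∷ xs) σ F.zero    = refl
      ⊕-lookup (x ∷ xs) σ (F.suc t) = ⊕-lookup xs σ t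

      measured-eval : ∀ (ρ : Vec Tm K) (xs : Vec Tm n) t →
        fsub (ρ ⊕ xs ⊕ var) (measured t) ≡ fsub (V.lookup xs t ∷ˢ (ρ ⊕ xs ⊕ var)) (measure t)
      measured-eval ρ xs t = trans (fsub-fuse (measure t)) (fsub-ext (measure t)
        λ { zero → trans (⊕-up ρ (xs ⊕ var) (F.toℕ t)) (⊕-lookup xs var t) ; (suc k) → refl })

      module _ (η : Subst) (xs : Vec Tm n) where
        ρ : Vec Tm K
        ρ = V.tabulate (η ∘ F.toℕ)
        tab : ∀ k (f : ℕ → Tm) σ j → j < k → (V.tabulate {n = k} (f ∘ F.toℕ) ⊕ σ) j ≡ f j
        tab (suc k) f σ zero    l       = refl
        tab (suc k) f σ (suc j) (s≤s l) = tab k (f ∘ suc) σ j l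
        ζ≡η : ∀ j → j < K → (ρ ⊕ xs ⊕ var) j ≡ η j
        ζ≡η j = tab K η (xs ⊕ var) j
        small : ∀ {φ} → φ ∈ relevant → fsub (ρ ⊕ xs ⊕ var) φ ≡ fsub η φ
        small {φ} m = fsub-occ φ λ j o → ζ≡η j (Nₚ.≤-trans (occF-bnd j φ o) (bndL-∈ m))

      rel-node : ∀ i {φ} → φ ∈ ant (node i) ++ sc (node i) → tr φ ∈ relevant
      rel-node i m = ∈ₚ.∈-++⁺ˡ (∈ₚ.∈-concatMap⁺ (λ i → map tr (ant (node i) ++ sc (node i)))
        (Any.map (λ { refl → ∈ₚ.∈-map⁺ tr m }) (∈ₚ.∈-allFin i)))
      rel-measure : ∀ t → measure t ∈ relevant
      rel-measure t = ∈ₚ.∈-++⁺ʳ (concatMap (λ i → map tr (ant (node i) ++ sc (node i))) (allFin N)) (∈ₚ.∈-map⁺ measure (∈ₚ.∈-allFin t))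

      -- A trivial instance, taken for its rules about `∀ⁿ` and `imps`.
      module D = WF T n ⊤ (λ _ _ → yes refl) (λ _ _ → tt) (λ _ _ _ → refl) (λ _ _ _ → ⊥') (λ _ _ _ _ → refl) (λ _ _ _ _ _ p _ → p)

      toHolds : ∀ {Γ} i xs → Γ ⊢ fsub (xs ⊕ var) (A i) → Holds Γ i xs
      toHolds i xs d η {Δ} w mh {Δ'} w' a b =
        D.impsE (negs i) ⊥' ζ (D.impsE (ants i) _ ζ (D.impsE (ms i) _ ζ (D.∀ⁿE (body i) (xs ⊕ var) (wkN (w' ∘ w) d) (ρ η xs)) hm) ha) hb
        where
        ζ = ρ η xs ⊕ xs ⊕ var
        hm : ∀ {φ} → φ ∈ ms i → Δ' ⊢ fsub ζ φ
        hm m with ∈ₚ.∈-map⁻ measured m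
        ... | t , t∈ , refl = cast (sym (trans (measured-eval (ρ η xs) xs t) (fsub-occ (measure t)
              λ { zero _ → refl ; (suc k) o → ζ≡η η xs k (Nₚ.<-trans (Nₚ.n<1+n k) (Nₚ.≤-trans (occF-bnd (suc k) (measure t) o) (bndL-∈ (rel-measure t)))) })))
              (wkN w' (mh t (proj₂ (∈ₚ.∈-filter⁻ (valid? i) {xs = objs} t∈))))
        ha : ∀ {φ} → φ ∈ ants i → Δ' ⊢ fsub ζ φ
        ha m with ∈ₚ.∈-map⁻ tr m
        ... | φ , m' , refl = cast (sym (small η xs (rel-node i (∈ₚ.∈-++⁺ˡ m')))) (a m')
        hb : ∀ {φ} → φ ∈ negs i → Δ' ⊢ fsub ζ φ
        hb m with ∈ₚ.∈-map⁻ (`¬ ∘ tr) m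
        ... | φ , m' , refl = cast (cong `¬ (sym (small η xs (rel-node i (∈ₚ.∈-++⁺ʳ (ant (node i)) m'))))) (b m')

      fromHolds : ∀ {Γ} i xs → Holds Γ i xs → Γ ⊢ fsub (xs ⊕ var) (A i)
      fromHolds i xs h = D.∀ⁿI (body i) (xs ⊕ var) λ ρ → let ζ = ρ ⊕ xs ⊕ var in
        D.impsI (ms i) _ ζ λ w₁ hm → D.impsI (ants i) _ ζ λ w₂ ha → D.impsI (negs i) ⊥' ζ λ w₃ hb →
          h ζ w₁ (λ t v → cast (measured-eval ρ xs t) (hm (∈ₚ.∈-map⁺ measured (∈ₚ.∈-filter⁺ (valid? i) (∈ₚ.∈-allFin t) v))))
            (w₃ ∘ w₂) (λ m → wkN w₃ (ha (∈ₚ.∈-map⁺ tr m))) (λ m → hb (∈ₚ.∈-map⁺ (`¬ ∘ tr) m))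

    sound : ∀ i {Γ} (xs : Vec Tm n) → Holds Γ i xs
    sound i xs = toHolds i xs (Descending.holds T N prem n stp prg good A
      (λ i xs ih → fromHolds i xs (local i xs λ j m w zs hs hp → toHolds j zs (ih j m w zs hs hp))) i xs)

-- Multiplication in TPA

module PA where
  open Arith TPA public

  ·-cong : ∀ {Γ a b c d} → Γ ⊢ a ≐ b → Γ ⊢ c ≐ d → Γ ⊢ a `· c ≐ b `· d
  ·-cong {a = a} {b} {c} e f = ≐S (var 1 `· var 2 ≐ var 0 `· var 2) (a ∷ˢ c ∷ˢ var) e (≐R _)
                             ∙ ≐S (var 2 `· var 1 ≐ var 2 `· var 0) (c ∷ˢ b ∷ˢ var) f (≐R _)
  ·0 : ∀ {Γ} t → Γ ⊢ t `· `0 ≐ `0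
  ·0 t = C.by₀ p-·0
  ·s : ∀ {Γ} t u → Γ ⊢ t `· `s u ≐ (t `· u) `+ t
  ·s t u = C.by₀ p-·s
  0· : ∀ {Γ} t → Γ ⊢ `0 `· t ≐ `0
  0· = ind (`0 `· var 0 ≐ `0) var (·0 `0) λ t → ·s `0 t ∙ +0 _ ∙ h0
  +-swap : ∀ {Γ} a b c → Γ ⊢ (a `+ b) `+ c ≐ (a `+ c) `+ b
  +-swap a b c = +assoc a b c ∙ +-cong (≐R a) (+comm b c) ∙ (+assoc a c b ⁻¹)
  s· : ∀ {Γ} a b → Γ ⊢ `s a `· b ≐ (a `· b) `+ b
  s· a = ind (`s (var 1) `· var 0 ≐ (var 1 `· var 0) `+ var 0) (a ∷ˢ var) (·0 _ ∙ (+0 _ ∙ ·0 a) ⁻¹)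
    λ t → ·s (`s a) t ∙ +s _ a ∙ s-cong (+-cong h0 (≐R a) ∙ +-swap _ t a ∙ +-cong (·s a t ⁻¹) (≐R t)) ∙ (+s _ t ⁻¹)
  ·comm : ∀ {Γ} a b → Γ ⊢ a `· b ≐ b `· a
  ·comm a = ind (var 1 `· var 0 ≐ var 0 `· var 1) (a ∷ˢ var) (·0 a ∙ (0· a ⁻¹))
    λ t → ·s a t ∙ +-cong h0 (≐R a) ∙ (s· t a ⁻¹)
  ·distribˡ : ∀ {Γ} a b c → Γ ⊢ a `· (b `+ c) ≐ (a `· b) `+ (a `· c)
  ·distribˡ a b = ind (var 1 `· (var 2 `+ var 0) ≐ (var 1 `· var 2) `+ (var 1 `· var 0)) (a ∷ˢ b ∷ˢ var)
    (·-cong (≐R a) (+0 b) ∙ (+0 _ ⁻¹) ∙ +-cong (≐R _) (·0 a ⁻¹))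
    λ t → ·-cong (≐R a) (+s b t) ∙ ·s a _ ∙ +-cong h0 (≐R a) ∙ +assoc _ _ a ∙ +-cong (≐R _) (·s a t ⁻¹)
  ·distribʳ : ∀ {Γ} a b c → Γ ⊢ (b `+ c) `· a ≐ (b `· a) `+ (c `· a)
  ·distribʳ a b c = ·comm _ a ∙ ·distribˡ a b c ∙ +-cong (·comm a b) (·comm a c)
  ·assoc : ∀ {Γ} a b c → Γ ⊢ (a `· b) `· c ≐ a `· (b `· c)
  ·assoc a b = ind ((var 1 `· var 2) `· var 0 ≐ var 1 `· (var 2 `· var 0)) (a ∷ˢ b ∷ˢ var)
    (·0 _ ∙ (·-cong (≐R a) (·0 b) ∙ ·0 a) ⁻¹)
    λ t → ·s _ t ∙ +-cong h0 (≐R _) ∙ (·distribˡ a (b `· t) b ⁻¹) ∙ ·-cong (≐R a) (·s b t ⁻¹)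
  ·1 : ∀ {Γ} a → Γ ⊢ a `· `s `0 ≐ a
  ·1 a = ·s a `0 ∙ +-cong (·0 a) (≐R a) ∙ 0+ a
  s-1 : ∀ {Γ} a → Γ ⊢ `s a ≐ a `+ `s `0
  s-1 a = s-cong (+0 a ⁻¹) ∙ (+s a `0 ⁻¹)

  -- Provable equality under Γ is a semiring equality, so the ring solver produces derivations of
  -- polynomial identities. Successors are rewritten as sums by `s-1` before it is called.
  semiring : List Fm → CommutativeSemiring _ _
  semiring Γ = record
    { Carrier = Tm ; _≈_ = λ a b → Γ ⊢ a ≐ b ; _+_ = _`+_ ; _*_ = _`·_ ; 0# = `0 ; 1# = `s `0
    ; isCommutativeSemiring = record
      { isSemiring = record
        { isSemiringWithoutAnnihilatingZero = record
          { +-isCommutativeMonoid = record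
            { isMonoid = record
              { isSemigroup = record
                { isMagma = record { isEquivalence = record { refl = ≐R _ ; sym = ≐sym ; trans = ≐trans } ; ∙-cong = +-cong }
                ; assoc = +assoc }
              ; identity = 0+ , +0 }
            ; comm = +comm }
          ; *-cong = ·-cong
          ; *-assoc = ·assoc
          ; *-identity = (λ a → ·comm _ a ∙ ·1 a) , ·1
          ; distrib = ·distribˡ , ·distribʳ }
        ; zero = 0· , ·0 }
      ; *-comm = ·comm } }

  module Ring (Γ : List Fm) = Solver (semiring Γ)

  lt⇒≺ : ∀ {Γ} a b → Γ ⊢ lt a b → Γ ⊢ a ≺ b
  lt⇒≺ a b p = leE (`s a) b p λ w → ≐S (var 1 ≺ var 0) (a ∷ˢ var) h0
    (ind (var 1 ≺ (`s (var 1) `+ var 0)) (a ∷ˢ var)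
      (≐S (var 1 ≺ var 0) (a ∷ˢ var) (+0 (`s a) ⁻¹) (C.by₀ o-suc))
      (λ x → ≐S (var 1 ≺ var 0) (a ∷ˢ var) (+s (`s a) x ⁻¹) (C.by₂ o-tr h0 (C.by₀ o-suc))) w)
  ≺⇒lt : ∀ {Γ} a b → Γ ⊢ a ≺ b → Γ ⊢ lt a b
  ≺⇒lt a b p = ∨E (le-total b a)
    (le-split b a h0 (C.no₂ o-as (p ↑²) (lt⇒≺ b a h0))
      (cutN (≐S (var 1 ≺ var 0) (a ∷ˢ var) h0 (p ↑²)) (C.no₂ o-as h0 h0)))
    h0

  le-·s : ∀ {Γ} a b → Γ ⊢ le a (a `· `s b)
  le-·s a b = leI a _ (a `· b) (+comm _ _ ∙ (·s a b ⁻¹))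

  -- val a m v: a = q m + v for some q; inv p m: p is invertible modulo m
  div : Tm → Tm → Fm
  div m p = `∃ (ren suc p ≐ (ren suc m `· var 0))
  val : Tm → Tm → Tm → Fm
  val a m v = `∃ (ren suc a ≐ ((var 0 `· ren suc m) `+ ren suc v))
  inv : Tm → Tm → Fm
  inv p m = `∃ (`∃ ((ren suc (ren suc p) `· var 1) ≐ `s (ren suc (ren suc m) `· var 0)))

  divI : ∀ {Γ} m p h → Γ ⊢ p ≐ m `· h → Γ ⊢ div m p
  divI m p h = ∃I (var 1 ≐ (var 2 `· var 0)) (p ∷ˢ m ∷ˢ var) h
  divE : ∀ {Γ ψ} m p → Γ ⊢ div m p → (∀ h → (p ≐ m `· h) ∷ Γ ⊢ ψ) → Γ ⊢ ψ
  divE m p = ∃E (var 1 ≐ (var 2 `· var 0)) (p ∷ˢ m ∷ˢ var)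
  valI : ∀ {Γ} a m v q → Γ ⊢ a ≐ (q `· m) `+ v → Γ ⊢ val a m v
  valI a m v q = ∃I (var 1 ≐ ((var 0 `· var 2) `+ var 3)) (a ∷ˢ m ∷ˢ v ∷ˢ var) q
  valE : ∀ {Γ ψ} a m v → Γ ⊢ val a m v → (∀ q → (a ≐ (q `· m) `+ v) ∷ Γ ⊢ ψ) → Γ ⊢ ψ
  valE a m v = ∃E (var 1 ≐ ((var 0 `· var 2) `+ var 3)) (a ∷ˢ m ∷ˢ v ∷ˢ var)
  invI : ∀ {Γ} p m x y → Γ ⊢ p `· x ≐ `s (m `· y) → Γ ⊢ inv p m
  invI p m x y d = ∃I (`∃ ((var 2 `· var 1) ≐ `s (var 3 `· var 0))) (p ∷ˢ m ∷ˢ var) x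
                     (∃I ((var 2 `· var 1) ≐ `s (var 3 `· var 0)) (x ∷ˢ p ∷ˢ m ∷ˢ var) y d)
  invE : ∀ {Γ ψ} p m → Γ ⊢ inv p m → (∀ x y {Δ} → Γ ⊆ Δ → Δ ⊢ p `· x ≐ `s (m `· y) → Δ ⊢ ψ) → Γ ⊢ ψ
  invE p m d k = ∃E (`∃ ((var 2 `· var 1) ≐ `s (var 3 `· var 0))) (p ∷ˢ m ∷ˢ var) d λ x →
    ∃E ((var 2 `· var 1) ≐ `s (var 3 `· var 0)) (x ∷ˢ p ∷ˢ m ∷ˢ var) h0 λ y → k x y (there ∘ there) h0

  val-fun : ∀ {Γ} a m v v' → Γ ⊢ val a m v → Γ ⊢ lt v m → Γ ⊢ val a m v' → Γ ⊢ lt v' m → Γ ⊢ v ≐ v'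
  val-fun {Γ} a m v v' p l p' l' = valE a m v p λ q → valE a m v' (p' ↑) λ q' →
    ∨E (le-total q q') (go q q' v v' (l ↑³) h2 h1 h0) (go q' q v' v (l' ↑³) h1 h2 (lt⇒le q' q h0) ⁻¹)
    where
    go : ∀ {Γ} q q' v v' → Γ ⊢ lt v m → Γ ⊢ a ≐ (q `· m) `+ v → Γ ⊢ a ≐ (q' `· m) `+ v' → Γ ⊢ le q q' → Γ ⊢ v ≐ v'
    go q q' v v' l e e' d = leE q q' d λ w → cases w
      (+cancelˡ (q `· m) v v' ((e ↑² ⁻¹) ∙ (e' ↑²) ∙ +-cong (·-cong ((h1 ⁻¹) ∙ +-cong (≐R q) h0 ∙ +0 q) (≐R m)) (≐R v')))
      -- If q' = q + 1 + x, then v = m + x m + v', against v < m.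
      λ x → lt-irr v (le-trans (`s v) m v (l ↑²) (leI m v ((x `· m) `+ v')
        (+cancelˡ (q `· m) _ v ((eq x ∙ +-cong (·-cong (+-cong (≐R q) (h0 ⁻¹) ∙ h1) (≐R m)) (≐R v')) ∙ (e' ↑² ⁻¹) ∙ (e ↑²)))))
      where
      eq : ∀ {Γ} x → Γ ⊢ (q `· m) `+ (m `+ ((x `· m) `+ v')) ≐ ((q `+ `s x) `· m) `+ v'
      eq {Γ} x = S.solve 4 (λ q m x v → (q S.:* m) S.:+ (m S.:+ ((x S.:* m) S.:+ v)) S.:= ((q S.:+ (x S.:+ S.con 1)) S.:* m) S.:+ v) (≐R _) q m x v'
                 ∙ +-cong (·-cong (+-cong (≐R q) (s-1 x ⁻¹)) (≐R m)) (≐R v')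
        where module S = Ring Γ

  val-ex : ∀ {Γ ψ} a e → (∀ v {Δ} → Γ ⊆ Δ → Δ ⊢ val a (`s e) v → Δ ⊢ lt v (`s e) → Δ ⊢ ψ) → Γ ⊢ ψ
  val-ex {Γ} a e k = ∃E (val (var 1) (`s (var 2)) (var 0) `∧ lt (var 0) (`s (var 2))) (a ∷ˢ e ∷ˢ var)
    (ind (`∃ (val (var 1) (`s (var 2)) (var 0) `∧ lt (var 0) (`s (var 2)))) (e ∷ˢ var)
      (mkv `0 `0 (valI `0 (`s e) `0 `0 ((0· _ ⁻¹) ∙ (+0 _ ⁻¹))) (le-s `0 e (le-0 e)))
      (λ x → ∃E (val (var 1) (`s (var 2)) (var 0) `∧ lt (var 0) (`s (var 2))) (x ∷ˢ e ∷ˢ var) h0 λ v →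
        valE x (`s e) v (∧E₁ h0) λ q → le-split (`s v) (`s e) (∧E₂ h1)
          (mkv (`s x) (`s v) (valI (`s x) (`s e) (`s v) q (s-cong h1 ∙ (+s _ v ⁻¹))) h0)
          (mkv (`s x) `0 (valI (`s x) (`s e) `0 (`s q) (s-cong h1 ∙ (+s _ v ⁻¹) ∙ +-cong (≐R _) h0 ∙ (s· q (`s e) ⁻¹) ∙ (+0 _ ⁻¹))) (le-s `0 e (le-0 e)))) a)
    λ v → k v there (∧E₁ h0) (∧E₂ h0)
    where
    mkv : ∀ {Γ} a v → Γ ⊢ val a (`s e) v → Γ ⊢ lt v (`s e) → Γ ⊢ `∃ (val (ren suc a) (`s (ren suc e)) (var 0) `∧ lt (var 0) (`s (ren suc e)))
    mkv a v p l = ∃I (val (var 1) (`s (var 2)) (var 0) `∧ lt (var 0) (`s (var 2))) (a ∷ˢ e ∷ˢ var) v (∧I p l)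

  -- c is the Cantor code of the pair (a, d)
  pr : Tm → Tm → Tm → Fm
  pr c a d = (c `+ c) ≐ (((a `+ d) `· `s (a `+ d)) `+ (d `+ d))

  double-inj : ∀ {Γ} a b → Γ ⊢ a `+ a ≐ b `+ b → Γ ⊢ a ≐ b
  double-inj a b e = ∨E (le-total a b) (go a b (e ↑) h0) (go b a (e ↑ ⁻¹) (lt⇒le b a h0) ⁻¹)
    where
    go : ∀ {Γ} a b → Γ ⊢ a `+ a ≐ b `+ b → Γ ⊢ le a b → Γ ⊢ a ≐ b
    go a b e l = leE a b l λ w → cases w ((+0 a ⁻¹) ∙ +-cong (≐R a) (h0 ⁻¹) ∙ h1)
      λ x → +-zeroʳ (x `+ `s x) `0 (+cancelˡ (a `+ a) _ `0
         (eq x ∙ +-cong (+-cong (≐R a) (h0 ⁻¹) ∙ h1) (+-cong (≐R a) (h0 ⁻¹) ∙ h1) ∙ (e ↑² ⁻¹) ∙ (+0 _ ⁻¹)))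
      where
      eq : ∀ {Γ} x → Γ ⊢ (a `+ a) `+ ((x `+ `s x) `+ `s `0) ≐ (a `+ `s x) `+ (a `+ `s x)
      eq {Γ} x = +-cong (≐R _) (+-cong (+-cong (≐R x) (s-1 x)) (≐R _))
        ∙ S.solve 2 (λ a x → (a S.:+ a) S.:+ ((x S.:+ (x S.:+ S.con 1)) S.:+ S.con 1) S.:= (a S.:+ (x S.:+ S.con 1)) S.:+ (a S.:+ (x S.:+ S.con 1))) (≐R _) a x
        ∙ (+-cong (+-cong (≐R a) (s-1 x)) (+-cong (≐R a) (s-1 x)) ⁻¹)
        where module S = Ring Γ

  pr-fun : ∀ {Γ} c a d a' d' → Γ ⊢ pr c a d → Γ ⊢ pr c a' d' → Γ ⊢ (a ≐ a') `∧ (d ≐ d')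
  pr-fun {Γ} c a d a' d' p p' = ∨E (le-total (a `+ d) (a' `+ d'))
      (le-split (a `+ d) (a' `+ d') h0 (clash a d a' d' (p ↑²) (p' ↑²) h0) (same (p ↑²) (p' ↑²) h0))
      (clash a' d' a d (p' ↑) (p ↑) h0)
    where
    clash : ∀ {Γ ψ} a d a' d' → Γ ⊢ pr c a d → Γ ⊢ pr c a' d' → Γ ⊢ lt (a `+ d) (a' `+ d') → Γ ⊢ ψ
    clash a d a' d' p p' l = leE (`s (a `+ d)) (a' `+ d') l λ w →
      +-zeroʳ _ _ (+cancelˡ (((a `+ d) `· `s (a `+ d)) `+ (d `+ d)) _ `0
        (eq w ∙ +-cong (·-cong h0 (s-cong h0)) (≐R (d' `+ d')) ∙ (p' ↑ ⁻¹) ∙ (p ↑) ∙ (+0 _ ⁻¹)))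
      where
      -- With n = a + d and a' + d' = n + 1 + w, the two right-hand sides of `pr` differ by `rest w`
      -- + 2; the summand 2n of their difference absorbs 2d and leaves 2a.
      rest : Tm → Tm
      rest w = ((((w `· w) `+ ((w `· (a `+ d)) `+ (w `· (a `+ d)))) `+ ((w `+ w) `+ w)) `+ (a `+ a)) `+ (d' `+ d')
      eq : ∀ {Γ} w → Γ ⊢ (((a `+ d) `· `s (a `+ d)) `+ (d `+ d)) `+ ((rest w `+ `s `0) `+ `s `0)
         ≐ ((`s (a `+ d) `+ w) `· `s (`s (a `+ d) `+ w)) `+ (d' `+ d')
      eq {Γ} w = +-cong (+-cong (·-cong (≐R _) (s-1 _)) (≐R _)) (≐R _)
        ∙ S.solve 4 (λ a d w d' → (((a S.:+ d) S.:* ((a S.:+ d) S.:+ S.con 1)) S.:+ (d S.:+ d)) S.:+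
             ((((((w S.:* w) S.:+ ((w S.:* (a S.:+ d)) S.:+ (w S.:* (a S.:+ d)))) S.:+ ((w S.:+ w) S.:+ w)) S.:+ (a S.:+ a)) S.:+ (d' S.:+ d') S.:+ S.con 1) S.:+ S.con 1)
             S.:= ((((a S.:+ d) S.:+ S.con 1) S.:+ w) S.:* ((((a S.:+ d) S.:+ S.con 1) S.:+ w) S.:+ S.con 1)) S.:+ (d' S.:+ d')) (≐R _) a d w d'
        ∙ (+-cong (·-cong (+-cong (s-1 _) (≐R w)) (s-1 _ ∙ +-cong (+-cong (s-1 _) (≐R w)) (≐R _))) (≐R _) ⁻¹)
        where module S = Ring Γ
    same : ∀ {Γ} → Γ ⊢ pr c a d → Γ ⊢ pr c a' d' → Γ ⊢ a `+ d ≐ a' `+ d' → Γ ⊢ (a ≐ a') `∧ (d ≐ d')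
    same p p' e = cutN (double-inj d d' (+cancelˡ _ _ _ ((+-cong (·-cong e (s-cong e)) (≐R (d `+ d)) ⁻¹) ∙ (p ⁻¹) ∙ p')))
      (∧I (+cancelʳ a a' d ((e ↑) ∙ +-cong (≐R a') (h0 ⁻¹))) h0)

  -- The code is h + d, where h is the triangular number of a + d; its existence takes an induction,
  -- as halving is no operation of the language.
  pr-ex : ∀ {Γ ψ} a d → (∀ c → pr c a d ∷ Γ ⊢ ψ) → Γ ⊢ ψ
  pr-ex {Γ} a d k = ∃E ((var 0 `+ var 0) ≐ (var 1 `· `s (var 1))) ((a `+ d) ∷ˢ var)
    (ind (`∃ ((var 0 `+ var 0) ≐ (var 1 `· `s (var 1)))) var
      (∃I ((var 0 `+ var 0) ≐ (var 1 `· `s (var 1))) (`0 ∷ˢ var) `0 (0+ `0 ∙ (0· _ ⁻¹)))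
      (λ n → ∃E ((var 0 `+ var 0) ≐ (var 1 `· `s (var 1))) (n ∷ˢ var) h0 λ h →
        ∃I ((var 0 `+ var 0) ≐ (var 1 `· `s (var 1))) (`s n ∷ˢ var) (h `+ `s n) (eq n h h0)) (a `+ d))
    λ h → cutN {φ = pr (h `+ d) a d} (shuffle h d ∙ +-cong h0 (≐R _)) (wkN (λ { (here e) → here e ; (there m) → there (there m) }) (k (h `+ d)))
    where
    shuffle : ∀ {Γ} h d → Γ ⊢ (h `+ d) `+ (h `+ d) ≐ (h `+ h) `+ (d `+ d)
    shuffle {Γ} = S.solve 2 (λ h d → (h S.:+ d) S.:+ (h S.:+ d) S.:= (h S.:+ h) S.:+ (d S.:+ d)) (≐R _)
      where module S = Ring Γ
    eq : ∀ {Γ} n h → Γ ⊢ h `+ h ≐ n `· `s n → Γ ⊢ (h `+ `s n) `+ (h `+ `s n) ≐ `s n `· `s (`s n)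
    eq {Γ} n h e = shuffle h (`s n) ∙ +-cong (e ∙ ·-cong (≐R n) (s-1 n)) (+-cong (s-1 n) (s-1 n))
      ∙ S.solve 1 (λ n → (n S.:* (n S.:+ S.con 1)) S.:+ ((n S.:+ S.con 1) S.:+ (n S.:+ S.con 1)) S.:= (n S.:+ S.con 1) S.:* ((n S.:+ S.con 1) S.:+ S.con 1)) (≐R _) n
      ∙ (·-cong (s-1 n) (s-1 _ ∙ +-cong (s-1 n) (≐R _)) ⁻¹)
      where module S = Ring Γ

-- The β-function in TPA

modulus : Tm → Tm → Tm
modulus i d = `s (`s i `· d)

B-cons : ∀ c i v → B c i v ≡ fsub (c ∷ˢ i ∷ˢ v ∷ˢ var) Bf
B-cons c i v = refl

module Beta where
  open PA

  private
    Bb : Fm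
    Bb = ((var 3 `+ var 3) ≐ (((var 2 `+ var 1) `· `s (var 2 `+ var 1)) `+ (var 1 `+ var 1)))
      `∧ ((var 2 ≐ ((var 0 `· modulus (var 4) (var 1)) `+ var 5)) `∧ (var 5 ≺ modulus (var 4) (var 1)))

  BI : ∀ {Γ} c i v a d → Γ ⊢ pr c a d → Γ ⊢ val a (modulus i d) v → Γ ⊢ lt v (modulus i d) → Γ ⊢ B c i v
  BI c i v a d p x l = valE a (modulus i d) v x λ q → cast (sym (B-cons c i v))
    (∃I (`∃ (`∃ Bb)) (c ∷ˢ i ∷ˢ v ∷ˢ var) a (∃I (`∃ Bb) (a ∷ˢ c ∷ˢ i ∷ˢ v ∷ˢ var) d (∃I Bb (d ∷ˢ a ∷ˢ c ∷ˢ i ∷ˢ v ∷ˢ var) q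
      (∧I (p ↑) (∧I h0 (lt⇒≺ v (modulus i d) (l ↑)))))))

  BE : ∀ {Γ ψ} c i v → Γ ⊢ B c i v →
       (∀ a d {Δ} → Γ ⊆ Δ → Δ ⊢ pr c a d → Δ ⊢ val a (modulus i d) v → Δ ⊢ lt v (modulus i d) → Δ ⊢ ψ) → Γ ⊢ ψ
  BE c i v x k = ∃E (`∃ (`∃ Bb)) (c ∷ˢ i ∷ˢ v ∷ˢ var) (cast (B-cons c i v) x) λ a → ∃E (`∃ Bb) (a ∷ˢ c ∷ˢ i ∷ˢ v ∷ˢ var) h0 λ d →
    ∃E Bb (d ∷ˢ a ∷ˢ c ∷ˢ i ∷ˢ v ∷ˢ var) h0 λ q → k a d (there ∘ there ∘ there) (∧E₁ h0)
      (valI a (modulus i d) v q (∧E₁ (∧E₂ h0))) (≺⇒lt v (modulus i d) (∧E₂ (∧E₂ h0)))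

  modulus-cong : ∀ {Γ d d'} i → Γ ⊢ d ≐ d' → Γ ⊢ modulus i d ≐ modulus i d'
  modulus-cong i e = s-cong (·-cong (≐R (`s i)) e)

  val-cong : ∀ {Γ a a' m m'} v → Γ ⊢ a ≐ a' → Γ ⊢ m ≐ m' → Γ ⊢ val a m v → Γ ⊢ val a' m' v
  val-cong {a = a} {a'} {m} {m'} v e f x = valE a m v x λ q → valI a' m' v q ((e ↑ ⁻¹) ∙ h0 ∙ +-cong (·-cong (≐R q) (f ↑)) (≐R v))

  -- all entries of one code c refer to the same pair (a, d)
  B-at : ∀ {Γ} c i v a d → Γ ⊢ pr c a d → Γ ⊢ B c i v → Γ ⊢ val a (modulus i d) v `∧ lt v (modulus i d)
  B-at c i v a d p x = BE c i v x λ a' d' w p' y l → cutN (pr-fun c a' d' a d p' (wkN w p))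
    (∧I (val-cong v (∧E₁ h0) (modulus-cong i (∧E₂ h0)) (y ↑)) (le-resp (≐R (`s v)) (modulus-cong i (∧E₂ h0)) (l ↑)))

  B-fun : ∀ {Γ} c i v w → Γ ⊢ B c i v → Γ ⊢ B c i w → Γ ⊢ v ≐ w
  B-fun c i v w x y = BE c i v x λ a d s p z l → cutN (B-at c i w a d p (wkN s y))
    (val-fun a (modulus i d) v w (z ↑) (l ↑) (∧E₁ h0) (∧E₂ h0))

  B-cong : ∀ {Γ} c i j v → Γ ⊢ i ≐ j → Γ ⊢ B c i v → Γ ⊢ B c j v
  B-cong c i j v e x = BE c i v x λ a d s p z l → let f = s-cong (·-cong (s-cong (wkN s e)) (≐R d)) in
    BI c j v a d p (val-cong v (≐R a) f z) (le-resp (≐R (`s v)) f l)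

  keep : ∀ {Γ} a p m v w → Γ ⊢ div m p → Γ ⊢ val a m v → Γ ⊢ val (a `+ (p `· w)) m v
  keep {Γ} a p m v w x y = divE m p x λ h → valE a m v (y ↑) λ q →
    valI _ m v (q `+ (h `· w)) (+-cong h0 (·-cong h1 (≐R w)) ∙ eq q h)
    where
    eq : ∀ {Γ} q h → Γ ⊢ ((q `· m) `+ v) `+ ((m `· h) `· w) ≐ ((q `+ (h `· w)) `· m) `+ v
    eq {Γ} q h = S.solve 5 (λ q m v h w → ((q S.:* m) S.:+ v) S.:+ ((m S.:* h) S.:* w) S.:= ((q S.:+ (h S.:* w)) S.:* m) S.:+ v) (≐R _) q m v h w
      where module S = Ring Γ

  -- Modulo e + 1 the number e a acts as -a, which avoids subtraction. With p x = 1 + (e + 1) y and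
  -- w = x (v + e a) one gets a + p w = v + (e + 1)(a + y (v + e a)).
  crt : ∀ {Γ ψ} a p e v → Γ ⊢ inv p (`s e) → (∀ w {Δ} → Γ ⊆ Δ → Δ ⊢ val (a `+ (p `· w)) (`s e) v → Δ ⊢ ψ) → Γ ⊢ ψ
  crt {Γ} a p e v i k = invE p (`s e) i λ x y s d → k (x `· (v `+ (e `· a))) s
    (valI _ (`s e) v (a `+ (y `· (v `+ (e `· a)))) (+-cong (≐R a) (·assoc p x _ ⁻¹ ∙ ·-cong (d ∙ s-1 _ ∙ +-cong (·-cong (s-1 e) (≐R y)) (≐R _)) (≐R _))
      ∙ eq y ∙ +-cong (·-cong (≐R _) (s-1 e ⁻¹)) (≐R v)))
    where
    eq : ∀ {Γ} y → Γ ⊢ a `+ ((((e `+ `s `0) `· y) `+ `s `0) `· (v `+ (e `· a))) ≐ ((a `+ (y `· (v `+ (e `· a)))) `· (e `+ `s `0)) `+ v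
    eq {Γ} y = S.solve 4 (λ a e v y → a S.:+ ((((e S.:+ S.con 1) S.:* y) S.:+ S.con 1) S.:* (v S.:+ (e S.:* a)))
        S.:= ((a S.:+ (y S.:* (v S.:+ (e S.:* a)))) S.:* (e S.:+ S.con 1)) S.:+ v) (≐R _) a e v y
      where module S = Ring Γ

  inv-one : ∀ {Γ} m → Γ ⊢ inv (`s `0) m
  inv-one m = invI (`s `0) m (`s `0) `0 (·1 _ ∙ s-cong (·0 m ⁻¹))

  inv-· : ∀ {Γ} p q m → Γ ⊢ inv p m → Γ ⊢ inv q m → Γ ⊢ inv (p `· q) m
  inv-· {Γ} p q m i j = invE p m i λ x y s d → invE q m (wkN s j) λ x' y' s' d' →
    invI (p `· q) m (x `· x') ((y `+ y') `+ (m `· (y `· y')))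
      (eq₁ x x' ∙ ·-cong (wkN s' d ∙ s-1 _) (d' ∙ s-1 _) ∙ eq₂ y y' ∙ (s-1 _ ⁻¹))
    where
    eq₁ : ∀ {Γ} x x' → Γ ⊢ (p `· q) `· (x `· x') ≐ (p `· x) `· (q `· x')
    eq₁ {Γ} x x' = S.solve 4 (λ p q x y → (p S.:* q) S.:* (x S.:* y) S.:= (p S.:* x) S.:* (q S.:* y)) (≐R _) p q x x'
      where module S = Ring Γ
    eq₂ : ∀ {Γ} y y' → Γ ⊢ ((m `· y) `+ `s `0) `· ((m `· y') `+ `s `0) ≐ (m `· ((y `+ y') `+ (m `· (y `· y')))) `+ `s `0
    eq₂ {Γ} y y' = S.solve 3 (λ m y z → ((m S.:* y) S.:+ S.con 1) S.:* ((m S.:* z) S.:+ S.con 1)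
        S.:= (m S.:* ((y S.:+ z) S.:+ (m S.:* (y S.:* z)))) S.:+ S.con 1) (≐R _) m y y'
      where module S = Ring Γ

  -- From p X + 1 = m Y the inverse of p = 1 + f modulo m = 1 + g is a square: (p (X + m))² ≡ 1.
  inv-neg : ∀ {Γ} f g X Y → Γ ⊢ (`s f `· X) `+ `s `0 ≐ `s g `· Y → Γ ⊢ inv (`s f) (`s g)
  inv-neg {Γ} f g X Y d = invI p m ((X `+ m) `· (p `· (X `+ m))) ((Y `+ p) `· p')
      (·-cong (s-1 f) (·-cong (+-cong (≐R X) (s-1 g)) (·-cong (s-1 f) (+-cong (≐R X) (s-1 g)))) ∙ eq₁
       ∙ +-cong (·-cong (+-cong (+-cong (·-cong (s-1 f ⁻¹) (≐R X)) (≐R _) ∙ d ∙ ·-cong (s-1 g) (≐R Y)) (≐R _)) (≐R _)) (≐R _) ∙ eq₂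
       ∙ +-cong (·-cong (s-1 g ⁻¹) (·-cong (+-cong (≐R Y) (s-1 f ⁻¹)) (≐R p'))) (≐R _) ∙ (s-1 _ ⁻¹))
    where
    module S = Ring Γ
    p = `s f
    m = `s g
    f+ = f `+ `s `0
    g+ = g `+ `s `0
    p' = (f+ `· X) `+ ((f `+ g) `+ (f `· g))
    eq₁ : Γ ⊢ f+ `· ((X `+ g+) `· (f+ `· (X `+ g+))) ≐ ((((f+ `· X) `+ `s `0) `+ (f+ `· g+)) `· p') `+ `s `0
    eq₁ = S.solve 3 (λ f g X → let f+ = f S.:+ S.con 1 ; g+ = g S.:+ S.con 1 in
       f+ S.:* ((X S.:+ g+) S.:* (f+ S.:* (X S.:+ g+))) S.:=
       ((((f+ S.:* X) S.:+ S.con 1) S.:+ (f+ S.:* g+)) S.:* ((f+ S.:* X) S.:+ ((f S.:+ g) S.:+ (f S.:* g)))) S.:+ S.con 1) (≐R _) f g X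
    eq₂ : Γ ⊢ (((g+ `· Y) `+ (f+ `· g+)) `· p') `+ `s `0 ≐ (g+ `· ((Y `+ f+) `· p')) `+ `s `0
    eq₂ = S.solve 4 (λ f g Y p → ((((g S.:* Y) S.:+ (f S.:* g)) S.:* p) S.:+ S.con 1) S.:= ((g S.:* ((Y S.:+ f) S.:* p)) S.:+ S.con 1)) (≐R _) f+ g+ Y p'

  -- Let p = 1 + K D and m = 1 + J D be the two moduli. Then J p - K m = J - K = δ, and
  -- multiplication by J e gives J J e p - J K e m = J D = m - 1. Hence p X + 1 = m (1 + J K e) for
  -- X = J J e, as `inv-neg` requires.
  inv-modulus : ∀ {Γ} k j D r e → Γ ⊢ j ≐ `s k `+ r → Γ ⊢ D ≐ `s r `· e → Γ ⊢ inv (modulus k D) (modulus j D)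
  inv-modulus {Γ} k j D r e x y = inv-neg (K `· D) (`s j `· D) X (`s `0 `+ ((J `· K) `· e))
      (+-cong (·-cong (s-1 _ ∙ +-cong (·-cong (≐R K) y) (≐R _)) (≐R X)) (≐R _) ∙ eq
       ∙ ·-cong (+-cong (·-cong (J≐ ⁻¹) (y ⁻¹)) (≐R _) ∙ (s-1 _ ⁻¹)) (≐R _))
    where
    module S = Ring Γ
    K = `s k
    δ = `s r
    J = K `+ δ
    X = (J `· J) `· e
    J≐ : Γ ⊢ `s j ≐ J
    J≐ = s-cong x ∙ (+s K r ⁻¹)
    eq : Γ ⊢ (((K `· (δ `· e)) `+ `s `0) `· X) `+ `s `0 ≐ ((J `· (δ `· e)) `+ `s `0) `· (`s `0 `+ ((J `· K) `· e))
    eq = S.solve 3 (λ K δ e → (((K S.:* (δ S.:* e)) S.:+ S.con 1) S.:* (((K S.:+ δ) S.:* (K S.:+ δ)) S.:* e)) S.:+ S.con 1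
       S.:= (((K S.:+ δ) S.:* (δ S.:* e)) S.:+ S.con 1) S.:* (S.con 1 S.:+ (((K S.:+ δ) S.:* K) S.:* e))) (≐R _) K δ e

  div-· : ∀ {Γ} m p q → Γ ⊢ div m p → Γ ⊢ div m (p `· q)
  div-· m p q x = divE m p x λ h → divI m _ (h `· q) (·-cong h0 (≐R q) ∙ ·assoc m h q)
  div-self : ∀ {Γ} m p → Γ ⊢ div m (p `· m)
  div-self m p = divI m _ p (·comm p m)

  div-cong : ∀ {Γ m m' p p'} → Γ ⊢ m ≐ m' → Γ ⊢ p ≐ p' → Γ ⊢ div m p → Γ ⊢ div m' p'
  div-cong {m = m} {m'} {p} {p'} e f x = divE m p x λ h → divI m' p' h ((f ↑ ⁻¹) ∙ h0 ∙ ·-cong (e ↑) (≐R h))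

  private
    mult : Fm
    mult = `∀ (lt (var 0) (var 2) `→ div (`s (var 0)) (`s (var 1)))

  -- `s g` is the factorial of N; the successor form records that it is positive.
  common : ∀ {Γ ψ} N → (∀ g {Δ} → Γ ⊆ Δ → (∀ r {Θ} → Δ ⊆ Θ → Θ ⊢ lt r N → Θ ⊢ div (`s r) (`s g)) → Δ ⊢ ψ) → Γ ⊢ ψ
  common {Γ} N k = ∃E mult (N ∷ˢ var) (ind (`∃ mult) var
      (∃I mult (`0 ∷ˢ var) `0 (∀I (lt (var 0) (var 2) `→ div (`s (var 0)) (`s (var 1))) (`0 ∷ˢ `0 ∷ˢ var) λ r → →I (lt-0 r h0)))
      (λ n → ∃E mult (n ∷ˢ var) h0 λ g → ∃I mult (`s n ∷ˢ var) (g `+ (`s g `· n))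
        (∀I (lt (var 0) (var 2) `→ div (`s (var 0)) (`s (var 1))) ((g `+ (`s g `· n)) ∷ˢ `s n ∷ˢ var) λ r →
          →I (le-split r n (le-s⁻ r n h0)
            (div-cong (≐R (`s r)) (eq g n) (div-· (`s r) (`s g) (`s n)
               (→E (∀E (lt (var 0) (var 2) `→ div (`s (var 0)) (`s (var 1))) (g ∷ˢ n ∷ˢ var) h2 r) h0)))
            (div-cong (s-cong (h0 ⁻¹)) (eq g n) (div-self (`s n) (`s g)))))) N)
    λ g → k g there λ r w l → →E (∀E (lt (var 0) (var 2) `→ div (`s (var 0)) (`s (var 1))) (g ∷ˢ N ∷ˢ var) (wkN w h0) r) l
    where
    eq : ∀ {Γ} g n → Γ ⊢ `s g `· `s n ≐ `s (g `+ (`s g `· n))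
    eq g n = ·s _ n ∙ +s _ g ∙ s-cong (+comm _ g)

  -- Under P, a': k is the number of moduli treated so far, N the number of all moduli.
  private
    Φ₁ Φ₁ᵛ Φ₂ : Fm
    Φ₁ᵛ = lt (var 0) (modulus (var 1) (var 6)) `→ (val (var 5) (modulus (var 1) (var 6)) (var 0) `→ val (var 3) (modulus (var 1) (var 7)) (var 0))
    Φ₁ = lt (var 0) (var 3) `→ (div (modulus (var 0) (var 6)) (var 1) `∧ `∀ Φ₁ᵛ)
    Φ₂ = le (var 3) (var 0) `→ (le (var 0) (var 7) `→ inv (var 1) (modulus (var 0) (var 6)))
    Φ : Fm
    Φ = `∀ Φ₁ `∧ `∀ Φ₂

  module CRT (a d D N : Tm) where
    ρ : Subst
    ρ = a ∷ˢ d ∷ˢ D ∷ˢ N ∷ˢ var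

    Coded : Tm → Tm → Tm → Fm
    Coded k a' P = fsub (P ∷ˢ a' ∷ˢ k ∷ˢ ρ) Φ

    codedI : ∀ {Γ} k a' P → (∀ u {Δ} → Γ ⊆ Δ → Δ ⊢ lt u k → Δ ⊢ div (modulus u D) P) →
      (∀ u v {Δ} → Γ ⊆ Δ → Δ ⊢ lt u k → Δ ⊢ lt v (modulus u d) → Δ ⊢ val a (modulus u d) v → Δ ⊢ val a' (modulus u D) v) →
      (∀ j {Δ} → Γ ⊆ Δ → Δ ⊢ le k j → Δ ⊢ le j N → Δ ⊢ inv P (modulus j D)) → Γ ⊢ Coded k a' P
    codedI k a' P f g h = ∧I
      (∀I Φ₁ (P ∷ˢ a' ∷ˢ k ∷ˢ ρ) λ u → →I (∧I (f u there h0)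
        (∀I Φ₁ᵛ (u ∷ˢ P ∷ˢ a' ∷ˢ k ∷ˢ ρ) λ v → →I (→I (g u v (there ∘ there ∘ there) h2 h1 h0)))))
      (∀I Φ₂ (P ∷ˢ a' ∷ˢ k ∷ˢ ρ) λ j → →I (→I (h j (there ∘ there) h1 h0)))

    coded-div : ∀ {Γ} k a' P → Γ ⊢ Coded k a' P → ∀ u → Γ ⊢ lt u k → Γ ⊢ div (modulus u D) P
    coded-div k a' P x u l = ∧E₁ (→E (∀E Φ₁ (P ∷ˢ a' ∷ˢ k ∷ˢ ρ) (∧E₁ x) u) l)
    coded-val : ∀ {Γ} k a' P → Γ ⊢ Coded k a' P → ∀ u v → Γ ⊢ lt u k → Γ ⊢ lt v (modulus u d) → Γ ⊢ val a (modulus u d) v → Γ ⊢ val a' (modulus u D) v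
    coded-val k a' P x u v l l' y = →E (→E (∀E Φ₁ᵛ (u ∷ˢ P ∷ˢ a' ∷ˢ k ∷ˢ ρ) (∧E₂ (→E (∀E Φ₁ (P ∷ˢ a' ∷ˢ k ∷ˢ ρ) (∧E₁ x) u) l)) v) l') y
    coded-inv : ∀ {Γ} k a' P → Γ ⊢ Coded k a' P → ∀ j → Γ ⊢ le k j → Γ ⊢ le j N → Γ ⊢ inv P (modulus j D)
    coded-inv k a' P x j l l' = →E (→E (∀E Φ₂ (P ∷ˢ a' ∷ˢ k ∷ˢ ρ) (∧E₂ x) j) l) l'

    -- P is the product of the first k new moduli. Adding a multiple of P to a' corrects its residue
    -- for the next modulus and disturbs none of the earlier ones; P is then multiplied by that
    -- modulus. It remains invertible for later moduli because D is divisible by every difference of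
    -- indices.
    coded : ∀ {Γ} → (∀ r {Δ} → Γ ⊆ Δ → Δ ⊢ lt r N → Δ ⊢ div (`s r) D) →
      ∀ k → Γ ⊢ le k N `→ fsub (k ∷ˢ ρ) (`∃ (`∃ Φ))
    coded {Γ} hD = ind (le (var 0) (var 4) `→ `∃ (`∃ Φ)) ρ
      (→I (mkE `0 `0 (`s `0) (codedI `0 `0 (`s `0) (λ u _ l → lt-0 u l) (λ u v _ l _ _ → lt-0 u l) (λ j _ _ _ → inv-one (modulus j D)))))
      λ k → →I (∃E (`∃ Φ) (k ∷ˢ ρ) (→E h1 (lt⇒le k N h0)) λ a' → ∃E Φ (a' ∷ˢ k ∷ˢ ρ) h0 λ P →
        val-ex a (`s k `· d) λ v s₁ x l → crt a' P (`s k `· D) v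
          (wkN s₁ (coded-inv k a' P h0 k (le-refl k) (lt⇒le k N h2))) λ w s₂ y →
          step k a' P v w (λ r s q → hD r (s ∘ s₂ ∘ s₁ ∘ there ∘ there ∘ there ∘ there) q)
            (wkN s₂ (wkN s₁ h0)) (wkN s₂ x) (wkN s₂ l) y)
      where
      mkE : ∀ {Γ} k a' P → Γ ⊢ Coded k a' P → Γ ⊢ fsub (k ∷ˢ ρ) (`∃ (`∃ Φ))
      mkE k a' P x = ∃I (`∃ Φ) (k ∷ˢ ρ) a' (∃I Φ (a' ∷ˢ k ∷ˢ ρ) P x)
      step : ∀ {Γ} k a' P v w → (∀ r {Δ} → Γ ⊆ Δ → Δ ⊢ lt r N → Δ ⊢ div (`s r) D) → Γ ⊢ Coded k a' P →
        Γ ⊢ val a (modulus k d) v → Γ ⊢ lt v (modulus k d) → Γ ⊢ val (a' `+ (P `· w)) (modulus k D) v → Γ ⊢ fsub (`s k ∷ˢ ρ) (`∃ (`∃ Φ))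
      step k a' P v w hD c x l y = mkE (`s k) (a' `+ (P `· w)) (P `· modulus k D) (codedI (`s k) (a' `+ (P `· w)) (P `· modulus k D)
        (λ u s q → le-split u k (le-s⁻ u k q)
          (div-· (modulus u D) P (modulus k D) (coded-div k a' P (wkN s c ↑) u h0))
          (div-cong (mcong D (h0 ⁻¹)) (≐R (P `· modulus k D)) (div-self (modulus k D) P)))
        (λ u v' s q lv z → le-split u k (le-s⁻ u k q)
          (keep a' P (modulus u D) v' w (coded-div k a' P (wkN s c ↑) u h0) (coded-val k a' P (wkN s c ↑) u v' h0 (lv ↑) (z ↑)))
          (cutN (val-fun a (modulus k d) v v' (wkN s x ↑) (wkN s l ↑) (val-cong v' (≐R a) (mcong d h0) (z ↑)) (le-resp (≐R (`s v')) (mcong d h0) (lv ↑)))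
            (≐S (val (var 1) (var 2) (var 0)) ((a' `+ (P `· w)) ∷ˢ modulus u D ∷ˢ var) h0
              (val-cong v (≐R (a' `+ (P `· w))) (mcong D (h1 ⁻¹)) (wkN s y ↑²)))))
        (λ j s q q' → inv-· P (modulus k D) (modulus j D) (coded-inv k a' P (wkN s c) j (lt⇒le k j q) q')
          (leE (`s k) j q λ r → divE (`s r) D (hD r (there ∘ s) (le-trans (`s r) j N (leI (`s r) j k (s+ r k ∙ s-cong (+comm r k) ∙ (s+ k r ⁻¹) ∙ h0)) (q' ↑)))
            λ e → inv-modulus k j D r e (h1 ⁻¹) h0)))
        where
        mcong : ∀ {Γ i j} D → Γ ⊢ i ≐ j → Γ ⊢ modulus i D ≐ modulus j D
        mcong D e = s-cong (·-cong (s-cong e) (≐R D))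

  -- The old parameter d may be too small for the new entry, or leave the moduli without a common
  -- solution, so all entries are coded afresh with a larger parameter D.
  append : ∀ {Γ ψ} c a d n t → Γ ⊢ pr c a d →
    (∀ c' {Δ} → Γ ⊆ Δ → (∀ u v {Θ} → Δ ⊆ Θ → Θ ⊢ le u n → Θ ⊢ B c u v → Θ ⊢ B c' u v) → Δ ⊢ B c' (`s n) t → Δ ⊢ ψ) → Γ ⊢ ψ
  append {Γ} {ψ} c a d n t p k = common (`s n) λ g s hg →
    -- The factorial makes D divisible by all differences of indices up to n + 1. The factor a + t +
    -- 1 makes D larger than t and than the old entries, which are remainders of a.
    let D = `s g `· `s (a `+ t)
        module X = CRT a d D (`s n)
    in ∃E (`∃ Φ) (`s n ∷ˢ X.ρ) (→E (X.coded (λ r s' l → div-· (`s r) (`s g) (`s (a `+ t)) (hg r s' l)) (`s n)) (le-refl (`s n))) λ a' →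
       ∃E Φ (a' ∷ˢ `s n ∷ˢ X.ρ) h0 λ P →
       crt a' P (`s (`s n) `· D) t (X.coded-inv (`s n) a' P h0 (`s n) (le-refl (`s n)) (le-refl (`s n))) λ w s₁ y →
       pr-ex (a' `+ (P `· w)) D λ c' →
       k c' (there ∘ s₁ ∘ there ∘ there ∘ s)
         (λ u v s₂ l b → cutN (B-at c u v a d (wkN (s₂ ∘ there ∘ s₁ ∘ there ∘ there ∘ s) p) b)
           (BI c' u v _ D (wkN (there ∘ s₂) h0)
             (keep a' P (modulus u D) v w (X.coded-div (`s n) a' P (wkN (there ∘ s₂ ∘ there ∘ s₁) h0) u (le-s u n (l ↑)))
               (X.coded-val (`s n) a' P (wkN (there ∘ s₂ ∘ there ∘ s₁) h0) u v (le-s u n (l ↑)) (∧E₂ h0) (∧E₁ h0)))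
             (small D u v (le-trans v a D (valE a (modulus u d) v (∧E₁ h0) λ q → leI v a (q `· modulus u d) (+comm _ _ ∙ (h0 ⁻¹)))
               (big g a (le-+ a t))))))
         (BI c' (`s n) t _ D h0 (y ↑) (small D (`s n) t (big g t (le-+ʳ a t))))
    where
    small : ∀ {Γ} D u v → Γ ⊢ le v D → Γ ⊢ lt v (modulus u D)
    small D u v l = le-s v (`s u `· D) (le-trans v D (`s u `· D) l (le-resp (≐R D) (·comm D (`s u)) (le-·s D u)))
    big : ∀ {Γ} g x → Γ ⊢ le x (a `+ t) → Γ ⊢ le x (`s g `· `s (a `+ t))
    big g x l = le-trans x (a `+ t) (`s g `· `s (a `+ t)) l (le-trans (a `+ t) (`s (a `+ t)) (`s g `· `s (a `+ t)) (le-suc (a `+ t))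
      (le-resp (≐R (`s (a `+ t))) (·comm (`s (a `+ t)) (`s g)) (le-·s (`s (a `+ t)) g)))

  singleton : ∀ {Γ ψ} t → (∀ c → B c `0 t ∷ Γ ⊢ ψ) → Γ ⊢ ψ
  -- For a = d = t the modulus at index 0 is t + 1, and t is its own remainder.
  singleton t k = pr-ex t t λ c → cutN (BI c `0 t t t h0 (valI t (modulus `0 t) t `0 ((+-cong (0· _) (≐R t) ∙ 0+ t) ⁻¹))
    (le-s t (`s `0 `· t) (le-resp (≐R t) (·comm t (`s `0)) (le-·s t `0)))) (wkN (λ { (here e) → here e ; (there m) → there (there m) }) (k c))

-- Decidable equality of syntax, by an encoding into binary trees

data Tree : Set where
  leaf : ℕ → Tree
  fork : Tree → Tree → Tree

_≟ᵗ_ : DecidableEquality Tree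
leaf m   ≟ᵗ leaf n   = map′ (cong leaf) (λ { refl → refl }) (m N.≟ n)
leaf m   ≟ᵗ fork _ _ = no λ ()
fork _ _ ≟ᵗ leaf n   = no λ ()
fork a b ≟ᵗ fork c d with a ≟ᵗ c | b ≟ᵗ d
... | yes refl | yes refl = yes refl
... | no ne    | _        = no λ { refl → ne refl }
... | _        | no ne    = no λ { refl → ne refl }

encT : Tm → Tree
encT (var n)  = fork (leaf 0) (leaf n)
encT `0       = leaf 0
encT (`s t)   = fork (leaf 1) (encT t)
encT (t `+ u) = fork (leaf 2) (fork (encT t) (encT u))
encT (t `· u) = fork (leaf 3) (fork (encT t) (encT u))

decT : Tree → Tm
decT (fork (leaf 0) (leaf n))   = var n
decT (fork (leaf 1) t)          = `s (decT t)
decT (fork (leaf 2) (fork t u)) = decT t `+ decT u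
decT (fork (leaf 3) (fork t u)) = decT t `· decT u
decT _                          = `0

decT-enc : ∀ t → decT (encT t) ≡ t
decT-enc (var n)  = refl
decT-enc `0       = refl
decT-enc (`s t)   = cong `s (decT-enc t)
decT-enc (t `+ u) = cong₂ _`+_ (decT-enc t) (decT-enc u)
decT-enc (t `· u) = cong₂ _`·_ (decT-enc t) (decT-enc u)

encF : Fm → Tree
encF (s ≐ t)     = fork (leaf 0) (fork (encT s) (encT t))
encF (s ≺ t)     = fork (leaf 1) (fork (encT s) (encT t))
encF (RTC φ s t) = fork (leaf 2) (fork (encF φ) (fork (encT s) (encT t)))
encF (`¬ φ)      = fork (leaf 3) (encF φ)
encF (φ `∧ ψ)    = fork (leaf 4) (fork (encF φ) (encF ψ))
encF (φ `∨ ψ)    = fork (leaf 5) (fork (encF φ) (encF ψ))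
encF (φ `→ ψ)    = fork (leaf 6) (fork (encF φ) (encF ψ))
encF (`∀ φ)      = fork (leaf 7) (encF φ)
encF (`∃ φ)      = fork (leaf 8) (encF φ)

decF : Tree → Fm
decF (fork (leaf 0) (fork s t))          = decT s ≐ decT t
decF (fork (leaf 1) (fork s t))          = decT s ≺ decT t
decF (fork (leaf 2) (fork φ (fork s t))) = RTC (decF φ) (decT s) (decT t)
decF (fork (leaf 3) φ)                   = `¬ (decF φ)
decF (fork (leaf 4) (fork φ ψ))          = decF φ `∧ decF ψ
decF (fork (leaf 5) (fork φ ψ))          = decF φ `∨ decF ψ
decF (fork (leaf 6) (fork φ ψ))          = decF φ `→ decF ψ
decF (fork (leaf 7) φ)                   = `∀ (decF φ)
decF (fork (leaf 8) φ)                   = `∃ (decF φ)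
decF _                                   = ⊥'

decF-enc : ∀ φ → decF (encF φ) ≡ φ
decF-enc (s ≐ t)     = cong₂ _≐_ (decT-enc s) (decT-enc t)
decF-enc (s ≺ t)     = cong₂ _≺_ (decT-enc s) (decT-enc t)
decF-enc (RTC φ s t) rewrite decF-enc φ | decT-enc s | decT-enc t = refl
decF-enc (`¬ φ)      = cong `¬ (decF-enc φ)
decF-enc (φ `∧ ψ)    = cong₂ _`∧_ (decF-enc φ) (decF-enc ψ)
decF-enc (φ `∨ ψ)    = cong₂ _`∨_ (decF-enc φ) (decF-enc ψ)
decF-enc (φ `→ ψ)    = cong₂ _`→_ (decF-enc φ) (decF-enc ψ)
decF-enc (`∀ φ)      = cong `∀ (decF-enc φ)
decF-enc (`∃ φ)      = cong `∃ (decF-enc φ)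

_≟T_ : DecidableEquality Tm
s ≟T t = map′ (λ e → trans (sym (decT-enc s)) (trans (cong decT e) (decT-enc t))) (cong encT) (encT s ≟ᵗ encT t)

_≟F_ : DecidableEquality Fm
φ ≟F ψ = map′ (λ e → trans (sym (decF-enc φ)) (trans (cong decF e) (decF-enc ψ))) (cong encF) (encF φ ≟ᵗ encF ψ)

-- RTC-paths coded by the β-function, with their length as a parameter

STEP LEN BR : Fm → Fm
-- under u, c, n, s, t: a χ-step between the entries u and u + 1 of c
STEP χ = `∃ (`∃ (B (var 3) (var 2) (var 1) `∧ B (var 3) (`s (var 2)) (var 0) `∧ fsub (var 0 ∷ˢ var 1 ∷ˢ up 7) χ))
-- under n, s, t: a χ-path of length n from s to t
LEN χ  = `∃ (B (var 0) `0 (var 2) `∧ B (var 0) (var 1) (var 3) `∧ `∀ (lt (var 0) (var 2) `→ STEP χ))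
-- under s, t: the body of β (RTC φ s t), for χ = β φ
BR χ   = (var 0 ≐ var 1) `∨ `∃ (`∃ (B (var 0) `0 (var 2) `∧ B (var 0) (`s (var 1)) (var 3) `∧ `∀ ((var 0 ≤' var 2) `→ STEP χ)))

β-RTC : ∀ φ s t → β (RTC φ s t) ≡ fsub (s ∷ˢ t ∷ˢ var) (BR (β φ))
β-RTC φ s t = cong₂ (λ a b → (s ≐ t) `∨ `∃ (`∃ (a `∧ b))) (cong (B (var 0) `0) (sym (tsub-fuse s)))
  (cong₂ _`∧_ (cong (B (var 0) (`s (var 1))) (sym (tsub-fuse t)))
    (cong (λ a → `∀ ((var 0 ≤' var 2) `→ `∃ (`∃ (B (var 3) (var 2) (var 1) `∧ B (var 3) (`s (var 2)) (var 0) `∧ a))))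
      (trans (fsub-ext (β φ) λ { zero → refl ; (suc zero) → refl ; (suc (suc n)) → refl }) (sym (fsub-fuse (β φ))))))

up-ren : ∀ t → ren suc (ren suc (ren suc (ren suc (ren suc (ren suc (ren suc t)))))) ≡ tsub (up 7) t
up-ren t = trans (tsub-fuse (ren suc (ren suc (ren suc (ren suc (ren suc t))))))
  (trans (tsub-fuse (ren suc (ren suc (ren suc (ren suc t))))) (trans (tsub-fuse (ren suc (ren suc (ren suc t))))
  (trans (tsub-fuse (ren suc (ren suc t))) (trans (tsub-fuse (ren suc t)) (tsub-fuse t)))))

BR-sub : ∀ {σ} χ → fsub (lift (lift σ)) (BR χ) ≡ BR (fsub (lift (lift σ)) χ)
BR-sub {σ} χ = cong (λ a → (var 0 ≐ var 1) `∨ `∃ (`∃ (B (var 0) `0 (var 2) `∧ B (var 0) (`s (var 1)) (var 3) `∧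
    `∀ ((var 0 ≤' var 2) `→ `∃ (`∃ (B (var 3) (var 2) (var 1) `∧ B (var 3) (`s (var 2)) (var 0) `∧ a))))))
  (trans (fsub-fuse χ) (trans (fsub-ext χ λ { zero → refl ; (suc zero) → refl
     ; (suc (suc n)) → trans (up-ren (σ n)) (sym (trans (tsub-fuse (ren suc (σ n))) (tsub-fuse (σ n)))) }) (sym (fsub-fuse χ))))

β-sub : ∀ {σ} φ → β (fsub σ φ) ≡ fsub σ (β φ)
β-sub (s ≐ t)     = refl
β-sub (s ≺ t)     = refl
β-sub {σ} (RTC φ s t) = trans (β-RTC _ (tsub σ s) (tsub σ t)) (trans
  (cong (fsub (tsub σ s ∷ˢ tsub σ t ∷ˢ var)) (trans (cong BR (β-sub φ)) (sym (BR-sub {σ} (β φ)))))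
  (trans (fsub-fuse (BR (β φ))) (trans (fsub-ext {τ = tsub σ s ∷ˢ tsub σ t ∷ˢ σ} (BR (β φ)) λ { zero → refl ; (suc zero) → refl
      ; (suc (suc n)) → trans (tsub-fuse (ren suc (σ n))) (trans (tsub-fuse (σ n)) (tsub-id (σ n))) })
  (trans (sym (fsub-ext (BR (β φ)) λ { zero → refl ; (suc zero) → refl ; (suc (suc n)) → refl }))
  (trans (sym (fsub-fuse (BR (β φ)))) (sym (cong (fsub σ) (β-RTC φ s t))))))))
β-sub (`¬ φ)      = cong `¬ (β-sub φ)
β-sub (φ `∧ ψ)    = cong₂ _`∧_ (β-sub φ) (β-sub ψ)
β-sub (φ `∨ ψ)    = cong₂ _`∨_ (β-sub φ) (β-sub ψ)
β-sub (φ `→ ψ)    = cong₂ _`→_ (β-sub φ) (β-sub ψ)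
β-sub (`∀ φ)      = cong `∀ (β-sub φ)
β-sub (`∃ φ)      = cong `∃ (β-sub φ)

β-fuse : ∀ {σ η η'} φ → (∀ n → occF n φ ≡ true → tsub η (σ n) ≡ η' n) → fsub η (β (fsub σ φ)) ≡ fsub η' (β φ)
β-fuse {σ} {η} {η'} φ h = trans (sym (β-sub (fsub σ φ))) (trans (cong β (trans (fsub-fuse φ) (fsub-occ φ h))) (β-sub φ))

βInterp : Interp TPA
βInterp = record
  { tr = β ; tr-¬ = λ _ → refl ; tr-∧ = λ _ _ → refl ; tr-∨ = λ _ _ → refl ; tr-→ = λ _ _ → refl ; tr-∀ = λ _ → refl ; tr-∃ = λ _ → refl
  ; Val = λ Γ t η v → tsub η t ≡ v ; Val-wk = λ _ e → e ; Val-var = λ _ _ → refl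
  ; Val-ex = λ t η k → k (tsub η t) id refl
  ; sub→ = λ φ h → PA.cast (β-fuse φ h)
  ; sub← = λ φ h → PA.cast (sym (β-fuse φ h))
  ; eq→ = λ { refl refl d → d } ; eq← = λ { refl refl d → d } }

module Len (χ : Fm) (η : Subst) where
  open PA
  open Beta

  stepfm : Tm → Tm → Fm
  stepfm v w = fsub (w ∷ˢ v ∷ˢ η) χ
  lenfm : Tm → Tm → Tm → Fm
  lenfm n s t = fsub (n ∷ˢ s ∷ˢ t ∷ˢ η) (LEN χ)
  rtcfm : Tm → Tm → Fm
  rtcfm s t = fsub (s ∷ˢ t ∷ˢ η) (BR χ)
  private
    S₂ : Fm
    S₂ = B (var 3) (var 2) (var 1) `∧ B (var 3) (`s (var 2)) (var 0) `∧ fsub (var 0 ∷ˢ var 1 ∷ˢ up 7) χ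
    L₁ : Fm
    L₁ = B (var 0) `0 (var 2) `∧ B (var 0) (var 1) (var 3) `∧ `∀ (lt (var 0) (var 2) `→ STEP χ)
    R₁ : Fm
    R₁ = B (var 0) `0 (var 2) `∧ B (var 0) (`s (var 1)) (var 3) `∧ `∀ ((var 0 ≤' var 2) `→ STEP χ)
    inner : ∀ v w u c n s t → fsub (w ∷ˢ v ∷ˢ u ∷ˢ c ∷ˢ n ∷ˢ s ∷ˢ t ∷ˢ η) (fsub (var 0 ∷ˢ var 1 ∷ˢ up 7) χ) ≡ stepfm v w
    inner v w u c n s t = trans (fsub-fuse χ) (fsub-ext χ λ { zero → refl ; (suc zero) → refl ; (suc (suc k)) → refl })

  stepI : ∀ {Γ} u c n s t v w → Γ ⊢ B c u v → Γ ⊢ B c (`s u) w → Γ ⊢ stepfm v w → Γ ⊢ fsub (u ∷ˢ c ∷ˢ n ∷ˢ s ∷ˢ t ∷ˢ η) (STEP χ)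
  stepI u c n s t v w x y z = ∃I (`∃ S₂) (u ∷ˢ c ∷ˢ n ∷ˢ s ∷ˢ t ∷ˢ η) v (∃I S₂ (v ∷ˢ u ∷ˢ c ∷ˢ n ∷ˢ s ∷ˢ t ∷ˢ η) w
    (∧I x (∧I y (cast (sym (inner v w u c n s t)) z))))

  stepE : ∀ {Γ ψ} u c n s t → Γ ⊢ fsub (u ∷ˢ c ∷ˢ n ∷ˢ s ∷ˢ t ∷ˢ η) (STEP χ) →
    (∀ v w {Δ} → Γ ⊆ Δ → Δ ⊢ B c u v → Δ ⊢ B c (`s u) w → Δ ⊢ stepfm v w → Δ ⊢ ψ) → Γ ⊢ ψ
  stepE u c n s t d k = ∃E (`∃ S₂) (u ∷ˢ c ∷ˢ n ∷ˢ s ∷ˢ t ∷ˢ η) d λ v → ∃E S₂ (v ∷ˢ u ∷ˢ c ∷ˢ n ∷ˢ s ∷ˢ t ∷ˢ η) h0 λ w →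
    k v w (there ∘ there) (∧E₁ h0) (∧E₁ (∧E₂ h0)) (cast (inner v w u c n s t) (∧E₂ (∧E₂ h0)))

  lenI : ∀ {Γ} n s t c → Γ ⊢ B c `0 s → Γ ⊢ B c n t →
    (∀ u {Δ} → Γ ⊆ Δ → Δ ⊢ lt u n → Δ ⊢ fsub (u ∷ˢ c ∷ˢ n ∷ˢ s ∷ˢ t ∷ˢ η) (STEP χ)) → Γ ⊢ lenfm n s t
  lenI n s t c x y f = ∃I L₁ (n ∷ˢ s ∷ˢ t ∷ˢ η) c (∧I x (∧I y
    (∀I (lt (var 0) (var 2) `→ STEP χ) (c ∷ˢ n ∷ˢ s ∷ˢ t ∷ˢ η) λ u → →I (f u there h0))))

  lenE : ∀ {Γ ψ} n s t → Γ ⊢ lenfm n s t →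
    (∀ c {Δ} → Γ ⊆ Δ → Δ ⊢ B c `0 s → Δ ⊢ B c n t →
      (∀ u {Θ} → Δ ⊆ Θ → Θ ⊢ lt u n → Θ ⊢ fsub (u ∷ˢ c ∷ˢ n ∷ˢ s ∷ˢ t ∷ˢ η) (STEP χ)) → Δ ⊢ ψ) → Γ ⊢ ψ
  lenE n s t d k = ∃E L₁ (n ∷ˢ s ∷ˢ t ∷ˢ η) d λ c → k c there (∧E₁ h0) (∧E₁ (∧E₂ h0))
    λ u w l → →E (∀E (lt (var 0) (var 2) `→ STEP χ) (c ∷ˢ n ∷ˢ s ∷ˢ t ∷ˢ η) (∧E₂ (∧E₂ (hyp (w (here refl))))) u) l

  B-val : ∀ {Γ} c i v w → Γ ⊢ v ≐ w → Γ ⊢ B c i v → Γ ⊢ B c i w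
  B-val c i v w e = ≐S (B (var 1) (var 2) (var 0)) (c ∷ˢ i ∷ˢ var) e

  len-zero : ∀ {Γ} s t → Γ ⊢ s ≐ t → Γ ⊢ lenfm `0 s t
  len-zero s t e = singleton s λ c → lenI `0 s t c h0 (B-val c `0 s t (e ↑) h0) λ u w l → lt-0 u l

  -- `append` keeps the entries up to n, so the old steps stay valid and only the step from r to the
  -- new last entry t has to be added.
  len-suc : ∀ {Γ} n s r t → Γ ⊢ lenfm n s r → Γ ⊢ stepfm r t → Γ ⊢ lenfm (`s n) s t
  len-suc n s r t d e = lenE n s r d λ c w₁ x y f → BE c `0 s x λ a b w₂ p _ _ → append c a b n t p λ c' w₃ old new →
    lenI (`s n) s t c' (old `0 s id (le-0 n) (wkN w₃ (wkN w₂ x))) new λ u w₄ l → le-split u n (le-s⁻ u n l)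
      (stepE u c n s r (f u (there ∘ w₄ ∘ w₃ ∘ w₂) h0) λ v w w₅ p q z →
        stepI u c' (`s n) s t v w (old u v (w₅ ∘ there ∘ w₄) (wkN w₅ (lt⇒le u n h0)) p) (old (`s u) w (w₅ ∘ there ∘ w₄) (wkN w₅ h0) q) z)
      (stepI u c' (`s n) s t r t
        (B-cong c' n u r (h0 ⁻¹) (old n r (there ∘ w₄) (le-refl n) (wkN (there ∘ w₄ ∘ w₃ ∘ w₂) y)))
        (B-cong c' (`s n) (`s u) t (s-cong (h0 ⁻¹)) (wkN (there ∘ w₄) new))
        (wkN (there ∘ w₄ ∘ w₃ ∘ w₂ ∘ w₁) e))

  -- Shortening a path needs no new code: c is read with one entry fewer.
  len-inv : ∀ {Γ ψ} n s t → Γ ⊢ lenfm n s t → (∀ {Δ} → Γ ⊆ Δ → Δ ⊢ s ≐ t → Δ ⊢ ψ) →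
    (∀ m z {Δ} → Γ ⊆ Δ → Δ ⊢ n ≐ `s m → Δ ⊢ lenfm m s z → Δ ⊢ stepfm z t → Δ ⊢ ψ) → Γ ⊢ ψ
  len-inv n s t d k l = lenE n s t d λ c w x y f → cases n
    (k (there ∘ w) (B-fun c `0 s t (x ↑) (B-cong c n `0 t h0 (y ↑))))
    λ m → stepE m c n s t (f m there (le-resp (≐R (`s m)) (h0 ⁻¹) (le-refl (`s m)))) λ v v' w₂ p q z →
      l m v (w₂ ∘ there ∘ w) (wkN w₂ h0)
        (lenI m s v c (wkN (w₂ ∘ there) x) p λ u w₃ lu →
          stepE u c n s t (f u (w₃ ∘ w₂ ∘ there) (le-resp (≐R (`s u)) (wkN w₃ (wkN w₂ h0) ⁻¹) (le-trans (`s u) m (`s m) lu (le-suc m))))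
            λ a b w₄ p' q' z' → stepI u c m s v a b p' q' z')
        (≐S χ (v ∷ˢ η) (B-fun c (`s m) v' t q (B-cong c n (`s m) t (wkN w₂ h0) (wkN (w₂ ∘ there) y))) z)

  len⇒rtc : ∀ {Γ} n s t → Γ ⊢ lenfm n s t → Γ ⊢ rtcfm s t
  len⇒rtc n s t d = lenE n s t d λ c w x y f → cases n
    (∨I₁ (B-fun c `0 s t (x ↑) (B-cong c n `0 t h0 (y ↑))))
    λ m → ∨I₂ (∃I (`∃ R₁) (s ∷ˢ t ∷ˢ η) m (∃I R₁ (m ∷ˢ s ∷ˢ t ∷ˢ η) c (∧I (x ↑) (∧I (B-cong c n (`s m) t h0 (y ↑))
      (∀I ((var 0 ≤' var 2) `→ STEP χ) (c ∷ˢ m ∷ˢ s ∷ˢ t ∷ˢ η) λ u → →I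
        (stepE u c n s t (f u (there ∘ there) (le-resp (≐R (`s u)) (h1 ⁻¹) (∨E h0 (le-s u m (lt⇒le u m (≺⇒lt u m h0)))
            (le-resp (s-cong (h0 ⁻¹)) (≐R (`s m)) (le-refl (`s m))))))
          λ a b w₄ p' q' z' → stepI u c m s t a b p' q' z')))))) 

  rtc⇒len : ∀ {Γ} s t → Γ ⊢ rtcfm s t → Γ ⊢ fsub (s ∷ˢ t ∷ˢ η) (`∃ (LEN χ))
  rtc⇒len s t d = ∨E d (∃I (LEN χ) (s ∷ˢ t ∷ˢ η) `0 (len-zero s t h0))
    (∃E (`∃ R₁) (s ∷ˢ t ∷ˢ η) h0 λ m → ∃E R₁ (m ∷ˢ s ∷ˢ t ∷ˢ η) h0 λ c →
      ∃I (LEN χ) (s ∷ˢ t ∷ˢ η) (`s m) (lenI (`s m) s t c (∧E₁ h0) (∧E₁ (∧E₂ h0)) λ u w l →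
        stepE u c m s t (→E (∀E ((var 0 ≤' var 2) `→ STEP χ) (c ∷ˢ m ∷ˢ s ∷ˢ t ∷ˢ η) (∧E₂ (∧E₂ (hyp (w (here refl))))) u)
            (le-split u m (le-s⁻ u m l) (∨I₁ (lt⇒≺ u m h0)) (∨I₂ h0)))
          λ a b w₄ p' q' z' → stepI u c (`s m) s t a b p' q' z'))

  rtc-refl : ∀ {Γ} s → Γ ⊢ rtcfm s s
  rtc-refl s = ∨I₁ (≐R s)

  rtc-snoc : ∀ {Γ} s r t → Γ ⊢ rtcfm s r → Γ ⊢ stepfm r t → Γ ⊢ rtcfm s t
  rtc-snoc s r t d e = ∃E (LEN χ) (s ∷ˢ r ∷ˢ η) (rtc⇒len s r d) λ n → len⇒rtc (`s n) s t (len-suc n s r t h0 (e ↑))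

-- Finitely many trace objects and the choice of their quantities

yes-intro : ∀ {P : Set} (d : Dec P) → P → isYes d ≡ true
yes-intro (yes _) _ = refl
yes-intro (no np) p = contradiction p np

yes-elim : ∀ {P : Set} (d : Dec P) → isYes d ≡ true → P
yes-elim (yes p) _ = p

module Choice (T : Theory) {A : Set} (_≟_ : DecidableEquality A) where
  open Theory T

  _[_:=_] : (A → Tm) → A → Tm → A → Tm
  (Z [ τ := x ]) τ' with τ ≟ τ'
  ... | yes _ = x
  ... | no _  = Z τ'

  -- An existential statement of the object theory can only be eliminated into a goal. The values
  -- therefore arrive one by one in continuation form and are collected into a single function,
  -- which is 0 outside the list.
  choose : ∀ {Γ ψ} (Q : List Fm → A → Tm → Set) → (∀ {Δ Θ τ x} → Δ ⊆ Θ → Q Δ τ x → Q Θ τ x) → ∀ Φ →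
    (∀ τ → τ ∈ Φ → ∀ {Δ} → Γ ⊆ Δ → (∀ x {Θ} → Δ ⊆ Θ → Q Θ τ x → Θ ⊢ ψ) → Δ ⊢ ψ) →
    (∀ Z {Δ} → Γ ⊆ Δ → (∀ τ → τ ∈ Φ → Q Δ τ (Z τ)) → Δ ⊢ ψ) → Γ ⊢ ψ
  choose Q mono []      f k = k (λ _ → `0) id λ _ ()
  choose Q mono (τ ∷ Φ) f k = f τ (here refl) id λ x w q →
    choose Q mono Φ (λ τ' m w' → f τ' (there m) (w' ∘ w)) λ Z {Δ} w' h → k (Z [ τ := x ]) (w' ∘ w) λ τ' m → set Z Δ x τ' m (mono w' q) h
    where
    set : ∀ Z Δ x τ' → τ' ∈ τ ∷ Φ → Q Δ τ x → (∀ τ → τ ∈ Φ → Q Δ τ (Z τ)) → Q Δ τ' ((Z [ τ := x ]) τ')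
    set Z Δ x τ' m q h with τ ≟ τ'
    ... | yes refl = q
    set Z Δ x τ' (here e)  q h | no ne = contradiction (sym e) ne
    set Z Δ x τ' (there m) q h | no ne = h τ' m

-- Cyclic proofs whose traces run through finitely many objects are sound in T,
-- provided each rule is, with respect to the quantities attached to the objects.
module TraceSound (T : Theory) (In : Interp T) {R : Seq → List Seq → Set} (TS : TraceSys R)
  (_≟_ : DecidableEquality (TraceSys.Obj TS)) (Valid? : ∀ S o → Dec (TraceSys.Valid TS S o))
  (Step? : ∀ {S Ps} (r : R S Ps) S' a b → Dec (TraceSys.Step TS r S' a b))
  (Prog? : ∀ {S Ps} (r : R S Ps) S' a b → Dec (TraceSys.Prog TS r S' a b))
  (measure : TraceSys.Obj TS → Fm) (objs : List (TraceSys.Obj TS))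
  where
  open TraceSys TS
  open Theory T
  open LKSound T In
  open DecMem _≟_ using (_∈?_)

  Measured : List Fm → Seq → Subst → (Obj → Tm) → Set
  Measured Γ S η X = ∀ o → o ∈ objs → Valid S o → Γ ⊢ fsub (X o ∷ˢ η) (measure o)

  record Decrease (Γ : List Fm) {S Ps} (r : R S Ps) (S' : Seq) (X Z : Obj → Tm) : Set where
    field
      weakly   : ∀ a b → a ∈ objs → b ∈ objs → Valid S a → Valid S' b → Step r S' a b → Γ ⊢ le (Z b) (X a)
      strictly : ∀ a b → a ∈ objs → b ∈ objs → Valid S a → Valid S' b → Prog r S' a b → Γ ⊢ lt (Z b) (X a)

  RuleSound : ∀ {S Ps} → R S Ps → Set
  RuleSound {S} {Ps} r = ∀ {Γ η} X → Measured Γ S η X →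
    (∀ S' → S' ∈ Ps → ∀ {Δ} → Γ ⊆ Δ → ∀ η' Z → Measured Δ S' η' Z → Decrease Δ r S' X Z → True Δ S' η') → True Γ S η

  module _ (G : Graph R)
    (good : (p : Path G) → Σ ℕ λ k₀ → Σ (ℕ → Obj) λ τ → IsTrace TS G p k₀ τ × InfProg TS G p k₀ τ × (∀ k → k₀ ≤ k → τ k ∈ objs))
    (ruleSound : ∀ i → RuleSound (Graph.rule G i)) where
    open Graph G
    private
      n = length objs
      obj : Fin n → Obj
      obj = List.lookup objs

      index-of : ∀ {o} → Dec (o ∈ objs) → Fin n → Fin n
      index-of (yes m) d = Any.index m
      index-of (no _)  d = d
      can : Obj → Fin n → Fin n
      can o = index-of (o ∈? objs)
      obj-can : ∀ {o} → o ∈ objs → ∀ d → obj (can o d) ≡ o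
      obj-can {o} m d = go (o ∈? objs)
        where
        go : (p : Dec (o ∈ objs)) → obj (index-of p d) ≡ o
        go (yes m') = sym (Anyₚ.lookup-index m')
        go (no nm)  = contradiction m nm
      can-irr : ∀ {o} → o ∈ objs → ∀ d e → can o d ≡ can o e
      can-irr {o} m d e = go (o ∈? objs)
        where
        go : (p : Dec (o ∈ objs)) → index-of p d ≡ index-of p e
        go (yes _) = refl
        go (no nm) = contradiction m nm
      -- An object may be listed in `objs` repeatedly. It is represented by the one index that the
      -- membership test returns, so that it has a single quantity.
      Canonical : Fin n → Set
      Canonical t = can (obj t) t ≡ t
      can-canonical : ∀ {o} → o ∈ objs → ∀ d → Canonical (can o d)
      can-canonical {o} m d = trans (cong (λ x → can x (can o d)) (obj-can m d)) (can-irr m _ _)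

      ValidAt : Fin size → Fin n → Set
      ValidAt i t = Canonical t × Valid (node i) (obj t)
      validAt? : ∀ i t → Dec (ValidAt i t)
      validAt? i t = (can (obj t) t F.≟ t) ×-dec Valid? (node i) (obj t)
      stp? : ∀ i j t u → Dec ((ValidAt i t × ValidAt j u) × Step (rule i) (node j) (obj t) (obj u))
      stp? i j t u = (validAt? i t ×-dec validAt? j u) ×-dec Step? (rule i) (node j) (obj t) (obj u)
      prg? : ∀ i j t u → Dec ((ValidAt i t × ValidAt j u) × Prog (rule i) (node j) (obj t) (obj u))
      prg? i j t u = (validAt? i t ×-dec validAt? j u) ×-dec Prog? (rule i) (node j) (obj t) (obj u)

      good' : ∀ (at : ℕ → Fin size) → (∀ k → at (suc k) ∈ prem (at k)) → Σ ℕ λ k₀ → Σ (ℕ → Fin n) λ τ →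
        (∀ k → k₀ ≤ k → isYes (stp? (at k) (at (suc k)) (τ k) (τ (suc k))) ≡ true) ×
        (∀ m → ∃ λ k → m ≤ k × k₀ ≤ k × isYes (prg? (at k) (at (suc k)) (τ k) (τ (suc k))) ≡ true)
      good' at st with good (record { at = at ; step = st })
      ... | k₀ , τ , tr , pr , inO = k₀ , τ' ,
          (λ k h → yes-intro (stp? _ _ _ _) ((v k h , v (suc k) (Nₚ.m≤n⇒m≤1+n h)) , lift₂ (Step (rule (at k)) (node (at (suc k)))) k h (proj₂ (tr k h)))) ,
          λ m → let k , a , h , p = pr m in k , a , h ,
            yes-intro (prg? _ _ _ _) ((v k h , v (suc k) (Nₚ.m≤n⇒m≤1+n h)) , lift₂ (Prog (rule (at k)) (node (at (suc k)))) k h p)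
        where
        d₀ : Fin n
        d₀ = Any.index (inO k₀ Nₚ.≤-refl)
        τ' : ℕ → Fin n
        τ' k = can (τ k) d₀
        objτ : ∀ k → k₀ ≤ k → obj (τ' k) ≡ τ k
        objτ k h = obj-can (inO k h) d₀
        v : ∀ k → k₀ ≤ k → ValidAt (at k) (τ' k)
        v k h = can-canonical (inO k h) d₀ , subst (Valid (node (at k))) (sym (objτ k h)) (proj₁ (tr k h))
        lift₂ : ∀ (Q : Obj → Obj → Set) k → k₀ ≤ k → Q (τ k) (τ (suc k)) → Q (obj (τ' k)) (obj (τ' (suc k)))
        lift₂ Q k h = subst₂ Q (sym (objτ k h)) (sym (objτ (suc k) (Nₚ.m≤n⇒m≤1+n h)))

      module So = Soundness T In size node prem n (λ i j t u → isYes (stp? i j t u)) (λ i j t u → isYes (prg? i j t u)) good'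
        (λ i t → isYes (validAt? i t)) (measure ∘ obj)

      value : Vec Tm n → Obj → Tm
      value xs o = go (o ∈? objs)
        where
        go : Dec (o ∈ objs) → Tm
        go (yes m) = V.lookup xs (Any.index m)
        go (no _)  = `0

      value-can : ∀ xs {o} → o ∈ objs → ∀ d → value xs o ≡ V.lookup xs (can o d)
      value-can xs {o} m d with o ∈? objs
      ... | yes _ = refl
      ... | no nm = contradiction m nm

      obj∈ : ∀ t → obj t ∈ objs
      obj∈ t = ∈ₚ.∈-lookup t

      value-at : ∀ xs t → Canonical t → value xs (obj t) ≡ V.lookup xs t
      value-at xs t c = trans (value-can xs (obj∈ t) t) (cong (V.lookup xs) c)

      local : So.Local
      local i {Γ} xs ih η {Δ} w mh = ruleSound i (value xs) meas prems
        where
        meas : Measured Δ (node i) η (value xs)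
        meas o m v = cast (cong₂ (λ x o' → fsub (x ∷ˢ η) (measure o')) (sym (value-can xs m d)) (obj-can m d))
            (mh t (yes-intro (validAt? i t) (can-canonical m d , subst (Valid (node i)) (sym (obj-can m d)) v)))
          where
          d : Fin n
          d = Any.index m
          t = can o d
        prems : ∀ S' → S' ∈ map node (prem i) → ∀ {Θ} → Δ ⊆ Θ → ∀ η' Z → Measured Θ S' η' Z → Decrease Θ (rule i) S' (value xs) Z → True Θ S' η'
        prems S' m {Θ} s η' Z mZ dec with ∈ₚ.∈-map⁻ node m
        ... | j , j∈ , refl = ih j j∈ (s ∘ w) zs
              (λ t u e → let ((c , v) , (c' , v')) , st = yes-elim (stp? i j t u) e in
                 cast (cong₂ le (sym (look u)) (value-at xs t c)) (Decrease.weakly dec (obj t) (obj u) (obj∈ t) (obj∈ u) v v' st))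
              (λ t u e → let ((c , v) , (c' , v')) , st = yes-elim (prg? i j t u) e in
                 cast (cong₂ lt (sym (look u)) (value-at xs t c)) (Decrease.strictly dec (obj t) (obj u) (obj∈ t) (obj∈ u) v v' st))
              η' id (λ t e → cast (cong (λ x → fsub (x ∷ˢ η') (measure (obj t))) (sym (look t))) (mZ (obj t) (obj∈ t) (proj₂ (yes-elim (validAt? j t) e))))
          where
          zs : Vec Tm n
          zs = V.tabulate (Z ∘ obj)
          look : ∀ u → V.lookup zs u ≡ Z (obj u)
          look u = Vₚ.lookup∘tabulate (Z ∘ obj) u

    sound : ∀ i {Γ η} X → Measured Γ (node i) η X → True Γ (node i) η
    sound i {Γ} {η} X m = So.sound local i (V.tabulate (X ∘ obj)) η id λ t e →
      cast (cong (λ x → fsub (x ∷ˢ η) (measure (obj t))) (sym (Vₚ.lookup∘tabulate (X ∘ obj) t))) (m (obj t) (obj∈ t) (proj₂ (yes-elim (validAt? i t) e)))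

-- Soundness of the cyclic RTC calculus in TPA, under the β-translation

lenAt : Fm → Fm
lenAt (RTC φ s t) = fsub (var 0 ∷ˢ ren suc s ∷ˢ ren suc t ∷ˢ up 1) (LEN (β φ))
lenAt _           = ⊥'

module RTCtoPA where
  open PA
  open LKSound TPA βInterp
  open DecMem _≟F_ using (_∈?_)

  isRTC? : ∀ φ → Dec (IsRTCFm φ)
  isRTC? (_ ≐ _)     = no λ ()
  isRTC? (_ ≺ _)     = no λ ()
  isRTC? (RTC _ _ _) = yes tt
  isRTC? (`¬ _)      = no λ ()
  isRTC? (_ `∧ _)    = no λ ()
  isRTC? (_ `∨ _)    = no λ ()
  isRTC? (_ `→ _)    = no λ ()
  isRTC? (`∀ _)      = no λ ()
  isRTC? (`∃ _)      = no λ ()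

  rtcStep? : ∀ {S Ps} (r : RTCRule S Ps) S' a b → Dec (rtcStep r S' a b)
  rtcStep? (lk _)      S' a b = a ≟F b
  rtcStep? (sub θ)     S' a b = a ≟F fsub θ b
  rtcStep? (axA _)     S' a b = a ≟F b
  rtcStep? RTCRule.refl      S' a b = a ≟F b
  rtcStep? (RTCRule.trans _) S' a b = a ≟F b
  rtcStep? (case {φ = φ} {s} {t} z _) S' a b = (a ≟F b) ⊎-dec ((a ≟F RTC φ s t) ×-dec (b ≟F RTC φ s (var z)))

  rtcProg? : ∀ {S Ps} (r : RTCRule S Ps) S' a b → Dec (rtcProg r S' a b)
  rtcProg? (lk _)      S' a b = no λ ()
  rtcProg? (sub θ)     S' a b = no λ ()
  rtcProg? (axA _)     S' a b = no λ ()
  rtcProg? RTCRule.refl      S' a b = no λ ()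
  rtcProg? (RTCRule.trans _) S' a b = no λ ()
  rtcProg? (case {φ = φ} {s} {t} z _) S' a b = (a ≟F RTC φ s t) ×-dec (b ≟F RTC φ s (var z))

  len : Fm → Subst → Tm → Tm → Tm → Fm
  len φ η = Len.lenfm (β φ) η

  len-eval : ∀ φ s t x η → fsub (x ∷ˢ η) (lenAt (RTC φ s t)) ≡ len φ η x (tsub η s) (tsub η t)
  len-eval φ s t x η = trans (fsub-fuse (LEN (β φ))) (fsub-ext (LEN (β φ))
    λ { zero → refl ; (suc zero) → ren-suc s ; (suc (suc zero)) → ren-suc t ; (suc (suc (suc n))) → refl })

  rtc-eval : ∀ φ s t η → sat η (RTC φ s t) ≡ Len.rtcfm (β φ) η (tsub η s) (tsub η t)
  rtc-eval φ s t η = trans (cong (fsub η) (β-RTC φ s t)) (trans (fsub-fuse (BR (β φ)))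
    (fsub-ext (BR (β φ)) λ { zero → refl ; (suc zero) → refl ; (suc (suc n)) → refl }))

  inst2-eval : ∀ φ r t η → sat η (inst2 φ r t) ≡ Len.stepfm (β φ) η (tsub η r) (tsub η t)
  inst2-eval φ r t η = trans (cong (sat η) (inst2-cons φ r t)) (β-fuse φ λ { zero _ → refl ; (suc zero) _ → refl ; (suc (suc n)) _ → refl })

  len-map : ∀ {Γ} χ η χ' η' n s t → (∀ v w → Len.stepfm χ η v w ≡ Len.stepfm χ' η' v w) → Γ ⊢ Len.lenfm χ η n s t → Γ ⊢ Len.lenfm χ' η' n s t
  len-map χ η χ' η' n s t e d = Len.lenE χ η n s t d λ c w x y f → Len.lenI χ' η' n s t c x y λ u w' l →
    Len.stepE χ η u c n s t (f u w' l) λ v v' w'' p q z → Len.stepI χ' η' u c n s t v v' p q (cast (e v v') z)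

  measure-sub : ∀ {Γ θ η η' x} τ → IsRTCFm τ → (∀ n → occF n τ ≡ true → tsub η (θ n) ≡ η' n) →
    Γ ⊢ fsub (x ∷ˢ η) (lenAt (fsub θ τ)) → Γ ⊢ fsub (x ∷ˢ η') (lenAt τ)
  measure-sub {Γ} {θ} {η} {η'} {x} (RTC φ s t) _ h d = cast (sym (len-eval φ s t x η'))
    (len-map (β (fsub (lift (lift θ)) φ)) η (β φ) η' x (tsub η' s) (tsub η' t)
      (λ v w → β-fuse φ λ { zero _ → refl ; (suc zero) _ → refl
         ; (suc (suc n)) o → trans (trans (ren-suc (ren suc (θ n))) (ren-suc (θ n))) (h n (∨-introˡ _ o)) })
      (cast (cong₂ (len (fsub (lift (lift θ)) φ) η x)
          (trans (tsub-fuse s) (tsub-occ s λ n o → h n (∨-introʳ (occF (suc (suc n)) φ) (∨-introˡ _ o))))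
          (trans (tsub-fuse t) (tsub-occ t λ n o → h n (∨-introʳ (occF (suc (suc n)) φ) (∨-introʳ (occT n s) o)))))
        (cast (len-eval _ (tsub θ s) (tsub θ t) x η) d)))

  measure-agree : ∀ {Γ η η' x} τ → IsRTCFm τ → (∀ n → occF n τ ≡ true → η n ≡ η' n) →
    Γ ⊢ fsub (x ∷ˢ η) (lenAt τ) → Γ ⊢ fsub (x ∷ˢ η') (lenAt τ)
  measure-agree {η = η} {x = x} τ i h d = measure-sub {θ = var} τ i h (cast (cong (fsub (x ∷ˢ η) ∘ lenAt) (sym (fsub-id τ))) d)

  has-length : ∀ {Γ ψ η} τ → IsRTCFm τ → Γ ⊢ sat η τ → (∀ x {Δ} → Γ ⊆ Δ → Δ ⊢ fsub (x ∷ˢ η) (lenAt τ) → Δ ⊢ ψ) → Γ ⊢ ψ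
  has-length {η = η} (RTC φ s t) _ d k = ∃E (LEN (β φ)) (tsub η s ∷ˢ tsub η t ∷ˢ η)
    (Len.rtc⇒len (β φ) η (tsub η s) (tsub η t) (cast (rtc-eval φ s t η) d)) λ x → k x there (cast (sym (len-eval φ s t x η)) h0)

  open Choice TPA _≟F_

  module Rules (objs : List Fm) where
    open TraceSound TPA βInterp RTCTrace _≟F_ (λ S o → (o ∈? ant S) ×-dec isRTC? o) rtcStep? rtcProg? lenAt objs public

    record Chosen {S Ps} (r : RTCRule S Ps) (S' : Seq) (η' : Subst) (X : Fm → Tm) (Δ : List Fm) (τ : Fm) (x : Tm) : Set where
      field
        measured : IsRTCFm τ → Δ ⊢ fsub (x ∷ˢ η') (lenAt τ)
        weakly   : ∀ a → a ∈ ant S → rtcStep r S' a τ → Δ ⊢ le x (X a)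
        strictly : ∀ a → a ∈ ant S → rtcProg r S' a τ → Δ ⊢ lt x (X a)

    module _ {S Ps} (r : RTCRule S Ps) {Γ} {η : Subst} (X : Fm → Tm)
      (prem : ∀ S' → S' ∈ Ps → ∀ {Δ} → Γ ⊆ Δ → ∀ η' Z → Measured Δ S' η' Z → Decrease Δ r S' X Z → True Δ S' η') where

      -- Lengths are not unique, so the quantity of a formula of the premise must be fixed with its
      -- ancestors in view. Either a value respecting all trace steps into τ is supplied, or no
      -- trace step leads to τ and any length of a path will do, as provided by the truth of τ.
      premise : ∀ S' → S' ∈ Ps → ∀ {Δ} → Γ ⊆ Δ → ∀ η' →
        (∀ τ → τ ∈ ant S' → Σ Tm (Chosen r S' η' X Δ τ) ⊎ (∀ a → a ∈ ant S → ¬ rtcStep r S' a τ × ¬ rtcProg r S' a τ)) → True Δ S' η'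
      premise S' m w η' opt {Θ} w' a b = choose (Chosen r S' η' X) (λ s q → record
            { measured = wkN s ∘ Chosen.measured q ; weakly = λ a m s' → wkN s (Chosen.weakly q a m s') ; strictly = λ a m s' → wkN s (Chosen.strictly q a m s') })
          (ant S') pick λ Z w″ q → prem S' m (w″ ∘ w' ∘ w) η' Z (λ o _ v → Chosen.measured (q o (proj₁ v)) (proj₂ v))
            (record { weakly = λ a b _ _ v v' s → Chosen.weakly (q b (proj₁ v')) a (proj₁ v) s
                    ; strictly = λ a b _ _ v v' s → Chosen.strictly (q b (proj₁ v')) a (proj₁ v) s })
            id (wkN w″ ∘ a) (wkN w″ ∘ b)
        where
        pick : ∀ τ → τ ∈ ant S' → ∀ {Δ} → Θ ⊆ Δ → (∀ x {Ξ} → Δ ⊆ Ξ → Chosen r S' η' X Ξ τ x → Ξ ⊢ ⊥') → Δ ⊢ ⊥'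
        pick τ m' s k with opt τ m'
        ... | inj₁ (x , q) = k x id (record
              { measured = wkN (s ∘ w') ∘ Chosen.measured q ; weakly = λ a m s' → wkN (s ∘ w') (Chosen.weakly q a m s')
              ; strictly = λ a m s' → wkN (s ∘ w') (Chosen.strictly q a m s') })
        ... | inj₂ none with isRTC? τ
        ...   | yes i = has-length τ i (wkN s (a m')) λ x s' d → k x s' (record
                  { measured = λ _ → d ; weakly = λ a m s → contradiction s (proj₁ (none a m)) ; strictly = λ a m s → contradiction s (proj₂ (none a m)) })
        ...   | no ni = k `0 id (record
                  { measured = λ i → contradiction i ni ; weakly = λ a m s → contradiction s (proj₁ (none a m)) ; strictly = λ a m s → contradiction s (proj₂ (none a m)) })

      stay : (∀ τ → τ ∈ ant S → IsRTCFm τ → Γ ⊢ fsub (X τ ∷ˢ η) (lenAt τ)) → ∀ S' → S' ∈ Ps → ∀ {Δ} → Γ ⊆ Δ → ∀ η' → Agree S η η' →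
        (∀ a τ → τ ∈ ant S' → rtcStep r S' a τ → a ≡ τ) → (∀ a τ → τ ∈ ant S' → ¬ rtcProg r S' a τ) → True Δ S' η'
      stay meas S' m w η' ag eq np = premise S' m w η' opt
        where
        opt : ∀ τ → τ ∈ ant S' → Σ Tm (Chosen r S' η' X _ τ) ⊎ (∀ a → a ∈ ant S → ¬ rtcStep r S' a τ × ¬ rtcProg r S' a τ)
        opt τ m' with τ ∈? ant S
        ... | yes m″ = inj₁ (X τ , record
                { measured = λ i → measure-agree τ i (λ n o → ag n (free-ant S m″ o)) (wkN w (meas τ m″ i))
                ; weakly = λ a _ s → cast (cong (le (X τ) ∘ X) (sym (eq a τ m' s))) (le-refl (X τ))
                ; strictly = λ a _ s → contradiction s (np a τ m') })
        ... | no nm = inj₂ λ a m → (λ s → nm (subst (_∈ ant S) (eq a τ m' s) m)) , np a τ m'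

    -- The immediate ancestor created by Case is therefore never also an old formula of the
    -- antecedent, which would claim the old quantity instead of the smaller one.
    fresh-RTC : ∀ {z φ s S} → Fresh z S → RTC φ s (var z) ∉ ant S
    fresh-RTC {z} {φ} {s} {S} f m = false≢true f (free-ant S m (∨-introʳ (occF (suc (suc z)) φ) (∨-introʳ (occT z s) (≡ᵇ-same z))))

    ruleSound : ∀ {S Ps} → (∀ {τ} → τ ∈ ant S → τ ∈ objs) → (r : RTCRule S Ps) → RuleSound r
    ruleSound inO r@(lk l) X meas prem = lkSound l λ S' m w η' ag →
      stay r X prem (λ τ m i → meas τ (inO m) (m , i)) S' m w η' ag (λ _ _ _ e → e) (λ _ _ _ ())
    ruleSound inO r@(sub {S} θ) {Γ} {η} X meas prem w a b =
      prem S (here refl) id (tsub η ∘ θ) (X ∘ fsub θ)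
        (λ τ _ v → measure-sub τ (proj₂ v) (λ _ _ → refl) (meas (fsub θ τ) (inO (∈ₚ.∈-map⁺ (fsub θ) (proj₁ v))) (∈ₚ.∈-map⁺ (fsub θ) (proj₁ v) , rtc-sub τ (proj₂ v))))
        (record { weakly = λ { _ b _ _ _ _ refl → le-refl (X (fsub θ b)) } ; strictly = λ _ _ _ _ _ _ () })
        w (λ {φ} m → cast (β-fuse φ λ _ _ → refl) (a (∈ₚ.∈-map⁺ (fsub θ) m)))
          (λ {φ} m → cast (cong `¬ (β-fuse φ λ _ _ → refl)) (b (∈ₚ.∈-map⁺ (fsub θ) m)))
      where
      rtc-sub : ∀ τ → IsRTCFm τ → IsRTCFm (fsub θ τ)
      rtc-sub (RTC _ _ _) _ = tt
    ruleSound inO (axA a-s0) X meas prem w a b = s0 (a (here refl))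
    ruleSound inO (axA a-inj) X meas prem w a b = ¬E (b (here refl)) (inj (a (here refl)))
    ruleSound inO (axA a-+0) X meas prem w a b = ¬E (b (here refl)) (+0 _)
    ruleSound inO (axA a-+s) X meas prem w a b = ¬E (b (here refl)) (+s _ _)
    ruleSound inO (axA a-nat) {Γ} {η} X meas prem {Δ} w a b = ¬E (b (here refl))
        (cast (sym (rtc-eval χ `0 (var 0) η)) (cast (ev (η 0)) (ind φ η (cast (sym (ev `0)) (Len.rtc-refl χ η `0))
          (λ x → cast (sym (ev (`s x))) (Len.rtc-snoc χ η `0 x (`s x) (cast (ev x) h0) (≐R _))) (η 0))))
      where
      χ φ : Fm
      χ = `s (var 1) ≐ var 0
      φ = fsub (`0 ∷ˢ var 0 ∷ˢ up 1) (BR χ)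
      ev : ∀ x → fsub (x ∷ˢ η) φ ≡ Len.rtcfm χ η `0 x
      ev x = refl
    ruleSound inO (RTCRule.refl {φ = φ} {s}) {η = η} X meas prem w a b = ¬E (b (here refl)) (cast (sym (rtc-eval φ s s η)) (Len.rtc-refl (β φ) η (tsub η s)))
    ruleSound inO r@(RTCRule.trans {φ = φ} {s} {t} x) {η = η} X meas prem w a b = ¬E (b (here refl)) (cast (sym (rtc-eval φ s t η))
        (Len.rtc-snoc (β φ) η (tsub η s) (tsub η x) (tsub η t)
          (cast (rtc-eval φ s x η) (raa (st _ (here refl) (there ∘ w) id (λ m → a m ↑) (h0 ▸ⁿ λ m → b (there m) ↑))))
          (cast (inst2-eval φ x t η) (raa (st _ (there (here refl)) (there ∘ w) id (λ m → a m ↑) (h0 ▸ⁿ λ m → b (there m) ↑))))))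
      where
      st : ∀ S' → S' ∈ _ → ∀ {Δ} → _ ⊆ Δ → True Δ S' η
      st S' m w = stay r X prem (λ τ m i → meas τ (inO m) (m , i)) S' m w η (λ _ _ → refl) (λ _ _ _ e → e) (λ _ _ _ ())
    ruleSound {S} inO r@(case {Γ = Φ} {Ψ} {φ} {s} {t} z f) {Γ} {η} X meas prem {Δ} w a b =
      -- The quantity `X τ₀` is the length of a coded path. If s = t results, the first premise
      -- applies; otherwise `X τ₀` = m + 1, the variable z denotes the last but one entry of the
      -- path, and the ancestor receives the quantity m.
      Len.len-inv (β φ) η (X τ₀) (tsub η s) (tsub η t) (cast (len-eval φ s t (X τ₀) η) (wkN w (meas τ₀ (inO (here refl)) (here refl , tt))))
        (λ w' e → stay r X prem meas' _ (here refl) (w' ∘ w) η (λ _ _ → refl)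
            (λ { a τ m (inj₁ e) → e ; a τ m (inj₂ (_ , refl)) → contradiction m fr₁ })
            (λ { a τ m (_ , refl) → fr₁ m })
            id (e ▸ λ m → wkN w' (a (there m))) (λ m → wkN w' (b m)))
        λ m z₀ {Θ} w' e ln st → let module E = Eigen {S} f η z₀ in
          premise r {η = η} X prem S₂ (there (here refl)) (w' ∘ w) E.η' (opt z₀ m (w' ∘ w) e ln) id
            (cast (sym (trans (rtc-eval φ s (var z) E.η') (cong₂ (Len.rtcfm (β φ) E.η') (s-same z₀) (upd-same η z z₀))))
                  (Len.len⇒rtc (β φ) E.η' m (tsub η s) z₀ (len-map (β φ) η (β φ) E.η' m (tsub η s) z₀ (step-same z₀) ln))
             ▸ cast (sym (trans (inst2-eval φ (var z) t E.η') (cong₂ (Len.stepfm (β φ) E.η') (upd-same η z z₀) (t-same z₀)))) (cast (step-same z₀ z₀ (tsub η t)) st)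
             ▸ λ {χ} m' → E.keep χ (λ n → free-ant S (there m')) (wkN w' (a (there m'))))
            (λ {χ} m' → E.keep¬ χ (λ n → free-sc S m') (wkN w' (b m')))
      where
      τ₀ = RTC φ s t
      τ₁ = RTC φ s (var z)
      S₂ : Seq
      S₂ = τ₁ ∷ inst2 φ (var z) t ∷ Φ ⇒ Ψ
      fr : τ₁ ∉ τ₀ ∷ Φ
      fr = fresh-RTC {S = S} f
      fr₁ : τ₁ ∉ (s ≐ t) ∷ Φ
      fr₁ (there m) = fr (there m)
      meas' : ∀ τ → τ ∈ ant S → IsRTCFm τ → Γ ⊢ fsub (X τ ∷ˢ η) (lenAt τ)
      meas' τ m i = meas τ (inO m) (m , i)
      free₀ : ∀ n → occF n τ₀ ≡ true → FreeIn n S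
      free₀ n o = free-ant S (here refl) o
      module _ (z₀ : Tm) where
        η' : Subst
        η' = η [ z ↦ z₀ ]
        s-same : tsub η' s ≡ tsub η s
        s-same = tsub-occ s λ n o → sym (agree-upd {S = S} f n (free₀ n (∨-introʳ (occF (suc (suc n)) φ) (∨-introˡ _ o))))
        t-same : tsub η' t ≡ tsub η t
        t-same = tsub-occ t λ n o → sym (agree-upd {S = S} f n (free₀ n (∨-introʳ (occF (suc (suc n)) φ) (∨-introʳ (occT n s) o))))
        step-same : ∀ v u → Len.stepfm (β φ) η v u ≡ Len.stepfm (β φ) η' v u
        step-same v u = trans (cong (λ ψ → fsub (u ∷ˢ v ∷ˢ η) (β ψ)) (sym (fsub-id φ))) (β-fuse φ
          λ { zero _ → refl ; (suc zero) _ → refl ; (suc (suc n)) o → agree-upd {S = S} f n (free₀ n (∨-introˡ _ o)) })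
        opt : ∀ m {Θ} → Γ ⊆ Θ → Θ ⊢ X τ₀ ≐ `s m → Θ ⊢ len φ η m (tsub η s) z₀ → ∀ τ → τ ∈ ant S₂ →
          Σ Tm (Chosen r S₂ η' X Θ τ) ⊎ (∀ a → a ∈ ant S → ¬ rtcStep r S₂ a τ × ¬ rtcProg r S₂ a τ)
        opt m {Θ} w e ln τ mτ with τ ≟F τ₁ | τ ∈? ant S
        ... | yes refl | _ = inj₁ (m , record
              { measured = λ _ → cast (sym (trans (len-eval φ s (var z) m η') (cong₂ (len φ η' m) s-same (upd-same η z z₀))))
                                  (len-map (β φ) η (β φ) η' m (tsub η s) z₀ step-same ln)
              ; weakly = λ { a ma (inj₁ refl) → contradiction ma fr ; a ma (inj₂ (refl , _)) → lt⇒le m (X τ₀) less }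
              ; strictly = λ { a ma (refl , _) → less } })
              where
              less : Θ ⊢ lt m (X τ₀)
              less = le-resp (≐R (`s m)) (e ⁻¹) (le-refl (`s m))
        ... | no ne | yes m' = inj₁ (X τ , record
              { measured = λ i → measure-agree τ i (λ n o → agree-upd {S = S} f n (free-ant S m' o)) (wkN w (meas' τ m' i))
              ; weakly = λ { a ma (inj₁ refl) → le-refl (X τ) ; a ma (inj₂ (_ , e)) → contradiction e ne }
              ; strictly = λ { a ma (_ , e) → contradiction e ne } })
        ... | no ne | no nm = inj₂ λ a ma → (λ { (inj₁ refl) → nm ma ; (inj₂ (_ , e)) → ne e }) , λ { (_ , e) → ne e }

  toPA : ∀ {L S} → Proof RTCRule RTCTrace L S → ∀ {Γ} η → True Γ S η
  toPA {S = S} P {Γ} η w a b = let i = Proof.root P in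
    choose (λ Δ τ x → IsRTCFm τ → Δ ⊢ fsub (x ∷ˢ η) (lenAt τ)) (λ s q i → wkN s (q i)) (ant S)
      (λ τ m s k → pick τ m s k)
      λ Z s q → subst (λ S' → Measured _ S' η Z → True _ S' η) (Proof.rootIs P) (sound (Proof.graph P) good (λ i → ruleSound (in-objs i) (rule i)) i Z)
        (λ o _ v → q o (proj₁ v) (proj₂ v)) id (wkN s ∘ a) (wkN s ∘ b)
    where
    open Graph (Proof.graph P)
    objs : List Fm
    objs = concatMap (ant ∘ node) (allFin size)
    open Rules objs
    in-objs : ∀ i {τ} → τ ∈ ant (node i) → τ ∈ objs
    in-objs i m = ∈ₚ.∈-concatMap⁺ (ant ∘ node) (Any.map (λ { refl → m }) (∈ₚ.∈-allFin i))
    good : (p : Path (Proof.graph P)) → Σ ℕ λ k₀ → Σ (ℕ → Fm) λ τ →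
      IsTrace RTCTrace (Proof.graph P) p k₀ τ × InfProg RTCTrace (Proof.graph P) p k₀ τ × (∀ k → k₀ ≤ k → τ k ∈ objs)
    good p = let k₀ , τ , tr , pr = Proof.good P p in k₀ , τ , tr , pr , λ k h → in-objs (Path.at p k) (proj₁ (proj₁ (tr k h)))
    pick : ∀ τ → τ ∈ ant S → ∀ {Δ} → _ ⊆ Δ → (∀ x {Θ} → Δ ⊆ Θ → (IsRTCFm τ → Θ ⊢ fsub (x ∷ˢ η) (lenAt τ)) → Θ ⊢ ⊥') → Δ ⊢ ⊥'
    pick τ m s k with isRTC? τ
    ... | yes i = has-length τ i (wkN s (a m)) λ x s' d → k x s' λ _ → d
    ... | no ni = k `0 id λ i → contradiction i ni

-- Multiplication in TR: the pairs (k N, k x) are the points k N + k x reached by a chain of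
-- steps N + x, decoded by division by N; taking x = 1 recovers k.

-- Says that e is a multiple of n; this form of divisibility is available before multiplication.
mu : Tm → Tm → Fm
mu e n = RTC (var 0 ≐ (var 1 `+ ren suc (ren suc n))) `0 e

-- under p', p, N, x: one step of the chain
CS : Fm
CS = `∃ (`∃ ((var 3 ≐ (var 1 `+ var 0)) `∧ mu (var 1) (var 4) `∧ lt (var 0 `+ var 5) (var 4) `∧ (var 2 ≐ ((var 1 `+ var 4) `+ (var 0 `+ var 5)))))

-- under e, s, N, x: the chain reaches the pair (e, s)
CH : Fm
CH = RTC (fsub (var 0 ∷ˢ var 1 ∷ˢ var 4 ∷ˢ var 5 ∷ˢ var) CS) `0 (var 0 `+ var 1) `∧ mu (var 0) (var 2) `∧ lt (var 1) (var 2)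

-- under x, y, z: z is x times y
MUL : Fm
MUL = `∃ (`∃ (fsub (var 0 ∷ˢ var 3 ∷ˢ var 1 ∷ˢ `s `0 ∷ˢ var) CH `∧ fsub (var 0 ∷ˢ var 4 ∷ˢ var 1 ∷ˢ var 2 ∷ˢ var) CH))

mul : Tm → Tm → Tm → Fm
mul x y z = fsub (x ∷ˢ y ∷ˢ z ∷ˢ var) MUL

module Mul where
  open Arith TR public

  rtcT : ∀ {Γ s t} φ σ r → Γ ⊢ RTC (fsub (lift (lift σ)) φ) s r → Γ ⊢ fsub (t ∷ˢ r ∷ˢ σ) φ → Γ ⊢ RTC (fsub (lift (lift σ)) φ) s t
  rtcT {t = t} φ σ r a b = RC.rtcT r a (cast (trans (sym (inst2-lift φ r t)) (inst2-cons _ r t)) b)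

  rtcC : ∀ {Γ ψ s t} φ σ → Γ ⊢ RTC (fsub (lift (lift σ)) φ) s t → (s ≐ t) ∷ Γ ⊢ ψ →
    (∀ z → fsub (t ∷ˢ z ∷ˢ σ) φ ∷ RTC (fsub (lift (lift σ)) φ) s z ∷ Γ ⊢ ψ) → Γ ⊢ ψ
  rtcC {Γ} {ψ} {s} {t} φ σ d k l = RC.cutP χ (RC.addR d) (RC.inf (case {φ = fsub (lift (lift σ)) φ} {s} {t} z (freshFor (χ ∷ Γ) (ψ ∷ [])))
      (k ∷ RC.ante (λ { (here e) → there (here (trans e (sym (inst2-lift φ (var z) t)))) ; (there (here e)) → here e ; (there (there m)) → there (there m) })
             (l (var z)) ∷ []))
    where
    χ = RTC (fsub (lift (lift σ)) φ) s t
    z = bndL ((χ ∷ Γ) ++ ψ ∷ [])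

  mu-0 : ∀ {Γ} n → Γ ⊢ mu `0 n
  mu-0 n = RC.rtcR _ `0
  mu-+ : ∀ {Γ} e n → Γ ⊢ mu e n → Γ ⊢ mu (e `+ n) n
  mu-+ e n d = rtcT (var 0 ≐ (var 1 `+ var 2)) (n ∷ˢ var) e d (≐R _)
  mu-case : ∀ {Γ ψ} e n → Γ ⊢ mu e n → (`0 ≐ e) ∷ Γ ⊢ ψ → (∀ f → (e ≐ f `+ n) ∷ mu f n ∷ Γ ⊢ ψ) → Γ ⊢ ψ
  mu-case e n d k l = rtcC (var 0 ≐ (var 1 `+ var 2)) (n ∷ˢ var) d k l

  sum-0 : ∀ {Γ} a b → Γ ⊢ `0 ≐ a `+ b → Γ ⊢ (a ≐ `0) `∧ (b ≐ `0)
  sum-0 a b e = cases b (∧I ((+0 a ⁻¹) ∙ +-cong (≐R a) (h0 ⁻¹) ∙ (e ↑ ⁻¹)) h0) λ x → +-zeroʳ a x (+-cong (≐R a) (h0 ⁻¹) ∙ (e ↑ ⁻¹))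

  -- under e, n: the quotient point and the remainder of a number are unique
  private
    U₁ U : Fm
    U₁ = mu (var 2) (var 4) `→ (lt (var 1) (var 4) `→ (lt (var 0) (var 4) `→ ((var 3 `+ var 1 ≐ var 2 `+ var 0) `→ ((var 3 ≐ var 2) `∧ (var 1 ≐ var 0)))))
    U = `∀ (`∀ (`∀ U₁))

  too-big : ∀ {Γ ψ} n s f s' → Γ ⊢ lt s n → Γ ⊢ `0 `+ s ≐ (f `+ n) `+ s' → Γ ⊢ ψ
  too-big n s f s' l e = lt-irr s (le-trans (`s s) n s l (leI n s (f `+ s') ((+assoc n f s' ⁻¹) ∙ +-cong (+comm n f) (≐R s') ∙ (e ⁻¹) ∙ 0+ s)))

  UI : ∀ {Γ} e n → (∀ e' s s' → (e `+ s ≐ e' `+ s') ∷ lt s' n ∷ lt s n ∷ mu e' n ∷ Γ ⊢ (e ≐ e') `∧ (s ≐ s')) → Γ ⊢ fsub (e ∷ˢ n ∷ˢ var) U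
  UI e n k = ∀I (`∀ (`∀ U₁)) (e ∷ˢ n ∷ˢ var) λ e' → ∀I (`∀ U₁) (e' ∷ˢ e ∷ˢ n ∷ˢ var) λ s → ∀I U₁ (s ∷ˢ e' ∷ˢ e ∷ˢ n ∷ˢ var) λ s' →
    →I (→I (→I (→I (k e' s s'))))
  UE : ∀ {Γ} e n → Γ ⊢ fsub (e ∷ˢ n ∷ˢ var) U → ∀ e' s s' → Γ ⊢ mu e' n → Γ ⊢ lt s n → Γ ⊢ lt s' n → Γ ⊢ e `+ s ≐ e' `+ s' → Γ ⊢ (e ≐ e') `∧ (s ≐ s')
  UE e n d e' s s' a b c f = →E (→E (→E (→E
    (∀E U₁ (s ∷ˢ e' ∷ˢ e ∷ˢ n ∷ˢ var) (∀E (`∀ U₁) (e' ∷ˢ e ∷ˢ n ∷ˢ var) (∀E (`∀ (`∀ U₁)) (e ∷ˢ n ∷ˢ var) d e') s) s') a) b) c) f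

  -- Induction along the multiples e of n, with a case distinction on the second multiple e'. If
  -- both are 0 the remainders are compared directly, a mixed pair would make a remainder at least
  -- n, and two successors cancel n.
  divide : ∀ {Γ} e n → Γ ⊢ mu e n → Γ ⊢ fsub (e ∷ˢ n ∷ˢ var) U
  divide e n d = rtcI (var 0 ≐ (var 1 `+ var 2)) U (n ∷ˢ var) {`0} {ren suc e} (cast (cong (RTC _ `0) (sym (trans (ren-suc e) (tsub-id e)))) d)
      (UI `0 n λ e' s s' → mu-case e' n h3
        (∧I h0 ((0+ s ⁻¹) ∙ h1 ∙ +-cong (h0 ⁻¹) (≐R s') ∙ 0+ s'))
        λ f → too-big n s f s' (hyp (there (there (there (there (here refl)))))) (h2 ∙ +-cong h0 (≐R s')))
      (λ x y → ≐S U (n ∷ˢ var) (h0 ⁻¹) (UI (x `+ n) n λ e' s s' → mu-case e' n h3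
        (too-big n s' x s h2 (+-cong h0 (≐R s') ∙ (h1 ⁻¹)))
        λ f → cutN (UE x n (hyp (there (there (there (there (there (there (there (here refl))))))))) f s s' h1 (hyp (there (there (there (there (here refl)))))) h3
                 (+cancelʳ _ _ n (shuf x s n ∙ h2 ∙ +-cong h0 (≐R s') ∙ (shuf f s' n ⁻¹))))
           (∧I (+-cong (∧E₁ h0) (≐R n) ∙ (h1 ⁻¹)) (∧E₂ h0))))
    ▹ cong (λ t → fsub (t ∷ˢ n ∷ˢ var) U) (trans (ren-suc e) (tsub-id e))
    where
    infixl 1 _▹_
    _▹_ : ∀ {Γ φ ψ} → Γ ⊢ φ → φ ≡ ψ → Γ ⊢ ψ
    d ▹ e = cast e d
    shuf : ∀ {Γ} a b c → Γ ⊢ (a `+ b) `+ c ≐ (a `+ c) `+ b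
    shuf a b c = +assoc a b c ∙ +-cong (≐R a) (+comm b c) ∙ (+assoc a c b ⁻¹)

  chain : Tm → Tm → Tm → Tm → Fm
  chain e s n x = fsub (e ∷ˢ s ∷ˢ n ∷ˢ x ∷ˢ var) CH

  private
    C₂ : Fm
    C₂ = (var 3 ≐ (var 1 `+ var 0)) `∧ mu (var 1) (var 4) `∧ lt (var 0 `+ var 5) (var 4) `∧ (var 2 ≐ ((var 1 `+ var 4) `+ (var 0 `+ var 5)))

  chain-cong : ∀ {Γ e e' s s'} n x → Γ ⊢ e ≐ e' → Γ ⊢ s ≐ s' → Γ ⊢ chain e s n x → Γ ⊢ chain e' s' n x
  chain-cong {e = e} {e'} {s} {s'} n x p q d = ≐S (fsub (var 1 ∷ˢ var 0 ∷ˢ var 2 ∷ˢ var 3 ∷ˢ var) CH) (e' ∷ˢ n ∷ˢ x ∷ˢ var) q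
    (≐S CH (s ∷ˢ n ∷ˢ x ∷ˢ var) p d)

  chain-0 : ∀ {Γ} n x → Γ ⊢ lt `0 n → Γ ⊢ chain `0 `0 n x
  chain-0 n x l = ∧I (≐S (RTC (fsub (var 0 ∷ˢ var 1 ∷ˢ var 3 ∷ˢ var 4 ∷ˢ var) CS) `0 (var 0)) (n ∷ˢ x ∷ˢ var) (+0 `0 ⁻¹) (RC.rtcR _ `0)) (∧I (mu-0 n) l)

  chain-+ : ∀ {Γ} e s n x → Γ ⊢ chain e s n x → Γ ⊢ lt (s `+ x) n → Γ ⊢ chain (e `+ n) (s `+ x) n x
  chain-+ e s n x d l = ∧I (rtcT CS (n ∷ˢ x ∷ˢ var) (e `+ s) (∧E₁ d)
      (∃I (`∃ C₂) (((e `+ n) `+ (s `+ x)) ∷ˢ (e `+ s) ∷ˢ n ∷ˢ x ∷ˢ var) e (∃I C₂ (e ∷ˢ ((e `+ n) `+ (s `+ x)) ∷ˢ (e `+ s) ∷ˢ n ∷ˢ x ∷ˢ var) s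
        (∧I (≐R _) (∧I (∧E₁ (∧E₂ d)) (∧I l (≐R _)))))))
    (∧I (mu-+ e n (∧E₁ (∧E₂ d))) l)

  -- The last step of the closure ends in the single number e + s. By `divide` its decomposition
  -- into multiple and remainder is unique, so the coordinates of the preceding point can be read
  -- off.
  chain-inv : ∀ {Γ ψ} e s n x → Γ ⊢ chain e s n x →
    (∀ {Δ} → Γ ⊆ Δ → Δ ⊢ e ≐ `0 → Δ ⊢ s ≐ `0 → Δ ⊢ ψ) →
    (∀ f k {Δ} → Γ ⊆ Δ → Δ ⊢ e ≐ f `+ n → Δ ⊢ s ≐ k `+ x → Δ ⊢ chain f k n x → Δ ⊢ ψ) → Γ ⊢ ψ
  chain-inv e s n x d k l = rtcC CS (n ∷ˢ x ∷ˢ var) (∧E₁ d)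
    (cutN (sum-0 e s h0) (k (there ∘ there) (∧E₁ h0) (∧E₂ h0)))
    λ q → ∃E (`∃ C₂) ((e `+ s) ∷ˢ q ∷ˢ n ∷ˢ x ∷ˢ var) h0 λ f → ∃E C₂ (f ∷ˢ (e `+ s) ∷ˢ q ∷ˢ n ∷ˢ x ∷ˢ var) h0 λ j →
      cutN (UE e n (divide e n (wkN (there ∘ there ∘ there ∘ there) (∧E₁ (∧E₂ d)))) (f `+ n) s (j `+ x) (mu-+ f n (∧E₁ (∧E₂ h0)))
              (wkN (there ∘ there ∘ there ∘ there) (∧E₂ (∧E₂ d))) (∧E₁ (∧E₂ (∧E₂ h0))) (∧E₂ (∧E₂ (∧E₂ h0))))
        (l f j (there ∘ there ∘ there ∘ there ∘ there) (∧E₁ h0) (∧E₂ h0)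
          (∧I (≐S (RTC (fsub (var 0 ∷ˢ var 1 ∷ˢ var 3 ∷ˢ var 4 ∷ˢ var) CS) `0 (var 0)) (n ∷ˢ x ∷ˢ var) (∧E₁ h1) (hyp (there (there (there (there (here refl)))))))
            (∧I (∧E₁ (∧E₂ h1)) (le-trans (`s j) (`s (j `+ x)) n (le-s j (j `+ x) (le-+ j x)) (∧E₁ (∧E₂ (∧E₂ h1)))))))

  private
    M₁ M₂ : Fm
    M₂ = fsub (var 0 ∷ˢ var 3 ∷ˢ var 1 ∷ˢ `s `0 ∷ˢ var) CH `∧ fsub (var 0 ∷ˢ var 4 ∷ˢ var 1 ∷ˢ var 2 ∷ˢ var) CH
    M₁ = `∃ M₂

  mulI : ∀ {Γ} x y z n e → Γ ⊢ chain e y n (`s `0) → Γ ⊢ chain e z n x → Γ ⊢ mul x y z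
  mulI x y z n e a b = ∃I M₁ (x ∷ˢ y ∷ˢ z ∷ˢ var) n (∃I M₂ (n ∷ˢ x ∷ˢ y ∷ˢ z ∷ˢ var) e (∧I a b))
  mulE : ∀ {Γ ψ} x y z → Γ ⊢ mul x y z → (∀ n e {Δ} → Γ ⊆ Δ → Δ ⊢ chain e y n (`s `0) → Δ ⊢ chain e z n x → Δ ⊢ ψ) → Γ ⊢ ψ
  mulE x y z d k = ∃E M₁ (x ∷ˢ y ∷ˢ z ∷ˢ var) d λ n → ∃E M₂ (n ∷ˢ x ∷ˢ y ∷ˢ z ∷ˢ var) h0 λ e → k n e (there ∘ there) (∧E₁ h0) (∧E₂ h0)

  mul-cong : ∀ {Γ x x' y y' z z'} → Γ ⊢ x ≐ x' → Γ ⊢ y ≐ y' → Γ ⊢ z ≐ z' → Γ ⊢ mul x y z → Γ ⊢ mul x' y' z'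
  mul-cong {x = x} {x'} {y} {y'} {z} {z'} p q r d = ≐S (fsub (var 1 ∷ˢ var 2 ∷ˢ var 0 ∷ˢ var) MUL) (x' ∷ˢ y' ∷ˢ var) r
    (≐S (fsub (var 1 ∷ˢ var 0 ∷ˢ var 2 ∷ˢ var) MUL) (x' ∷ˢ z ∷ˢ var) q (≐S MUL (y ∷ˢ z ∷ˢ var) p d))

  +1 : ∀ {Γ} a → Γ ⊢ a `+ `s `0 ≐ `s a
  +1 a = +s a `0 ∙ s-cong (+0 a)

  positive : ∀ {Γ ψ} f n s → Γ ⊢ lt s n → Γ ⊢ f `+ n ≐ `0 → Γ ⊢ ψ
  positive f n s l e = lt-0 s (le-resp (≐R (`s s)) (∧E₂ (sum-0 f n (e ⁻¹))) l)

  mul-0 : ∀ {Γ} x z → Γ ⊢ mul x `0 z → Γ ⊢ z ≐ `0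
  mul-0 x z d = mulE x `0 z d λ n e w a b → chain-inv e `0 n (`s `0) a
    (λ w₁ p _ → chain-inv e z n x (wkN w₁ b) (λ _ _ q → q)
      λ f k w₂ q _ c → positive f n k (∧E₂ (∧E₂ c)) ((q ⁻¹) ∙ wkN w₂ p))
    λ f k w₁ _ q _ → +-zeroʳ k `0 (q ⁻¹)

  mul-s : ∀ {Γ ψ} x y z → Γ ⊢ mul x (`s y) z → (∀ u {Δ} → Γ ⊆ Δ → Δ ⊢ z ≐ u `+ x → Δ ⊢ mul x y u → Δ ⊢ ψ) → Γ ⊢ ψ
  mul-s x y z d l = mulE x (`s y) z d λ n e w a b → chain-inv e (`s y) n (`s `0) a
    (λ w₁ _ q → botE (s0 q))
    λ f k w₁ p q c → chain-inv e z n x (wkN w₁ b)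
      (λ w₂ p' _ → positive f n k (wkN w₂ (∧E₂ (∧E₂ c))) ((wkN w₂ p ⁻¹) ∙ p'))
      λ g u w₂ p' q' c' → l u (w₂ ∘ w₁ ∘ w) q' (mulI x y u n g
        (chain-cong n (`s `0) (+cancelʳ f g n ((wkN w₂ p ⁻¹) ∙ p')) (inj ((+1 k ⁻¹) ∙ (wkN w₂ q ⁻¹))) (wkN w₂ c)) c')

  -- Two witnesses may use different N, so their chains are not directly comparable. Instead the
  -- recursion equations `mul-0` and `mul-s` determine both products by induction on y.
  mul-fun : ∀ {Γ} x y z z' → Γ ⊢ mul x y z → Γ ⊢ mul x y z' → Γ ⊢ z ≐ z'
  mul-fun x y z z' d e = →E (→E (∀E F₂ (z ∷ˢ y ∷ˢ x ∷ˢ var) (∀E F₁ (y ∷ˢ x ∷ˢ var) (all y) z) z') d) e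
    where
    F₂ F₁ : Fm
    F₂ = fsub (var 3 ∷ˢ var 2 ∷ˢ var 1 ∷ˢ var) MUL `→ (fsub (var 3 ∷ˢ var 2 ∷ˢ var 0 ∷ˢ var) MUL `→ (var 1 ≐ var 0))
    F₁ = `∀ F₂
    all : ∀ {Γ} y → Γ ⊢ fsub (y ∷ˢ x ∷ˢ var) (`∀ F₁)
    all = ind (`∀ F₁) (x ∷ˢ var)
      (∀I F₁ (`0 ∷ˢ x ∷ˢ var) λ z → ∀I F₂ (z ∷ˢ `0 ∷ˢ x ∷ˢ var) λ z' → →I (→I (mul-0 x z h1 ∙ (mul-0 x z' h0 ⁻¹))))
      λ y → ∀I F₁ (`s y ∷ˢ x ∷ˢ var) λ z → ∀I F₂ (z ∷ˢ `s y ∷ˢ x ∷ˢ var) λ z' → →I (→I (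
        mul-s x y z h1 λ u w p a → mul-s x y z' (wkN w h0) λ u' w' p' b →
          wkN w' p ∙ +-cong (→E (→E (∀E F₂ (u ∷ˢ y ∷ˢ x ∷ˢ var) (∀E F₁ (y ∷ˢ x ∷ˢ var) (wkN w' (wkN w h2)) u) u') (wkN w' a)) b) (≐R x) ∙ (p' ⁻¹)))

  -- The induction needs a witness for every sufficiently large N, not just for one.
  mul-ex : ∀ {Γ ψ} x y → (∀ z {Δ} → Γ ⊆ Δ → Δ ⊢ mul x y z → Δ ⊢ ψ) → Γ ⊢ ψ
  mul-ex {Γ} x y k = ∃E (`∀ E₁) (y ∷ˢ x ∷ˢ var) (all y) λ z →
    get y z (`s (y `+ z)) h0 (le-s y (y `+ z) (le-+ y z)) (le-s z (y `+ z) (le-+ʳ y z)) λ e w a b →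
      k z (w ∘ there) (mulI x y z (`s (y `+ z)) e a b)
    where
    -- under N, z, y, x
    E₂ E₁ : Fm
    E₂ = fsub (var 0 ∷ˢ var 3 ∷ˢ var 1 ∷ˢ `s `0 ∷ˢ var) CH `∧ fsub (var 0 ∷ˢ var 2 ∷ˢ var 1 ∷ˢ var 4 ∷ˢ var) CH
    E₁ = lt (var 2) (var 0) `→ (lt (var 1) (var 0) `→ `∃ E₂)
    get : ∀ {Γ ψ} y z n → Γ ⊢ fsub (z ∷ˢ y ∷ˢ x ∷ˢ var) (`∀ E₁) → Γ ⊢ lt y n → Γ ⊢ lt z n →
      (∀ e {Δ} → Γ ⊆ Δ → Δ ⊢ chain e y n (`s `0) → Δ ⊢ chain e z n x → Δ ⊢ ψ) → Γ ⊢ ψ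
    get y z n d a b k = ∃E E₂ (n ∷ˢ z ∷ˢ y ∷ˢ x ∷ˢ var) (→E (→E (∀E E₁ (z ∷ˢ y ∷ˢ x ∷ˢ var) d n) a) b) λ e → k e there (∧E₁ h0) (∧E₂ h0)
    make : ∀ {Γ} y z → (∀ n → lt z n ∷ lt y n ∷ Γ ⊢ fsub (n ∷ˢ z ∷ˢ y ∷ˢ x ∷ˢ var) (`∃ E₂)) → Γ ⊢ fsub (y ∷ˢ x ∷ˢ var) (`∃ (`∀ E₁))
    make y z k = ∃I (`∀ E₁) (y ∷ˢ x ∷ˢ var) z (∀I E₁ (z ∷ˢ y ∷ˢ x ∷ˢ var) λ n → →I (→I (k n)))
    all : ∀ {Γ} y → Γ ⊢ fsub (y ∷ˢ x ∷ˢ var) (`∃ (`∀ E₁))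
    all = ind (`∃ (`∀ E₁)) (x ∷ˢ var)
      (make `0 `0 λ n → ∃I E₂ (n ∷ˢ `0 ∷ˢ `0 ∷ˢ x ∷ˢ var) `0 (∧I (chain-0 n (`s `0) h1) (chain-0 n x h0)))
      λ y → ∃E (`∀ E₁) (y ∷ˢ x ∷ˢ var) h0 λ z → make (`s y) (z `+ x) λ n →
        get y z n h2 (lt⇒le (`s y) n h1) (le-trans (`s z) (`s (z `+ x)) n (le-s z (z `+ x) (le-+ z x)) h0) λ e w a b →
          ∃I E₂ (n ∷ˢ (z `+ x) ∷ˢ `s y ∷ˢ x ∷ˢ var) (e `+ n)
            (∧I (chain-cong n (`s `0) (≐R _) (+1 y) (chain-+ e y n (`s `0) a (le-resp (s-cong (+1 y ⁻¹)) (≐R n) (wkN w h1))))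
                (chain-+ e z n x b (wkN w h0)))

-- Relational interpretation of arithmetic in TR

-- under y, η: y is the value of t under η
valF : Tm → Fm
valF (var n)  = var 0 ≐ var (suc n)
valF `0       = var 0 ≐ `0
valF (`s t)   = `∃ (fsub (var 0 ∷ˢ up 2) (valF t) `∧ (var 1 ≐ `s (var 0)))
valF (t `+ u) = `∃ (`∃ (fsub (var 1 ∷ˢ up 3) (valF t) `∧ fsub (var 0 ∷ˢ up 3) (valF u) `∧ (var 2 ≐ var 1 `+ var 0)))
valF (t `· u) = `∃ (`∃ (fsub (var 1 ∷ˢ up 3) (valF t) `∧ fsub (var 0 ∷ˢ up 3) (valF u) `∧ mul (var 1) (var 0) (var 2)))

rel : Fm → Fm
rel (s ≐ t)     = `∃ (valF s `∧ valF t)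
rel (s ≺ t)     = `∃ (`∃ (fsub (var 1 ∷ˢ up 2) (valF s) `∧ fsub (var 0 ∷ˢ up 2) (valF t) `∧ lt (var 1) (var 0)))
-- No rule of arithmetic deals with RTC, so any formula that is stable under substitution can stand
-- here.
rel (RTC _ _ _) = ⊥'
rel (`¬ φ)      = `¬ (rel φ)
rel (φ `∧ ψ)    = rel φ `∧ rel ψ
rel (φ `∨ ψ)    = rel φ `∨ rel ψ
rel (φ `→ ψ)    = rel φ `→ rel ψ
rel (`∀ φ)      = `∀ (rel φ)
rel (`∃ φ)      = `∃ (rel φ)

module Rel where
  open Mul

  Value : List Fm → Tm → Subst → Tm → Set
  Value Γ t η v = Γ ⊢ fsub (v ∷ˢ η) (valF t)

  private
    S₁ : Tm → Fm
    S₁ t = fsub (var 0 ∷ˢ up 2) (valF t) `∧ (var 1 ≐ `s (var 0))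
    S₂ S₃ : Tm → Tm → Fm
    S₂ t u = fsub (var 1 ∷ˢ up 3) (valF t) `∧ fsub (var 0 ∷ˢ up 3) (valF u) `∧ (var 2 ≐ var 1 `+ var 0)
    S₃ t u = fsub (var 1 ∷ˢ up 3) (valF t) `∧ fsub (var 0 ∷ˢ up 3) (valF u) `∧ mul (var 1) (var 0) (var 2)
    e₁ : ∀ t a v η → fsub (a ∷ˢ v ∷ˢ η) (fsub (var 0 ∷ˢ up 2) (valF t)) ≡ fsub (a ∷ˢ η) (valF t)
    e₁ t a v η = trans (fsub-fuse (valF t)) (fsub-ext (valF t) λ { zero → refl ; (suc n) → refl })
    e₂ : ∀ t a b v η → fsub (b ∷ˢ a ∷ˢ v ∷ˢ η) (fsub (var 1 ∷ˢ up 3) (valF t)) ≡ fsub (a ∷ˢ η) (valF t)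
    e₂ t a b v η = trans (fsub-fuse (valF t)) (fsub-ext (valF t) λ { zero → refl ; (suc n) → refl })
    e₃ : ∀ t a b v η → fsub (b ∷ˢ a ∷ˢ v ∷ˢ η) (fsub (var 0 ∷ˢ up 3) (valF t)) ≡ fsub (b ∷ˢ η) (valF t)
    e₃ t a b v η = trans (fsub-fuse (valF t)) (fsub-ext (valF t) λ { zero → refl ; (suc n) → refl })

  val-sI : ∀ {Γ η} t a v → Value Γ t η a → Γ ⊢ v ≐ `s a → Value Γ (`s t) η v
  val-sI {η = η} t a v x e = ∃I (S₁ t) (v ∷ˢ η) a (∧I (cast (sym (e₁ t a v η)) x) e)
  val-sE : ∀ {Γ ψ} t η v → Value Γ (`s t) η v → (∀ a {Δ} → Γ ⊆ Δ → Value Δ t η a → Δ ⊢ v ≐ `s a → Δ ⊢ ψ) → Γ ⊢ ψ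
  val-sE t η v d k = ∃E (S₁ t) (v ∷ˢ η) d λ a → k a there (cast (e₁ t a v η) (∧E₁ h0)) (∧E₂ h0)

  val-+I : ∀ {Γ η} t u a b v → Value Γ t η a → Value Γ u η b → Γ ⊢ v ≐ a `+ b → Value Γ (t `+ u) η v
  val-+I {η = η} t u a b v x y e = ∃I (`∃ (S₂ t u)) (v ∷ˢ η) a (∃I (S₂ t u) (a ∷ˢ v ∷ˢ η) b
    (∧I (cast (sym (e₂ t a b v η)) x) (∧I (cast (sym (e₃ u a b v η)) y) e)))
  val-+E : ∀ {Γ ψ} t u η v → Value Γ (t `+ u) η v → (∀ a b {Δ} → Γ ⊆ Δ → Value Δ t η a → Value Δ u η b → Δ ⊢ v ≐ a `+ b → Δ ⊢ ψ) → Γ ⊢ ψ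
  val-+E t u η v d k = ∃E (`∃ (S₂ t u)) (v ∷ˢ η) d λ a → ∃E (S₂ t u) (a ∷ˢ v ∷ˢ η) h0 λ b →
    k a b (there ∘ there) (cast (e₂ t a b v η) (∧E₁ h0)) (cast (e₃ u a b v η) (∧E₁ (∧E₂ h0))) (∧E₂ (∧E₂ h0))

  val-·I : ∀ {Γ η} t u a b v → Value Γ t η a → Value Γ u η b → Γ ⊢ mul a b v → Value Γ (t `· u) η v
  val-·I {η = η} t u a b v x y e = ∃I (`∃ (S₃ t u)) (v ∷ˢ η) a (∃I (S₃ t u) (a ∷ˢ v ∷ˢ η) b
    (∧I (cast (sym (e₂ t a b v η)) x) (∧I (cast (sym (e₃ u a b v η)) y) e)))
  val-·E : ∀ {Γ ψ} t u η v → Value Γ (t `· u) η v → (∀ a b {Δ} → Γ ⊆ Δ → Value Δ t η a → Value Δ u η b → Δ ⊢ mul a b v → Δ ⊢ ψ) → Γ ⊢ ψ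
  val-·E t u η v d k = ∃E (`∃ (S₃ t u)) (v ∷ˢ η) d λ a → ∃E (S₃ t u) (a ∷ˢ v ∷ˢ η) h0 λ b →
    k a b (there ∘ there) (cast (e₂ t a b v η) (∧E₁ h0)) (cast (e₃ u a b v η) (∧E₁ (∧E₂ h0))) (∧E₂ (∧E₂ h0))

  val-conv : ∀ {Γ η v w} t → Γ ⊢ v ≐ w → Value Γ t η v → Value Γ t η w
  val-conv {η = η} t e = ≐S (valF t) η e

  value-ex : ∀ {Γ ψ} t η → (∀ v {Δ} → Γ ⊆ Δ → Value Δ t η v → Δ ⊢ ψ) → Γ ⊢ ψ
  value-ex (var n)  η k = k (η n) id (≐R _)
  value-ex `0       η k = k `0 id (≐R _)
  value-ex (`s t)   η k = value-ex t η λ a w x → k (`s a) w (val-sI t a (`s a) x (≐R _))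
  value-ex (t `+ u) η k = value-ex t η λ a w x → value-ex u η λ b w' y →
    k (a `+ b) (w' ∘ w) (val-+I t u a b (a `+ b) (wkN w' x) y (≐R _))
  value-ex (t `· u) η k = value-ex t η λ a w x → value-ex u η λ b w' y → mul-ex a b λ c w″ m →
    k c (w″ ∘ w' ∘ w) (val-·I t u a b c (wkN w″ (wkN w' x)) (wkN w″ y) m)

  value-fun : ∀ {Γ} t η v w → Value Γ t η v → Value Γ t η w → Γ ⊢ v ≐ w
  value-fun (var n)  η v w x y = x ∙ (y ⁻¹)
  value-fun `0       η v w x y = x ∙ (y ⁻¹)
  value-fun (`s t)   η v w x y = val-sE t η v x λ a s p e → val-sE t η w (wkN s y) λ b s' q f →
    wkN s' e ∙ s-cong (value-fun t η a b (wkN s' p) q) ∙ (f ⁻¹)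
  value-fun (t `+ u) η v w x y = val-+E t u η v x λ a b s p q e → val-+E t u η w (wkN s y) λ a' b' s' p' q' e' →
    wkN s' e ∙ +-cong (value-fun t η a a' (wkN s' p) p') (value-fun u η b b' (wkN s' q) q') ∙ (e' ⁻¹)
  value-fun (t `· u) η v w x y = val-·E t u η v x λ a b s p q m → val-·E t u η w (wkN s y) λ a' b' s' p' q' m' →
    mul-fun a' b' v w (mul-cong (value-fun t η a a' (wkN s' p) p') (value-fun u η b b' (wkN s' q) q') (≐R v) (wkN s' m)) m'

  value-sub→ : ∀ {Γ σ η η' v} t → (∀ n → occT n t ≡ true → Value Γ (σ n) η (η' n)) → Value Γ (tsub σ t) η v → Value Γ t η' v
  value-sub← : ∀ {Γ σ η η' v} t → (∀ n → occT n t ≡ true → Value Γ (σ n) η (η' n)) → Value Γ t η' v → Value Γ (tsub σ t) η v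
  value-sub→ {σ = σ} {η} {η'} {v} (var n) h d = value-fun (σ n) η v (η' n) d (h n (≡ᵇ-same n))
  value-sub→ `0       h d = d
  value-sub→ {σ = σ} {η} {η'} {v} (`s t) h d = val-sE (tsub σ t) η v d λ a s x e → val-sI t a v (value-sub→ t (λ n o → wkN s (h n o)) x) e
  value-sub→ {σ = σ} {η} {η'} {v} (t `+ u) h d = val-+E (tsub σ t) (tsub σ u) η v d λ a b s x y e → val-+I t u a b v
    (value-sub→ t (λ n o → wkN s (h n (∨-introˡ _ o))) x) (value-sub→ u (λ n o → wkN s (h n (∨-introʳ (occT n t) o))) y) e
  value-sub→ {σ = σ} {η} {η'} {v} (t `· u) h d = val-·E (tsub σ t) (tsub σ u) η v d λ a b s x y e → val-·I t u a b v
    (value-sub→ t (λ n o → wkN s (h n (∨-introˡ _ o))) x) (value-sub→ u (λ n o → wkN s (h n (∨-introʳ (occT n t) o))) y) e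
  value-sub← {σ = σ} {η} {η'} {v} (var n) h d = val-conv (σ n) (d ⁻¹) (h n (≡ᵇ-same n))
  value-sub← `0       h d = d
  value-sub← {σ = σ} {η} {η'} {v} (`s t) h d = val-sE t η' v d λ a s x e → val-sI (tsub σ t) a v (value-sub← t (λ n o → wkN s (h n o)) x) e
  value-sub← {σ = σ} {η} {η'} {v} (t `+ u) h d = val-+E t u η' v d λ a b s x y e → val-+I (tsub σ t) (tsub σ u) a b v
    (value-sub← t (λ n o → wkN s (h n (∨-introˡ _ o))) x) (value-sub← u (λ n o → wkN s (h n (∨-introʳ (occT n t) o))) y) e
  value-sub← {σ = σ} {η} {η'} {v} (t `· u) h d = val-·E t u η' v d λ a b s x y e → val-·I (tsub σ t) (tsub σ u) a b v
    (value-sub← t (λ n o → wkN s (h n (∨-introˡ _ o))) x) (value-sub← u (λ n o → wkN s (h n (∨-introʳ (occT n t) o))) y) e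

  eqI : ∀ {Γ} s t η v → Value Γ s η v → Value Γ t η v → Γ ⊢ fsub η (rel (s ≐ t))
  eqI s t η v x y = ∃I (valF s `∧ valF t) η v (∧I x y)
  eqE : ∀ {Γ ψ} s t η → Γ ⊢ fsub η (rel (s ≐ t)) → (∀ v {Δ} → Γ ⊆ Δ → Value Δ s η v → Value Δ t η v → Δ ⊢ ψ) → Γ ⊢ ψ
  eqE s t η d k = ∃E (valF s `∧ valF t) η d λ v → k v there (∧E₁ h0) (∧E₂ h0)

  private
    O : Tm → Tm → Fm
    O s t = fsub (var 1 ∷ˢ up 2) (valF s) `∧ fsub (var 0 ∷ˢ up 2) (valF t) `∧ lt (var 1) (var 0)
    o₁ : ∀ t a b η → fsub (b ∷ˢ a ∷ˢ η) (fsub (var 1 ∷ˢ up 2) (valF t)) ≡ fsub (a ∷ˢ η) (valF t)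
    o₁ t a b η = trans (fsub-fuse (valF t)) (fsub-ext (valF t) λ { zero → refl ; (suc n) → refl })
    o₂ : ∀ t a b η → fsub (b ∷ˢ a ∷ˢ η) (fsub (var 0 ∷ˢ up 2) (valF t)) ≡ fsub (b ∷ˢ η) (valF t)
    o₂ t a b η = trans (fsub-fuse (valF t)) (fsub-ext (valF t) λ { zero → refl ; (suc n) → refl })
  ltI : ∀ {Γ} s t η a b → Value Γ s η a → Value Γ t η b → Γ ⊢ lt a b → Γ ⊢ fsub η (rel (s ≺ t))
  ltI s t η a b x y l = ∃I (`∃ (O s t)) η a (∃I (O s t) (a ∷ˢ η) b (∧I (cast (sym (o₁ s a b η)) x) (∧I (cast (sym (o₂ t a b η)) y) l)))
  ltE : ∀ {Γ ψ} s t η → Γ ⊢ fsub η (rel (s ≺ t)) → (∀ a b {Δ} → Γ ⊆ Δ → Value Δ s η a → Value Δ t η b → Δ ⊢ lt a b → Δ ⊢ ψ) → Γ ⊢ ψ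
  ltE s t η d k = ∃E (`∃ (O s t)) η d λ a → ∃E (O s t) (a ∷ˢ η) h0 λ b →
    k a b (there ∘ there) (cast (o₁ s a b η) (∧E₁ h0)) (cast (o₂ t a b η) (∧E₁ (∧E₂ h0))) (∧E₂ (∧E₂ h0))

  Values : List Fm → (ℕ → Bool) → Subst → Subst → Subst → Set
  Values Γ occ σ η η' = ∀ n → occ n ≡ true → Value Γ (σ n) η (η' n)

  lift-values : ∀ {Γ σ η η'} {occ : ℕ → Bool} x → (∀ n → occ (suc n) ≡ true → Value Γ (σ n) η (η' n)) →
    Values Γ occ (lift σ) (x ∷ˢ η) (x ∷ˢ η')
  lift-values x h zero    o = ≐R x
  lift-values {σ = σ} x h (suc n) o = value-sub← (σ n) (λ m _ → ≐R _) (h n o)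

  rel-sub→ : ∀ {Γ σ η η'} φ → Values Γ (λ n → occF n φ) σ η η' → Γ ⊢ fsub η (rel (fsub σ φ)) → Γ ⊢ fsub η' (rel φ)
  rel-sub← : ∀ {Γ σ η η'} φ → Values Γ (λ n → occF n φ) σ η η' → Γ ⊢ fsub η' (rel φ) → Γ ⊢ fsub η (rel (fsub σ φ))
  rel-sub→ {σ = σ} {η} {η'} (s ≐ t) h d = eqE (tsub σ s) (tsub σ t) η d λ v w x y → eqI s t η' v
    (value-sub→ s (λ n o → wkN w (h n (∨-introˡ _ o))) x) (value-sub→ t (λ n o → wkN w (h n (∨-introʳ (occT n s) o))) y)
  rel-sub→ {σ = σ} {η} {η'} (s ≺ t) h d = ltE (tsub σ s) (tsub σ t) η d λ a b w x y l → ltI s t η' a b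
    (value-sub→ s (λ n o → wkN w (h n (∨-introˡ _ o))) x) (value-sub→ t (λ n o → wkN w (h n (∨-introʳ (occT n s) o))) y) l
  rel-sub→ (RTC φ s t) h d = d
  rel-sub→ (`¬ φ)   h d = ¬I (¬E (d ↑) (rel-sub← φ (λ n o → h n o ↑) h0))
  rel-sub→ (φ `∧ ψ) h d = ∧I (rel-sub→ φ (λ n o → h n (∨-introˡ _ o)) (∧E₁ d)) (rel-sub→ ψ (λ n o → h n (∨-introʳ (occF n φ) o)) (∧E₂ d))
  rel-sub→ (φ `∨ ψ) h d = ∨E d (∨I₁ (rel-sub→ φ (λ n o → h n (∨-introˡ _ o) ↑) h0)) (∨I₂ (rel-sub→ ψ (λ n o → h n (∨-introʳ (occF n φ) o) ↑) h0))
  rel-sub→ (φ `→ ψ) h d = →I (rel-sub→ ψ (λ n o → h n (∨-introʳ (occF n φ) o) ↑) (→E (d ↑) (rel-sub← φ (λ n o → h n (∨-introˡ _ o) ↑) h0)))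
  rel-sub→ {σ = σ} {η} {η'} (`∀ φ) h d = ∀I (rel φ) η' λ x → rel-sub→ φ (lift-values x h) (∀E (rel (fsub (lift σ) φ)) η d x)
  rel-sub→ {σ = σ} {η} {η'} (`∃ φ) h d = ∃E (rel (fsub (lift σ) φ)) η d λ x → ∃I (rel φ) η' x (rel-sub→ φ (lift-values x λ n o → h n o ↑) h0)
  rel-sub← {σ = σ} {η} {η'} (s ≐ t) h d = eqE s t η' d λ v w x y → eqI (tsub σ s) (tsub σ t) η v
    (value-sub← s (λ n o → wkN w (h n (∨-introˡ _ o))) x) (value-sub← t (λ n o → wkN w (h n (∨-introʳ (occT n s) o))) y)
  rel-sub← {σ = σ} {η} {η'} (s ≺ t) h d = ltE s t η' d λ a b w x y l → ltI (tsub σ s) (tsub σ t) η a b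
    (value-sub← s (λ n o → wkN w (h n (∨-introˡ _ o))) x) (value-sub← t (λ n o → wkN w (h n (∨-introʳ (occT n s) o))) y) l
  rel-sub← (RTC φ s t) h d = d
  rel-sub← (`¬ φ)   h d = ¬I (¬E (d ↑) (rel-sub→ φ (λ n o → h n o ↑) h0))
  rel-sub← (φ `∧ ψ) h d = ∧I (rel-sub← φ (λ n o → h n (∨-introˡ _ o)) (∧E₁ d)) (rel-sub← ψ (λ n o → h n (∨-introʳ (occF n φ) o)) (∧E₂ d))
  rel-sub← (φ `∨ ψ) h d = ∨E d (∨I₁ (rel-sub← φ (λ n o → h n (∨-introˡ _ o) ↑) h0)) (∨I₂ (rel-sub← ψ (λ n o → h n (∨-introʳ (occF n φ) o) ↑) h0))
  rel-sub← (φ `→ ψ) h d = →I (rel-sub← ψ (λ n o → h n (∨-introʳ (occF n φ) o) ↑) (→E (d ↑) (rel-sub→ φ (λ n o → h n (∨-introˡ _ o) ↑) h0)))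
  rel-sub← {σ = σ} {η} {η'} (`∀ φ) h d = ∀I (rel (fsub (lift σ) φ)) η λ x → rel-sub← φ (lift-values x h) (∀E (rel φ) η' d x)
  rel-sub← {σ = σ} {η} {η'} (`∃ φ) h d = ∃E (rel φ) η' d λ x → ∃I (rel (fsub (lift σ) φ)) η x (rel-sub← φ (lift-values x λ n o → h n o ↑) h0)

  relInterp : Interp TR
  relInterp = record
    { tr = rel ; tr-¬ = λ _ → refl ; tr-∧ = λ _ _ → refl ; tr-∨ = λ _ _ → refl ; tr-→ = λ _ _ → refl ; tr-∀ = λ _ → refl ; tr-∃ = λ _ → refl
    ; Val = Value ; Val-wk = λ w x → wkN w x ; Val-var = λ _ _ → ≐R _ ; Val-ex = value-ex
    ; sub→ = rel-sub→ ; sub← = rel-sub←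
    ; eq→ = λ {Γ} {s} {t} {η} {v} {w} x y d → eqE s t η d λ u i p q →
        value-fun s η v u (wkN i x) p ∙ value-fun t η u w q (wkN i y)
    ; eq← = λ {Γ} {s} {t} {η} {v} {w} x y e → eqI s t η w (val-conv s e x) y }

-- Soundness of cyclic arithmetic in TR, under the relational interpretation

depth : Tm → ℕ
depth (var n)  = 1
depth `0       = 1
depth (`s t)   = suc (depth t)
depth (t `+ u) = suc (depth t ⊔ depth u)
depth (t `· u) = suc (depth t ⊔ depth u)

-- Variables have depth 1, the least depth there is.
depth-sub : ∀ {θ} t → depth t ≤ depth (tsub θ t)
depth-sub {θ} (var n) = pos (θ n)
  where
  pos : ∀ t → 1 ≤ depth t
  pos (var _)  = s≤s z≤n
  pos `0       = s≤s z≤n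
  pos (`s _)   = s≤s z≤n
  pos (_ `+ _) = s≤s z≤n
  pos (_ `· _) = s≤s z≤n
depth-sub `0       = s≤s z≤n
depth-sub (`s t)   = s≤s (depth-sub t)
depth-sub (t `+ u) = s≤s (Nₚ.⊔-mono-≤ (depth-sub t) (depth-sub u))
depth-sub (t `· u) = s≤s (Nₚ.⊔-mono-≤ (depth-sub t) (depth-sub u))

terms : ℕ → ℕ → List Tm
terms K zero    = []
terms K (suc d) = map var (upTo K) ++ `0 ∷ map `s (terms K d) ++
  cartesianProductWith _`+_ (terms K d) (terms K d) ++ cartesianProductWith _`·_ (terms K d) (terms K d)

∈-terms : ∀ {K} d t → depth t ≤ d → (∀ n → occT n t ≡ true → n < K) → t ∈ terms K d
∈-terms zero    (var n)  () h
∈-terms zero    `0       () h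
∈-terms zero    (`s t)   () h
∈-terms zero    (t `+ u) () h
∈-terms zero    (t `· u) () h
∈-terms (suc d) (var n)  _ h = ∈ₚ.∈-++⁺ˡ (∈ₚ.∈-map⁺ var (∈ₚ.∈-upTo⁺ (h n (≡ᵇ-same n))))
∈-terms {K} (suc d) `0   _ h = ∈ₚ.∈-++⁺ʳ (map var (upTo K)) (here refl)
∈-terms {K} (suc d) (`s t) (s≤s l) h = ∈ₚ.∈-++⁺ʳ (map var (upTo K)) (there (∈ₚ.∈-++⁺ˡ (∈ₚ.∈-map⁺ `s (∈-terms d t l h))))
∈-terms {K} (suc d) (t `+ u) (s≤s l) h = ∈ₚ.∈-++⁺ʳ (map var (upTo K)) (there (∈ₚ.∈-++⁺ʳ (map `s (terms K d)) (∈ₚ.∈-++⁺ˡ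
  (∈ₚ.∈-cartesianProductWith⁺ _`+_ (∈-terms d t (Nₚ.m⊔n≤o⇒m≤o (depth t) (depth u) l) λ n o → h n (∨-introˡ _ o))
                                   (∈-terms d u (Nₚ.m⊔n≤o⇒n≤o (depth t) (depth u) l) λ n o → h n (∨-introʳ (occT n t) o))))))
∈-terms {K} (suc d) (t `· u) (s≤s l) h = ∈ₚ.∈-++⁺ʳ (map var (upTo K)) (there (∈ₚ.∈-++⁺ʳ (map `s (terms K d)) (∈ₚ.∈-++⁺ʳ
  (cartesianProductWith _`+_ (terms K d) (terms K d))
  (∈ₚ.∈-cartesianProductWith⁺ _`·_ (∈-terms d t (Nₚ.m⊔n≤o⇒m≤o (depth t) (depth u) l) λ n o → h n (∨-introˡ _ o))
                                   (∈-terms d u (Nₚ.m⊔n≤o⇒n≤o (depth t) (depth u) l) λ n o → h n (∨-introʳ (occT n t) o))))))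

atom-depth : Fm → ℕ
atom-depth (s ≐ t) = depth s ⊔ depth t
atom-depth (s ≺ t) = depth s ⊔ depth t
atom-depth _       = 0

max-depth : List Fm → ℕ
max-depth []      = 0
max-depth (φ ∷ Φ) = atom-depth φ ⊔ max-depth Φ

∈-depth : ∀ {φ Φ} → φ ∈ Φ → atom-depth φ ≤ max-depth Φ
∈-depth {Φ = φ ∷ Φ} (here refl) = Nₚ.m≤m⊔n (atom-depth φ) (max-depth Φ)
∈-depth {Φ = φ ∷ Φ} (there m)   = Nₚ.≤-trans (∈-depth m) (Nₚ.m≤n⊔m (atom-depth φ) (max-depth Φ))

Linked : Seq → Tm → Tm → Set
Linked S' a b = (a ≡ b) ⊎ ((b ≐ a) ∈ ant S') ⊎ ((a ≐ b) ∈ ant S') ⊎ ((b ≺ a) ∈ ant S')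

module CAtoR where
  open Mul
  open Rel
  open LKSound TR relInterp
  open DecMem _≟F_ using (_∈?_)

  linked? : ∀ S' a b → Dec (Linked S' a b)
  linked? S' a b = (a ≟T b) ⊎-dec (((b ≐ a) ∈? ant S') ⊎-dec (((a ≐ b) ∈? ant S') ⊎-dec ((b ≺ a) ∈? ant S')))

  caStep? : ∀ {S Ps} (r : CARule S Ps) S' a b → Dec (caStep r S' a b)
  caStep? (lk _)     S' a b = linked? S' a b
  caStep? (sub θ)    S' a b = a ≟T tsub θ b
  caStep? (axPA _)   S' a b = linked? S' a b
  caStep? (case _ _) S' a b = linked? S' a b

  caProg? : ∀ {S Ps} (r : CARule S Ps) S' a b → Dec (caProg r S' a b)
  caProg? (lk _)     S' a b = (b ≺ a) ∈? ant S'
  caProg? (sub θ)    S' a b = no λ ()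
  caProg? (axPA _)   S' a b = (b ≺ a) ∈? ant S'
  caProg? (case _ _) S' a b = (b ≺ a) ∈? ant S'

  TmIn? : ∀ S t → Dec (TmIn S t)
  TmIn? S@(Γ ⇒ Δ) t = map′ (λ f n o → f (occT-bnd n t o) o) (λ g {n} _ o → g n o)
    (Nₚ.allUpTo? (λ n → (occT n t Data.Bool.≟ true) →-dec (any (occF n) (Γ ++ Δ) Data.Bool.≟ true)) (bndT t))

  value-agree : ∀ {Γ η η' v} t → (∀ n → occT n t ≡ true → η n ≡ η' n) → Value Γ t η v → Value Γ t η' v
  value-agree {Γ} {η} {η'} {v} t h d = value-sub→ {σ = var} {η = η} {η' = η'} t (λ n o → subst (λ x → Γ ⊢ x ≐ η n) (h n o) (≐R (η n)))
    (cast (cong (λ u → fsub (v ∷ˢ η) (valF u)) (sym (tsub-id t))) d)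

  module ChT = Choice TR _≟T_
  module ChN = Choice TR N._≟_

  module _ (objs : List Tm) where
    open TraceSound TR relInterp CATrace _≟T_ TmIn? caStep? caProg? valF objs

    module _ {S Ps} (r : CARule S Ps) {Γ η} (X : Tm → Tm) (meas : Measured Γ S η X)
      (stp : ∀ {S' a b} → caStep r S' a b → Linked S' a b) (prg : ∀ {S' a b} → caProg r S' a b → (b ≺ a) ∈ ant S')
      (prem : ∀ S' → S' ∈ Ps → ∀ {Δ} → Γ ⊆ Δ → ∀ η' Z → Measured Δ S' η' Z → Decrease Δ r S' X Z → True Δ S' η') where

      -- Values of terms are unique, so in contrast to path lengths the new quantities cannot
      -- conflict: they are compared with the old ones through the atoms in the antecedent of S'.
      -- Validity in S is what keeps the old value under η'.
      premise : ∀ S' → S' ∈ Ps → ∀ {Δ} → Γ ⊆ Δ → ∀ η' → Agree S η η' → True Δ S' η'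
      premise S' m {Δ} w η' ag {Θ} w' a b = ChT.choose (λ Δ o x → Value Δ o η' x) (λ s → wkN s) objs (λ o _ _ k → value-ex o η' k) λ Z {Ξ} w″ q →
        prem S' m (w″ ∘ w' ∘ w) η' Z (λ o m _ → q o m)
            (record { weakly = λ t u mt mu vt _ s → leq w″ q t u mt mu vt (stp s) ; strictly = λ t u mt mu vt _ s → less w″ q t u mt mu vt (prg s) })
            id (wkN w″ ∘ a) (wkN w″ ∘ b)
        where
        eq : ∀ {Γ x y} → Γ ⊢ x ≐ y → Γ ⊢ le x y
        eq {x = x} e = le-resp (≐R x) e (le-refl x)
        old : ∀ {Ξ} → Θ ⊆ Ξ → ∀ t → t ∈ objs → TmIn S t → Value Ξ t η' (X t)
        old s t mt vt = value-agree t (λ n o → ag n (vt n o)) (wkN (s ∘ w' ∘ w) (meas t mt vt))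
        module _ {Z : Tm → Tm} {Ξ : List Fm} (w″ : Θ ⊆ Ξ) (q : ∀ o → o ∈ objs → Value Ξ o η' (Z o)) where
          less : ∀ t u → t ∈ objs → u ∈ objs → TmIn S t → (u ≺ t) ∈ ant S' → Ξ ⊢ lt (Z u) (X t)
          less t u mt mu vt m' = ltE u t η' (wkN w″ (a m')) λ x y s p q' l → le-resp
            (s-cong (value-fun u η' x (Z u) p (wkN s (q u mu)))) (value-fun t η' y (X t) q' (wkN s (old w″ t mt vt))) l
          leq : ∀ t u → t ∈ objs → u ∈ objs → TmIn S t → Linked S' t u → Ξ ⊢ le (Z u) (X t)
          leq t u mt mu vt (inj₁ refl) = eq (value-fun t η' (Z t) (X t) (q t mt) (old w″ t mt vt))
          leq t u mt mu vt (inj₂ (inj₁ m')) = eqE u t η' (wkN w″ (a m')) λ v s x y →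
            eq (value-fun u η' (Z u) v (wkN s (q u mu)) x ∙ value-fun t η' v (X t) y (wkN s (old w″ t mt vt)))
          leq t u mt mu vt (inj₂ (inj₂ (inj₁ m'))) = eqE t u η' (wkN w″ (a m')) λ v s x y →
            eq (value-fun u η' (Z u) v (wkN s (q u mu)) y ∙ value-fun t η' v (X t) x (wkN s (old w″ t mt vt)))
          leq t u mt mu vt (inj₂ (inj₂ (inj₂ m'))) = lt⇒le (Z u) (X t) (less t u mt mu vt m')

    axSound : ∀ {S} → AxPA S → ∀ {Δ η} → Ants Δ (ant S) η → Negs Δ (sc S) η → Δ ⊢ ⊥'
    axSound (p-s0 {t}) {η = η} a b = eqE (`s t) `0 η (a (here refl)) λ v w x y → val-sE t η v x λ v' w' x' e → s0 ((e ⁻¹) ∙ wkN w' y)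
    axSound (p-inj {t} {u}) {η = η} a b = eqE (`s t) (`s u) η (a (here refl)) λ v w x y → val-sE t η v x λ p w' x' e → val-sE u η v (wkN w' y) λ q w″ y' e' →
      ¬E (wkN w″ (wkN w' (wkN w (b (here refl))))) (eqI t u η p (wkN w″ x') (val-conv u (inj ((e' ⁻¹) ∙ wkN w″ e)) y'))
    axSound (p-+0 {t}) {η = η} a b = value-ex t η λ v w x → ¬E (wkN w (b (here refl)))
      (eqI (t `+ `0) t η v (val-+I t `0 v `0 v x (≐R `0) (+0 v ⁻¹)) x)
    axSound (p-+s {t} {u}) {η = η} a b = value-ex t η λ v w x → value-ex u η λ v' w' y → ¬E (wkN w' (wkN w (b (here refl))))
      (eqI (t `+ `s u) (`s (t `+ u)) η (`s (v `+ v'))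
        (val-+I t (`s u) v (`s v') (`s (v `+ v')) (wkN w' x) (val-sI u v' (`s v') y (≐R _)) (+s v v' ⁻¹))
        (val-sI (t `+ u) (v `+ v') (`s (v `+ v')) (val-+I t u v v' (v `+ v') (wkN w' x) y (≐R _)) (≐R _)))
    axSound (p-·0 {t}) {η = η} a b = value-ex t η λ v w x → mul-ex v `0 λ c w' m → ¬E (wkN w' (wkN w (b (here refl))))
      (eqI (t `· `0) `0 η c (val-·I t `0 v `0 c (wkN w' x) (≐R `0) m) (mul-0 v c m))
    axSound (p-·s {t} {u}) {η = η} a b = value-ex t η λ v w x → value-ex u η λ v' w' y → mul-ex v (`s v') λ c w″ m → mul-s v v' c m λ d w‴ e m' →
      ¬E (wkN w‴ (wkN w″ (wkN w' (wkN w (b (here refl))))))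
      (eqI (t `· `s u) ((t `· u) `+ t) η c
        (val-·I t (`s u) v (`s v') c (wkN w‴ (wkN w″ (wkN w' x))) (val-sI u v' (`s v') (wkN w‴ (wkN w″ y)) (≐R _)) (wkN w‴ m))
        (val-+I (t `· u) t d v c (val-·I t u v v' d (wkN w‴ (wkN w″ (wkN w' x))) (wkN w‴ (wkN w″ y)) m') (wkN w‴ (wkN w″ (wkN w' x))) e))
    axSound (o-tr {t} {u} {v}) {η = η} a b = ltE t u η (a (here refl)) λ p q w x y l → ltE u v η (wkN w (a (there (here refl)))) λ p' q' w' x' y' l' →
      ¬E (wkN w' (wkN w (b (here refl)))) (ltI t v η p q' (wkN w' x) y'
        (le-trans (`s p) p' q' (le-resp (≐R (`s p)) (value-fun u η q p' (wkN w' y) x') (wkN w' l)) (lt⇒le p' q' l')))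
    axSound (o-as {t} {u}) {η = η} a b = ltE t u η (a (here refl)) λ p q w x y l → ltE u t η (wkN w (a (there (here refl)))) λ p' q' w' x' y' l' →
      lt-irr p (le-trans (`s p) q p (wkN w' l) (lt⇒le q p (le-resp (s-cong (value-fun u η p' q x' (wkN w' y))) (value-fun t η q' p y' (wkN w' x)) l')))
    axSound (o-dis {t} {u}) {η = η} a b = ltE t u η (a (here refl)) λ p q w x y l → ltE u (`s t) η (wkN w (a (there (here refl)))) λ p' q' w' x' y' l' →
      lt-irr p (le-trans (`s p) q p (wkN w' l) (le-s⁻ q p (le-resp (s-cong (value-fun u η p' q x' (wkN w' y)))
        (value-fun (`s t) η q' (`s p) y' (val-sI t p (`s p) (wkN w' x) (≐R _))) l')))
    axSound (o-0 {t}) {η = η} a b = ltE t `0 η (a (here refl)) λ p q w x y l → lt-0 p (le-resp (≐R (`s p)) y l)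
    axSound (o-mon {t} {u}) {η = η} a b = ltE t u η (a (here refl)) λ p q w x y l → ¬E (wkN w (b (here refl)))
      (ltI (`s t) (`s u) η (`s p) (`s q) (val-sI t p (`s p) x (≐R _)) (val-sI u q (`s q) y (≐R _)) (le-s (`s p) q l))
    axSound (o-suc {t}) {η = η} a b = value-ex t η λ v w x → ¬E (wkN w (b (here refl)))
      (ltI t (`s t) η v (`s v) x (val-sI t v (`s v) x (≐R _)) (le-refl (`s v)))
    axSound (o-tot {t} {u}) {η = η} a b = value-ex t η λ v w x → value-ex u η λ v' w' y → ∨E (le-total v v')
      (le-split v v' h0
        (¬E (wkN (there ∘ there ∘ w' ∘ w) (b (here refl))) (ltI t u η v v' (wkN (there ∘ there ∘ w') x) (y ↑²) h0))
        (¬E (wkN (there ∘ there ∘ w' ∘ w) (b (there (here refl)))) (eqI t u η v (wkN (there ∘ there ∘ w') x) (val-conv u (h0 ⁻¹) (y ↑²)))))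
      (¬E (wkN (there ∘ w' ∘ w) (b (there (there (here refl))))) (ltI u t η v' v (y ↑) (wkN (there ∘ w') x) h0))

    ruleSound : ∀ {S Ps} (r : CARule S Ps) → RuleSound r
    ruleSound r@(lk l) X meas prem = lkSound l λ S' m w η' ag → premise r X meas id id prem S' m w η' ag
    ruleSound (axPA x) X meas prem w a b = axSound x a b
    ruleSound r@(sub {S@(Φ ⇒ Ψ)} θ) {Γ} {η} X meas prem {Δ} w a b =
      -- θ n need not have a value that is a term of the RTC language in η, so the assignment for
      -- the premise is chosen at its finitely many free variables.
      ChN.choose (λ Δ n x → Value Δ (θ n) η x) (λ s → wkN s) (upTo K) (λ n _ _ k → value-ex (θ n) η k) λ η' w₁ q →
      ChT.choose (λ Δ o x → Value Δ o η' x) (λ s → wkN s) objs (λ o _ _ k → value-ex o η' k) λ Z {Ξ} w₂ q' →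
      let
        vals : ∀ {occ : ℕ → Bool} → (∀ n → occ n ≡ true → FreeIn n S) → Values Ξ occ θ η η'
        vals h n o = wkN w₂ (q n (∈ₚ.∈-upTo⁺ (free⇒< {Φ} {Ψ} (h n o))))
      in prem S (here refl) (w₂ ∘ w₁ ∘ w) η' Z (λ o m _ → q' o m)
        (record { weakly = λ { t u mt mu vt vu refl → let e = value-fun u η' (Z u) (X t) (q' u mu)
                                                             (value-sub→ u (vals vu) (wkN (w₂ ∘ w₁ ∘ w) (meas t mt vt)))
                                                      in le-resp (≐R (Z u)) e (le-refl (Z u)) }
                ; strictly = λ _ _ _ _ _ _ () })
        id (λ {φ} m → rel-sub→ φ (vals λ n → free-ant S m) (wkN (w₂ ∘ w₁) (a (∈ₚ.∈-map⁺ (fsub θ) m))))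
        (λ {φ} m → ¬I (¬E (wkN (there ∘ w₂ ∘ w₁) (b (∈ₚ.∈-map⁺ (fsub θ) m))) (rel-sub← φ (λ n o → vals (λ n → free-sc S m) n o ↑) h0)))
      where
      K = bndL (Φ ++ Ψ)
    ruleSound {S} r@(case {Φ} {Ψ} {t} x f) {Γ} {η} X meas prem {Δ} w a b = ltE `0 t η (a (here refl)) λ y v w₁ _ vt l → cases v
      (lt-0 y (le-resp (≐R (`s y)) h0 (l ↑)))
      λ p → let module E = Eigen {S} f η p in
        premise r X meas id id prem (t ≐ `s (var x) ∷ Φ ⇒ Ψ) (here refl) (there ∘ w₁ ∘ w) E.η' (agree-upd {S = S} f) id
          (eqI t (`s (var x)) E.η' v (value-agree t (λ n o → agree-upd {S = S} f n (free-ant S (here refl) o)) (vt ↑))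
               (val-sI {η = E.η'} (var x) p v (cast (cong (p ≐_) (sym (upd-same η x p))) (≐R p)) h0)
           ▸ λ {φ} m → E.keep φ (λ n → free-ant S (there m)) (wkN (there ∘ w₁) (a (there m))))
          (λ {φ} m → E.keep¬ φ (λ n → free-sc S m) (wkN (there ∘ w₁) (b m)))

  -- A trace term stays the same, is replaced by a term occurring in an antecedent, or passes
  -- backwards through a substitution, which cannot increase its depth.
  step-depth : ∀ {S Ps D} (r : CARule S Ps) S' a b → max-depth (ant S') ≤ D → caStep r S' a b → depth a ≤ D → depth b ≤ D
  step-depth {D = D} r S' a b dS st da = go r st
    where
    sum : Linked S' a b → depth b ≤ D
    sum (inj₁ refl) = da
    sum (inj₂ (inj₁ m)) = Nₚ.≤-trans (Nₚ.m≤m⊔n (depth b) (depth a)) (Nₚ.≤-trans (∈-depth m) dS)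
    sum (inj₂ (inj₂ (inj₁ m))) = Nₚ.≤-trans (Nₚ.m≤n⊔m (depth a) (depth b)) (Nₚ.≤-trans (∈-depth m) dS)
    sum (inj₂ (inj₂ (inj₂ m))) = Nₚ.≤-trans (Nₚ.m≤m⊔n (depth b) (depth a)) (Nₚ.≤-trans (∈-depth m) dS)
    go : ∀ {S Ps} (r : CARule S Ps) → caStep r S' a b → depth b ≤ D
    go (lk _)     st   = sum st
    go (sub θ)    refl = Nₚ.≤-trans (depth-sub b) da
    go (axPA _)   st   = sum st
    go (case _ _) st   = sum st

  prog-depth : ∀ {S Ps D} (r : CARule S Ps) S' a b → max-depth (ant S') ≤ D → caProg r S' a b → depth b ≤ D
  prog-depth {D = D} r S' a b dS p = Nₚ.≤-trans (Nₚ.m≤m⊔n (depth b) (depth a)) (Nₚ.≤-trans (∈-depth (go r p)) dS)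
    where
    go : ∀ {S Ps} (r : CARule S Ps) → caProg r S' a b → (b ≺ a) ∈ ant S'
    go (lk _)     p = p
    go (axPA _)   p = p
    go (case _ _) p = p

  toR : ∀ {L S} → Proof CARule CATrace L S → ∀ {Γ} η → True Γ S η
  toR {S = S} P {Γ} η w a b = ChT.choose (λ Δ o x → Value Δ o η x) (λ s → wkN s) objs (λ o _ _ k → value-ex o η k)
      λ Z s q → subst (λ S' → Measured _ S' η Z → True _ S' η) (Proof.rootIs P)
        (TraceSound.sound TR relInterp CATrace _≟T_ TmIn? caStep? caProg? valF objs (Proof.graph P) good (λ i → ruleSound objs (rule i)) (Proof.root P) Z)
        (λ o m _ → q o m) id (wkN s ∘ a) (wkN s ∘ b)
    where
    open Graph (Proof.graph P)
    all-fms : List Fm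
    all-fms = concatMap (λ i → ant (node i) ++ sc (node i)) (allFin size)
    K D : ℕ
    K = bndL all-fms
    D = max-depth all-fms
    objs : List Tm
    objs = terms K D
    open TraceSound TR relInterp CATrace _≟T_ TmIn? caStep? caProg? valF objs using (Measured)
    in-all : ∀ i {φ} → φ ∈ ant (node i) ++ sc (node i) → φ ∈ all-fms
    in-all i m = ∈ₚ.∈-concatMap⁺ (λ i → ant (node i) ++ sc (node i)) (Any.map (λ { refl → m }) (∈ₚ.∈-allFin i))
    max-⊆ : ∀ Φ Ψ → Φ ⊆ Ψ → max-depth Φ ≤ max-depth Ψ
    max-⊆ []      Ψ s = z≤n
    max-⊆ (φ ∷ Φ) Ψ s = Nₚ.⊔-lub (∈-depth (s (here refl))) (max-⊆ Φ Ψ (s ∘ there))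
    node-depth : ∀ i → max-depth (ant (node i)) ≤ D
    node-depth i = max-⊆ (ant (node i)) all-fms λ m → in-all i (∈ₚ.∈-++⁺ˡ m)
    small : ∀ i t → TmIn (node i) t → ∀ n → occT n t ≡ true → n < K
    small i t v n o with any-elim (occF n) (ant (node i) ++ sc (node i)) (v n o)
    ... | φ , m , o' = Nₚ.≤-trans (occF-bnd n φ o') (bndL-∈ (in-all i m))
    good : (p : Path (Proof.graph P)) → Σ ℕ λ k₀ → Σ (ℕ → Tm) λ τ →
      IsTrace CATrace (Proof.graph P) p k₀ τ × InfProg CATrace (Proof.graph P) p k₀ τ × (∀ k → k₀ ≤ k → τ k ∈ objs)
    good p with Proof.good P p
    ... | k₀ , τ , tr , pr with pr k₀
    -- The trace is cut off right after a progress point. The term reached there is an argument of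
    -- `≺` in an antecedent and hence of depth at most D; before that point nothing bounds the
    -- depth.
    ...   | k₁ , _ , h₁ , p₁ = suc k₁ , τ , (λ k h → tr k (≤₀ h)) ,
            (λ m → let k , a , h , q = pr (m ⊔ suc k₁) in k , Nₚ.m⊔n≤o⇒m≤o m (suc k₁) a , Nₚ.m⊔n≤o⇒n≤o m (suc k₁) a , q) ,
            λ k h → ∈-terms D (τ k) (dep k h) (small (at k) (τ k) (proj₁ (tr k (≤₀ h))))
            where
            open Path p
            ≤₀ : ∀ {k} → suc k₁ ≤ k → k₀ ≤ k
            ≤₀ h = Nₚ.≤-trans h₁ (Nₚ.≤-trans (Nₚ.n≤1+n k₁) h)
            dep' : ∀ d → depth (τ (d + suc k₁)) ≤ D
            dep' zero    = prog-depth (rule (at k₁)) (node (at (suc k₁))) (τ k₁) (τ (suc k₁)) (node-depth (at (suc k₁))) p₁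
            dep' (suc d) = step-depth (rule (at (d + suc k₁))) (node (at (suc d + suc k₁))) (τ (d + suc k₁)) _ (node-depth (at (suc d + suc k₁)))
              (proj₂ (tr (d + suc k₁) (≤₀ (Nₚ.m≤n+m (suc k₁) d)))) (dep' d)
            dep : ∀ k → suc k₁ ≤ k → depth (τ k) ≤ D
            dep k h = subst (λ x → depth (τ x) ≤ D) (Nₚ.m∸n+n≡m h) (dep' (k N.∸ suc k₁))

-- Erasing foreign symbols from proofs: · and ≺ from RTC-proofs, RTC from proofs of arithmetic.
-- The images keep all free variables, since these matter for freshness and for traces.

data Lang : Set where
  rtc pa : Lang

eMul : Lang → Tm → Tm → Tm
eMul rtc t u = t `+ u
eMul pa  t u = t `· u

eLt : Lang → Tm → Tm → Fm
eLt rtc t u = t ≐ u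
eLt pa  t u = t ≺ u

-- The two quantifiers bind the variables that RTC binds in φ, and the equation keeps the variables
-- of both end terms.
eRTC : Lang → Fm → Tm → Tm → Fm
eRTC rtc φ t u = RTC φ t u
eRTC pa  φ t u = `∃ (`∃ φ) `∧ (t ≐ u)

module Erase (l : Lang) where
  eT : Tm → Tm
  eT (var n)  = var n
  eT `0       = `0
  eT (`s t)   = `s (eT t)
  eT (t `+ u) = eT t `+ eT u
  eT (t `· u) = eMul l (eT t) (eT u)

  eF : Fm → Fm
  eF (s ≐ t)     = eT s ≐ eT t
  eF (s ≺ t)     = eLt l (eT s) (eT t)
  eF (RTC φ s t) = eRTC l (eF φ) (eT s) (eT t)
  eF (`¬ φ)      = `¬ (eF φ)
  eF (φ `∧ ψ)    = eF φ `∧ eF ψ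
  eF (φ `∨ ψ)    = eF φ `∨ eF ψ
  eF (φ `→ ψ)    = eF φ `→ eF ψ
  eF (`∀ φ)      = `∀ (eF φ)
  eF (`∃ φ)      = `∃ (eF φ)

  eMul-sub : ∀ l {σ} t u → tsub σ (eMul l t u) ≡ eMul l (tsub σ t) (tsub σ u)
  eMul-sub rtc t u = refl
  eMul-sub pa  t u = refl

  eLt-sub : ∀ l {σ} t u → fsub σ (eLt l t u) ≡ eLt l (tsub σ t) (tsub σ u)
  eLt-sub rtc t u = refl
  eLt-sub pa  t u = refl

  eRTC-sub : ∀ l {σ} φ t u → fsub σ (eRTC l φ t u) ≡ eRTC l (fsub (lift (lift σ)) φ) (tsub σ t) (tsub σ u)
  eRTC-sub rtc φ t u = refl
  eRTC-sub pa  φ t u = refl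

  eT-sub : ∀ {σ} t → eT (tsub σ t) ≡ tsub (eT ∘ σ) (eT t)
  eT-sub (var n)  = refl
  eT-sub `0       = refl
  eT-sub (`s t)   = cong `s (eT-sub t)
  eT-sub (t `+ u) = cong₂ _`+_ (eT-sub t) (eT-sub u)
  eT-sub (t `· u) = trans (cong₂ (eMul l) (eT-sub t) (eT-sub u)) (sym (eMul-sub l (eT t) (eT u)))

  eT-lift : ∀ {σ} n → eT (lift σ n) ≡ lift (eT ∘ σ) n
  eT-lift zero        = refl
  eT-lift {σ} (suc n) = eT-sub (σ n)

  eF-lift : ∀ {σ} φ → fsub (eT ∘ lift σ) φ ≡ fsub (lift (eT ∘ σ)) φ
  eF-lift φ = fsub-ext φ eT-lift

  eF-sub : ∀ {σ} φ → eF (fsub σ φ) ≡ fsub (eT ∘ σ) (eF φ)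
  eF-sub (s ≐ t)     = cong₂ _≐_ (eT-sub s) (eT-sub t)
  eF-sub (s ≺ t)     = trans (cong₂ (eLt l) (eT-sub s) (eT-sub t)) (sym (eLt-sub l (eT s) (eT t)))
  eF-sub {σ} (RTC φ s t) = trans (cong (λ x → eRTC l x _ _) (trans (eF-sub φ) (fsub-ext (eF φ)
      λ n → trans (eT-lift {lift σ} n) (lift-agree {P = λ _ → ⊤} (λ m _ → eT-lift m) n tt))))
    (trans (cong₂ (eRTC l _) (eT-sub s) (eT-sub t)) (sym (eRTC-sub l (eF φ) (eT s) (eT t))))
  eF-sub (`¬ φ)      = cong `¬ (eF-sub φ)
  eF-sub (φ `∧ ψ)    = cong₂ _`∧_ (eF-sub φ) (eF-sub ψ)
  eF-sub (φ `∨ ψ)    = cong₂ _`∨_ (eF-sub φ) (eF-sub ψ)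
  eF-sub (φ `→ ψ)    = cong₂ _`→_ (eF-sub φ) (eF-sub ψ)
  eF-sub (`∀ φ)      = cong `∀ (trans (eF-sub φ) (eF-lift (eF φ)))
  eF-sub (`∃ φ)      = cong `∃ (trans (eF-sub φ) (eF-lift (eF φ)))

  eF-inst1 : ∀ φ t → eF (inst1 φ t) ≡ inst1 (eF φ) (eT t)
  eF-inst1 φ t = trans (cong eF (inst1-cons φ t)) (trans (eF-sub φ) (trans
    (fsub-ext (eF φ) λ { zero → refl ; (suc n) → refl }) (sym (inst1-cons (eF φ) (eT t)))))

  eF-inst2 : ∀ φ r t → eF (inst2 φ r t) ≡ inst2 (eF φ) (eT r) (eT t)
  eF-inst2 φ r t = trans (cong eF (inst2-cons φ r t)) (trans (eF-sub φ) (trans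
    (fsub-ext (eF φ) λ { zero → refl ; (suc zero) → refl ; (suc (suc n)) → refl }) (sym (inst2-cons (eF φ) (eT r) (eT t)))))

  eT-occ : ∀ n t → occT n (eT t) ≡ occT n t
  eT-occ n (var m)  = refl
  eT-occ n `0       = refl
  eT-occ n (`s t)   = eT-occ n t
  eT-occ n (t `+ u) = cong₂ _∨_ (eT-occ n t) (eT-occ n u)
  eT-occ n (t `· u) = trans (go l) (cong₂ _∨_ (eT-occ n t) (eT-occ n u))
    where
    go : ∀ l → occT n (eMul l (eT t) (eT u)) ≡ occT n (eT t) ∨ occT n (eT u)
    go rtc = refl
    go pa  = refl

  eF-occ : ∀ n φ → occF n (eF φ) ≡ occF n φ
  eF-occ n (s ≐ t)     = cong₂ _∨_ (eT-occ n s) (eT-occ n t)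
  eF-occ n (s ≺ t)     = trans (go l) (cong₂ _∨_ (eT-occ n s) (eT-occ n t))
    where
    go : ∀ l → occF n (eLt l (eT s) (eT t)) ≡ occT n (eT s) ∨ occT n (eT t)
    go rtc = refl
    go pa  = refl
  eF-occ n (RTC φ s t) = trans (go l) (cong₂ _∨_ (eF-occ (suc (suc n)) φ) (cong₂ _∨_ (eT-occ n s) (eT-occ n t)))
    where
    go : ∀ l → occF n (eRTC l (eF φ) (eT s) (eT t)) ≡ occF (suc (suc n)) (eF φ) ∨ (occT n (eT s) ∨ occT n (eT t))
    go rtc = refl
    go pa  = refl
  eF-occ n (`¬ φ)      = eF-occ n φ
  eF-occ n (φ `∧ ψ)    = cong₂ _∨_ (eF-occ n φ) (eF-occ n ψ)
  eF-occ n (φ `∨ ψ)    = cong₂ _∨_ (eF-occ n φ) (eF-occ n ψ)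
  eF-occ n (φ `→ ψ)    = cong₂ _∨_ (eF-occ n φ) (eF-occ n ψ)
  eF-occ n (`∀ φ)      = eF-occ (suc n) φ
  eF-occ n (`∃ φ)      = eF-occ (suc n) φ

  eS : Seq → Seq
  eS (Γ ⇒ Δ) = map eF Γ ⇒ map eF Δ

  any-e : ∀ z Γ Δ → any (occF z) (map eF Γ ++ map eF Δ) ≡ any (occF z) (Γ ++ Δ)
  any-e z []      []      = refl
  any-e z []      (φ ∷ Δ) = cong₂ _∨_ (eF-occ z φ) (any-e z [] Δ)
  any-e z (φ ∷ Γ) Δ       = cong₂ _∨_ (eF-occ z φ) (any-e z Γ Δ)

  eFresh : ∀ {z Γ Δ} → Fresh z (Γ ⇒ Δ) → Fresh z (eS (Γ ⇒ Δ))
  eFresh {z} {Γ} {Δ} f = trans (any-e z Γ Δ) f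

  e⊆ : ∀ {Γ Δ : List Fm} → Γ ⊆ Δ → map eF Γ ⊆ map eF Δ
  e⊆ s m with ∈ₚ.∈-map⁻ eF m
  ... | φ , m' , refl = ∈ₚ.∈-map⁺ eF (s m')

  eSub : ∀ θ S → eS (substSeq θ S) ≡ substSeq (eT ∘ θ) (eS S)
  eSub θ (Γ ⇒ Δ) = cong₂ _⇒_ (go Γ) (go Δ)
    where
    go : ∀ Φ → map eF (map (fsub θ) Φ) ≡ map (fsub (eT ∘ θ)) (map eF Φ)
    go []      = refl
    go (φ ∷ Φ) = cong₂ _∷_ (eF-sub φ) (go Φ)

  eLK : ∀ {S Ps} → LK S Ps → LK (eS S) (map eS Ps)
  eLK ax        = ax
  eLK (wk s s') = wk (e⊆ s) (e⊆ s')
  eLK ¬L        = ¬L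
  eLK ¬R        = ¬R
  eLK ∧L        = ∧L
  eLK ∧R        = ∧R
  eLK ∨L        = ∨L
  eLK ∨R        = ∨R
  eLK →L        = →L
  eLK →R        = →R
  eLK (∀L {φ = φ} t) rewrite eF-inst1 φ t = ∀L (eT t)
  eLK (∀R {Γ} {Δ} {φ} z f) rewrite eF-inst1 φ (var z) = ∀R z (eFresh {z} {Γ} {`∀ φ ∷ Δ} f)
  eLK (∃L {Γ} {Δ} {φ} z f) rewrite eF-inst1 φ (var z) = ∃L z (eFresh {z} {`∃ φ ∷ Γ} {Δ} f)
  eLK (∃R {φ = φ} t) rewrite eF-inst1 φ t = ∃R (eT t)
  eLK (=L₁ {φ = φ} {s} {t}) rewrite eF-inst1 φ s | eF-inst1 φ t = =L₁ {φ = eF φ}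
  eLK (=L₂ {φ = φ} {s} {t}) rewrite eF-inst1 φ s | eF-inst1 φ t = =L₂ {φ = eF φ}
  eLK =R        = =R
  eLK (cut φ)   = cut (eF φ)

  module Map {R : Seq → List Seq → Set} (TS : TraceSys R) (eO : TraceSys.Obj TS → TraceSys.Obj TS)
    (eValid : ∀ {S o} → TraceSys.Valid TS S o → TraceSys.Valid TS (eS S) (eO o)) where
    open TraceSys TS

    Image : ∀ {S Ps} → R S Ps → Seq → List Seq → Set
    Image r X Qs = Σ (R X Qs) λ r' → (∀ S' a b → Step r S' a b → Step r' (eS S') (eO a) (eO b))
                                    × (∀ S' a b → Prog r S' a b → Prog r' (eS S') (eO a) (eO b))

    erase : ∀ {L L' : Fm → Set} → (∀ φ → L' (eF φ)) → (∀ {S Ps} (r : R S Ps) → Image r (eS S) (map eS Ps)) →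
      ∀ {S S'} → Proof R TS L S → eS S ≡ S' → Proof R TS L' S'
    erase {L' = L'} lang' image P eq = record
      { graph = g ; root = Proof.root P ; rootIs = trans (cong eS (Proof.rootIs P)) eq
      ; lang = λ i → all-e (ant (P.node i)) , all-e (sc (P.node i))
      ; good = λ p → let k₀ , τ , tr , pr = Proof.good P (record { at = Path.at p ; step = Path.step p }) in
          k₀ , eO ∘ τ
          , (λ k h → eValid (proj₁ (tr k h)) , Join.Step-subst TS (sym (Lₚ.map-∘ (P.prem (Path.at p k))))
                       (proj₁ (proj₂ (image (P.rule (Path.at p k)))) _ _ _ (proj₂ (tr k h))))
          , λ m → let k , a , b , q = pr m in
              k , a , b , Join.Prog-subst TS (sym (Lₚ.map-∘ (P.prem (Path.at p k))))
                (proj₂ (proj₂ (image (P.rule (Path.at p k)))) _ _ _ q) }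
      where
      module P = Graph (Proof.graph P)
      all-e : ∀ Φ → All L' (map eF Φ)
      all-e Φ = Allₚ.map⁺ (All.universal lang' Φ)
      g : Graph R
      g = record { size = P.size ; node = eS ∘ P.node ; prem = P.prem
                 ; rule = λ i → subst (R _) (sym (Lₚ.map-∘ (P.prem i))) (proj₁ (image (P.rule i))) }

module EraseRTC where
  open Erase rtc

  eIsRTC : ∀ φ → IsRTCFm φ → IsRTCFm (eF φ)
  eIsRTC (RTC _ _ _) _ = tt

  valid : ∀ {S o} → o ∈ ant S × IsRTCFm o → eF o ∈ ant (eS S) × IsRTCFm (eF o)
  valid {S} {o} (m , i) = ∈ₚ.∈-map⁺ eF m , eIsRTC o i

  open Map RTCTrace eF (λ {S} {o} → valid {S} {o})

  image : ∀ {S Ps} (r : RTCRule S Ps) → Image r (eS S) (map eS Ps)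
  image (lk r) = lk (eLK r) , (λ _ _ _ → cong eF) , λ _ _ _ ()
  image r@(sub {S} θ) = subst (λ X → Image r X (eS S ∷ [])) (sym (eSub θ S))
    (sub (eT ∘ θ) , (λ _ a b e → trans (cong eF e) (eF-sub b)) , λ _ _ _ ())
  image (axA a-s0)  = axA a-s0  , (λ _ _ _ → cong eF) , λ _ _ _ ()
  image (axA a-inj) = axA a-inj , (λ _ _ _ → cong eF) , λ _ _ _ ()
  image (axA a-+0)  = axA a-+0  , (λ _ _ _ → cong eF) , λ _ _ _ ()
  image (axA a-+s)  = axA a-+s  , (λ _ _ _ → cong eF) , λ _ _ _ ()
  image (axA a-nat) = axA a-nat , (λ _ _ _ → cong eF) , λ _ _ _ ()
  image RTCRule.refl = RTCRule.refl , (λ _ _ _ → cong eF) , λ _ _ _ ()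
  image r₀@(RTCRule.trans {Γ} {Δ} {φ} {s} {t} r) = subst (λ ψ → Image r₀ (map eF Γ ⇒ RTC (eF φ) (eT s) (eT t) ∷ map eF Δ)
      ((map eF Γ ⇒ RTC (eF φ) (eT s) (eT r) ∷ map eF Δ) ∷ (map eF Γ ⇒ ψ ∷ map eF Δ) ∷ [])) (sym (eF-inst2 φ r t))
    (RTCRule.trans (eT r) , (λ _ _ _ → cong eF) , λ _ _ _ ())
  image r₀@(case {Γ} {Δ} {φ} {s} {t} z f) = subst (λ ψ → Image r₀ (RTC (eF φ) (eT s) (eT t) ∷ map eF Γ ⇒ map eF Δ)
      ((eT s ≐ eT t ∷ map eF Γ ⇒ map eF Δ) ∷ (RTC (eF φ) (eT s) (var z) ∷ ψ ∷ map eF Γ ⇒ map eF Δ) ∷ [])) (sym (eF-inst2 φ (var z) t))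
    (case z (eFresh {z} {RTC φ s t ∷ Γ} {Δ} f)
    , (λ { _ _ _ (inj₁ e) → inj₁ (cong eF e) ; _ _ _ (inj₂ (e , e')) → inj₂ (cong eF e , cong eF e') })
    , λ { _ _ _ (e , e') → cong eF e , cong eF e' })

  noMul : ∀ t → TmNoMul (eT t)
  noMul (var n)  = tt
  noMul `0       = tt
  noMul (`s t)   = noMul t
  noMul (t `+ u) = noMul t , noMul u
  noMul (t `· u) = noMul t , noMul u

  inLRTC : ∀ φ → LRTC (eF φ)
  inLRTC (s ≐ t)     = noMul s , noMul t
  inLRTC (s ≺ t)     = noMul s , noMul t
  inLRTC (RTC φ s t) = inLRTC φ , noMul s , noMul t
  inLRTC (`¬ φ)      = inLRTC φ
  inLRTC (φ `∧ ψ)    = inLRTC φ , inLRTC ψ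
  inLRTC (φ `∨ ψ)    = inLRTC φ , inLRTC ψ
  inLRTC (φ `→ ψ)    = inLRTC φ , inLRTC ψ
  inLRTC (`∀ φ)      = inLRTC φ
  inLRTC (`∃ φ)      = inLRTC φ

  fixT : ∀ t → TmNoMul t → eT t ≡ t
  fixT (var n)  _       = refl
  fixT `0       _       = refl
  fixT (`s t)   a       = cong `s (fixT t a)
  fixT (t `+ u) (a , b) = cong₂ _`+_ (fixT t a) (fixT u b)

  fixF : ∀ φ → LRTC φ → eF φ ≡ φ
  fixF (s ≐ t)     (a , b)     = cong₂ _≐_ (fixT s a) (fixT t b)
  fixF (RTC φ s t) (a , b , c) rewrite fixF φ a | fixT s b | fixT t c = refl
  fixF (`¬ φ)      a           = cong `¬ (fixF φ a)
  fixF (φ `∧ ψ)    (a , b)     = cong₂ _`∧_ (fixF φ a) (fixF ψ b)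
  fixF (φ `∨ ψ)    (a , b)     = cong₂ _`∨_ (fixF φ a) (fixF ψ b)
  fixF (φ `→ ψ)    (a , b)     = cong₂ _`→_ (fixF φ a) (fixF ψ b)
  fixF (`∀ φ)      a           = cong `∀ (fixF φ a)
  fixF (`∃ φ)      a           = cong `∃ (fixF φ a)

  fixL : ∀ Φ → All LRTC Φ → map eF Φ ≡ Φ
  fixL []      []       = refl
  fixL (φ ∷ Φ) (a ∷ as) = cong₂ _∷_ (fixF φ a) (fixL Φ as)

  pure : ∀ {Γ Δ} → All LRTC Γ → All LRTC Δ → Proof RTCRule RTCTrace AnyFm (Γ ⇒ Δ) → ProvRTC (Γ ⇒ Δ)
  pure {Γ} {Δ} a b P = erase inLRTC image P (cong₂ _⇒_ (fixL Γ a) (fixL Δ b))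

module EraseCA where
  open Erase pa

  valid : ∀ {S o} → TmIn S o → TmIn (eS S) (eT o)
  valid {Γ ⇒ Δ} {o} v n e = trans (any-e n Γ Δ) (v n (trans (sym (eT-occ n o)) e))

  open Map CATrace eT (λ {S} {o} → valid {S} {o})

  eLinked : ∀ S' a b → Linked S' a b → Linked (eS S') (eT a) (eT b)
  eLinked S' a b (inj₁ e)               = inj₁ (cong eT e)
  eLinked S' a b (inj₂ (inj₁ m))        = inj₂ (inj₁ (∈ₚ.∈-map⁺ eF m))
  eLinked S' a b (inj₂ (inj₂ (inj₁ m))) = inj₂ (inj₂ (inj₁ (∈ₚ.∈-map⁺ eF m)))
  eLinked S' a b (inj₂ (inj₂ (inj₂ m))) = inj₂ (inj₂ (inj₂ (∈ₚ.∈-map⁺ eF m)))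

  eAx : ∀ {S} → AxPA S → AxPA (eS S)
  eAx p-s0  = p-s0
  eAx p-inj = p-inj
  eAx p-+0  = p-+0
  eAx p-+s  = p-+s
  eAx p-·0  = p-·0
  eAx p-·s  = p-·s
  eAx o-tr  = o-tr
  eAx o-as  = o-as
  eAx o-dis = o-dis
  eAx o-0   = o-0
  eAx o-mon = o-mon
  eAx o-suc = o-suc
  eAx o-tot = o-tot

  image : ∀ {S Ps} (r : CARule S Ps) → Image r (eS S) (map eS Ps)
  image (lk r)   = lk (eLK r) , eLinked , λ _ _ _ → ∈ₚ.∈-map⁺ eF
  image (axPA a) = axPA (eAx a) , eLinked , λ _ _ _ → ∈ₚ.∈-map⁺ eF
  image r@(sub {S} θ) = subst (λ X → Image r X (eS S ∷ [])) (sym (eSub θ S))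
    (sub (eT ∘ θ) , (λ _ a b e → trans (cong eT e) (eT-sub b)) , λ _ _ _ ())
  image (case {Γ} {Δ} {t} x f) = case x (eFresh {x} {`0 ≺ t ∷ Γ} {Δ} f) , eLinked , λ _ _ _ → ∈ₚ.∈-map⁺ eF

  inLPA : ∀ φ → LPA (eF φ)
  inLPA (s ≐ t)     = tt
  inLPA (s ≺ t)     = tt
  inLPA (RTC φ s t) = inLPA φ , tt
  inLPA (`¬ φ)      = inLPA φ
  inLPA (φ `∧ ψ)    = inLPA φ , inLPA ψ
  inLPA (φ `∨ ψ)    = inLPA φ , inLPA ψ
  inLPA (φ `→ ψ)    = inLPA φ , inLPA ψ
  inLPA (`∀ φ)      = inLPA φ
  inLPA (`∃ φ)      = inLPA φ

  fixT : ∀ t → eT t ≡ t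
  fixT (var n)  = refl
  fixT `0       = refl
  fixT (`s t)   = cong `s (fixT t)
  fixT (t `+ u) = cong₂ _`+_ (fixT t) (fixT u)
  fixT (t `· u) = cong₂ _`·_ (fixT t) (fixT u)

  fixF : ∀ φ → LPA φ → eF φ ≡ φ
  fixF (s ≐ t)  a       = cong₂ _≐_ (fixT s) (fixT t)
  fixF (s ≺ t)  a       = cong₂ _≺_ (fixT s) (fixT t)
  fixF (`¬ φ)   a       = cong `¬ (fixF φ a)
  fixF (φ `∧ ψ) (a , b) = cong₂ _`∧_ (fixF φ a) (fixF ψ b)
  fixF (φ `∨ ψ) (a , b) = cong₂ _`∨_ (fixF φ a) (fixF ψ b)
  fixF (φ `→ ψ) (a , b) = cong₂ _`→_ (fixF φ a) (fixF ψ b)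
  fixF (`∀ φ)   a       = cong `∀ (fixF φ a)
  fixF (`∃ φ)   a       = cong `∃ (fixF φ a)

  LPA-sub : ∀ {σ} φ → LPA φ → LPA (fsub σ φ)
  LPA-sub (s ≐ t)  a       = tt
  LPA-sub (s ≺ t)  a       = tt
  LPA-sub (`¬ φ)   a       = LPA-sub φ a
  LPA-sub (φ `∧ ψ) (a , b) = LPA-sub φ a , LPA-sub ψ b
  LPA-sub (φ `∨ ψ) (a , b) = LPA-sub φ a , LPA-sub ψ b
  LPA-sub (φ `→ ψ) (a , b) = LPA-sub φ a , LPA-sub ψ b
  LPA-sub (`∀ φ)   a       = LPA-sub φ a
  LPA-sub (`∃ φ)   a       = LPA-sub φ a

  β-LPA : ∀ φ → LPA (β φ)
  β-LPA (s ≐ t)     = tt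
  β-LPA (s ≺ t)     = tt
  β-LPA (RTC φ s t) = tt , _ , _ , (_ , (_ , _ , LPA-sub (β φ) (β-LPA φ)))
  β-LPA (`¬ φ)      = β-LPA φ
  β-LPA (φ `∧ ψ)    = β-LPA φ , β-LPA ψ
  β-LPA (φ `∨ ψ)    = β-LPA φ , β-LPA ψ
  β-LPA (φ `→ ψ)    = β-LPA φ , β-LPA ψ
  β-LPA (`∀ φ)      = β-LPA φ
  β-LPA (`∃ φ)      = β-LPA φ

  fixL : ∀ Φ → map eF (map β Φ) ≡ map β Φ
  fixL []      = refl
  fixL (φ ∷ Φ) = cong₂ _∷_ (fixF (β φ) (β-LPA φ)) (fixL Φ)

  pure : ∀ Γ Δ → Proof CARule CATrace AnyFm (map β Γ ⇒ map β Δ) → ProvCA (map β Γ ⇒ map β Δ)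
  pure Γ Δ P = erase inLPA image P (cong₂ _⇒_ (fixL Γ) (fixL Δ))

-- Comparison of φ with the relational interpretation of β φ, inside TR

-- under n, s, t: the last step of a path of length n
LAST : Fm → Fm → Fm
LAST χ ln = (var 1 ≐ var 2) `∨ `∃ (`∃ ((var 2 ≐ `s (var 1)) `∧ fsub (var 1 ∷ˢ var 3 ∷ˢ var 0 ∷ˢ up 5) ln `∧ fsub (var 4 ∷ˢ var 0 ∷ˢ up 5) χ))

-- Closed theorems of TPA about the formulas br = BR χ and ln = LEN χ, which are kept
-- abstract because they are too large to be unfolded.
record Facts (χ br ln : Fm) : Set where
  field
    has-len    : [] C.⊢ br `→ `∃ ln
    last-step  : [] C.⊢ ln `→ LAST χ ln
    reflexive  : [] C.⊢ fsub (var 0 ∷ˢ var 0 ∷ˢ up 1) br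
    -- under r, s, t
    transitive : [] C.⊢ fsub (var 1 ∷ˢ var 0 ∷ˢ up 3) br `→ (fsub (var 2 ∷ˢ var 0 ∷ˢ up 3) χ `→ fsub (var 1 ∷ˢ var 2 ∷ˢ up 3) br)

module MakeFacts (χ br ln : Fm) where
  open PA

  id₂ : ∀ φ → fsub (var 0 ∷ˢ var 1 ∷ˢ up 2) φ ≡ φ
  id₂ φ = trans (fsub-ext φ λ { zero → refl ; (suc zero) → refl ; (suc (suc n)) → refl }) (fsub-id φ)
  id₃ : ∀ φ → fsub (var 0 ∷ˢ var 1 ∷ˢ var 2 ∷ˢ up 3) φ ≡ φ
  id₃ φ = trans (fsub-ext φ λ { zero → refl ; (suc zero) → refl ; (suc (suc zero)) → refl ; (suc (suc (suc n))) → refl }) (fsub-id φ)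

  module _
    (rtc⇒len : ∀ {Γ} η s t → Γ ⊢ fsub (s ∷ˢ t ∷ˢ η) br → Γ ⊢ fsub (s ∷ˢ t ∷ˢ η) (`∃ ln))
    (len-inv : ∀ {Γ ψ} η n s t → Γ ⊢ fsub (n ∷ˢ s ∷ˢ t ∷ˢ η) ln → (∀ {Δ} → Γ ⊆ Δ → Δ ⊢ s ≐ t → Δ ⊢ ψ) →
      (∀ m z {Δ} → Γ ⊆ Δ → Δ ⊢ n ≐ `s m → Δ ⊢ fsub (m ∷ˢ s ∷ˢ z ∷ˢ η) ln → Δ ⊢ fsub (t ∷ˢ z ∷ˢ η) χ → Δ ⊢ ψ) → Γ ⊢ ψ)
    (rtc-refl : ∀ {Γ} η s → Γ ⊢ fsub (s ∷ˢ s ∷ˢ η) br)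
    (rtc-snoc : ∀ {Γ} η s r t → Γ ⊢ fsub (s ∷ˢ r ∷ˢ η) br → Γ ⊢ fsub (t ∷ˢ r ∷ˢ η) χ → Γ ⊢ fsub (s ∷ˢ t ∷ˢ η) br)
    where

    facts : Facts χ br ln
    facts = record
      { has-len = →I (cast (id₂ (`∃ ln)) (rtc⇒len (up 2) (var 0) (var 1) (cast (sym (id₂ br)) h0)))
      ; last-step = →I (len-inv (up 3) (var 0) (var 1) (var 2) (cast (sym (id₃ ln)) h0)
          (λ w e → ∨I₁ e)
          λ m z w e l st → ∨I₂ (cast (cong₂ (λ a b → `∃ (`∃ ((var 2 ≐ `s (var 1)) `∧ a `∧ b))) (id₅ ln σ₁) (id₅ χ σ₂))
            (∃I (`∃ body) var m (∃I body (m ∷ˢ var) z (∧I e (∧I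
              (cast (sym (ev ln m z λ { zero → refl ; (suc zero) → refl ; (suc (suc zero)) → refl ; (suc (suc (suc n))) → refl })) l)
              (cast (sym (ev χ m z λ { zero → refl ; (suc zero) → refl ; (suc (suc n)) → refl })) st)))))))
      ; reflexive = rtc-refl (up 1) (var 0)
      ; transitive = →I (→I (rtc-snoc (up 3) (var 1) (var 0) (var 2) h1 h0)) }
      where
      σ₁ σ₂ : Subst
      σ₁ = var 1 ∷ˢ var 3 ∷ˢ var 0 ∷ˢ up 5
      σ₂ = var 4 ∷ˢ var 0 ∷ˢ up 5
      body : Fm
      body = (var 2 ≐ `s (var 1)) `∧ fsub σ₁ ln `∧ fsub σ₂ χ
      id₅ : ∀ φ τ → fsub (lift (lift var)) (fsub τ φ) ≡ fsub τ φ
      id₅ φ τ = trans (fsub-ext (fsub τ φ) λ { zero → refl ; (suc zero) → refl ; (suc (suc n)) → refl }) (fsub-id _)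
      ev : ∀ φ m z {σ τ} → (∀ n → tsub (z ∷ˢ m ∷ˢ var) (τ n) ≡ σ n) → fsub (z ∷ˢ m ∷ˢ var) (fsub τ φ) ≡ fsub σ φ
      ev φ m z h = trans (fsub-fuse φ) (fsub-ext φ h)

pathFacts : ∀ χ → Facts χ (BR χ) (LEN χ)
pathFacts χ = MakeFacts.facts χ (BR χ) (LEN χ) (λ η → Len.rtc⇒len χ η) (λ η → Len.len-inv χ η) (λ η → Len.rtc-refl χ η) (λ η → Len.rtc-snoc χ η)

module Equiv where
  open Mul
  open Rel
  open LKSound TR relInterp
  open CAtoR using (toR)

  -- In this way the arithmetic of β-codes is done only once, in TPA, and need not be repeated with
  -- relational multiplication.
  transfer : ∀ {φ} → [] C.⊢ φ → ∀ {Γ} η → Γ ⊢ fsub η (rel φ)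
  transfer P η = raa (toR P η id (λ ()) (h0 ▸ⁿ λ ()))

  val-noMul : ∀ {Γ} t η → TmNoMul t → Value Γ t η (tsub η t)
  val-noMul (var n)  η _       = ≐R _
  val-noMul `0       η _       = ≐R _
  val-noMul (`s t)   η a       = val-sI t (tsub η t) _ (val-noMul t η a) (≐R _)
  val-noMul (t `+ u) η (a , b) = val-+I t u (tsub η t) (tsub η u) _ (val-noMul t η a) (val-noMul u η b) (≐R _)

  value-eq : ∀ {Γ η} s t v w → Value Γ s η v → Value Γ t η w → Γ ⊢ fsub η (rel (s ≐ t)) → Γ ⊢ v ≐ w
  value-eq {η = η} s t v w x y d = Interp.eq→ relInterp {s = s} {t} {η} {v} {w} x y d

  ren→ : ∀ {Γ σ η η'} φ → (∀ n → Value Γ (σ n) η (η' n)) → Γ ⊢ fsub η (rel (fsub σ φ)) → Γ ⊢ fsub η' (rel φ)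
  ren→ φ h = rel-sub→ φ λ n _ → h n
  ren← : ∀ {Γ σ η η'} φ → (∀ n → Value Γ (σ n) η (η' n)) → Γ ⊢ fsub η' (rel φ) → Γ ⊢ fsub η (rel (fsub σ φ))
  ren← φ h = rel-sub← φ λ n _ → h n

  record Same (φ χ : Fm) : Set where
    field
      to   : ∀ {Γ} η → Γ ⊢ fsub η (rel χ) → Γ ⊢ fsub η φ
      from : ∀ {Γ} η → Γ ⊢ fsub η φ → Γ ⊢ fsub η (rel χ)

  module Closure (φ χ br ln : Fm) (facts : Facts χ br ln) (same : Same φ χ) (η : Subst) where
    open Facts facts
    open Same same
    path : Tm → Tm → Fm
    path s t = RTC (fsub (lift (lift η)) φ) s t
    brf : Tm → Tm → Fm
    brf s t = fsub (s ∷ˢ t ∷ˢ η) (rel br)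
    lenf : Tm → Tm → Tm → Fm
    lenf n s t = fsub (n ∷ˢ s ∷ˢ t ∷ˢ η) (rel ln)

    path-refl : ∀ {Γ} s t → Γ ⊢ s ≐ t → Γ ⊢ path s t
    path-refl s t e = cast (cong₂ (λ a b → RTC a b t) (shift t) (trans (ren-suc s) (tsub-id s)))
      (≐S (RTC (fsub (lift (lift (λ n → ren suc (η n)))) φ) (ren suc s) (var 0)) var e
        (cast (cong₂ (λ a b → RTC a b s) (sym (shift s)) (sym (trans (ren-suc s) (tsub-id s)))) (RC.rtcR _ s)))
      where
      shift : ∀ t → fsub (lift (lift (t ∷ˢ var))) (fsub (lift (lift (λ n → ren suc (η n)))) φ) ≡ fsub (lift (lift η)) φ
      shift t = trans (fsub-fuse φ) (fsub-ext φ λ n → trans (lift-fuse {lift (t ∷ˢ var)} {lift (λ n → ren suc (η n))} n)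
        (lift-agree {P = λ _ → ⊤} (λ m _ → trans (lift-fuse {t ∷ˢ var} {λ n → ren suc (η n)} m)
          (lift-agree {P = λ _ → ⊤} (λ k _ → trans (ren-suc (η k)) (tsub-id (η k))) m tt)) n tt))

    -- under t, n, s
    Q : Fm
    Q = fsub (var 1 ∷ˢ var 2 ∷ˢ var 0 ∷ˢ up 3) (rel ln) `→ RTC (fsub (var 0 ∷ˢ var 1 ∷ˢ up 5) φ) (var 2) (var 0)

    -- The end point t is generalised and s kept fixed, because removing the last step of a path
    -- changes only its end.
    by-length : ∀ {Γ} s n → Γ ⊢ fsub (n ∷ˢ s ∷ˢ η) (`∀ Q)
    by-length s = ind (`∀ Q) (s ∷ˢ η)
        (∀I Q (`0 ∷ˢ s ∷ˢ η) λ t → cast (sym (evQ `0 t)) (→I (split `0 t h0 (λ w e → path-refl s t e) λ m z w e _ _ → botE (s0 (e ⁻¹)))))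
        λ n → ∀I Q (`s n ∷ˢ s ∷ˢ η) λ t → cast (sym (evQ (`s n) t)) (→I (split (`s n) t h0 (λ w e → path-refl s t e) λ m z w e l st →
          rtcT φ η z (→E (cast (evQ n z) (∀E Q (n ∷ˢ s ∷ˢ η) (hyp (w (there (here refl)))) z))
                         (≐S (rel ln) (s ∷ˢ z ∷ˢ η) (inj e ⁻¹) l))
            (to (t ∷ˢ z ∷ˢ η) st)))
      where
      evQ : ∀ n t → fsub (t ∷ˢ n ∷ˢ s ∷ˢ η) Q ≡ (lenf n s t `→ path s t)
      evQ n t = cong₂ _`→_
        (trans (fsub-fuse (rel ln)) (fsub-ext (rel ln) λ { zero → refl ; (suc zero) → refl ; (suc (suc zero)) → refl ; (suc (suc (suc k))) → refl }))
        (cong (λ a → RTC a s t) (trans (fsub-fuse φ) (fsub-ext φ λ { zero → refl ; (suc zero) → refl ; (suc (suc k)) → refl })))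
      split : ∀ {Γ ψ} n t → Γ ⊢ lenf n s t → (∀ {Δ} → Γ ⊆ Δ → Δ ⊢ s ≐ t → Δ ⊢ ψ) →
        (∀ m z {Δ} → Γ ⊆ Δ → Δ ⊢ n ≐ `s m → Δ ⊢ lenf m s z → Δ ⊢ fsub (t ∷ˢ z ∷ˢ η) (rel χ) → Δ ⊢ ψ) → Γ ⊢ ψ
      split n t d k l = ∨E (→E (transfer last-step (n ∷ˢ s ∷ˢ t ∷ˢ η)) d)
        (k there (value-eq {η = n ∷ˢ s ∷ˢ t ∷ˢ η} (var 1) (var 2) s t (≐R s) (≐R t) h0))
        (∃E (`∃ body) (n ∷ˢ s ∷ˢ t ∷ˢ η) h0 λ m → ∃E body (m ∷ˢ n ∷ˢ s ∷ˢ t ∷ˢ η) h0 λ z →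
          l m z (there ∘ there ∘ there)
            (value-eq {η = z ∷ˢ m ∷ˢ n ∷ˢ s ∷ˢ t ∷ˢ η} (var 2) (`s (var 1)) n (`s m) (≐R n) (val-noMul (`s (var 1)) (z ∷ˢ m ∷ˢ n ∷ˢ s ∷ˢ t ∷ˢ η) tt) (∧E₁ h0))
            (ren→ ln (λ { zero → ≐R _ ; (suc zero) → ≐R _ ; (suc (suc zero)) → ≐R _ ; (suc (suc (suc k))) → ≐R _ }) (∧E₁ (∧E₂ h0)))
            (ren→ χ (λ { zero → ≐R _ ; (suc zero) → ≐R _ ; (suc (suc k)) → ≐R _ }) (∧E₂ (∧E₂ h0))))
        where
        body : Fm
        body = rel (var 2 ≐ `s (var 1)) `∧ rel (fsub (var 1 ∷ˢ var 3 ∷ˢ var 0 ∷ˢ up 5) ln) `∧ rel (fsub (var 4 ∷ˢ var 0 ∷ˢ up 5) χ)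

    br⇒path : ∀ {Γ} s t → Γ ⊢ brf s t → Γ ⊢ path s t
    br⇒path s t d = ∃E (rel ln) (s ∷ˢ t ∷ˢ η) (→E (transfer has-len (s ∷ˢ t ∷ˢ η)) d) λ n →
      →E (cast (cong₂ _`→_
          (trans (fsub-fuse (rel ln)) (fsub-ext (rel ln) λ { zero → refl ; (suc zero) → refl ; (suc (suc zero)) → refl ; (suc (suc (suc k))) → refl }))
          (cong (λ a → RTC a s t) (trans (fsub-fuse φ) (fsub-ext φ λ { zero → refl ; (suc zero) → refl ; (suc (suc k)) → refl }))))
        (∀E Q (n ∷ˢ s ∷ˢ η) (by-length s n) t)) h0

    path⇒br : ∀ {Γ} s t → Γ ⊢ path s t → Γ ⊢ brf s t
    path⇒br s t d = cast (ev₀ t) (≐S Y (s ∷ˢ η) (≐R t) (cast (cong (λ u → fsub (u ∷ˢ s ∷ˢ η) Y) (trans (ren-suc t) (tsub-id t)))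
      (rtcI φ' Y' (s ∷ˢ var) {var 0} {ren suc t}
        (cast (cong₂ (λ a b → RTC a s b) evφ (sym (trans (ren-suc t) (tsub-id t)))) d)
        (cast (sym (evY' s)) (ren→ br (λ { zero → ≐R _ ; (suc zero) → ≐R _ ; (suc (suc k)) → ≐R _ }) (transfer reflexive (s ∷ˢ η))))
        (λ x y → cast (sym (evY' y)) (ren→ br (λ { zero → ≐R _ ; (suc zero) → ≐R _ ; (suc (suc k)) → ≐R _ })
          (→E (→E (transfer transitive (x ∷ˢ s ∷ˢ y ∷ˢ η))
            (ren← br (λ { zero → ≐R _ ; (suc zero) → ≐R _ ; (suc (suc k)) → ≐R _ }) (cast (evY' x) h1)))
            (ren← χ (λ { zero → ≐R _ ; (suc zero) → ≐R _ ; (suc (suc k)) → ≐R _ }) (from (y ∷ˢ x ∷ˢ η) (cast (evφ' x y) h0))))))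
        ▹ trans (evY' (tsub (s ∷ˢ var) (ren suc t))) (sym (ev₀ _)))))
      where
      infixl 1 _▹_
      _▹_ : ∀ {Γ φ ψ} → Γ ⊢ φ → φ ≡ ψ → Γ ⊢ ψ
      d ▹ e = cast e d
      Y φ' Y' : Fm
      Y = fsub (var 1 ∷ˢ var 0 ∷ˢ up 2) (rel br)
      -- `rtcI` wants both end points to be instances under its substitution. With `s ∷ˢ var` every
      -- term t is one, so η is built into the templates `φ'` and `Y'` instead.
      φ' = fsub (var 0 ∷ˢ var 1 ∷ˢ λ n → tsub (up 3) (η n)) φ
      Y' = fsub (var 1 ∷ˢ var 0 ∷ˢ λ n → tsub (up 2) (η n)) (rel br)
      back : ∀ {a b} k u → tsub (a ∷ˢ b ∷ˢ var) (tsub (up 2) u) ≡ u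
      back k u = trans (tsub-fuse u) (tsub-id u)
      ev₀ : ∀ u → fsub (u ∷ˢ s ∷ˢ η) Y ≡ brf s u
      ev₀ u = trans (fsub-fuse (rel br)) (fsub-ext (rel br) λ { zero → refl ; (suc zero) → refl ; (suc (suc k)) → refl })
      evY' : ∀ u → fsub (u ∷ˢ s ∷ˢ var) Y' ≡ brf s u
      evY' u = trans (fsub-fuse (rel br)) (fsub-ext (rel br) λ { zero → refl ; (suc zero) → refl ; (suc (suc k)) → back k (η k) })
      evφ' : ∀ x y → fsub (y ∷ˢ x ∷ˢ s ∷ˢ var) φ' ≡ fsub (y ∷ˢ x ∷ˢ η) φ
      evφ' x y = trans (fsub-fuse φ) (fsub-ext φ λ { zero → refl ; (suc zero) → refl ; (suc (suc k)) → trans (tsub-fuse (η k)) (tsub-id (η k)) })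
      evφ : fsub (lift (lift η)) φ ≡ fsub (lift (lift (s ∷ˢ var))) φ'
      evφ = sym (trans (fsub-fuse φ) (fsub-ext φ λ { zero → refl ; (suc zero) → refl
        ; (suc (suc k)) → trans (tsub-fuse (η k)) (sym (tsub-fuse (η k))) }))

  equiv : ∀ φ → LRTC φ → Same φ (β φ)
  equiv (s ≐ t) (a , b) = record
    { to = λ η d → value-eq s t (tsub η s) (tsub η t) (val-noMul s η a) (val-noMul t η b) d
    ; from = λ η d → eqI s t η (tsub η t) (val-conv s d (val-noMul s η a)) (val-noMul t η b) }
  equiv (RTC φ s t) (l , a , b) = record
    { to = λ η d → br⇒path η (tsub η s) (tsub η t) (ren→ (BR (β φ)) (vals η) (cast (cong (fsub η ∘ rel) (β-RTC φ s t)) d))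
    ; from = λ η d → cast (cong (fsub η ∘ rel) (sym (β-RTC φ s t))) (ren← (BR (β φ)) (vals η) (path⇒br η (tsub η s) (tsub η t) d)) }
    where
    open Closure φ (β φ) (BR (β φ)) (LEN (β φ)) (pathFacts (β φ)) (equiv φ l)
    vals : ∀ {Γ} η n → Value Γ ((s ∷ˢ t ∷ˢ var) n) η ((tsub η s ∷ˢ tsub η t ∷ˢ η) n)
    vals η zero          = val-noMul s η a
    vals η (suc zero)    = val-noMul t η b
    vals η (suc (suc n)) = ≐R _
  equiv (`¬ φ) l = let A = equiv φ l in record
    { to = λ η d → ¬I (¬E (d ↑) (Same.from A η h0)) ; from = λ η d → ¬I (¬E (d ↑) (Same.to A η h0)) }
  equiv (φ `∧ ψ) (l , m) = let A = equiv φ l ; E = equiv ψ m in record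
    { to = λ η d → ∧I (Same.to A η (∧E₁ d)) (Same.to E η (∧E₂ d)) ; from = λ η d → ∧I (Same.from A η (∧E₁ d)) (Same.from E η (∧E₂ d)) }
  equiv (φ `∨ ψ) (l , m) = let A = equiv φ l ; E = equiv ψ m in record
    { to = λ η d → ∨E d (∨I₁ (Same.to A η h0)) (∨I₂ (Same.to E η h0)) ; from = λ η d → ∨E d (∨I₁ (Same.from A η h0)) (∨I₂ (Same.from E η h0)) }
  equiv (φ `→ ψ) (l , m) = let A = equiv φ l ; E = equiv ψ m in record
    { to = λ η d → →I (Same.to E η (→E (d ↑) (Same.from A η h0))) ; from = λ η d → →I (Same.from E η (→E (d ↑) (Same.to A η h0))) }
  equiv (`∀ φ) l = let A = equiv φ l in record
    { to = λ η d → ∀I φ η λ x → Same.to A (x ∷ˢ η) (∀E (rel (β φ)) η d x) ; from = λ η d → ∀I (rel (β φ)) η λ x → Same.from A (x ∷ˢ η) (∀E φ η d x) }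
  equiv (`∃ φ) l = let A = equiv φ l in record
    { to = λ η d → ∃E (rel (β φ)) η d λ x → ∃I φ η x (Same.to A (x ∷ˢ η) h0) ; from = λ η d → ∃E φ η d λ x → ∃I (rel (β φ)) η x (Same.from A (x ∷ˢ η) h0) }

  toRTC : ∀ Γ Δ → All LRTC Γ → All LRTC Δ → ProvCA (map β Γ ⇒ map β Δ) → ProvRTC (Γ ⇒ Δ)
  toRTC Γ Δ lΓ lΔ P = EraseRTC.pure lΓ lΔ (RC.refute Δ (toR P var id antes negs))
    where
    antes : Ants (map `¬ Δ ++ Γ) (map β Γ) var
    antes m with ∈ₚ.∈-map⁻ β m
    ... | φ , m' , refl = Same.from (equiv φ (All.lookup lΓ m')) var (cast (sym (fsub-id φ)) (hyp (∈ₚ.∈-++⁺ʳ (map `¬ Δ) m')))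
    negs : Negs (map `¬ Δ ++ Γ) (map β Δ) var
    negs m with ∈ₚ.∈-map⁻ β m
    ... | φ , m' , refl = ¬I (¬E (hyp (there (∈ₚ.∈-++⁺ˡ (∈ₚ.∈-map⁺ `¬ m')))) (cast (fsub-id φ) (Same.to (equiv φ (All.lookup lΔ m')) var h0)))

-- From RTC-proofs to cyclic arithmetic, and the equivalence

toCA : ∀ Γ Δ → ProvRTC (Γ ⇒ Δ) → ProvCA (map β Γ ⇒ map β Δ)
toCA Γ Δ P = EraseCA.pure Γ Δ (C.refute (map β Δ) (RTCtoPA.toPA P var id
    (λ {φ} m → cast (sym (fsub-id (β φ))) (hyp (∈ₚ.∈-++⁺ʳ (map `¬ (map β Δ)) (∈ₚ.∈-map⁺ β m))))
    λ {φ} m → cast (cong `¬ (sym (fsub-id (β φ)))) (hyp (∈ₚ.∈-++⁺ˡ (∈ₚ.∈-map⁺ `¬ (∈ₚ.∈-map⁺ β m))))))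
  where open PA

theorem8 : (Γ Δ : List Fm) → All LRTC Γ → All LRTC Δ →
    ProvRTC (Γ ⇒ Δ) ⇔ ProvCA (map β Γ ⇒ map β Δ)
theorem8 Γ Δ lΓ lΔ = mk⇔ (toCA Γ Δ) (Equiv.toRTC Γ Δ lΓ lΔ)
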